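{- For all positive integers $m,n$: (a) $[s_{1^n}]_{m,n}=[s_{(n)}]_{m+n,n}$; (b) for every integer $a\ge0$ with $n-am\ge1$ and every partition $\lambda'\vdash n-am$ whose parts are at most $m$, $[s_{m^a\lambda'}]_{m,n}=[s_{\lambda'}]_{m,n-am}$, where $m^a\lambda'$ is the partition consisting of $a$ parts equal to $m$ followed by the parts of $\lambda'$; (c) for every integer $k$ with $1\le k\le\min(m,n)$, $[s_{k1^{n-k}}]_{m,n}=[s_{k1^{m-k}}]_{n,m}$.
   Context: For positive integers $m,n$: an $(m,n)$-Dyck path is a north/east lattice path from $(0,0)$ to $(m,n)$ weakly above $y=\frac nm x$. An $(m,n)$-parking function $\pi$ is such a path $\Pi(\pi)$ whose $n$ north steps are labeled bijectively by $1,\dots,n$ ("cars", each occupying the cell just right of its north step), increasing upward within each column; $\mathcal{PF}_{m,n}$ is the set of these. With $d=\gcd(m,n)$, the cell with lower-left corner $(x,y)$ has rank $my-nx+\lfloor xd/m\rfloor$; a car's rank is that of its cell. $\mathrm{ides}(\pi)=\{i:\mathrm{rank}(i)<\mathrm{rank}(i+1)\}=\{i_1<\dots<i_r\}$ and $\mathrm{pides}(\pi)=(i_1,i_2-i_1,\dots,n-i_r)$. $\mathrm{area}(\pi)$ is the number of full cells between the path and the diagonal. $\lambda(P)$ is the partition (English notation) of cells of the rectangle above $P$; for $c\in\lambda(P)$, $\mathrm{arm}(c)$, $\mathrm{leg}(c)$ count cells of $\lambda(P)$ to its right and below it. $\mathrm{pdinv}(P)=\#\{c\in\lambda(P):\frac{\mathrm{arm}(c)}{\mathrm{leg}(c)+1}\le\frac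 mn<\frac{\mathrm{arm}(c)+1}{\mathrm{leg}(c)}\}$ (with $x/0=\infty$). $\mathrm{tdinv}(\pi)=\#\{\text{cars } i<j:\mathrm{rank}(i)<\mathrm{rank}(j)<\mathrm{rank}(i)+m\}$, $\mathrm{maxdinv}(P)$ is the maximum of tdinv over parking functions on $P$, and $\mathrm{dinv}(\pi)=\mathrm{tdinv}(\pi)+\mathrm{pdinv}(\Pi(\pi))-\mathrm{maxdinv}(\Pi(\pi))$. Writing $(m,n)=(km_0,kn_0)$ with $m_0,n_0$ coprime, $\mathrm{ret}(\pi)$ is the least $i\ge1$ with $\Pi(\pi)$ through $(im_0,in_0)$; $[r]_{1/t}=1+t^{ -1}+\dots+t^{ -(r-1)}$. With $F_\alpha$ Gessel's fundamental quasisymmetric function, the (extended) Hikita polynomial $\mathrm{H}_{m,n}[X;q,t]=\sum_{\pi\in\mathcal{PF}_{m,n}}[\mathrm{ret}(\pi)]_{1/t}t^{\mathrm{area}(\pi)}q^{\mathrm{dinv}(\pi)}F_{\mathrm{pides}(\pi)}[X]$ is a symmetric function, and $[s_\lambda]_{m,n}$ denotes the coefficient of the Schur function $s_\lambda$ in its Schur expansion (equivalently, in $\mathrm{Q}_{m,n}(1)$ by the Extended Rational Shuffle Theorem). -}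

module Defs where

open import Data.Bool using (Bool; true; false; _∧_; _∨_; not; if_then_else_)
open import Data.Nat using (ℕ; zero; suc; _+_; _*_; _∸_; _⊔_; _≤_; _<_; _≡ᵇ_; _<ᵇ_; _≤ᵇ_)
open import Data.Nat.DivMod using (_/_)
open import Data.Nat.GCD using (gcd)
open import Data.Integer as ℤ using (ℤ; +_)
open import Data.List using (List; []; _∷_; map; concatMap; upTo; filterᵇ; length; foldr; take)
open import Data.Nat.ListAction using (sum)
open import Data.List.Relation.Unary.All using (All)
open import Data.Product using (_×_)
open import Data.Unit using (⊤)
open import Relation.Nullary using (does)
open import Relation.Binary.PropositionalEquality using (_≡_)

allᵇ : {A : Set} → (A → Bool) → List A → Bool
allᵇ p []       = true
allᵇ p (x ∷ xs) = p x ∧ allᵇ p xs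

at : List ℕ → ℕ → ℕ
at []       _       = 0
at (x ∷ _)  zero    = x
at (_ ∷ xs) (suc i) = at xs i

indexOf : List ℕ → ℕ → ℕ
indexOf []       c = 0
indexOf (x ∷ xs) c = if x ≡ᵇ c then 0 else suc (indexOf xs c)

eqList : List ℕ → List ℕ → Bool
eqList []       []       = true
eqList (x ∷ xs) (y ∷ ys) = (x ≡ᵇ y) ∧ eqList xs ys
eqList _        _        = false

eqℤ : ℤ → ℤ → Bool
eqℤ a b = does (a ℤ.≟ b)

count : {A : Set} → (A → Bool) → List A → ℕ
count p xs = length (filterᵇ p xs)

occ : ℕ → List ℕ → ℕ
occ r w = count (λ x → x ≡ᵇ r) w

sumℤ : List ℤ → ℤ
sumℤ = foldr ℤ._+_ (+ 0)

words : ℕ → ℕ → List (List ℕ)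
words zero    k = [] ∷ []
words (suc l) k = concatMap (λ w → map (_∷ w) (upTo k)) (words l k)

distinct : List ℕ → Bool
distinct []       = true
distinct (x ∷ xs) = allᵇ (λ y → not (x ≡ᵇ y)) xs ∧ distinct xs

-- floor division, with value 0 for divisor 0 (never used with divisor 0)
divℕ : ℕ → ℕ → ℕ
divℕ a zero    = 0
divℕ a (suc k) = a / suc k

-- integer compositions from an indicator list b_1..b_{n-1} of a subset
-- S = {i_1<…<i_r} ⊆ {1..n-1}: produces (i_1, i_2-i_1, …, n-i_r)
compOf : List Bool → List ℕ
compOf = go 1
  where
  go : ℕ → List Bool → List ℕ
  go k []           = k ∷ []
  go k (true ∷ bs)  = k ∷ go 1 bs
  go k (false ∷ bs) = go (suc k) bs

IsPartition : List ℕ → Set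
IsPartition []       = ⊤
IsPartition (p ∷ ps) = (0 < p) × All (_≤ p) ps × IsPartition ps

-- partitions of n with all parts ≤ k (fuel f ≥ n)
partsF : ℕ → ℕ → ℕ → List (List ℕ)
partsF _       zero    k = [] ∷ []
partsF zero    (suc n) k = []
partsF (suc f) (suc n) k =
  concatMap (λ p → map (suc p ∷_) (partsF f (n ∸ p) (suc p)))
            (filterᵇ (λ p → suc p ≤ᵇ k) (upTo (suc n)))

partitions : ℕ → List (List ℕ)
partitions n = partsF n n n

-- Standard Young tableaux of shape λ ⊢ n, encoded by their row words
-- (Yamanouchi words): w_i = row (0 = top, English notation) of entry i+1.

isLattice : ℕ → List ℕ → Bool
isLattice n w = allᵇ (λ p → allᵇ (λ r → occ (suc r) (take p w) ≤ᵇ occ r (take p w)) (upTo n)) (upTo (suc n))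

hasContent : ℕ → List ℕ → List ℕ → Bool
hasContent n lam w = allᵇ (λ r → occ r w ≡ᵇ at lam r) (upTo n)

-- descent indicators b_1..b_{n-1} of the SYT: i is a descent iff i+1 lies
-- in a strictly lower row than i
sytDes : List ℕ → List Bool
sytDes []           = []
sytDes (x ∷ [])     = []
sytDes (x ∷ y ∷ ws) = (x <ᵇ y) ∷ sytDes (y ∷ ws)

-- number of SYT of shape lam with descent composition α;
-- so s_lam = Σ_α kF n lam α · F_α  (Gessel)
kF : ℕ → List ℕ → List ℕ → ℕ
kF n lam α = count (λ w → isLattice n w ∧ hasContent n lam w ∧ eqList (compOf (sytDes w)) α) (words n n)

-- (m,n)-Dyck paths: a path is encoded by x = (x_0,…,x_{n-1}), x_j being the
-- x-coordinate of the north step from (x_j , j) to (x_j , j+1).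

isDyck : ℕ → ℕ → List ℕ → Bool
isDyck m n x =
  (length x ≡ᵇ n)
  ∧ allᵇ (λ j → at x j ≤ᵇ at x (suc j)) (upTo (n ∸ 1))
  ∧ allᵇ (λ j → n * at x j ≤ᵇ m * j) (upTo n)

dyckPaths : ℕ → ℕ → List (List ℕ)
dyckPaths m n = filterᵇ (isDyck m n) (words n m)

-- labelings: σ_j ∈ {0..n-1} is the car (car σ_j + 1) on the north step of row j;
-- bijective, increasing upward within each column
isLabeling : ℕ → List ℕ → List ℕ → Bool
isLabeling n x σ =
  distinct σ
  ∧ allᵇ (λ j → if at x j ≡ᵇ at x (suc j) then at σ j <ᵇ at σ (suc j) else true) (upTo (n ∸ 1))

labelings : ℕ → List ℕ → List (List ℕ)
labelings n x = filterᵇ (isLabeling n x) (words n n)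

-- rank of the cell with lower-left corner (cx , cy); my - nx ≥ 0 for all
-- cells used (cells of cars on a Dyck path), so truncated subtraction is exact
cellRank : ℕ → ℕ → ℕ → ℕ → ℕ
cellRank m n cx cy = (m * cy ∸ n * cx) + divℕ (cx * gcd m n) m

-- rank of car c+1 (c = 0..n-1)
carRank : ℕ → ℕ → List ℕ → List ℕ → ℕ → ℕ
carRank m n x σ c = cellRank m n (at x j) j
  where j = indexOf σ c

pides : ℕ → ℕ → List ℕ → List ℕ → List ℕ
pides m n x σ = compOf (map (λ i → carRank m n x σ i <ᵇ carRank m n x σ (suc i)) (upTo (n ∸ 1)))

tdinv : ℕ → ℕ → List ℕ → List ℕ → ℕ
tdinv m n x σ = sum (map (λ i → count (λ j →
    (i <ᵇ j) ∧ (carRank m n x σ i <ᵇ carRank m n x σ j)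
             ∧ (carRank m n x σ j <ᵇ carRank m n x σ i + m)) (upTo n)) (upTo n))

maxdinv : ℕ → ℕ → List ℕ → ℕ
maxdinv m n x = foldr _⊔_ 0 (map (tdinv m n x) (labelings n x))

-- λ(P): row i from the top (i = 0..n-1) has length x_{n-1-i}
lamRow : ℕ → List ℕ → ℕ → ℕ
lamRow n x i = at x (n ∸ suc i)

pdinv : ℕ → ℕ → List ℕ → ℕ
pdinv m n x = sum (map (λ i → count (λ c →
    let arm = lamRow n x i ∸ suc c
        leg = count (λ i' → (i <ᵇ i') ∧ (c <ᵇ lamRow n x i')) (upTo n)
    in (arm * n ≤ᵇ m * suc leg) ∧ ((leg ≡ᵇ 0) ∨ (m * leg <ᵇ n * suc arm)))
    (upTo (lamRow n x i))) (upTo n))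

-- full cells between the path and the diagonal: in row y, the cells
-- [cx,cx+1]×[y,y+1] with x_y ≤ cx and lower-right corner weakly above y = nx/m
area : ℕ → ℕ → List ℕ → ℕ
area m n x = sum (map (λ y → count (λ cx → (at x y ≤ᵇ cx) ∧ (n * suc cx ≤ᵇ m * y)) (upTo m)) (upTo n))

onPath : ℕ → ℕ → List ℕ → ℕ → ℕ → Bool
onPath m n x X Y = (lo ≤ᵇ X) ∧ (X ≤ᵇ hi)
  where
  lo = if Y ≡ᵇ 0 then 0 else at x (Y ∸ 1)
  hi = if Y ≡ᵇ n then m else at x Y

ret : ℕ → ℕ → List ℕ → ℕ
ret m n x = search (upTo k)
  where
  k  = gcd m n
  m₀ = divℕ m k
  n₀ = divℕ n k
  search : List ℕ → ℕ
  search []       = k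
  search (i ∷ is) = if onPath m n x (suc i * m₀) (suc i * n₀) then suc i else search is

dinv : ℕ → ℕ → List ℕ → List ℕ → ℤ
dinv m n x σ = (+ tdinv m n x σ ℤ.+ + pdinv m n x) ℤ.- + maxdinv m n x

-- Hikita polynomial, coefficientwise:
-- H_{m,n} = Σ_α Σ_{a,b ∈ ℤ} hikitaCoeff m n α a b · q^a t^b F_α.
-- The factor [ret]_{1/t} t^area = Σ_{j<ret} t^(area-j).

hikitaCoeff : ℕ → ℕ → List ℕ → ℤ → ℤ → ℕ
hikitaCoeff m n α a b =
  sum (map (λ x → sum (map (λ σ → count (λ j →
      eqList (pides m n x σ) α ∧ eqℤ (dinv m n x σ) a ∧ eqℤ (+ area m n x ℤ.- + j) b)
    (upTo (ret m n x))) (labelings n x))) (dyckPaths m n))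

-- d is the Schur expansion of H_{m,n}: d lam a b is the coefficient of
-- q^a t^b in [s_lam]_{m,n}, i.e. H_{m,n} = Σ_{lam ⊢ n} d lam · s_lam,
-- compared in the fundamental basis F_α of quasisymmetric functions.
IsSchurExpansion : ℕ → ℕ → (List ℕ → ℤ → ℤ → ℤ) → Set
IsSchurExpansion m n d =
  ∀ (α : List ℕ) (a b : ℤ) →
    + hikitaCoeff m n α a b ≡ sumℤ (map (λ lam → d lam a b ℤ.* + kF n lam α) (partitions n))

{-# OPTIONS --safe #-}
-- A Schur expansion can be peeled at its first part, so the coefficient of the hook s_{k 1^{n-k}} is the coefficient
-- of F_{(k, 1^{n-k})} in H_{m,n}: a sum over lattice paths with k - 1 marked valleys, in which every mark lowers
-- dinv by the number of rows attacking it.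
--
-- (b) A composition with first part m puts m cars into m different columns, as their bottom cars; deleting them
-- lowers n by m and preserves area, dinv and ret.
-- (c) A marked path is a closed walk with steps N, E and D = EN on the levels m y - n x.  Up to quantities that
-- depend only on the multiset of steps and are symmetric under transposition, dinv is minus the number of inversions
-- between steps leaving the same level.  Walks are counted by inversions through products of q-multinomials of the
-- degrees of the levels, in which transposition exchanges the degrees out of and into each level.  Cutting a walk
-- at its first return keeps track of ret.
-- (a) Transpose s_{1^n} to s_{1^m}, add a part n by (b), and transpose back.
module Submission where

open import Defs
open import Data.Bool using (Bool; true; false; _∧_; _∨_; not; if_then_else_)
open import Data.Nat using (ℕ; zero; suc; _+_; _*_; _∸_; _^_; _⊔_; _≤_; _<_; _≥_; z≤n; s≤s; _≡ᵇ_; _<ᵇ_; _≤ᵇ_; _≟_; _≤?_; _<?_; pred; NonZero; nonZero; >-nonZero)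
open import Data.Nat.Properties
open import Data.Nat.DivMod using (_/_)
open import Data.Nat.GCD using (gcd; gcd-greatest; gcd[m,n]∣m; gcd[m,n]∣n)
open import Data.Nat.ListAction using (sum)
open import Data.Nat.Induction using (<-rec)
open import Data.Nat.Tactic.RingSolver using (solve-∀)
open import Data.Integer using (ℤ) renaming (+_ to pos)
open import Data.List using (List; []; _∷_; _++_; map; concatMap; upTo; applyUpTo; filterᵇ; length; foldr; take; drop; replicate; deduplicate; reverse)
open import Data.List.Membership.Propositional using (_∈_)
open import Data.List.Membership.Propositional.Properties using (∈-map⁺; ∈-map⁻; ∈-++⁺ˡ; ∈-++⁺ʳ; ∈-++⁻; ∈-∃++; ∈-concat⁺′; ∈-concat⁻′; ∈-upTo⁺; ∈-upTo⁻; ∈-deduplicate⁺)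
open import Data.List.Relation.Unary.Any using (here; there)
open import Data.List.Relation.Unary.All using (All; []; _∷_)
open import Data.List.Relation.Unary.AllPairs using ([]; _∷_)
open import Data.List.Relation.Unary.Unique.Propositional using (Unique)
open import Data.Product using (∃; _×_; _,_; proj₁; proj₂)
open import Data.Sum using (_⊎_; inj₁; inj₂)
open import Data.Empty using (⊥)
open import Data.Unit using (⊤; tt)
open import Function using (_∘_; id; case_of_)
open import Relation.Nullary using (¬_; Dec; yes; no; contradiction)
open import Relation.Binary.PropositionalEquality using (_≡_; _≢_; refl; sym; trans; cong; cong₂; subst; subst₂; module ≡-Reasoning)
open import Relation.Binary.Definitions using (tri<; tri≈; tri>)
import Data.Integer as Int hiding (+_)
import Data.Integer.Properties as ℤₚ
import Data.List.Properties as List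
import Data.List.Relation.Unary.All as All
import Data.List.Relation.Unary.Unique.Propositional.Properties as Uniqueₚ
import Data.Integer.Tactic.RingSolver as ℤSolver
open import Data.Nat.Divisibility using (_∣_; divides; ∣-trans; ∣m+n∣m⇒∣n; m∣m*n; n∣m*n; ∣⇒≤; ∣m∣n⇒∣m+n; *-monoʳ-∣; *-cancelˡ-∣; ∣-antisym)
import Data.Nat.DivMod as DivMod
import Data.Nat.GCD as GCD
import Data.List.Relation.Unary.Unique.DecPropositional.Properties as UniqueDecₚ
open import Data.Bool.Properties using (∧-comm)
open import Data.Nat.Coprimality using (coprime-divisor; gcd≡1⇒coprime)

private variable
  A B C : Set

infixr 5 _∙_

_∙_ : {A : Set} {x y z : A} → x ≡ y → y ≡ z → x ≡ z
_∙_ = trans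

infixr 5 _≤∙_

_≤∙_ : ∀ {a b c} → a ≤ b → b ≤ c → a ≤ c
_≤∙_ = ≤-trans

-- Booleans

ι : Bool → ℕ
ι true = 1
ι false = 0

bool-ext : ∀ {a b} → (a ≡ true → b ≡ true) → (b ≡ true → a ≡ true) → a ≡ b
bool-ext {true} {true} f g = refl
bool-ext {true} {false} f g = sym (f refl)
bool-ext {false} {true} f g = g refl
bool-ext {false} {false} f g = refl

≢true⇒false : ∀ {b} → b ≢ true → b ≡ false
≢true⇒false {true} h = contradiction refl h
≢true⇒false {false} h = refl

true≢false : true ≢ false
true≢false ()

∧-elim : ∀ {a b} → a ∧ b ≡ true → a ≡ true × b ≡ true
∧-elim {true} {true} refl = refl , refl

∧-intro : ∀ {a b} → a ≡ true → b ≡ true → a ∧ b ≡ true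
∧-intro refl refl = refl

∨-elim : ∀ {a b} → a ∨ b ≡ true → a ≡ true ⊎ b ≡ true
∨-elim {true} _ = inj₁ refl
∨-elim {false} h = inj₂ h

ι-∧ : ∀ a b → ι (a ∧ b) ≡ ι a * ι b
ι-∧ true b = sym (+-identityʳ (ι b))
ι-∧ false b = refl

ι≤1 : ∀ b → ι b ≤ 1
ι≤1 true = s≤s z≤n
ι≤1 false = z≤n

ι≢0 : ∀ {b} → ι b ≢ 0 → b ≡ true
ι≢0 {true} _ = refl
ι≢0 {false} h = contradiction refl h

<⇒<ᵇ≡ : ∀ {a b} → a < b → (a <ᵇ b) ≡ true
<⇒<ᵇ≡ {zero} {suc b} _ = refl
<⇒<ᵇ≡ {suc a} {suc b} (s≤s h) = <⇒<ᵇ≡ h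

<ᵇ≡⇒< : ∀ {a b} → (a <ᵇ b) ≡ true → a < b
<ᵇ≡⇒< {zero} {suc b} _ = s≤s z≤n
<ᵇ≡⇒< {suc a} {suc b} h = s≤s (<ᵇ≡⇒< h)

≮⇒<ᵇ≡ : ∀ {a b} → b ≤ a → (a <ᵇ b) ≡ false
≮⇒<ᵇ≡ h = ≢true⇒false λ e → <⇒≱ (<ᵇ≡⇒< e) h

<ᵇ≡false⇒≥ : ∀ {a b} → (a <ᵇ b) ≡ false → b ≤ a
<ᵇ≡false⇒≥ e = ≮⇒≥ λ h → true≢false (sym (<⇒<ᵇ≡ h) ∙ e)

≤⇒≤ᵇ≡ : ∀ {a b} → a ≤ b → (a ≤ᵇ b) ≡ true
≤⇒≤ᵇ≡ {zero} _ = refl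
≤⇒≤ᵇ≡ {suc a} h = <⇒<ᵇ≡ h

≤ᵇ≡⇒≤ : ∀ {a b} → (a ≤ᵇ b) ≡ true → a ≤ b
≤ᵇ≡⇒≤ {zero} _ = z≤n
≤ᵇ≡⇒≤ {suc a} h = <ᵇ≡⇒< h

≰⇒≤ᵇ≡ : ∀ {a b} → b < a → (a ≤ᵇ b) ≡ false
≰⇒≤ᵇ≡ h = ≢true⇒false λ e → <⇒≱ h (≤ᵇ≡⇒≤ e)

≡⇒≡ᵇ≡ : ∀ {a b} → a ≡ b → (a ≡ᵇ b) ≡ true
≡⇒≡ᵇ≡ {zero} refl = refl
≡⇒≡ᵇ≡ {suc a} refl = ≡⇒≡ᵇ≡ {a} refl

≡ᵇ≡⇒≡ : ∀ {a b} → (a ≡ᵇ b) ≡ true → a ≡ b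
≡ᵇ≡⇒≡ {zero} {zero} _ = refl
≡ᵇ≡⇒≡ {suc a} {suc b} h = cong suc (≡ᵇ≡⇒≡ h)

≢⇒≡ᵇ≡ : ∀ {a b} → a ≢ b → (a ≡ᵇ b) ≡ false
≢⇒≡ᵇ≡ h = ≢true⇒false λ e → h (≡ᵇ≡⇒≡ e)

<ᵇ-cong : ∀ {a b c d} → (a < b → c < d) → (c < d → a < b) → (a <ᵇ b) ≡ (c <ᵇ d)
<ᵇ-cong f g = bool-ext (λ h → <⇒<ᵇ≡ (f (<ᵇ≡⇒< h))) (λ h → <⇒<ᵇ≡ (g (<ᵇ≡⇒< h)))

<ᵇ-+ʳ : ∀ k a b → (a + k <ᵇ b + k) ≡ (a <ᵇ b)
<ᵇ-+ʳ k a b = <ᵇ-cong (+-cancelʳ-< k a b) (+-monoˡ-< k)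

≤ᵇ-+ʳ : ∀ k a b → (a + k ≤ᵇ b + k) ≡ (a ≤ᵇ b)
≤ᵇ-+ʳ k a b = bool-ext (λ t → ≤⇒≤ᵇ≡ (+-cancelʳ-≤ k a b (≤ᵇ≡⇒≤ t))) (λ t → ≤⇒≤ᵇ≡ (+-monoˡ-≤ k (≤ᵇ≡⇒≤ {a} {b} t)))

≤ᵇ-+ˡ : ∀ k a b → (k + a ≤ᵇ k + b) ≡ (a ≤ᵇ b)
≤ᵇ-+ˡ k a b = cong₂ _≤ᵇ_ (+-comm k a) (+-comm k b) ∙ ≤ᵇ-+ʳ k a b

not-true : ∀ {b} → not b ≡ true → b ≡ false
not-true {false} _ = refl

not-false : ∀ {b} → b ≡ false → not b ≡ true
not-false {false} _ = refl

allᵇ-elim : ∀ {A : Set} {p : A → Bool} xs → allᵇ p xs ≡ true → ∀ {x} → x ∈ xs → p x ≡ true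
allᵇ-elim (x ∷ xs) h (here refl) = proj₁ (∧-elim h)
allᵇ-elim (x ∷ xs) h (there i) = allᵇ-elim xs (proj₂ (∧-elim h)) i

allᵇ-intro : ∀ {A : Set} {p : A → Bool} xs → (∀ {x} → x ∈ xs → p x ≡ true) → allᵇ p xs ≡ true
allᵇ-intro [] h = refl
allᵇ-intro (x ∷ xs) h = ∧-intro (h (here refl)) (allᵇ-intro xs (h ∘ there))

allᵇ-upTo-elim : ∀ {p : ℕ → Bool} n → allᵇ p (upTo n) ≡ true → ∀ {i} → i < n → p i ≡ true
allᵇ-upTo-elim n h i<n = allᵇ-elim (upTo n) h (∈-upTo⁺ i<n)

allᵇ-upTo-intro : ∀ {p : ℕ → Bool} n → (∀ {i} → i < n → p i ≡ true) → allᵇ p (upTo n) ≡ true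
allᵇ-upTo-intro n h = allᵇ-intro (upTo n) (h ∘ ∈-upTo⁻)

-- Sums over lists


Σ : List A → (A → ℕ) → ℕ
Σ xs f = sum (map f xs)

Σ< : ℕ → (ℕ → ℕ) → ℕ
Σ< n = Σ (upTo n)

Σ-cong-∈ : ∀ {f g : A → ℕ} xs → (∀ {x} → x ∈ xs → f x ≡ g x) → Σ xs f ≡ Σ xs g
Σ-cong-∈ [] h = refl
Σ-cong-∈ (x ∷ xs) h = cong₂ _+_ (h (here refl)) (Σ-cong-∈ xs (h ∘ there))

Σ-cong : ∀ {f g : A → ℕ} xs → (∀ x → f x ≡ g x) → Σ xs f ≡ Σ xs g
Σ-cong xs h = Σ-cong-∈ xs λ {x} _ → h x

Σ-mono : ∀ {f g : A → ℕ} xs → (∀ {x} → x ∈ xs → f x ≤ g x) → Σ xs f ≤ Σ xs g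
Σ-mono [] h = z≤n
Σ-mono (x ∷ xs) h = +-mono-≤ (h (here refl)) (Σ-mono xs (h ∘ there))

Σ-0 : ∀ (xs : List A) → Σ xs (λ _ → 0) ≡ 0
Σ-0 [] = refl
Σ-0 (x ∷ xs) = Σ-0 xs

Σ-const : ∀ (xs : List A) k → Σ xs (λ _ → k) ≡ length xs * k
Σ-const [] k = refl
Σ-const (x ∷ xs) k = cong (k +_) (Σ-const xs k)

Σ-vanish : ∀ {f : A → ℕ} xs → (∀ {x} → x ∈ xs → f x ≡ 0) → Σ xs f ≡ 0
Σ-vanish xs h = Σ-cong-∈ xs h ∙ Σ-0 xs

Σ-+ : ∀ (f g : A → ℕ) xs → Σ xs (λ x → f x + g x) ≡ Σ xs f + Σ xs g
Σ-+ f g [] = refl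
Σ-+ f g (x ∷ xs) rewrite Σ-+ f g xs = eq (f x) (g x) (Σ xs f) (Σ xs g)
  where
  eq : ∀ a b c d → (a + b) + (c + d) ≡ (a + c) + (b + d)
  eq = solve-∀

Σ-*ˡ : ∀ k (f : A → ℕ) xs → Σ xs (λ x → k * f x) ≡ k * Σ xs f
Σ-*ˡ k f [] = sym (*-zeroʳ k)
Σ-*ˡ k f (x ∷ xs) = cong (k * f x +_) (Σ-*ˡ k f xs) ∙ sym (*-distribˡ-+ k (f x) (Σ xs f))

Σ-*ʳ : ∀ k (f : A → ℕ) xs → Σ xs (λ x → f x * k) ≡ Σ xs f * k
Σ-*ʳ k f [] = refl
Σ-*ʳ k f (x ∷ xs) = cong (f x * k +_) (Σ-*ʳ k f xs) ∙ sym (*-distribʳ-+ k (f x) (Σ xs f))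

Σ-++ : ∀ (f : A → ℕ) xs ys → Σ (xs ++ ys) f ≡ Σ xs f + Σ ys f
Σ-++ f [] ys = refl
Σ-++ f (x ∷ xs) ys = cong (f x +_) (Σ-++ f xs ys) ∙ sym (+-assoc (f x) _ _)

Σ-map : ∀ (f : B → ℕ) (g : A → B) xs → Σ (map g xs) f ≡ Σ xs (f ∘ g)
Σ-map f g [] = refl
Σ-map f g (x ∷ xs) = cong (f (g x) +_) (Σ-map f g xs)

Σ-concatMap : ∀ (f : B → ℕ) (g : A → List B) xs → Σ (concatMap g xs) f ≡ Σ xs (λ x → Σ (g x) f)
Σ-concatMap f g [] = refl
Σ-concatMap f g (x ∷ xs) = Σ-++ f (g x) _ ∙ cong (Σ (g x) f +_) (Σ-concatMap f g xs)

Σ-filter : ∀ (p : A → Bool) (f : A → ℕ) xs → Σ (filterᵇ p xs) f ≡ Σ xs (λ x → ι (p x) * f x)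
Σ-filter p f [] = refl
Σ-filter p f (x ∷ xs) with p x
... | true = cong₂ _+_ (sym (+-identityʳ (f x))) (Σ-filter p f xs)
... | false = Σ-filter p f xs

Σ-swap : ∀ (f : A → B → ℕ) xs ys → Σ xs (λ x → Σ ys (f x)) ≡ Σ ys (λ y → Σ xs (λ x → f x y))
Σ-swap f [] ys = sym (Σ-0 ys)
Σ-swap f (x ∷ xs) ys = cong (Σ ys (f x) +_) (Σ-swap f xs ys) ∙ sym (Σ-+ (f x) _ ys)

count≡Σ : ∀ (p : A → Bool) xs → count p xs ≡ Σ xs (ι ∘ p)
count≡Σ p [] = refl
count≡Σ p (x ∷ xs) with p x
... | true = cong suc (count≡Σ p xs)
... | false = count≡Σ p xs

Σ-upTo-suc : ∀ n (f : ℕ → ℕ) → Σ< (suc n) f ≡ f 0 + Σ< n (f ∘ suc)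
Σ-upTo-suc n f = cong (λ l → f 0 + sum l) (shift-map n suc)
  where
  shift-map : ∀ n g → map f (applyUpTo g n) ≡ map (f ∘ g) (upTo n)
  shift-map n g = List.map-applyUpTo g f n ∙ sym (List.map-applyUpTo id (f ∘ g) n)

Σ-upTo-snoc : ∀ n (f : ℕ → ℕ) → Σ< (suc n) f ≡ Σ< n f + f n
Σ-upTo-snoc zero f = +-comm (f 0) 0
Σ-upTo-snoc (suc n) f
  rewrite Σ-upTo-suc (suc n) f | Σ-upTo-snoc n (f ∘ suc) | Σ-upTo-suc n f = sym (+-assoc (f 0) _ _)

Σ-upTo-+ : ∀ n k (f : ℕ → ℕ) → Σ< (n + k) f ≡ Σ< n f + Σ< k (λ i → f (n + i))
Σ-upTo-+ zero k f = refl
Σ-upTo-+ (suc n) k f rewrite Σ-upTo-suc (n + k) f | Σ-upTo-suc n f | Σ-upTo-+ n k (f ∘ suc) = sym (+-assoc (f 0) _ _)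

Σ-upTo-cong : ∀ n {f g : ℕ → ℕ} → (∀ {i} → i < n → f i ≡ g i) → Σ< n f ≡ Σ< n g
Σ-upTo-cong n h = Σ-cong-∈ (upTo n) (h ∘ ∈-upTo⁻)

Σ-upTo-vanish : ∀ n {f : ℕ → ℕ} → (∀ {i} → i < n → f i ≡ 0) → Σ< n f ≡ 0
Σ-upTo-vanish n h = Σ-vanish (upTo n) (h ∘ ∈-upTo⁻)

Σ-upTo-reverse : ∀ n (f : ℕ → ℕ) → Σ< n (λ i → f (n ∸ suc i)) ≡ Σ< n f
Σ-upTo-reverse zero f = refl
Σ-upTo-reverse (suc n) f = Σ-upTo-suc n _
  ∙ cong (f n +_) (Σ-upTo-reverse n f)
  ∙ +-comm (f n) _
  ∙ sym (Σ-upTo-snoc n f)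

Σ-upTo-δ : ∀ n {i} (f : ℕ → ℕ) → i < n → Σ< n (λ j → ι (i ≡ᵇ j) * f j) ≡ f i
Σ-upTo-δ (suc n) {i} f i<n with i ≟ n
... | yes refl = Σ-upTo-snoc n _
  ∙ cong₂ _+_ (Σ-upTo-vanish n λ {j} j<n → cong (λ b → ι b * f j) (≢⇒≡ᵇ≡ (>⇒≢ j<n))) (cong (λ b → ι b * f n) (≡⇒≡ᵇ≡ {n} refl))
  ∙ *-identityˡ (f n)
... | no i≢n = Σ-upTo-snoc n _
  ∙ cong₂ _+_ (Σ-upTo-δ n f (≤∧≢⇒< (≤-pred i<n) i≢n)) (cong (λ b → ι b * f n) (≢⇒≡ᵇ≡ i≢n))
  ∙ +-identityʳ (f i)

Σ≢0⇒∃ : ∀ {f : A → ℕ} xs → Σ xs f ≢ 0 → ∃ λ x → x ∈ xs × f x ≢ 0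
Σ≢0⇒∃ [] h = contradiction refl h
Σ≢0⇒∃ {f = f} (x ∷ xs) h with f x ≟ 0
... | no fx≢0 = x , here refl , fx≢0
... | yes fx≡0 with Σ≢0⇒∃ xs (λ e → h (cong₂ _+_ fx≡0 e ∙ refl))
... | y , y∈ , fy = y , there y∈ , fy

term≤Σ : ∀ (f : A → ℕ) {x} xs → x ∈ xs → f x ≤ Σ xs f
term≤Σ f (x ∷ xs) (here refl) = m≤m+n _ _
term≤Σ f (x ∷ xs) (there i) = term≤Σ f xs i ≤∙ m≤n+m _ _

-- Only the supports of the weights have to correspond.
Σ-inj-≤ : ∀ (F : A → ℕ) (G : B → ℕ) (φ : A → B) xs ys → Unique xs →
  (∀ {x} → x ∈ xs → F x ≢ 0 → φ x ∈ ys × F x ≤ G (φ x)) →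
  (∀ {x x'} → x ∈ xs → x' ∈ xs → F x ≢ 0 → F x' ≢ 0 → φ x ≡ φ x' → x ≡ x') →
  Σ xs F ≤ Σ ys G
Σ-inj-≤ F G φ [] ys u h inj = z≤n
Σ-inj-≤ F G φ (x ∷ xs) ys (x∉ ∷ u) h inj with F x ≟ 0
... | yes Fx≡0 rewrite Fx≡0 = Σ-inj-≤ F G φ xs ys u (h ∘ there) (λ i j → inj (there i) (there j))
... | no Fx≢0 with h (here refl) Fx≢0
... | φx∈ , Fx≤ with ∈-∃++ φx∈
... | ys1 , ys2 , refl = begin
  F x + Σ xs F ≤⟨ +-mono-≤ Fx≤ rec ⟩
  G (φ x) + Σ (ys1 ++ ys2) G ≡⟨ cong (G (φ x) +_) (Σ-++ G ys1 ys2) ⟩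
  G (φ x) + (Σ ys1 G + Σ ys2 G) ≡⟨ eq (G (φ x)) (Σ ys1 G) (Σ ys2 G) ⟩
  Σ ys1 G + (G (φ x) + Σ ys2 G) ≡⟨ sym (Σ-++ G ys1 (φ x ∷ ys2)) ⟩
  Σ (ys1 ++ φ x ∷ ys2) G ∎
  where
  open ≤-Reasoning
  eq : ∀ a b c → a + (b + c) ≡ b + (a + c)
  eq = solve-∀
  remove : ∀ {y} → y ∈ ys1 ++ φ x ∷ ys2 → y ≢ φ x → y ∈ ys1 ++ ys2
  remove y∈ y≢ with ∈-++⁻ ys1 y∈
  ... | inj₁ i = ∈-++⁺ˡ i
  ... | inj₂ (here e) = contradiction e y≢
  ... | inj₂ (there i) = ∈-++⁺ʳ ys1 i
  rec : Σ xs F ≤ Σ (ys1 ++ ys2) G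
  rec = Σ-inj-≤ F G φ xs (ys1 ++ ys2) u
    (λ i F≢0 → remove (proj₁ (h (there i) F≢0))
       (λ e → All.lookup x∉ i (inj (here refl) (there i) Fx≢0 F≢0 (sym e))) , proj₂ (h (there i) F≢0))
    (λ i j → inj (there i) (there j))

Σ-bij : ∀ (F : A → ℕ) (G : B → ℕ) (φ : A → B) (ψ : B → A) xs ys → Unique xs → Unique ys →
  (∀ {x} → x ∈ xs → F x ≢ 0 → φ x ∈ ys × G (φ x) ≡ F x × ψ (φ x) ≡ x) →
  (∀ {y} → y ∈ ys → G y ≢ 0 → ψ y ∈ xs × F (ψ y) ≡ G y × φ (ψ y) ≡ y) →
  Σ xs F ≡ Σ ys G
Σ-bij F G φ ψ xs ys ux uy h k = ≤-antisym
  (Σ-inj-≤ F G φ xs ys ux (λ i e → let (a , b , _) = h i e in a , ≤-reflexive (sym b))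
    (λ i j e e' p → sym (proj₂ (proj₂ (h i e))) ∙ cong ψ p ∙ proj₂ (proj₂ (h j e'))))
  (Σ-inj-≤ G F ψ ys xs uy (λ i e → let (a , b , _) = k i e in a , ≤-reflexive (sym b))
    (λ i j e e' p → sym (proj₂ (proj₂ (k i e))) ∙ cong φ p ∙ proj₂ (proj₂ (k j e'))))

*-≢0 : ∀ {a b} → a * b ≢ 0 → a ≢ 0 × b ≢ 0
*-≢0 {a} {b} h = (λ { refl → h refl }) , (λ { refl → h (*-zeroʳ a) })

-- Lists as functions of the position

at-++ˡ : ∀ xs ys {i} → i < length xs → at (xs ++ ys) i ≡ at xs i
at-++ˡ (x ∷ xs) ys {zero} _ = refl
at-++ˡ (x ∷ xs) ys {suc i} (s≤s h) = at-++ˡ xs ys h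

at-++ʳ : ∀ xs ys i → at (xs ++ ys) (length xs + i) ≡ at ys i
at-++ʳ [] ys i = refl
at-++ʳ (x ∷ xs) ys i = at-++ʳ xs ys i

at-applyUpTo : ∀ (f : ℕ → ℕ) n {i} → i < n → at (applyUpTo f n) i ≡ f i
at-applyUpTo f (suc n) {zero} _ = refl
at-applyUpTo f (suc n) {suc i} (s≤s h) = at-applyUpTo (f ∘ suc) n h

at-ext : ∀ xs ys → length xs ≡ length ys → (∀ {i} → i < length xs → at xs i ≡ at ys i) → xs ≡ ys
at-ext [] [] _ _ = refl
at-ext (x ∷ xs) (y ∷ ys) e h = cong₂ _∷_ (h {0} (s≤s z≤n)) (at-ext xs ys (suc-injective e) (λ i<n → h (s≤s i<n)))

Σ-at : ∀ (f : ℕ → ℕ) xs → Σ xs f ≡ Σ< (length xs) (λ i → f (at xs i))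
Σ-at f [] = refl
Σ-at f (x ∷ xs) = cong (f x +_) (Σ-at f xs) ∙ sym (Σ-upTo-suc (length xs) (λ i → f (at (x ∷ xs) i)))

∈⇒at : ∀ {x} (w : List ℕ) → x ∈ w → ∃ λ i → i < length w × at w i ≡ x
∈⇒at (y ∷ w) (here refl) = 0 , s≤s z≤n , refl
∈⇒at (y ∷ w) (there j) with ∈⇒at w j
... | i , i< , e = suc i , s≤s i< , e

words-complete : ∀ l k w → length w ≡ l → (∀ {i} → i < l → at w i < k) → w ∈ words l k
words-complete zero k [] _ _ = here refl
words-complete (suc l) k (x ∷ w) e h =
  ∈-concat⁺′ (∈-map⁺ (_∷ w) (∈-upTo⁺ (h {0} (s≤s z≤n))))
    (∈-map⁺ _ (words-complete l k w (suc-injective e) (λ i<l → h (s≤s i<l))))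

words-sound : ∀ l k {w} → w ∈ words l k → length w ≡ l × (∀ {i} → i < l → at w i < k)
words-sound zero k (here refl) = refl , λ ()
words-sound (suc l) k w∈ with ∈-concat⁻′ (map (λ w → map (_∷ w) (upTo k)) (words l k)) w∈
... | ws , w∈ws , ws∈ with ∈-map⁻ (λ w → map (_∷ w) (upTo k)) ws∈
... | v , v∈ , refl with ∈-map⁻ (_∷ v) w∈ws
... | x , x∈ , refl with words-sound l k v∈
... | len , bound = cong suc len , λ { {zero} _ → ∈-upTo⁻ x∈ ; {suc i} (s≤s h) → bound h }

∷-head-injective : ∀ {x y : A} {xs ys : List A} → x ∷ xs ≡ y ∷ ys → x ≡ y
∷-head-injective refl = refl

∷-tail-injective : ∀ {x y : A} {xs ys : List A} → x ∷ xs ≡ y ∷ ys → xs ≡ ys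
∷-tail-injective refl = refl

concatMap-unique : ∀ {A B : Set} (g : A → List B) (tag : B → A) xs → Unique xs →
  (∀ x → Unique (g x)) → (∀ {x y} → y ∈ g x → tag y ≡ x) → Unique (concatMap g xs)
concatMap-unique g tag [] u ug t = []
concatMap-unique g tag (x ∷ xs) (x∉ ∷ u) ug t =
  Uniqueₚ.++⁺ (ug x) (concatMap-unique g tag xs u ug t) disj
  where
  disj : ∀ {v} → ¬ (v ∈ g x × v ∈ concatMap g xs)
  disj (i , j) with ∈-concat⁻′ _ j
  ... | ys , v∈ys , ys∈ with ∈-map⁻ g ys∈
  ... | x' , x'∈ , refl = All.lookup x∉ x'∈ (sym (t i) ∙ t v∈ys)

words-unique : ∀ l k → Unique (words l k)
words-unique zero k = [] ∷ []
words-unique (suc l) k = concatMap-unique _ (drop 1) (words l k) (words-unique l k)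
  (λ w → Uniqueₚ.map⁺ ∷-head-injective (Uniqueₚ.upTo⁺ k)) t
  where
  t : ∀ {w v} → v ∈ map (_∷ w) (upTo k) → drop 1 v ≡ w
  t i with ∈-map⁻ _ i
  ... | _ , _ , refl = refl

filterᵇ-∈⁻ : ∀ (p : A → Bool) xs {x} → x ∈ filterᵇ p xs → x ∈ xs × p x ≡ true
filterᵇ-∈⁻ p (y ∷ xs) i with p y in eq
... | false = let (a , b) = filterᵇ-∈⁻ p xs i in there a , b
filterᵇ-∈⁻ p (y ∷ xs) (here refl) | true = here refl , eq
filterᵇ-∈⁻ p (y ∷ xs) (there i) | true = let (a , b) = filterᵇ-∈⁻ p xs i in there a , b

filterᵇ-∈⁺ : ∀ (p : A → Bool) xs {x} → x ∈ xs → p x ≡ true → x ∈ filterᵇ p xs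
filterᵇ-∈⁺ p (y ∷ xs) (here refl) e rewrite e = here refl
filterᵇ-∈⁺ p (y ∷ xs) (there i) e with p y
... | true = there (filterᵇ-∈⁺ p xs i e)
... | false = filterᵇ-∈⁺ p xs i e

filterᵇ-unique : ∀ (p : A → Bool) xs → Unique xs → Unique (filterᵇ p xs)
filterᵇ-unique p [] u = []
filterᵇ-unique p (x ∷ xs) (x∉ ∷ u) with p x
... | false = filterᵇ-unique p xs u
... | true = All.tabulate (λ i → All.lookup x∉ (proj₁ (filterᵇ-∈⁻ p xs i))) ∷ filterᵇ-unique p xs u

eqList⇒≡ : ∀ {xs ys} → eqList xs ys ≡ true → xs ≡ ys
eqList⇒≡ {[]} {[]} _ = refl
eqList⇒≡ {x ∷ xs} {y ∷ ys} h with ∧-elim h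
... | a , b = cong₂ _∷_ (≡ᵇ≡⇒≡ a) (eqList⇒≡ b)

≡⇒eqList : ∀ {xs ys} → xs ≡ ys → eqList xs ys ≡ true
≡⇒eqList {[]} refl = refl
≡⇒eqList {x ∷ xs} refl = ∧-intro (≡⇒≡ᵇ≡ {x} refl) (≡⇒eqList {xs} refl)

-- Compositions and descents

compFrom : ℕ → List Bool → List ℕ
compFrom k [] = k ∷ []
compFrom k (true ∷ bs) = k ∷ compFrom 1 bs
compFrom k (false ∷ bs) = compFrom (suc k) bs

compFrom-unique : (g : ℕ → List Bool → List ℕ) → (∀ k → g k [] ≡ k ∷ []) →
  (∀ k bs → g k (true ∷ bs) ≡ k ∷ g 1 bs) → (∀ k bs → g k (false ∷ bs) ≡ g (suc k) bs) →
  ∀ k bs → g k bs ≡ compFrom k bs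
compFrom-unique g a b c k [] = a k
compFrom-unique g a b c k (true ∷ bs) = b k bs ∙ cong (k ∷_) (compFrom-unique g a b c 1 bs)
compFrom-unique g a b c k (false ∷ bs) = c k bs ∙ compFrom-unique g a b c (suc k) bs

-- The local recursion of compOf has no name outside Defs; it is recovered by unification.
mutual
  compOf-go : ℕ → List Bool → List ℕ
  compOf-go = _

  compOf≡compFrom : ∀ bs → compOf bs ≡ compFrom 1 bs
  compOf≡compFrom bs with 1
  ... | k = compFrom-unique compOf-go (λ _ → refl) (λ _ _ → refl) (λ _ _ → refl) k bs

compFrom-split : ∀ k bs {p α} → compFrom k bs ≡ p ∷ α → α ≢ [] →
  ∃ λ j → ∃ λ bs' → p ≡ k + j × bs ≡ replicate j false ++ true ∷ bs' × compFrom 1 bs' ≡ α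
compFrom-split k [] refl α≢ = contradiction refl α≢
compFrom-split k (true ∷ bs) refl α≢ = 0 , bs , sym (+-identityʳ k) , refl , refl
compFrom-split k (false ∷ bs) e α≢ with compFrom-split (suc k) bs e α≢
... | j , bs' , refl , refl , e' = suc j , bs' , sym (+-suc k j) , refl , e'

compFrom-single : ∀ k bs {p} → compFrom k bs ≡ p ∷ [] → p ≡ k + length bs × bs ≡ replicate (length bs) false
compFrom-single k [] refl = sym (+-identityʳ k) , refl
compFrom-single k (true ∷ []) ()
compFrom-single k (true ∷ true ∷ bs) ()
compFrom-single k (true ∷ false ∷ bs) e with compFrom 2 bs in eq
... | [] = contradiction eq (nonempty 2 bs)
  where
  nonempty : ∀ k bs → compFrom k bs ≢ []
  nonempty k (false ∷ bs) e = nonempty (suc k) bs e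
compFrom-single k (true ∷ false ∷ bs) () | _ ∷ _
compFrom-single k (false ∷ bs) e with compFrom-single (suc k) bs e
... | refl , e' = sym (+-suc k _) , cong (false ∷_) e'

compFrom-join : ∀ k j bs → compFrom k (replicate j false ++ true ∷ bs) ≡ (k + j) ∷ compFrom 1 bs
compFrom-join k zero bs = cong (_∷ compFrom 1 bs) (sym (+-identityʳ k))
compFrom-join k (suc j) bs = compFrom-join (suc k) j bs ∙ cong (_∷ compFrom 1 bs) (sym (+-suc k j))

compFrom-false : ∀ k j → compFrom k (replicate j false) ≡ (k + j) ∷ []
compFrom-false k zero = cong (_∷ []) (sym (+-identityʳ k))
compFrom-false k (suc j) = compFrom-false (suc k) j ∙ cong (_∷ []) (sym (+-suc k j))

compFrom-ones : ∀ bs r → compFrom 1 bs ≡ replicate (suc r) 1 → bs ≡ replicate r true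
compFrom-ones bs zero e with compFrom-single 1 bs e
compFrom-ones [] zero e | _ , _ = refl
compFrom-ones bs (suc r) e with compFrom-split 1 bs e (λ ())
... | zero , bs' , _ , refl , e' = cong (true ∷_) (compFrom-ones bs' r e')

compFrom-true : ∀ r → compFrom 1 (replicate r true) ≡ replicate (suc r) 1
compFrom-true zero = refl
compFrom-true (suc r) = cong (1 ∷_) (compFrom-true r)

occ-∷ : ∀ r x w → occ r (x ∷ w) ≡ ι (x ≡ᵇ r) + occ r w
occ-∷ r x w with x ≡ᵇ r
... | true = refl
... | false = refl

-- c extra copies of 0 are available in front of w.
LatticeFrom : ℕ → List ℕ → Set
LatticeFrom c w = ∀ k r → occ (suc r) (take k w) ≤ occ r (take k w) + (if r ≡ᵇ 0 then c else 0)

lattice-0∷⁻ : ∀ {c w} → LatticeFrom c (0 ∷ w) → LatticeFrom (suc c) w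
lattice-0∷⁻ {c} {w} h k zero = h (suc k) 0 ≤∙ ≤-reflexive (sym (+-suc (occ 0 (take k w)) c))
lattice-0∷⁻ h k (suc r) = h (suc k) (suc r)

lattice-0∷⁺ : ∀ {c w} → LatticeFrom (suc c) w → LatticeFrom c (0 ∷ w)
lattice-0∷⁺ h zero r = z≤n
lattice-0∷⁺ {c} {w} h (suc k) zero = h k 0 ≤∙ ≤-reflexive (+-suc (occ 0 (take k w)) c)
lattice-0∷⁺ h (suc k) (suc r) = h k (suc r)

lattice-replicate⁻ : ∀ p {c w} → LatticeFrom c (replicate p 0 ++ w) → LatticeFrom (p + c) w
lattice-replicate⁻ zero h = h
lattice-replicate⁻ (suc p) {c} {w} h = subst (λ c → LatticeFrom c w) (+-suc p c) (lattice-replicate⁻ p (lattice-0∷⁻ h))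

lattice-replicate⁺ : ∀ p {c w} → LatticeFrom (p + c) w → LatticeFrom c (replicate p 0 ++ w)
lattice-replicate⁺ zero h = h
lattice-replicate⁺ (suc p) {c} {w} h = lattice-0∷⁺ (lattice-replicate⁺ p (subst (λ c → LatticeFrom c w) (sym (+-suc p c)) h))

occ-map-suc : ∀ r u → occ (suc r) (map suc u) ≡ occ r u
occ-map-suc r [] = refl
occ-map-suc r (x ∷ u) = occ-∷ (suc r) (suc x) (map suc u) ∙ cong (ι (x ≡ᵇ r) +_) (occ-map-suc r u) ∙ sym (occ-∷ r x u)

occ-map-suc-0 : ∀ u → occ 0 (map suc u) ≡ 0
occ-map-suc-0 [] = refl
occ-map-suc-0 (x ∷ u) = occ-map-suc-0 u

occ-take≤ : ∀ r k u → occ r (take k u) ≤ occ r u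
occ-take≤ r zero u = z≤n
occ-take≤ r (suc k) [] = z≤n
occ-take≤ r (suc k) (x ∷ u) rewrite occ-∷ r x (take k u) | occ-∷ r x u = +-monoʳ-≤ (ι (x ≡ᵇ r)) (occ-take≤ r k u)

lattice-map-suc⁻ : ∀ {c u} → LatticeFrom c (map suc u) → LatticeFrom 0 u
lattice-map-suc⁻ {c} {u} h k r = begin
  occ (suc r) (take k u) ≡⟨ sym (occ-map-suc (suc r) (take k u)) ⟩
  occ (suc (suc r)) (map suc (take k u)) ≡⟨ cong (occ (suc (suc r))) (sym (List.take-map k u)) ⟩
  occ (suc (suc r)) (take k (map suc u)) ≤⟨ h k (suc r) ⟩
  occ (suc r) (take k (map suc u)) + 0 ≡⟨ cong (λ v → occ (suc r) v + 0) (List.take-map k u) ⟩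
  occ (suc r) (map suc (take k u)) + 0 ≡⟨ cong (_+ 0) (occ-map-suc r (take k u)) ⟩
  occ r (take k u) + 0 ≤⟨ +-monoʳ-≤ (occ r (take k u)) z≤n ⟩
  occ r (take k u) + (if r ≡ᵇ 0 then 0 else 0) ∎
  where open ≤-Reasoning

lattice-map-suc⁺ : ∀ {c u} → occ 0 u ≤ c → LatticeFrom 0 u → LatticeFrom c (map suc u)
lattice-map-suc⁺ {c} {u} b h k zero = begin
  occ 1 (take k (map suc u)) ≡⟨ cong (occ 1) (List.take-map k u) ⟩
  occ 1 (map suc (take k u)) ≡⟨ occ-map-suc 0 (take k u) ⟩
  occ 0 (take k u) ≤⟨ occ-take≤ 0 k u ⟩
  occ 0 u ≤⟨ b ⟩
  c ≤⟨ m≤n+m c _ ⟩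
  occ 0 (take k (map suc u)) + c ∎
  where open ≤-Reasoning
lattice-map-suc⁺ {c} {u} b h k (suc r) = begin
  occ (suc (suc r)) (take k (map suc u)) ≡⟨ cong (occ (suc (suc r))) (List.take-map k u) ⟩
  occ (suc (suc r)) (map suc (take k u)) ≡⟨ occ-map-suc (suc r) (take k u) ⟩
  occ (suc r) (take k u) ≤⟨ h k r ⟩
  occ r (take k u) + (if r ≡ᵇ 0 then 0 else 0) ≡⟨ cong (occ r (take k u) +_) (if-0 (r ≡ᵇ 0)) ⟩
  occ r (take k u) + 0 ≡⟨ cong (_+ 0) (sym (occ-map-suc r (take k u))) ⟩
  occ (suc r) (map suc (take k u)) + 0 ≡⟨ cong (λ v → occ (suc r) v + 0) (sym (List.take-map k u)) ⟩
  occ (suc r) (take k (map suc u)) + 0 ∎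
  where
  open ≤-Reasoning
  if-0 : ∀ b → (if b then 0 else 0) ≡ 0
  if-0 true = refl
  if-0 false = refl

occ-∈ : ∀ {r} w → r ∈ w → 1 ≤ occ r w
occ-∈ {r} (x ∷ w) (here refl) rewrite occ-∷ r r w | ≡⇒≡ᵇ≡ {r} refl = s≤s z≤n
occ-∈ {r} (x ∷ w) (there i) rewrite occ-∷ r x w = occ-∈ w i ≤∙ m≤n+m _ _

occ≡0 : ∀ {r} w → (∀ {x} → x ∈ w → x ≢ r) → occ r w ≡ 0
occ≡0 [] h = refl
occ≡0 {r} (x ∷ w) h rewrite occ-∷ r x w | ≢⇒≡ᵇ≡ (h (here refl)) = occ≡0 w (h ∘ there)

Σ-occ≤length : ∀ k w → Σ< k (λ r → occ r w) ≤ length w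
Σ-occ≤length k [] = ≤-reflexive (Σ-0 (upTo k))
Σ-occ≤length k (x ∷ w) = begin
  Σ< k (λ r → occ r (x ∷ w)) ≡⟨ Σ-cong (upTo k) (λ r → occ-∷ r x w) ⟩
  Σ< k (λ r → ι (x ≡ᵇ r) + occ r w) ≡⟨ Σ-+ _ _ (upTo k) ⟩
  Σ< k (λ r → ι (x ≡ᵇ r)) + Σ< k (λ r → occ r w) ≤⟨ +-mono-≤ one (Σ-occ≤length k w) ⟩
  suc (length w) ∎
  where
  open ≤-Reasoning
  one : Σ< k (λ r → ι (x ≡ᵇ r)) ≤ 1
  one with x <? k
  ... | yes x<k = ≤-reflexive (Σ-cong (upTo k) (λ r → sym (*-identityʳ _)) ∙ Σ-upTo-δ k (λ _ → 1) x<k)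
  ... | no x≮k = ≤-reflexive (Σ-upTo-vanish k (λ r<k → cong ι (≢⇒≡ᵇ≡ {x} λ { refl → x≮k r<k }))) ≤∙ z≤n

lattice-letter-bound : ∀ {w} → LatticeFrom 0 w → ∀ {i} → i < length w → at w i ≤ i
lattice-letter-bound {w} L {i} i<n = ≤-pred (begin
  suc (at w i) ≡⟨ sym (Σ-const (upTo (suc (at w i))) 1 ∙ *-identityʳ _ ∙ List.length-upTo (suc (at w i))) ⟩
  Σ< (suc (at w i)) (λ _ → 1) ≤⟨ Σ-mono (upTo (suc (at w i))) (λ r∈ → down (≤-pred (∈-upTo⁻ r∈))) ⟩
  Σ< (suc (at w i)) (λ r → occ r (take (suc i) w)) ≤⟨ Σ-occ≤length (suc (at w i)) (take (suc i) w) ⟩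
  length (take (suc i) w) ≤⟨ ≤-reflexive (List.length-take (suc i) w) ≤∙ m⊓n≤m (suc i) (length w) ⟩
  suc i ∎)
  where
  open ≤-Reasoning
  at-∈-take : ∀ (w : List ℕ) {i} → i < length w → at w i ∈ take (suc i) w
  at-∈-take (x ∷ w) {zero} _ = here refl
  at-∈-take (x ∷ w) {suc i} (s≤s h) = there (at-∈-take w h)
  step : ∀ r → 1 ≤ occ (suc r) (take (suc i) w) → 1 ≤ occ r (take (suc i) w)
  step zero h = h ≤∙ L (suc i) 0 ≤∙ ≤-reflexive (+-identityʳ _)
  step (suc r) h = h ≤∙ L (suc i) (suc r) ≤∙ ≤-reflexive (+-identityʳ _)
  chain : ∀ j r → 1 ≤ occ (j + r) (take (suc i) w) → 1 ≤ occ r (take (suc i) w)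
  chain zero r h = h
  chain (suc j) r h = chain j r (step (j + r) h)
  down : ∀ {r} → r ≤ at w i → 1 ≤ occ r (take (suc i) w)
  down {r} r≤ = chain (at w i ∸ r) r (subst (λ x → 1 ≤ occ x (take (suc i) w)) (sym (m∸n+n≡m r≤)) (occ-∈ _ (at-∈-take w i<n)))

take-beyond : ∀ (w : List A) {k} → length w ≤ k → take k w ≡ w
take-beyond [] {zero} _ = refl
take-beyond [] {suc k} _ = refl
take-beyond (x ∷ w) {suc k} (s≤s h) = cong (x ∷_) (take-beyond w h)

∈-take : ∀ k (w : List A) {x} → x ∈ take k w → x ∈ w
∈-take (suc k) (y ∷ w) (here e) = here e
∈-take (suc k) (y ∷ w) (there i) = there (∈-take k w i)

isLattice⇒lattice : ∀ n {w} → w ∈ words n n → isLattice n w ≡ true → LatticeFrom 0 w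
isLattice⇒lattice n {w} w∈ h k r with words-sound n n w∈ | suc r <? n
... | len , bound | no r≮ = ≤-reflexive (occ≡0 (take k w) absent) ≤∙ z≤n
  where
  absent : ∀ {x} → x ∈ take k w → x ≢ suc r
  absent i refl with ∈⇒at w (∈-take k w i)
  ... | j , j< , e = r≮ (subst (_< n) e (bound (subst (j <_) len j<)))
... | len , bound | yes r< = bounded (k ≤? n) ≤∙ m≤m+n _ _
  where
  L : ∀ {p} → p ≤ n → occ (suc r) (take p w) ≤ occ r (take p w)
  L p≤n = ≤ᵇ≡⇒≤ (allᵇ-upTo-elim n (allᵇ-upTo-elim (suc n) h (s≤s p≤n)) (<-trans (n<1+n r) r<))
  bounded : Dec (k ≤ n) → occ (suc r) (take k w) ≤ occ r (take k w)
  bounded (yes k≤n) = L k≤n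
  bounded (no k≰n) rewrite take-beyond w (subst (_≤ k) (sym len) (<⇒≤ (≰⇒> k≰n)))
    = subst (λ v → occ (suc r) v ≤ occ r v) (take-beyond w (≤-reflexive len)) (L ≤-refl)

lattice⇒isLattice : ∀ n {w} → LatticeFrom 0 w → isLattice n w ≡ true
lattice⇒isLattice n {w} L = allᵇ-upTo-intro (suc n) λ {p} _ → allᵇ-upTo-intro n λ {r} _ →
  ≤⇒≤ᵇ≡ (L p r ≤∙ ≤-reflexive (cong (occ r (take p w) +_) (if-0 (r ≡ᵇ 0)) ∙ +-identityʳ _))
  where
  if-0 : ∀ b → (if b then 0 else 0) ≡ 0
  if-0 true = refl
  if-0 false = refl

lattice-head : ∀ {x w} → LatticeFrom 0 (x ∷ w) → x ≡ 0
lattice-head L = n≤0⇒n≡0 (lattice-letter-bound L {0} (s≤s z≤n))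

sytDes-split : ∀ j w {bs} → sytDes (0 ∷ w) ≡ replicate j false ++ true ∷ bs →
  ∃ λ y → ∃ λ v → 0 ∷ w ≡ replicate (suc j) 0 ++ suc y ∷ v × sytDes (suc y ∷ v) ≡ bs
sytDes-split zero (suc y ∷ v) refl = y , v , refl , refl
sytDes-split zero (zero ∷ v) ()
sytDes-split zero [] ()
sytDes-split (suc j) [] ()
sytDes-split (suc j) (zero ∷ w) e with sytDes-split j w (∷-tail-injective e)
... | y , v , e1 , e2 = y , v , cong (0 ∷_) e1 , e2
sytDes-split (suc j) (suc x ∷ w) ()

sytDes-join : ∀ j y v → sytDes (replicate (suc j) 0 ++ suc y ∷ v) ≡ replicate j false ++ true ∷ sytDes (suc y ∷ v)
sytDes-join zero y v = refl
sytDes-join (suc j) y v = cong (false ∷_) (sytDes-join j y v)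

sytDes-map-suc : ∀ u → sytDes (map suc u) ≡ sytDes u
sytDes-map-suc [] = refl
sytDes-map-suc (x ∷ []) = refl
sytDes-map-suc (x ∷ y ∷ u) = cong ((x <ᵇ y) ∷_) (sytDes-map-suc (y ∷ u))

sytDes-false : ∀ w → sytDes (0 ∷ w) ≡ replicate (length w) false → 0 ∷ w ≡ replicate (suc (length w)) 0
sytDes-false [] e = refl
sytDes-false (zero ∷ w) e = cong (0 ∷_) (sytDes-false w (∷-tail-injective e))
sytDes-false (suc x ∷ w) ()

length-sytDes : ∀ x w → length (sytDes (x ∷ w)) ≡ length w
length-sytDes x [] = refl
length-sytDes x (y ∷ w) = cong suc (length-sytDes y w)

occ-++ : ∀ r u v → occ r (u ++ v) ≡ occ r u + occ r v
occ-++ r [] v = refl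
occ-++ r (x ∷ u) v rewrite occ-∷ r x (u ++ v) | occ-∷ r x u | occ-++ r u v = sym (+-assoc (ι (x ≡ᵇ r)) _ _)

occ-replicate : ∀ p → occ 0 (replicate p 0) ≡ p
occ-replicate zero = refl
occ-replicate (suc p) = cong suc (occ-replicate p)

occ-replicate-suc : ∀ p r → occ (suc r) (replicate p 0) ≡ 0
occ-replicate-suc zero r = refl
occ-replicate-suc (suc p) r = occ-replicate-suc p r

record Tableau (n : ℕ) (lam α w : List ℕ) : Set where
  constructor tableau
  field
    word : w ∈ words n n
    lattice : LatticeFrom 0 w
    content : ∀ {r} → r < n → occ r w ≡ at lam r
    descent : compFrom 1 (sytDes w) ≡ α

open Tableau

kFTest : ℕ → List ℕ → List ℕ → List ℕ → Bool
kFTest n lam α w = isLattice n w ∧ hasContent n lam w ∧ eqList (compOf (sytDes w)) α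

kF≡Σ : ∀ n lam α → kF n lam α ≡ Σ (words n n) (λ w → ι (kFTest n lam α w))
kF≡Σ n lam α = count≡Σ _ (words n n)

test⇒tableau : ∀ {n lam α w} → w ∈ words n n → kFTest n lam α w ≡ true → Tableau n lam α w
test⇒tableau {n} {lam} {α} {w} w∈ h = tableau w∈ (isLattice⇒lattice n w∈ a)
  (λ r<n → ≡ᵇ≡⇒≡ (allᵇ-upTo-elim n b r<n)) (sym (compOf≡compFrom (sytDes w)) ∙ eqList⇒≡ c)
  where
  a = proj₁ (∧-elim {isLattice n w} h)
  b = proj₁ (∧-elim {hasContent n lam w} (proj₂ (∧-elim {isLattice n w} h)))
  c = proj₂ (∧-elim {hasContent n lam w} (proj₂ (∧-elim {isLattice n w} h)))

tableau⇒test : ∀ {n lam α w} → Tableau n lam α w → kFTest n lam α w ≡ true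
tableau⇒test {n} {lam} {α} {w} t = ∧-intro (lattice⇒isLattice n (lattice t))
  (∧-intro (allᵇ-upTo-intro n (λ {r} r<n → ≡⇒≡ᵇ≡ (content t r<n)))
           (≡⇒eqList (compOf≡compFrom (sytDes w) ∙ descent t)))

tableau-split : ∀ {p n lam α w} → α ≢ [] → Tableau (suc (p + n)) lam (suc p ∷ α) w →
  ∃ λ y → ∃ λ v → w ≡ replicate (suc p) 0 ++ suc y ∷ v × compFrom 1 (sytDes (suc y ∷ v)) ≡ α
tableau-split {p} {n} {w = []} α≢ t with words-sound (suc (p + n)) (suc (p + n)) (word t)
... | () , _
tableau-split {w = x ∷ w} α≢ t with lattice-head (lattice t)
... | refl with compFrom-split 1 (sytDes (0 ∷ w)) (descent t) α≢
... | j , bs , refl , e , e' with sytDes-split j w e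
... | y , v , e1 , refl = y , v , e1 , e'

kF-vanish : ∀ {n lam α} → (∀ {w} → ¬ Tableau n lam α w) → kF n lam α ≡ 0
kF-vanish {n} {lam} {α} h = kF≡Σ n lam α ∙ (Σ-vanish (words n n) λ {w} w∈ →
  cong ι (≢true⇒false λ e → h (test⇒tableau w∈ e)))

kF-first-part : ∀ p n lam {α} → α ≢ [] → at lam 0 < suc p → kF (suc (p + n)) lam (suc p ∷ α) ≡ 0
kF-first-part p n lam {α} α≢ lt = kF-vanish bad
  where
  bad : ∀ {w} → ¬ Tableau (suc (p + n)) lam (suc p ∷ α) w
  bad t with tableau-split α≢ t
  ... | y , v , refl , _ = <⇒≱ lt (≤-reflexive (sym (occ-replicate (suc p))) ≤∙
    m≤m+n _ _ ≤∙ ≤-reflexive (sym (occ-++ 0 (replicate (suc p) 0) (suc y ∷ v)) ∙ content t (s≤s z≤n)))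

map-suc-pred : ∀ v → (∀ {x} → x ∈ v → x ≢ 0) → map suc (map pred v) ≡ v
map-suc-pred [] h = refl
map-suc-pred (zero ∷ v) h = contradiction refl (h (here refl))
map-suc-pred (suc x ∷ v) h = cong (suc x ∷_) (map-suc-pred v (h ∘ there))

map-pred-suc : ∀ u → map pred (map suc u) ≡ u
map-pred-suc [] = refl
map-pred-suc (x ∷ u) = cong (x ∷_) (map-pred-suc u)

drop-replicate : ∀ p (v : List ℕ) → drop p (replicate p 0 ++ v) ≡ v
drop-replicate zero v = refl
drop-replicate (suc p) v = drop-replicate p v

words-intro : ∀ l {k w} → length w ≡ l → (∀ {x} → x ∈ w → x < k) → w ∈ words l k
words-intro l {k} {w} len h = words-complete l k w len λ i<l → h (at-∈ w (subst (_ <_) (sym len) i<l))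
  where
  at-∈ : ∀ (w : List ℕ) {i} → i < length w → at w i ∈ w
  at-∈ (x ∷ w) {zero} _ = here refl
  at-∈ (x ∷ w) {suc i} (s≤s h) = there (at-∈ w h)

words-< : ∀ l {k w} → w ∈ words l k → ∀ {x} → x ∈ w → x < k
words-< l {k} {w} w∈ x∈ with words-sound l k w∈ | ∈⇒at w x∈
... | len , bound | i , i< , refl = bound (subst (i <_) len i<)

-- A standard tableau whose first p entries fill its first row is a tableau on the other rows.
tableau-peel : ∀ {p n μ α w} → α ≢ [] → Tableau (suc (p + n)) (suc p ∷ μ) (suc p ∷ α) w →
  Tableau n μ α (map pred (drop (suc p) w)) × replicate (suc p) 0 ++ map suc (map pred (drop (suc p) w)) ≡ w
tableau-peel {p} {n} {μ} {α} α≢ t with tableau-split α≢ t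
... | y , v' , refl , desc = tab , cong (replicate (suc p) 0 ++_) (cong (map suc ∘ map pred) dropped ∙ sp)
  where
  v = suc y ∷ v'
  dropped : drop (suc p) (replicate (suc p) 0 ++ v) ≡ v
  dropped = drop-replicate (suc p) v
  occ-v : ∀ r → occ (suc r) (replicate (suc p) 0 ++ v) ≡ occ (suc r) v
  occ-v r = occ-++ (suc r) (replicate (suc p) 0) v ∙ cong (_+ occ (suc r) v) (occ-replicate-suc (suc p) r)
  no0 : occ 0 v ≡ 0
  no0 = +-cancelˡ-≡ (suc p) _ _ (cong (_+ occ 0 v) (sym (occ-replicate (suc p))) ∙
    sym (occ-++ 0 (replicate (suc p) 0) v) ∙ content t (s≤s z≤n) ∙ sym (+-identityʳ (suc p)))
  sp : map suc (map pred v) ≡ v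
  sp = map-suc-pred v λ { x∈ refl → <⇒≢ (occ-∈ v x∈) (sym no0) }
  u = map pred v
  lat-u : LatticeFrom 0 u
  lat-u = lattice-map-suc⁻ (subst (LatticeFrom (suc p + 0)) (sym sp) (lattice-replicate⁻ (suc p) (lattice t)))
  len-v : length v ≡ n
  len-v = +-cancelˡ-≡ (suc p) _ _ (sym (List.length-++ (replicate (suc p) 0) ∙ cong (_+ length v) (List.length-replicate (suc p))) ∙
    proj₁ (words-sound _ _ (word t)))
  len-u : length u ≡ n
  len-u = List.length-map pred v ∙ len-v
  tab : Tableau n μ α (map pred (drop (suc p) (replicate (suc p) 0 ++ v)))
  tab = subst (Tableau n μ α) (cong (map pred) (sym dropped)) (tableau
    (words-complete n n u len-u (λ i<n → ≤-<-trans (lattice-letter-bound lat-u (subst (_ <_) (sym len-u) i<n)) i<n))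
    lat-u
    (λ {r} r<n → sym (occ-map-suc r u) ∙ cong (occ (suc r)) sp ∙ sym (occ-v r) ∙ content t (s≤s (r<n ≤∙ m≤n+m n p)))
    (cong (compFrom 1) (sym (sytDes-map-suc u) ∙ cong sytDes sp) ∙ desc))

tableau-unpeel : ∀ {p n μ α u} → 0 < n → at μ 0 ≤ suc p → (∀ r → n ≤ r → at μ r ≡ 0) →
  Tableau n μ α u → Tableau (suc (p + n)) (suc p ∷ μ) (suc p ∷ α) (replicate (suc p) 0 ++ map suc u)
tableau-unpeel {p} {n} {μ} {α} {[]} n>0 b z t with words-sound n n (word t)
... | refl , _ = contradiction n>0 λ ()
tableau-unpeel {p} {n} {μ} {α} {x ∷ u'} n>0 b z t = tableau
  (words-intro (suc (p + n)) len bound)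
  (lattice-replicate⁺ (suc p) (lattice-map-suc⁺ (≤-reflexive (content t n>0) ≤∙ b ≤∙ m≤m+n _ _) (lattice t)))
  cont
  (cong (compFrom 1) (sytDes-join p x (map suc u')) ∙
    compFrom-join 1 p _ ∙ cong (suc p ∷_) (cong (compFrom 1) (sytDes-map-suc u) ∙ descent t))
  where
  u = x ∷ u'
  len : length (replicate (suc p) 0 ++ map suc u) ≡ suc (p + n)
  len = List.length-++ (replicate (suc p) 0) ∙ cong₂ _+_ (List.length-replicate (suc p))
    (List.length-map suc u ∙ proj₁ (words-sound _ _ (word t)))
  bound : ∀ {y} → y ∈ replicate (suc p) 0 ++ map suc u → y < suc (p + n)
  bound y∈ with ∈-++⁻ (replicate (suc p) 0) y∈
  ... | inj₁ i = subst (_< suc (p + n)) (sym (∈-replicate (suc p) i)) (s≤s z≤n)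
    where
    ∈-replicate : ∀ k {y} → y ∈ replicate k 0 → y ≡ 0
    ∈-replicate (suc k) (here e) = e
    ∈-replicate (suc k) (there i) = ∈-replicate k i
  ... | inj₂ i with ∈-map⁻ suc i
  ... | y' , y'∈ , refl = s≤s (words-< n (word t) y'∈ ≤∙ m≤n+m n p)
  cont : ∀ {r} → r < suc (p + n) → occ r (replicate (suc p) 0 ++ map suc u) ≡ at (suc p ∷ μ) r
  cont {zero} _ = occ-++ 0 (replicate (suc p) 0) (map suc u) ∙ cong₂ _+_ (occ-replicate (suc p)) (occ-map-suc-0 u) ∙ +-identityʳ _
  cont {suc r} _ = occ-++ (suc r) (replicate (suc p) 0) (map suc u) ∙ cong₂ _+_ (occ-replicate-suc (suc p) r) (occ-map-suc r u) ∙ body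
    where
    body : occ r u ≡ at μ r
    body with r <? n
    ... | yes r<n = content t r<n
    ... | no r≮n = occ≡0 u (λ { y∈ refl → r≮n (words-< n (word t) y∈) }) ∙ sym (z r (≮⇒≥ r≮n))

kF-peel : ∀ p {n} μ {α} → 0 < n → α ≢ [] → at μ 0 ≤ suc p → (∀ r → n ≤ r → at μ r ≡ 0) →
  kF (suc (p + n)) (suc p ∷ μ) (suc p ∷ α) ≡ kF n μ α
kF-peel p {n} μ {α} n>0 α≢ b z = kF≡Σ (suc (p + n)) (suc p ∷ μ) (suc p ∷ α) ∙ trans
  (Σ-bij (λ w → ι (kFTest (suc (p + n)) (suc p ∷ μ) (suc p ∷ α) w)) (λ u → ι (kFTest n μ α u))
    (λ w → map pred (drop (suc p) w)) (λ u → replicate (suc p) 0 ++ map suc u)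
    (words (suc (p + n)) (suc (p + n))) (words n n)
    (words-unique (suc (p + n)) (suc (p + n))) (words-unique n n) to from)
  (sym (kF≡Σ n μ α))
  where
  to : ∀ {w} → w ∈ words (suc (p + n)) (suc (p + n)) → ι (kFTest (suc (p + n)) (suc p ∷ μ) (suc p ∷ α) w) ≢ 0 →
    map pred (drop (suc p) w) ∈ words n n × ι (kFTest n μ α (map pred (drop (suc p) w))) ≡ ι (kFTest (suc (p + n)) (suc p ∷ μ) (suc p ∷ α) w)
      × replicate (suc p) 0 ++ map suc (map pred (drop (suc p) w)) ≡ w
  to w∈ e with tableau-peel α≢ (test⇒tableau w∈ (ι≢0 e))
  ... | t' , e' = word t' , cong ι (tableau⇒test t' ∙ sym (ι≢0 e)) , e'
  from : ∀ {u} → u ∈ words n n → ι (kFTest n μ α u) ≢ 0 →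
    replicate (suc p) 0 ++ map suc u ∈ words (suc (p + n)) (suc (p + n))
      × ι (kFTest (suc (p + n)) (suc p ∷ μ) (suc p ∷ α) (replicate (suc p) 0 ++ map suc u)) ≡ ι (kFTest n μ α u)
      × map pred (drop (suc p) (replicate (suc p) 0 ++ map suc u)) ≡ u
  from {u} u∈ e with tableau-unpeel n>0 b z (test⇒tableau u∈ (ι≢0 e))
  ... | t' = word t' , cong ι (tableau⇒test t' ∙ sym (ι≢0 e)) ,
    trans (cong (map pred) (drop-replicate (suc p) (map suc u))) (map-pred-suc u)

tableau-row : ∀ {n lam w} → Tableau (suc n) lam (suc n ∷ []) w → w ≡ replicate (suc n) 0
tableau-row {n} {w = []} t with words-sound (suc n) (suc n) (word t)
... | () , _
tableau-row {n} {w = x ∷ w} t with lattice-head (lattice t) | words-sound (suc n) (suc n) (word t)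
... | refl | len , _ = sytDes-false w (proj₂ cs ∙ cong (λ k → replicate k false) (length-sytDes 0 w)) ∙ cong (λ k → replicate k 0) len
  where cs = compFrom-single 1 (sytDes (0 ∷ w)) (descent t)

kF-row-vanish : ∀ n lam → at lam 0 ≢ suc n → kF (suc n) lam (suc n ∷ []) ≡ 0
kF-row-vanish n lam ne = kF-vanish {suc n} {lam} {suc n ∷ []} λ t →
  ne (sym (content t (s≤s z≤n)) ∙ cong (occ 0) (tableau-row t) ∙ occ-replicate (suc n))

kF-row : ∀ n lam → at lam 0 ≡ suc n → (∀ r → at lam (suc r) ≡ 0) → kF (suc n) lam (suc n ∷ []) ≡ 1
kF-row n lam e z = kF≡Σ (suc n) lam (suc n ∷ []) ∙ Σ-bij (λ w → ι (kFTest (suc n) lam (suc n ∷ []) w)) (λ _ → 1)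
  (λ _ → tt) (λ _ → replicate (suc n) 0) (words (suc n) (suc n)) (tt ∷ [])
  (words-unique (suc n) (suc n)) ([] ∷ [])
  (λ w∈ e → here refl , cong ι (sym (ι≢0 e)) , sym (tableau-row (test⇒tableau {suc n} {lam} {suc n ∷ []} w∈ (ι≢0 e))))
  (λ _ _ → word t , cong ι (tableau⇒test t) , refl)
  where
  w = replicate (suc n) 0
  lat : LatticeFrom 0 w
  lat = subst (LatticeFrom 0) (List.++-identityʳ w) (lattice-replicate⁺ (suc n) {w = []} (λ { zero r → z≤n ; (suc k) r → z≤n }))
  des : ∀ n → sytDes (replicate (suc n) 0) ≡ replicate n false
  des zero = refl
  des (suc n) = cong (false ∷_) (des n)
  zeros : ∀ k {y} → y ∈ replicate k 0 → y ≡ 0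
  zeros (suc k) (here e) = e
  zeros (suc k) (there i) = zeros k i
  t : Tableau (suc n) lam (suc n ∷ []) w
  t = tableau (words-intro (suc n) (List.length-replicate (suc n)) (λ i → subst (_< suc n) (sym (zeros (suc n) i)) (s≤s z≤n))) lat
    (λ { {zero} _ → trans (occ-replicate (suc n)) (sym e) ; {suc r} _ → occ-replicate-suc (suc n) r ∙ sym (z r) })
    (cong (compFrom 1) (des n) ∙ compFrom-false 1 n)

-- After the first row the descents are strict, so no further entry can lie in that row.
kF-hook-vanish : ∀ p r lam → suc p < at lam 0 → kF (suc (p + suc r)) lam (suc p ∷ replicate (suc r) 1) ≡ 0
kF-hook-vanish p r lam lt = kF-vanish bad
  where
  rising : ∀ y v {r} → sytDes (suc y ∷ v) ≡ replicate r true → occ 0 (suc y ∷ v) ≡ 0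
  rising y [] e = refl
  rising y (zero ∷ v) {suc r} ()
  rising y (suc x ∷ v) {suc r} e = rising x v (∷-tail-injective e)
  bad : ∀ {w} → ¬ Tableau (suc (p + suc r)) lam (suc p ∷ replicate (suc r) 1) w
  bad t with tableau-split (λ ()) t
  ... | y , v , refl , e = <⇒≢ lt (sym (occ-++ 0 (replicate (suc p) 0) (suc y ∷ v) ∙
      cong₂ _+_ (occ-replicate (suc p)) (rising y v (compFrom-ones (sytDes (suc y ∷ v)) r e)) ∙ +-identityʳ _) ∙
    content t (s≤s z≤n))

-- Schur expansions

Σℤ : List A → (A → ℤ) → ℤ
Σℤ xs f = sumℤ (map f xs)

Σℤ-cong-∈ : ∀ {f g : A → ℤ} xs → (∀ {x} → x ∈ xs → f x ≡ g x) → Σℤ xs f ≡ Σℤ xs g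
Σℤ-cong-∈ [] h = refl
Σℤ-cong-∈ (x ∷ xs) h = cong₂ Int._+_ (h (here refl)) (Σℤ-cong-∈ xs (h ∘ there))

Σℤ-vanish : ∀ {f : A → ℤ} xs → (∀ {x} → x ∈ xs → f x ≡ Int.0ℤ) → Σℤ xs f ≡ Int.0ℤ
Σℤ-vanish [] h = refl
Σℤ-vanish (x ∷ xs) h = (cong₂ Int._+_ (h (here refl)) (Σℤ-vanish xs (h ∘ there))) ∙ refl

Σℤ-++ : ∀ (f : A → ℤ) xs ys → Σℤ (xs ++ ys) f ≡ Σℤ xs f Int.+ Σℤ ys f
Σℤ-++ f [] ys = sym (ℤₚ.+-identityˡ _)
Σℤ-++ f (x ∷ xs) ys = cong (Int._+_ (f x)) (Σℤ-++ f xs ys) ∙ sym (ℤₚ.+-assoc (f x) _ _)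

Σℤ-map : ∀ (f : B → ℤ) (g : A → B) xs → Σℤ (map g xs) f ≡ Σℤ xs (f ∘ g)
Σℤ-map f g [] = refl
Σℤ-map f g (x ∷ xs) = cong (Int._+_ (f (g x))) (Σℤ-map f g xs)

Σℤ-concatMap : ∀ (f : B → ℤ) (g : A → List B) xs → Σℤ (concatMap g xs) f ≡ Σℤ xs (λ x → Σℤ (g x) f)
Σℤ-concatMap f g [] = refl
Σℤ-concatMap f g (x ∷ xs) = Σℤ-++ f (g x) _ ∙ cong (Int._+_ (Σℤ (g x) f)) (Σℤ-concatMap f g xs)

Σℤ-filter : ∀ (p : A → Bool) (f : A → ℤ) xs → Σℤ (filterᵇ p xs) f ≡ Σℤ xs (λ x → if p x then f x else Int.0ℤ)
Σℤ-filter p f [] = refl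
Σℤ-filter p f (x ∷ xs) with p x
... | true = cong (Int._+_ (f x)) (Σℤ-filter p f xs)
... | false = Σℤ-filter p f xs ∙ sym (ℤₚ.+-identityˡ _)

Σℤ-- : ∀ (f g : A → ℤ) xs → Σℤ xs (λ x → f x Int.- g x) ≡ Σℤ xs f Int.- Σℤ xs g
Σℤ-- f g [] = refl
Σℤ-- f g (x ∷ xs) = cong (Int._+_ ((f x Int.- g x))) (Σℤ-- f g xs) ∙ solve-ℤ (f x) (g x) (Σℤ xs f) (Σℤ xs g)
  where
  solve-ℤ : ∀ a b c d → (a Int.- b) Int.+ (c Int.- d) ≡ (a Int.+ c) Int.- (b Int.+ d)
  solve-ℤ = ℤSolver.solve-∀

Σℤ-single : ∀ {f : A → ℤ} {x} xs → Unique xs → x ∈ xs → (∀ {y} → y ∈ xs → y ≢ x → f y ≡ Int.0ℤ) → Σℤ xs f ≡ f x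
Σℤ-single {f = f} {x} (.x ∷ xs) (x∉ ∷ u) (here refl) h =
  trans (cong (Int._+_ (f x)) (Σℤ-vanish xs λ {y} y∈ → h (there y∈) λ e → All.lookup x∉ y∈ (sym e))) (ℤₚ.+-identityʳ _)
Σℤ-single {f = f} {x} (y ∷ xs) (y∉ ∷ u) (there i) h =
  trans (cong₂ Int._+_ (h (here refl) (λ e → All.lookup y∉ i e)) (Σℤ-single xs u i (h ∘ there))) (ℤₚ.+-identityˡ _)

concatMap-cong-∈ : ∀ {f g : A → List B} xs → (∀ {x} → x ∈ xs → f x ≡ g x) → concatMap f xs ≡ concatMap g xs
concatMap-cong-∈ [] h = refl
concatMap-cong-∈ (x ∷ xs) h = cong₂ _++_ (h (here refl)) (concatMap-cong-∈ xs (h ∘ there))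

partsF-fuel : ∀ f f' n k → n ≤ f → n ≤ f' → partsF f n k ≡ partsF f' n k
partsF-fuel zero zero zero k _ _ = refl
partsF-fuel zero (suc f') zero k _ _ = refl
partsF-fuel (suc f) zero zero k _ _ = refl
partsF-fuel (suc f) (suc f') zero k _ _ = refl
partsF-fuel (suc f) (suc f') (suc n) k (s≤s a) (s≤s b) =
  concatMap-cong-∈ (filterᵇ (λ p → suc p ≤ᵇ k) (upTo (suc n))) λ {p} _ →
    cong (map (suc p ∷_)) (partsF-fuel f f' (n ∸ p) (suc p) (m∸n≤m n p ≤∙ a) (m∸n≤m n p ≤∙ b))

partsF-sound : ∀ f n k {lam} → lam ∈ partsF f n k → IsPartition lam × sum lam ≡ n × All (_≤ k) lam
partsF-sound zero zero k (here refl) = tt , refl , []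
partsF-sound (suc f) zero k (here refl) = tt , refl , []
partsF-sound (suc f) (suc n) k i with ∈-concat⁻′ (map (λ p → map (suc p ∷_) (partsF f (n ∸ p) (suc p))) (filterᵇ (λ p → suc p ≤ᵇ k) (upTo (suc n)))) i
... | ls , l∈ , ls∈ with ∈-map⁻ (λ p → map (suc p ∷_) (partsF f (n ∸ p) (suc p))) ls∈
... | p , p∈ , refl with ∈-map⁻ (suc p ∷_) l∈ | filterᵇ-∈⁻ (λ p → suc p ≤ᵇ k) (upTo (suc n)) p∈
... | μ , μ∈ , refl | p∈' , p≤k with partsF-sound f (n ∸ p) (suc p) μ∈
... | P , S , B = (s≤s z≤n , B , P) ,
  cong suc (cong (p +_) S ∙ m+[n∸m]≡n (≤-pred (∈-upTo⁻ p∈'))) ,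
  (≤ᵇ≡⇒≤ {suc p} p≤k ∷ All.map (λ b → b ≤∙ ≤ᵇ≡⇒≤ {suc p} p≤k) B)

partition-at-beyond : ∀ lam → IsPartition lam → ∀ r → sum lam ≤ r → at lam r ≡ 0
partition-at-beyond [] P r h = refl
partition-at-beyond (suc p ∷ lam) (_ , _ , P) zero ()
partition-at-beyond (suc p ∷ lam) (_ , _ , P) (suc r) (s≤s h) = partition-at-beyond lam P r (m≤n+m _ p ≤∙ h)

partition-at-head : ∀ {p} lam → All (_≤ p) lam → at lam 0 ≤ p
partition-at-head [] _ = z≤n
partition-at-head (x ∷ lam) (h ∷ _) = h

Σℤ-partsF : ∀ f n k (X : List ℕ → ℤ) → Σℤ (partsF (suc f) (suc n) k) X ≡
  Σℤ (upTo (suc n)) (λ p → if suc p ≤ᵇ k then Σℤ (partsF f (n ∸ p) (suc p)) (λ μ → X (suc p ∷ μ)) else Int.0ℤ)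
Σℤ-partsF f n k X = Σℤ-concatMap X _ (filterᵇ (λ p → suc p ≤ᵇ k) (upTo (suc n))) ∙ trans
  (Σℤ-filter (λ p → suc p ≤ᵇ k) _ (upTo (suc n)))
  (Σℤ-cong-∈ (upTo (suc n)) λ {p} _ → cong (λ z → if suc p ≤ᵇ k then z else Int.0ℤ) (Σℤ-map X (suc p ∷_) (partsF f (n ∸ p) (suc p))))

bounded : ℕ → (List ℕ → ℤ) → List ℕ → ℤ
bounded k X μ = if at μ 0 ≤ᵇ k then X μ else Int.0ℤ

bounded-≤ : ∀ {k} X μ → at μ 0 ≤ k → bounded k X μ ≡ X μ
bounded-≤ {k} X μ h rewrite ≤⇒≤ᵇ≡ h = refl

Σℤ-partsF-bounded : ∀ n k X → Σℤ (partsF n n k) X ≡ Σℤ (partitions n) (bounded k X)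
Σℤ-partsF-bounded zero k X = refl
Σℤ-partsF-bounded (suc n) k X = Σℤ-partsF n n k X
  ∙ Σℤ-cong-∈ (upTo (suc n)) (λ {p} p∈ → pointwise p (≤⇒≤ᵇ≡ {suc p} (∈-upTo⁻ p∈)))
  ∙ sym (Σℤ-partsF n n (suc n) (bounded k X))
  where
  pointwise : ∀ p → (suc p ≤ᵇ suc n) ≡ true →
    (if suc p ≤ᵇ k then Σℤ (partsF n (n ∸ p) (suc p)) (λ μ → X (suc p ∷ μ)) else Int.0ℤ) ≡
    (if suc p ≤ᵇ suc n then Σℤ (partsF n (n ∸ p) (suc p)) (λ μ → bounded k X (suc p ∷ μ)) else Int.0ℤ)
  pointwise p e rewrite e with suc p ≤ᵇ k
  ... | true = refl
  ... | false = sym (Σℤ-vanish (partsF n (n ∸ p) (suc p)) λ _ → refl)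

expansion : ℕ → (List ℕ → ℤ) → List ℕ → ℤ
expansion n e α = Σℤ (partitions n) (λ lam → e lam Int.* pos (kF n lam α))

tail : ℕ → (List ℕ → ℤ) → List ℕ → ℤ
tail p e = bounded p (λ μ → e (p ∷ μ))

*-kF-vanish : ∀ z {k} → k ≡ 0 → z Int.* pos k ≡ Int.0ℤ
*-kF-vanish z refl = ℤₚ.*-zeroʳ z

expansion-cong : ∀ n {e e'} α → (∀ {lam} → lam ∈ partitions n → e lam Int.* pos (kF n lam α) ≡ e' lam Int.* pos (kF n lam α)) → expansion n e α ≡ expansion n e' α
expansion-cong n α h = Σℤ-cong-∈ (partitions n) h

expansion-peel : ∀ p n e {α} → 0 < n → α ≢ [] →
  (∀ lam → IsPartition lam → sum lam ≡ suc (p + n) → suc p < at lam 0 → e lam ≡ Int.0ℤ) →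
  expansion (suc (p + n)) e (suc p ∷ α) ≡ expansion n (tail (suc p) e) α
expansion-peel p n e {α} n>0 α≢ large = Σℤ-partsF (p + n) (p + n) N X
  ∙ Σℤ-single (upTo N) (Uniqueₚ.upTo⁺ N) (∈-upTo⁺ p<N) (λ {q} → other q)
  ∙ cong (λ b → if b then Σℤ (partsF (p + n) (p + n ∸ p) (suc p)) (λ μ → X (suc p ∷ μ)) else Int.0ℤ) (≤⇒≤ᵇ≡ {suc p} p<N)
  ∙ cong (λ l → Σℤ l (λ μ → X (suc p ∷ μ))) (cong (λ k → partsF (p + n) k (suc p)) (m+n∸m≡n p n) ∙ partsF-fuel (p + n) n n (suc p) (m≤n+m n p) ≤-refl)
  ∙ Σℤ-partsF-bounded n (suc p) _
  ∙ Σℤ-cong-∈ (partitions n) (λ {μ} → inner μ)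
  where
  N = suc (p + n)
  X : List ℕ → ℤ
  X lam = e lam Int.* pos (kF N lam (suc p ∷ α))
  p<N : p < N
  p<N = s≤s (m≤m+n p n)
  other : ∀ q → q ∈ upTo N → q ≢ p →
    (if suc q ≤ᵇ N then Σℤ (partsF (p + n) (p + n ∸ q) (suc q)) (λ μ → X (suc q ∷ μ)) else Int.0ℤ) ≡ Int.0ℤ
  other q q∈ q≢p rewrite ≤⇒≤ᵇ≡ {suc q} (∈-upTo⁻ q∈) = Σℤ-vanish (partsF (p + n) (p + n ∸ q) (suc q)) λ {μ} μ∈ →
    case (partsF-sound (p + n) (p + n ∸ q) (suc q) μ∈) of λ where
      (P , S , B) → case <-cmp q p of λ where
        (tri< q<p _ _) → *-kF-vanish (e (suc q ∷ μ)) (kF-first-part p n (suc q ∷ μ) α≢ (s≤s q<p))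
        (tri≈ _ q≡p _) → contradiction q≡p q≢p
        (tri> _ _ p<q) → cong (Int._* pos (kF N (suc q ∷ μ) (suc p ∷ α))) (large (suc q ∷ μ) (s≤s z≤n , B , P)
          (cong suc (cong (q +_) S ∙ m+[n∸m]≡n (≤-pred (∈-upTo⁻ q∈)))) (s≤s p<q)) ∙ ℤₚ.*-zeroˡ (pos (kF N (suc q ∷ μ) (suc p ∷ α)))
  inner : ∀ μ → μ ∈ partitions n → bounded (suc p) (λ μ → X (suc p ∷ μ)) μ ≡ tail (suc p) e μ Int.* pos (kF n μ α)
  inner μ μ∈ with at μ 0 ≤ᵇ suc p in eq | partsF-sound n n n μ∈
  ... | false | _ = sym (ℤₚ.*-zeroˡ (pos (kF n μ α)))
  ... | true | P , S , _ = cong (λ k → e (suc p ∷ μ) Int.* pos k)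
    (kF-peel p μ n>0 α≢ (≤ᵇ≡⇒≤ eq) (λ r n≤r → partition-at-beyond μ P r (≤-reflexive S ≤∙ n≤r)))

sum≡0⇒[] : ∀ lam → IsPartition lam → sum lam ≡ 0 → lam ≡ []
sum≡0⇒[] [] P e = refl
sum≡0⇒[] (suc p ∷ lam) P ()
sum≡0⇒[] (zero ∷ lam) (() , _) e

partition-row : ∀ n lam → IsPartition lam → sum lam ≡ suc n → at lam 0 ≡ suc n → lam ≡ suc n ∷ []
partition-row n (.(suc n) ∷ lam) (_ , _ , P) S refl = cong (suc n ∷_) (sum≡0⇒[] lam P (+-cancelˡ-≡ (suc n) _ _ (S ∙ sym (+-identityʳ _))))

concatMap-complete : ∀ (g : A → List B) {xs x y} → x ∈ xs → y ∈ g x → y ∈ concatMap g xs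
concatMap-complete g x∈ y∈ = ∈-concat⁺′ y∈ (∈-map⁺ g x∈)

partsF-complete : ∀ f n k lam → n ≤ f → IsPartition lam → sum lam ≡ n → All (_≤ k) lam → lam ∈ partsF f n k
partsF-complete zero zero k [] _ _ _ _ = here refl
partsF-complete (suc f) zero k [] _ _ _ _ = here refl
partsF-complete f zero k (suc p ∷ lam) _ _ () _
partsF-complete f zero k (zero ∷ lam) _ (() , _) _ _
partsF-complete (suc f) (suc n) k (zero ∷ lam) _ (() , _) _ _
partsF-complete (suc f) (suc n) k (suc p ∷ lam) (s≤s n≤f) (_ , B , P) S (b ∷ _) =
  concatMap-complete (λ p → map (suc p ∷_) (partsF f (n ∸ p) (suc p)))
    (filterᵇ-∈⁺ (λ p → suc p ≤ᵇ k) (upTo (suc n)) (∈-upTo⁺ (s≤s p≤n)) (≤⇒≤ᵇ≡ {suc p} b))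
    (∈-map⁺ (suc p ∷_) (partsF-complete f (n ∸ p) (suc p) lam (m∸n≤m n p ≤∙ n≤f) P S' B))
  where
  S0 : p + sum lam ≡ n
  S0 = suc-injective S
  p≤n : p ≤ n
  p≤n = subst (p ≤_) S0 (m≤m+n p (sum lam))
  S' : sum lam ≡ n ∸ p
  S' = sym (cong (_∸ p) (sym S0) ∙ m+n∸m≡n p (sum lam))

All-≤-sum : ∀ lam → All (_≤ sum lam) lam
All-≤-sum [] = []
All-≤-sum (x ∷ lam) = m≤m+n x (sum lam) ∷ All.map (λ b → b ≤∙ m≤n+m (sum lam) x) (All-≤-sum lam)

partitions-complete : ∀ n lam → IsPartition lam → sum lam ≡ n → lam ∈ partitions n
partitions-complete n lam P refl = partsF-complete n n n lam ≤-refl P refl (All-≤-sum lam)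

partsF-unique : ∀ f n k → Unique (partsF f n k)
partsF-unique zero zero k = [] ∷ []
partsF-unique (suc f) zero k = [] ∷ []
partsF-unique zero (suc n) k = []
partsF-unique (suc f) (suc n) k = concatMap-unique _ (λ lam → pred (at lam 0)) _
  (filterᵇ-unique (λ p → suc p ≤ᵇ k) _ (Uniqueₚ.upTo⁺ (suc n)))
  (λ p → Uniqueₚ.map⁺ ∷-tail-injective (partsF-unique f (n ∸ p) (suc p))) t
  where
  t : ∀ {p lam} → lam ∈ map (suc p ∷_) (partsF f (n ∸ p) (suc p)) → pred (at lam 0) ≡ p
  t i with ∈-map⁻ _ i
  ... | _ , _ , refl = refl

row-partition : ∀ n → IsPartition (suc n ∷ [])
row-partition n = s≤s z≤n , [] , tt

expansion-row : ∀ n e → expansion (suc n) e (suc n ∷ []) ≡ e (suc n ∷ [])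
expansion-row n e = trans
  (Σℤ-single (partitions (suc n)) (partsF-unique (suc n) (suc n) (suc n))
    (partitions-complete (suc n) (suc n ∷ []) (row-partition n) (+-identityʳ (suc n)))
    (λ {lam} lam∈ ne → *-kF-vanish (e lam) (kF-row-vanish n lam λ h → case partsF-sound (suc n) (suc n) (suc n) lam∈ of λ where
      (P , S , _) → ne (partition-row n lam P S h))))
  (cong (λ k → e (suc n ∷ []) Int.* pos k) (kF-row n (suc n ∷ []) refl (λ _ → refl)) ∙ ℤₚ.*-identityʳ _)

-- Descending induction on the first part, peeling it off each time.
expansion-injective : ∀ n t e → (∀ p α → t < p → expansion n e (p ∷ α) ≡ Int.0ℤ) →
  ∀ lam → IsPartition lam → sum lam ≡ n → t < at lam 0 → e lam ≡ Int.0ℤ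
expansion-injective = <-rec _ step
  where
  Claim : ℕ → Set
  Claim n = ∀ t e → (∀ p α → t < p → expansion n e (p ∷ α) ≡ Int.0ℤ) →
    ∀ lam → IsPartition lam → sum lam ≡ n → t < at lam 0 → e lam ≡ Int.0ℤ
  step : ∀ n → (∀ {n'} → n' < n → Claim n') → Claim n
  step n IH t e hyp lam0 P0 S0 t0 = <-rec Down down (n ∸ at lam0 0) lam0 P0 S0 t0 refl
    where
    Down : ℕ → Set
    Down j = ∀ lam → IsPartition lam → sum lam ≡ n → t < at lam 0 → n ∸ at lam 0 ≡ j → e lam ≡ Int.0ℤ
    down : ∀ j → (∀ {j'} → j' < j → Down j') → Down j
    down j rec [] P S () E
    down j rec (zero ∷ μ) P S () E
    down j rec (suc p ∷ []) P refl tp E = sym (subst (λ k → expansion (suc k) e (suc k ∷ []) ≡ e (suc p ∷ [])) (sym (+-identityʳ p)) (subst (λ k → expansion (suc p) e (suc p ∷ []) ≡ e (suc k ∷ [])) refl (expansion-row p e))) ∙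
      hyp (suc (p + 0)) [] (subst (λ k → t < suc k) (sym (+-identityʳ p)) tp)
    down j rec (suc p ∷ zero ∷ μ) (_ , _ , (() , _)) S tp E
    down j rec (suc p ∷ suc x ∷ μ) (_ , b ∷ B , P) refl tp E =
      trans (sym (bounded-≤ (λ ν → e (suc p ∷ ν)) (suc x ∷ μ) b))
        (IH (s≤s (m≤n+m n' p)) 0 (tail (suc p) e) zero' (suc x ∷ μ) P refl (s≤s z≤n))
      where
      n' = sum (suc x ∷ μ)
      zero' : ∀ q α → 0 < q → expansion n' (tail (suc p) e) (q ∷ α) ≡ Int.0ℤ
      zero' q α _ = sym (expansion-peel p n' e (s≤s z≤n) (λ ()) larger) ∙ hyp (suc p) (q ∷ α) tp
        where
        larger : ∀ lam → IsPartition lam → sum lam ≡ suc (p + n') → suc p < at lam 0 → e lam ≡ Int.0ℤ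
        larger lam P' S' lt = rec (subst (n ∸ at lam 0 <_) E
          (∸-monoʳ-< lt (head≤sum lam ≤∙ ≤-reflexive S'))) lam P' S' (<-trans tp lt) refl
          where
          head≤sum : ∀ lam → at lam 0 ≤ sum lam
          head≤sum [] = z≤n
          head≤sum (x ∷ lam) = m≤m+n x _

expansion-unique : ∀ n e e' → 0 < n → (∀ p α → expansion n e (p ∷ α) ≡ expansion n e' (p ∷ α)) →
  ∀ lam → IsPartition lam → sum lam ≡ n → e lam ≡ e' lam
expansion-unique n e e' n>0 h lam P S = ℤₚ.i-j≡0⇒i≡j (e lam) (e' lam)
  (expansion-injective n 0 (λ lam → e lam Int.- e' lam) diff lam P S (head>0 lam P S))
  where
  head>0 : ∀ lam → IsPartition lam → sum lam ≡ n → 0 < at lam 0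
  head>0 [] _ refl = n>0
  head>0 (x ∷ lam) (x>0 , _) _ = x>0
  diff : ∀ p α → 0 < p → expansion n (λ lam → e lam Int.- e' lam) (p ∷ α) ≡ Int.0ℤ
  diff p α _ = Σℤ-cong-∈ (partitions n) (λ {lam} _ → ℤₚ.*-distribʳ-+ (pos (kF n lam (p ∷ α))) (e lam) (Int.- e' lam)) ∙
    Σℤ-cong-∈ (partitions n) (λ {lam} _ → cong (Int._+_ (e lam Int.* pos (kF n lam (p ∷ α)))) (sym (ℤₚ.neg-distribˡ-* (e' lam) (pos (kF n lam (p ∷ α)))))) ∙
    Σℤ-- _ _ (partitions n) ∙ ℤₚ.i≡j⇒i-j≡0 {expansion n e (p ∷ α)} {expansion n e' (p ∷ α)} (h p α)

expansion-hook : ∀ p r e → expansion (suc (p + r)) e (suc p ∷ replicate r 1) ≡ e (suc p ∷ replicate r 1)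
expansion-hook p zero e = subst (λ k → expansion (suc k) e (suc p ∷ []) ≡ e (suc p ∷ [])) (sym (+-identityʳ p)) (expansion-row p e)
expansion-hook p (suc r) e = expansion-cong (suc (p + suc r)) {e} {bounded (suc p) e} (suc p ∷ replicate (suc r) 1) (λ {lam} _ → restrict lam)
  ∙ expansion-peel p (suc r) (bounded (suc p) e) (s≤s z≤n) (λ ()) (λ lam _ _ lt → cong (λ b → if b then e lam else Int.0ℤ) (≰⇒≤ᵇ≡ lt))
  ∙ expansion-hook 0 r (tail (suc p) (bounded (suc p) e))
  ∙ bounded-≤ {suc p} (λ μ → bounded (suc p) e (suc p ∷ μ)) (1 ∷ replicate r 1) (s≤s z≤n)
  ∙ bounded-≤ e (suc p ∷ replicate (suc r) 1) ≤-refl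
  where
  restrict : ∀ lam → e lam Int.* pos (kF (suc (p + suc r)) lam (suc p ∷ replicate (suc r) 1)) ≡
    bounded (suc p) e lam Int.* pos (kF (suc (p + suc r)) lam (suc p ∷ replicate (suc r) 1))
  restrict lam with at lam 0 ≤ᵇ suc p in eq
  ... | true = refl
  ... | false = *-kF-vanish (e lam) (kF-hook-vanish p r lam (≰⇒> λ h → true≢false (sym (≤⇒≤ᵇ≡ h) ∙ eq))) ∙ sym (ℤₚ.*-zeroˡ (pos (kF (suc (p + suc r)) lam (suc p ∷ replicate (suc r) 1))))

-- Permutations and standardization

record Perm (n : ℕ) (σ : List ℕ) : Set where
  field
    size : length σ ≡ n
    bound : ∀ {i} → i < n → at σ i < n
    injective : ∀ {i j} → i < n → j < n → at σ i ≡ at σ j → i ≡ j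


at-∈ : ∀ (w : List ℕ) {i} → i < length w → at w i ∈ w
at-∈ (x ∷ w) {zero} _ = here refl
at-∈ (x ∷ w) {suc i} (s≤s h) = there (at-∈ w h)

distinct⇒injective : ∀ σ → distinct σ ≡ true → ∀ {i j} → i < length σ → j < length σ → at σ i ≡ at σ j → i ≡ j
distinct⇒injective (x ∷ σ) d {zero} {zero} _ _ e = refl
distinct⇒injective (x ∷ σ) d {zero} {suc j} _ (s≤s j<) e = contradiction (≡⇒≡ᵇ≡ e) λ t →
  true≢false (sym t ∙ not-true (allᵇ-elim σ (proj₁ (∧-elim d)) (at-∈ σ j<)))
distinct⇒injective (x ∷ σ) d {suc i} {zero} (s≤s i<) _ e = contradiction (≡⇒≡ᵇ≡ (sym e)) λ t →
  true≢false (sym t ∙ not-true (allᵇ-elim σ (proj₁ (∧-elim d)) (at-∈ σ i<)))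
distinct⇒injective (x ∷ σ) d {suc i} {suc j} (s≤s i<) (s≤s j<) e =
  cong suc (distinct⇒injective σ (proj₂ (∧-elim {allᵇ (λ y → not (x ≡ᵇ y)) σ} d)) i< j< e)

injective⇒distinct : ∀ σ → (∀ {i j} → i < length σ → j < length σ → at σ i ≡ at σ j → i ≡ j) → distinct σ ≡ true
injective⇒distinct [] h = refl
injective⇒distinct (x ∷ σ) h = ∧-intro
  (allᵇ-intro σ λ {y} y∈ → case ∈⇒at σ y∈ of λ where
    (j , j< , refl) → not-false (≢⇒≡ᵇ≡ λ e → case h {0} {suc j} (s≤s z≤n) (s≤s j<) e of λ ()))
  (injective⇒distinct σ λ i< j< e → suc-injective (h (s≤s i<) (s≤s j<) e))

indexOf-correct : ∀ σ {i} → i < length σ → indexOf σ (at σ i) < length σ × at σ (indexOf σ (at σ i)) ≡ at σ i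
indexOf-correct (x ∷ σ) {i} i< with x ≡ᵇ at (x ∷ σ) i in eq
... | true = s≤s z≤n , ≡ᵇ≡⇒≡ eq
indexOf-correct (x ∷ σ) {zero} i< | false = contradiction (sym (≡⇒≡ᵇ≡ {x} refl) ∙ eq) true≢false
indexOf-correct (x ∷ σ) {suc i} (s≤s i<) | false = let (a , b) = indexOf-correct σ i< in s≤s a , b

module Permutation {n σ} (P : Perm n σ) where
  open Perm P

  surjective : ∀ {c} → c < n → ∃ λ i → i < n × at σ i ≡ c
  surjective {c} c<n with Σ< n (λ i → ι (at σ i ≡ᵇ c)) ≟ 0
  ... | no ≢0 with Σ≢0⇒∃ (upTo n) ≢0
  ... | i , i∈ , e = i , ∈-upTo⁻ i∈ , ≡ᵇ≡⇒≡ (ι≢0 e)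
  surjective {c} c<n | yes ≡0 = contradiction too-many (<⇒≱ (≤-reflexive fewer))
    where
    others : ℕ → ℕ
    others j = ι (not (c ≡ᵇ j))
    missed : ∀ {i} → i < n → at σ i ≢ c
    missed i<n e = case ≤-trans (≤-reflexive (cong ι (sym (≡⇒≡ᵇ≡ e)))) (term≤Σ (λ i → ι (at σ i ≡ᵇ c)) (upTo n) (∈-upTo⁺ i<n) ≤∙ ≤-reflexive ≡0) of λ ()
    too-many : n ≤ Σ< n others
    too-many = ≤-reflexive (sym (Σ-const (upTo n) 1 ∙ *-identityʳ _ ∙ List.length-upTo n)) ≤∙
      Σ-inj-≤ (λ _ → 1) others (at σ) (upTo n) (upTo n) (Uniqueₚ.upTo⁺ n)
        (λ i∈ _ → ∈-upTo⁺ (bound (∈-upTo⁻ i∈)) , ≤-reflexive (cong ι (sym (not-false (≢⇒≡ᵇ≡ λ e → missed (∈-upTo⁻ i∈) (sym e))))))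
        (λ i∈ j∈ _ _ e → injective (∈-upTo⁻ i∈) (∈-upTo⁻ j∈) e)
    fewer : suc (Σ< n others) ≡ n
    fewer = cong (_+ Σ< n others) (sym (Σ-upTo-δ n (λ _ → 1) c<n))
      ∙ sym (Σ-+ _ _ (upTo n))
      ∙ Σ-cong (upTo n) (λ j → one (c ≡ᵇ j))
      ∙ Σ-const (upTo n) 1 ∙ *-identityʳ _ ∙ List.length-upTo n
      where
      one : ∀ b → ι b * 1 + ι (not b) ≡ 1
      one true = refl
      one false = refl

  index : ℕ → ℕ
  index = indexOf σ

  at-index : ∀ {c} → c < n → at σ (index c) ≡ c
  at-index c<n with surjective c<n
  ... | i , i<n , refl = proj₂ (indexOf-correct σ (subst (i <_) (sym size) i<n))

  index-bound : ∀ {c} → c < n → index c < n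
  index-bound {c} c<n with surjective c<n
  ... | i , i<n , refl = subst (index (at σ i) <_) size (proj₁ (indexOf-correct σ (subst (i <_) (sym size) i<n)))

  index-at : ∀ {i} → i < n → index (at σ i) ≡ i
  index-at i<n = injective (index-bound (bound i<n)) i<n (at-index (bound i<n))

  Σ-at-perm : ∀ f → Σ< n (λ i → f (at σ i)) ≡ Σ< n f
  Σ-at-perm f = Σ-bij (λ i → f (at σ i)) f (at σ) index (upTo n) (upTo n) (Uniqueₚ.upTo⁺ n) (Uniqueₚ.upTo⁺ n)
    (λ i∈ _ → ∈-upTo⁺ (bound (∈-upTo⁻ i∈)) , refl , index-at (∈-upTo⁻ i∈))
    (λ c∈ _ → ∈-upTo⁺ (index-bound (∈-upTo⁻ c∈)) , cong f (at-index (∈-upTo⁻ c∈)) , at-index (∈-upTo⁻ c∈))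

  Σ-index : ∀ f → Σ< n (λ c → f (index c)) ≡ Σ< n f
  Σ-index f = sym (Σ-at-perm (f ∘ index)) ∙ (Σ-upTo-cong n λ i<n → cong f (index-at i<n))

Σ-upTo-1 : ∀ n → Σ< n (λ _ → 1) ≡ n
Σ-upTo-1 n = Σ-const (upTo n) 1 ∙ *-identityʳ _ ∙ List.length-upTo n

Σ-upTo-< : ∀ n {c} → c ≤ n → Σ< n (λ i → ι (i <ᵇ c)) ≡ c
Σ-upTo-< n {c} c≤n with m≤n⇒∃[o]m+o≡n c≤n
... | k , refl = Σ-upTo-+ c k _
  ∙ cong₂ _+_ (Σ-upTo-cong c (λ i<c → cong ι (<⇒<ᵇ≡ i<c))) (Σ-upTo-vanish k λ {i} _ → cong ι (≮⇒<ᵇ≡ (m≤m+n c i)))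
  ∙ +-identityʳ _ ∙ Σ-upTo-1 c

std-rank : ℕ → (ℕ → ℕ) → ℕ → ℕ
std-rank n key j = Σ< n (λ i → ι (key i <ᵇ key j))

std : ℕ → (ℕ → ℕ) → List ℕ
std n key = applyUpTo (std-rank n key) n

at-std : ∀ n key {j} → j < n → at (std n key) j ≡ std-rank n key j
at-std n key j<n = at-applyUpTo (std-rank n key) n j<n

module Standardize (n : ℕ) (key : ℕ → ℕ) (key-inj : ∀ {i j} → i < n → j < n → key i ≡ key j → i ≡ j) where

  rank : ℕ → ℕ
  rank = std-rank n key

  rank-mono : ∀ {i j} → i < n → key i < key j → rank i < rank j
  rank-mono {i} {j} i<n lt = begin
    suc (rank i) ≡⟨ cong (_+ rank i) (sym (Σ-upTo-δ n (λ _ → 1) i<n)) ⟩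
    Σ< n (λ k → ι (i ≡ᵇ k) * 1) + rank i ≡⟨ sym (Σ-+ _ _ (upTo n)) ⟩
    Σ< n (λ k → ι (i ≡ᵇ k) * 1 + ι (key k <ᵇ key i)) ≤⟨ Σ-mono (upTo n) (λ {k} _ → pointwise k) ⟩
    rank j ∎
    where
    open ≤-Reasoning
    pointwise : ∀ k → ι (i ≡ᵇ k) * 1 + ι (key k <ᵇ key i) ≤ ι (key k <ᵇ key j)
    pointwise k with i ≟ k
    ... | yes refl rewrite ≡⇒≡ᵇ≡ {i} refl | ≮⇒<ᵇ≡ (≤-refl {key i}) | <⇒<ᵇ≡ lt = ≤-refl
    ... | no i≢k rewrite ≢⇒≡ᵇ≡ i≢k with key k <ᵇ key i in eq
    ... | false = z≤n
    ... | true rewrite <⇒<ᵇ≡ (<-trans (<ᵇ≡⇒< {key k} eq) lt) = ≤-refl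

  rank-bound : ∀ {j} → j < n → rank j < n
  rank-bound {j} j<n = begin
    suc (rank j) ≡⟨ cong (_+ rank j) (sym (Σ-upTo-δ n (λ _ → 1) j<n)) ⟩
    Σ< n (λ k → ι (j ≡ᵇ k) * 1) + rank j ≡⟨ sym (Σ-+ _ _ (upTo n)) ⟩
    Σ< n (λ k → ι (j ≡ᵇ k) * 1 + ι (key k <ᵇ key j)) ≤⟨ Σ-mono (upTo n) (λ {k} _ → pointwise k) ⟩
    Σ< n (λ _ → 1) ≡⟨ Σ-upTo-1 n ⟩
    n ∎
    where
    open ≤-Reasoning
    pointwise : ∀ k → ι (j ≡ᵇ k) * 1 + ι (key k <ᵇ key j) ≤ 1
    pointwise k with j ≟ k
    ... | yes refl rewrite ≡⇒≡ᵇ≡ {j} refl | ≮⇒<ᵇ≡ (≤-refl {key j}) = ≤-refl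
    ... | no j≢k rewrite ≢⇒≡ᵇ≡ j≢k = ι≤1 (key k <ᵇ key j)

  rank-reflects : ∀ {i j} → j < n → rank i < rank j → key i < key j
  rank-reflects {i} {j} j<n lt with <-cmp (key i) (key j)
  ... | tri< h _ _ = h
  ... | tri≈ _ e _ = contradiction lt (<-irrefl (Σ-cong (upTo n) λ k → cong (λ z → ι (key k <ᵇ z)) e))
  ... | tri> _ _ h = contradiction (rank-mono j<n h) (<-asym lt)

  std-perm : Perm n (std n key)
  std-perm = record
    { size = List.length-applyUpTo rank n
    ; bound = λ j<n → subst (_< n) (sym (at-std n key j<n)) (rank-bound j<n)
    ; injective = λ {i} {j} i<n j<n e → key-inj i<n j<n (rank-injective i<n j<n (sym (at-std n key i<n) ∙ e ∙ at-std n key j<n))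
    }
    where
    rank-injective : ∀ {i j} → i < n → j < n → rank i ≡ rank j → key i ≡ key j
    rank-injective {i} {j} i<n j<n e with <-cmp (key i) (key j)
    ... | tri< h _ _ = contradiction (rank-mono i<n h) (<-irrefl e)
    ... | tri≈ _ h _ = h
    ... | tri> _ _ h = contradiction (rank-mono j<n h) (<-irrefl (sym e))

  std-unique : ∀ {σ} → Perm n σ → (∀ {i j} → i < n → j < n → key i < key j → at σ i < at σ j) → σ ≡ std n key
  std-unique {σ} P mono = at-ext σ (std n key) (size ∙ sym (List.length-applyUpTo rank n)) λ {j} j< →
    let j<n = subst (j <_) size j< in trans (value j<n) (sym (at-std n key j<n))
    where
    open Perm P
    open Permutation P
    reflects : ∀ {i j} → i < n → j < n → at σ i < at σ j → key i < key j
    reflects {i} {j} i<n j<n lt with <-cmp (key i) (key j)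
    ... | tri< h _ _ = h
    ... | tri≈ _ e _ = contradiction lt (<-irrefl (cong (at σ) (key-inj i<n j<n e)))
    ... | tri> _ _ h = contradiction (mono j<n i<n h) (<-asym lt)
    value : ∀ {j} → j < n → at σ j ≡ rank j
    value {j} j<n = sym (Σ-upTo-< n (<⇒≤ (bound j<n)))
      ∙ sym (Σ-at-perm (λ c → ι (c <ᵇ at σ j)))
      ∙ Σ-upTo-cong n (λ i<n → cong ι (<ᵇ-cong (reflects i<n j<n) (mono i<n j<n)))

-- Dyck paths by rows

record Dyck (m n : ℕ) (x : List ℕ) : Set where
  field
    size : length x ≡ n
    col : ∀ {j} → j < n → at x j < m
    step : ∀ {j} → suc j < n → at x j ≤ at x (suc j)
    diag : ∀ {j} → j < n → n * at x j ≤ m * j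

<∸1⇒ : ∀ {j} n → j < n ∸ 1 → suc j < n
<∸1⇒ (suc n) h = s≤s h

⇒<∸1 : ∀ {j} n → suc j < n → j < n ∸ 1
⇒<∸1 (suc n) (s≤s h) = h

dyckPaths-sound : ∀ m n {x} → x ∈ dyckPaths m n → Dyck m n x
dyckPaths-sound m n {x} x∈ with filterᵇ-∈⁻ (isDyck m n) (words n m) x∈
... | w∈ , t with words-sound n m w∈ | ∧-elim {length x ≡ᵇ n} t
... | len , bound | _ , t' with ∧-elim {allᵇ (λ j → at x j ≤ᵇ at x (suc j)) (upTo (n ∸ 1))} t'
... | s , d = record
  { size = len
  ; col = bound
  ; step = λ {j} h → ≤ᵇ≡⇒≤ (allᵇ-upTo-elim (n ∸ 1) s (⇒<∸1 n h))
  ; diag = λ {j} h → ≤ᵇ≡⇒≤ (allᵇ-upTo-elim n d h)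
  }

dyckPaths-complete : ∀ m n {x} → Dyck m n x → x ∈ dyckPaths m n
dyckPaths-complete m n {x} D = filterᵇ-∈⁺ (isDyck m n) (words n m) (words-complete n m x size col)
  (∧-intro (≡⇒≡ᵇ≡ size) (∧-intro
    (allᵇ-upTo-intro (n ∸ 1) (λ h → ≤⇒≤ᵇ≡ (step (<∸1⇒ n h))))
    (allᵇ-upTo-intro n (λ h → ≤⇒≤ᵇ≡ (diag h)))))
  where open Dyck D

divℕ-mono : ∀ {a b} m → a ≤ b → divℕ a m ≤ divℕ b m
divℕ-mono zero h = z≤n
divℕ-mono (suc m) h = DivMod./-monoˡ-≤ (suc m) h

divℕ-< : ∀ {a b} m → 0 < m → a < b * m → divℕ a m < b
divℕ-< (suc m) _ h = DivMod.m<n*o⇒m/o<n h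

divℕ-step : ∀ {a b} m → 0 < m → a + m ≤ b → divℕ a m < divℕ b m
divℕ-step {a} {b} (suc m) _ h = begin
  suc (a / suc m) ≡⟨ cong (λ z → suc (z / suc m)) (sym (m+n∸n≡m a (suc m))) ⟩
  suc ((a + suc m ∸ suc m) / suc m) ≡⟨ sym (DivMod.m/n≡1+[m∸n]/n (m≤n+m (suc m) a)) ⟩
  (a + suc m) / suc m ≤⟨ DivMod./-monoˡ-≤ (suc m) h ⟩
  b / suc m ∎
  where open ≤-Reasoning

∣-gap : ∀ {d u v} → 0 < d → d ∣ u → d ∣ v → u < v → u + d ≤ v
∣-gap {d} {u} {v} d>0 d∣u d∣v u<v with m≤n⇒∃[o]m+o≡n (<⇒≤ u<v)
... | zero , refl = contradiction u<v (<-irrefl (sym (+-identityʳ u)))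
... | suc o , refl = +-monoʳ-≤ u (∣⇒≤ (∣m+n∣m⇒∣n d∣v d∣u))

window : ℕ → ℕ → ℕ → ℕ
window a b e = ι ((a <ᵇ e) ∧ (e ≤ᵇ b))

above : ℕ → ℕ → ℕ
above a e = ι (a <ᵇ e)

not-≤ : ∀ e b → (e ≤ᵇ b) ≡ not (b <ᵇ e)
not-≤ e b with e ≤? b
... | yes h rewrite ≤⇒≤ᵇ≡ h | ≮⇒<ᵇ≡ h = refl
... | no h rewrite ≰⇒≤ᵇ≡ (≰⇒> h) | <⇒<ᵇ≡ (≰⇒> h) = refl

window-above : ∀ {a b} e → a ≤ b → window a b e + above b e ≡ above a e
window-above {a} {b} e a≤b rewrite not-≤ e b with b <ᵇ e in eq
... | false = +-identityʳ _ ∙ ι-∧ (a <ᵇ e) true ∙ *-identityʳ _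
... | true rewrite <⇒<ᵇ≡ (≤-<-trans a≤b (<ᵇ≡⇒< {b} {e} eq)) = refl

window-split : ∀ {a b c} e → a ≤ b → b ≤ c → window a c e ≡ window a b e + window b c e
window-split {a} {b} {c} e a≤b b≤c = +-cancelʳ-≡ (above c e) _ _ (window-above e (a≤b ≤∙ b≤c)
  ∙ sym (window-above e a≤b)
  ∙ cong (window a b e +_) (sym (window-above e b≤c))
  ∙ sym (+-assoc (window a b e) _ _))

above-∸ : ∀ L k e → above (L + k) e ≡ above L (e ∸ k)
above-∸ L k e = cong ι (<ᵇ-cong {L + k} {e} (λ h → +-cancelʳ-< k L (e ∸ k) (<-≤-trans h (≤-reflexive (sym (m∸n+n≡m (m≤n+m k L ≤∙ <⇒≤ h))))))
  (λ h → <-≤-trans (+-monoˡ-< k h) (≤-reflexive (m∸n+n≡m (<⇒≤ (m<n∸o⇒o<n' h))))))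
  where
  m<n∸o⇒o<n' : L < e ∸ k → k < e
  m<n∸o⇒o<n' h with k <? e
  ... | yes k<e = k<e
  ... | no k≮e rewrite m≤n⇒m∸n≡0 (≮⇒≥ k≮e) = contradiction h λ ()

-- A step from s up to s + k crosses the line just above L.
crossing : ℕ → ℕ → ℕ → ℕ
crossing L k s = ι ((s ≤ᵇ L) ∧ (L <ᵇ s + k))

crossing-above : ∀ L k s → crossing L k s + above L s ≡ above L (s + k)
crossing-above L k s rewrite not-≤ s L with L <ᵇ s in eq
... | false = +-identityʳ _
... | true rewrite <⇒<ᵇ≡ (<-≤-trans (<ᵇ≡⇒< {L} {s} eq) (m≤m+n s k)) = refl

Σ-pairs : ∀ n (F : ℕ → ℕ → ℕ) → Σ< n (λ j → Σ< n (λ i → F i j)) ≡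
  Σ< n (λ j → Σ< j (λ i → F i j + F j i)) + Σ< n (λ j → F j j)
Σ-pairs zero F = refl
Σ-pairs (suc n) F = Σ-upTo-snoc n _
  ∙ cong₂ _+_ (Σ-cong (upTo n) (λ j → Σ-upTo-snoc n _) ∙ Σ-+ _ _ (upTo n)) (Σ-upTo-snoc n _)
  ∙ cong (λ z → (z + R) + (S + F n n)) (Σ-pairs n F)
  ∙ eq P D R S (F n n)
  ∙ cong₂ _+_ (cong (P +_) (sym (Σ-+ _ _ (upTo n))) ∙ sym (Σ-upTo-snoc n _)) (sym (Σ-upTo-snoc n _))
  where
  P = Σ< n (λ j → Σ< j (λ i → F i j + F j i))
  D = Σ< n (λ j → F j j)
  R = Σ< n (λ j → F n j)
  S = Σ< n (λ i → F i n)
  eq : ∀ p d r s f → ((p + d) + r) + (s + f) ≡ (p + (s + r)) + (d + f)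
  eq = solve-∀

foldr-⊔-max : ∀ (f : A → ℕ) {M} xs → (∀ {x} → x ∈ xs → f x ≤ M) → (∃ λ x → x ∈ xs × f x ≡ M) → foldr _⊔_ 0 (map f xs) ≡ M
foldr-⊔-max f {M} xs h (x , x∈ , e) = ≤-antisym (upper xs h) (lower xs x∈)
  where
  upper : ∀ ys → (∀ {x} → x ∈ ys → f x ≤ M) → foldr _⊔_ 0 (map f ys) ≤ M
  upper [] h = z≤n
  upper (y ∷ ys) h = ⊔-lub (h (here refl)) (upper ys (h ∘ there))
  lower : ∀ ys → x ∈ ys → M ≤ foldr _⊔_ 0 (map f ys)
  lower (y ∷ ys) (here refl) = ≤-reflexive (sym e) ≤∙ m≤m⊔n (f y) _
  lower (y ∷ ys) (there i) = lower ys i ≤∙ m≤n⊔m (f y) _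

Σ-telescope : ∀ k (ψ : ℕ → ℕ) → ψ 0 + Σ< k (λ t → ψ (suc t)) ≡ ψ k + Σ< k ψ
Σ-telescope zero ψ = refl
Σ-telescope (suc k) ψ rewrite Σ-upTo-snoc k (ψ ∘ suc) | Σ-upTo-snoc k ψ =
  trans (sym (+-assoc (ψ 0) _ _)) (cong (_+ ψ (suc k)) (Σ-telescope k ψ) ∙ eq (ψ k) (Σ< k ψ) (ψ (suc k)))
  where
  eq : ∀ a b c → a + b + c ≡ c + (b + a)
  eq = solve-∀

record Labeling (n : ℕ) (x σ : List ℕ) : Set where
  field
    perm : Perm n σ
    column : ∀ {j} → suc j < n → at x j ≡ at x (suc j) → at σ j < at σ (suc j)

labelings-sound : ∀ n x {σ} → σ ∈ labelings n x → Labeling n x σ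
labelings-sound n x {σ} σ∈ with filterᵇ-∈⁻ (isLabeling n x) (words n n) σ∈
... | w∈ , t with words-sound n n w∈ | ∧-elim {distinct σ} t
... | len , bound | d , c = record
  { perm = record { size = len ; bound = bound ; injective = λ i<n j<n → distinct⇒injective σ d (subst (_ <_) (sym len) i<n) (subst (_ <_) (sym len) j<n) }
  ; column = λ {j} h e → column j (allᵇ-upTo-elim (n ∸ 1) c (⇒<∸1 n h)) e
  }
  where
  column : ∀ j → (if at x j ≡ᵇ at x (suc j) then at σ j <ᵇ at σ (suc j) else true) ≡ true → at x j ≡ at x (suc j) → at σ j < at σ (suc j)
  column j t e rewrite ≡⇒≡ᵇ≡ e = <ᵇ≡⇒< t

labelings-complete : ∀ n x {σ} → Labeling n x σ → σ ∈ labelings n x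
labelings-complete n x {σ} L = filterᵇ-∈⁺ (isLabeling n x) (words n n) (words-complete n n σ size bound)
  (∧-intro (injective⇒distinct σ λ i< j< → injective (subst (_ <_) size i<) (subst (_ <_) size j<))
    (allᵇ-upTo-intro (n ∸ 1) λ {j} h → column' j (<∸1⇒ n h)))
  where
  open Labeling L
  open Perm perm
  column' : ∀ j → suc j < n → (if at x j ≡ᵇ at x (suc j) then at σ j <ᵇ at σ (suc j) else true) ≡ true
  column' j h with at x j ≡ᵇ at x (suc j) in eq
  ... | true = <⇒<ᵇ≡ (column h (≡ᵇ≡⇒≡ eq))
  ... | false = refl

module Path (m n : ℕ) (x : List ℕ) (m>0 : 0 < m) (n>0 : 0 < n) (D : Dyck m n x) where
  open Dyck D public

  level : ℕ → ℕ
  level j = m * j ∸ n * at x j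

  level-eq : ∀ {j} → j < n → level j + n * at x j ≡ m * j
  level-eq j<n = m∸n+n≡m (diag j<n)

  mono : ∀ {i j} → i ≤ j → j < n → at x i ≤ at x j
  mono {i} i≤j j<n with m≤n⇒∃[o]m+o≡n i≤j
  ... | k , refl = go k j<n
    where
    go : ∀ k → i + k < n → at x i ≤ at x (i + k)
    go zero h = ≤-reflexive (cong (at x) (sym (+-identityʳ i)))
    go (suc k) h = go k (<-trans (n<1+n _) h') ≤∙ step h' ≤∙ ≤-reflexive (cong (at x) (sym (+-suc i k)))
      where h' = subst (_< n) (+-suc i k) h

  start : at x 0 ≡ 0
  start with at x 0 | diag n>0
  ... | zero | _ = refl
  ... | suc c | h = contradiction (h ≤∙ ≤-reflexive (*-zeroʳ m)) (<⇒≱ (n>0 ≤∙ m≤m*n n (suc c)))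

  level-0 : level 0 ≡ 0
  level-0 rewrite start | *-zeroʳ m = 0∸n≡0 (n * 0)

  d = gcd m n

  d>0 : 0 < d
  d>0 = n≢0⇒n>0 λ e → <⇒≢ m>0 (sym (GCD.gcd[m,n]≡0⇒m≡0 e))

  d∣level : ∀ {j} → j < n → d ∣ level j
  d∣level {j} j<n = ∣m+n∣m⇒∣n (subst (d ∣_) (sym (level-eq j<n) ∙ +-comm (level j) _) (∣-trans (gcd[m,n]∣m m n) (m∣m*n j))) (∣-trans (gcd[m,n]∣n m n) (m∣m*n (at x j)))

  shift : ℕ → ℕ
  shift c = divℕ (c * d) m

  rank : ℕ → ℕ
  rank j = cellRank m n (at x j) j

  shift< : ∀ {c} → c < m → shift c < d
  shift< {c} c<m = divℕ-< m m>0 (subst (c * d <_) (*-comm m d) (*-monoˡ-< d {{>-nonZero d>0}} c<m))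

  shift-mono : ∀ {i j} → i ≤ j → j < n → shift (at x i) ≤ shift (at x j)
  shift-mono i≤j j<n = divℕ-mono m (*-monoˡ-≤ d (mono i≤j j<n))

  -- If nΔ is a multiple of m then so is dΔ, because gcd(mΔ, nΔ) = dΔ.
  shift-strict : ∀ {c c'} t → n * c + m * suc t ≡ n * c' → shift c < shift c'
  shift-strict {c} {c'} t e = divℕ-step m m>0 (begin
    c * d + m ≤⟨ +-monoʳ-≤ (c * d) m≤ ⟩
    c * d + (c' ∸ c) * d ≡⟨ sym (*-distribʳ-+ d c (c' ∸ c)) ⟩
    (c + (c' ∸ c)) * d ≡⟨ cong (_* d) (m+[n∸m]≡n (<⇒≤ c<c')) ⟩
    c' * d ∎)
    where
    open ≤-Reasoning
    c<c' : c < c'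
    c<c' = *-cancelˡ-< n c c' (<-≤-trans (m<m+n (n * c) (<-≤-trans m>0 (m≤m*n m (suc t)))) (≤-reflexive e))
    Δ = c' ∸ c
    nΔ : n * Δ ≡ m * suc t
    nΔ = *-distribˡ-∸ n c' c ∙ cong (_∸ n * c) (sym e) ∙ m+n∸m≡n (n * c) _
    m∣ : m ∣ Δ * d
    m∣ = subst (m ∣_) (sym (GCD.c*gcd[m,n]≡gcd[cm,cn] Δ m n) ∙ refl)
      (gcd-greatest (n∣m*n Δ) (subst (m ∣_) (sym nΔ ∙ *-comm n Δ) (m∣m*n (suc t))))
    m≤ : m ≤ Δ * d
    m≤ = ∣⇒≤ {{>-nonZero (*-mono-≤ (m<n⇒0<n∸m c<c') d>0)}} m∣

  lift-< : ∀ u v c c' → c < m → d ∣ u → d ∣ v → u < v → u + shift c < v + shift c'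
  lift-< u v c c' c<m d∣u d∣v u<v = <-≤-trans (+-monoʳ-< u (shift< c<m)) (∣-gap d>0 d∣u d∣v u<v ≤∙ m≤m+n v _)

  d∣m : d ∣ m
  d∣m = gcd[m,n]∣m m n

  d∣level+m : ∀ {j} → j < n → d ∣ level j + m
  d∣level+m j<n = ∣m∣n⇒∣m+n (d∣level j<n) d∣m

  module _ {i j : ℕ} (i<j : i < j) (j<n : j < n) where
    i<n = <-trans i<j j<n
    xi = at x i
    xj = at x j
    gap : ∃ λ k → suc (i + k) ≡ j
    gap = m≤n⇒∃[o]m+o≡n i<j
    swap-m : ∀ a b c → a + b + c ≡ a + c + b
    swap-m = solve-∀

    rank-up : level i ≤ level j → rank i < rank j
    rank-up h with m≤n⇒m<n∨m≡n h
    ... | inj₁ lt = lift-< (level i) (level j) xi xj (col i<n) (d∣level i<n) (d∣level j<n) lt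
    ... | inj₂ e with gap
    ... | k , refl = subst (λ z → level i + shift xi < z + shift xj) e (+-monoʳ-< (level i) (shift-strict k (+-cancelˡ-≡ (level i) _ _ eq)))
      where
      arith : ∀ m i k → m * i + m * suc k ≡ m * suc (i + k)
      arith = solve-∀
      eq : level i + (n * xi + m * suc k) ≡ level i + n * xj
      eq = sym (+-assoc (level i) _ _)
        ∙ cong (_+ m * suc k) (level-eq i<n)
        ∙ arith m i k
        ∙ sym (level-eq j<n)
        ∙ cong (_+ n * xj) (sym e)

    rank-down : level j < level i → rank j < rank i
    rank-down lt = lift-< (level j) (level i) xj xi (col j<n) (d∣level j<n) (d∣level i<n) lt

    rank-within : level j < level i + m → rank j < rank i + m
    rank-within lt = subst (rank j <_) (swap-m (level i) m (shift xi)) (lift-< (level j) (level i + m) xj xi (col j<n) (d∣level j<n) (d∣level+m i<n) lt)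

    rank-beyond : level i + m ≤ level j → rank i + m ≤ rank j
    rank-beyond h = subst (_≤ rank j) (swap-m (level i) m (shift xi)) (+-mono-≤ h (shift-mono (<⇒≤ i<j) j<n))

    rank-within' : level i ≤ level j + m → rank i < rank j + m
    rank-within' h with m≤n⇒m<n∨m≡n h
    ... | inj₁ lt = subst (rank i <_) (swap-m (level j) m (shift xj)) (lift-< (level i) (level j + m) xi xj (col i<n) (d∣level i<n) (d∣level+m j<n) lt)
    ... | inj₂ e with gap
    ... | k , refl = subst (rank i <_) (swap-m (level j) m (shift xj))
      (subst (λ z → level i + shift xi < z + shift xj) e (+-monoʳ-< (level i) (shift-strict (suc k) (+-cancelˡ-≡ (level i) _ _ eq))))
      where
      arith : ∀ m i k → m * i + m * suc (suc k) ≡ m * suc (i + k) + m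
      arith = solve-∀
      eq : level i + (n * xi + m * suc (suc k)) ≡ level i + n * xj
      eq = sym (+-assoc (level i) _ _)
        ∙ cong (_+ m * suc (suc k)) (level-eq i<n)
        ∙ arith m i k
        ∙ cong (_+ m) (sym (level-eq j<n))
        ∙ swap-m (level j) (n * xj) m
        ∙ cong (_+ n * xj) (sym e)

    rank-beyond' : level j + m < level i → rank j + m < rank i
    rank-beyond' lt = subst (_< rank i) (swap-m (level j) m (shift xj)) (lift-< (level j + m) (level i) xj xi (col j<n) (d∣level+m j<n) (d∣level i<n) lt)

    rank-≢ : rank i ≢ rank j
    rank-≢ e with level i ≤? level j
    ... | yes h = <⇒≢ (rank-up h) e
    ... | no h = <⇒≢ (rank-down (≰⇒> h)) (sym e)

  attack : ℕ → ℕ → Bool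
  attack i j = (rank i <ᵇ rank j) ∧ (rank j <ᵇ rank i + m)

  attack-up : ∀ {i j} → i < j → j < n → ι (attack i j) ≡ crossing (level j) m (level i)
  attack-up {i} {j} i<j j<n = cong ι (cong₂ _∧_
    (bool-ext (λ t → ≤⇒≤ᵇ≡ (≮⇒≥ λ h → <-asym (<ᵇ≡⇒< t) (rank-down i<j j<n h))) (λ t → <⇒<ᵇ≡ (rank-up i<j j<n (≤ᵇ≡⇒≤ t))))
    (<ᵇ-cong (λ t → ≰⇒> λ h → <⇒≱ t (rank-beyond i<j j<n h)) (rank-within i<j j<n)))

  attack-down : ∀ {i j} → i < j → j < n → ι (attack j i) ≡ window (level j) (level j + m) (level i)
  attack-down {i} {j} i<j j<n = cong ι (cong₂ _∧_
    (<ᵇ-cong (λ t → ≰⇒> λ h → <-asym t (rank-up i<j j<n h)) (rank-down i<j j<n))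
    (bool-ext (λ t → ≤⇒≤ᵇ≡ (≮⇒≥ λ h → <-asym (<ᵇ≡⇒< t) (rank-beyond' i<j j<n h))) (λ t → <⇒<ᵇ≡ (rank-within' i<j j<n (≤ᵇ≡⇒≤ t)))))

  attack-self : ∀ j → ι (attack j j) ≡ 0
  attack-self j rewrite ≮⇒<ᵇ≡ (≤-refl {rank j}) = refl

  rank-injective : ∀ {i j} → i < n → j < n → rank i ≡ rank j → i ≡ j
  rank-injective {i} {j} i<n j<n e with <-cmp i j
  ... | tri< h _ _ = contradiction e (rank-≢ h j<n)
  ... | tri≈ _ h _ = h
  ... | tri> _ _ h = contradiction (sym e) (rank-≢ h i<n)

  rank-0-min : ∀ {j} → 0 < j → j < n → rank 0 < rank j
  rank-0-min {j} j>0 j<n = rank-up j>0 j<n (subst (_≤ level j) (sym level-0) z≤n)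

  rank-column : ∀ {j} → suc j < n → at x j ≡ at x (suc j) → rank j < rank (suc j)
  rank-column {j} h e = rank-up ≤-refl h (subst (λ c → m * j ∸ n * at x j ≤ m * suc j ∸ n * c) e (∸-monoˡ-≤ (n * at x j) (*-monoʳ-≤ m (n≤1+n j))))

  total : ℕ
  total = Σ< n (λ j → Σ< n (λ i → ι (attack i j)))

  carAttack : List ℕ → ℕ → ℕ → Bool
  carAttack σ c c' = attack (indexOf σ c) (indexOf σ c')

  tdinv≡Σ : ∀ σ → tdinv m n x σ ≡ Σ< n (λ c → Σ< n (λ c' → ι (c <ᵇ c') * ι (carAttack σ c c')))
  tdinv≡Σ σ = Σ-cong (upTo n) λ c → count≡Σ _ (upTo n) ∙ (Σ-cong (upTo n) λ c' → ι-∧ (c <ᵇ c') (carAttack σ c c'))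

  total-cars : ∀ {σ} → Perm n σ → Σ< n (λ c → Σ< n (λ c' → ι (carAttack σ c c'))) ≡ total
  total-cars {σ} P = Σ-cong (upTo n) (λ c → Σ-index (λ j → ι (attack (index c) j)))
    ∙ Σ-index (λ i → Σ< n (λ j → ι (attack i j)))
    ∙ Σ-swap _ (upTo n) (upTo n)
    where
    open Permutation P

  tdinv-≤ : ∀ {σ} → Perm n σ → tdinv m n x σ ≤ total
  tdinv-≤ {σ} P = begin
    tdinv m n x σ ≡⟨ tdinv≡Σ σ ⟩
    Σ< n (λ c → Σ< n (λ c' → ι (c <ᵇ c') * ι (carAttack σ c c')))
      ≤⟨ Σ-mono (upTo n) (λ {c} _ → Σ-mono (upTo n) λ {c'} _ → *-monoˡ-≤ (ι (carAttack σ c c')) (ι≤1 (c <ᵇ c')) ≤∙ ≤-reflexive (*-identityˡ _)) ⟩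
    Σ< n (λ c → Σ< n (λ c' → ι (carAttack σ c c'))) ≡⟨ total-cars P ⟩
    total ∎
    where open ≤-Reasoning

  module ByRank = Standardize n rank rank-injective

  increasing : List ℕ
  increasing = std n rank

  increasing-labeling : Labeling n x increasing
  increasing-labeling = record
    { perm = ByRank.std-perm
    ; column = λ {j} h e → subst₂ _<_ (sym (at-std n rank (<-trans (n<1+n j) h))) (sym (at-std n rank h)) (ByRank.rank-mono (<-trans (n<1+n j) h) (rank-column h e))
    }

  tdinv-increasing : tdinv m n x increasing ≡ total
  tdinv-increasing = tdinv≡Σ increasing ∙ trans
    (Σ-upTo-cong n λ {c} c<n → Σ-upTo-cong n λ {c'} c'<n → pointwise c<n c'<n)
    (total-cars ByRank.std-perm)
    where
    open Permutation ByRank.std-perm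
    pointwise : ∀ {c c'} → c < n → c' < n → ι (c <ᵇ c') * ι (carAttack increasing c c') ≡ ι (carAttack increasing c c')
    pointwise {c} {c'} c<n c'<n with carAttack increasing c c' in eq
    ... | false = *-zeroʳ (ι (c <ᵇ c'))
    ... | true = cong (_* 1) (cong ι (<⇒<ᵇ≡ {c} (subst₂ _<_ (at-index c<n) (at-index c'<n)
          (subst₂ _<_ (sym (at-std n rank (index-bound c<n))) (sym (at-std n rank (index-bound c'<n)))
            (ByRank.rank-mono (index-bound c<n) (<ᵇ≡⇒< (proj₁ (∧-elim eq))))))))

  maxdinv≡total : maxdinv m n x ≡ total
  maxdinv≡total = foldr-⊔-max (tdinv m n x) (labelings n x)
    (λ σ∈ → tdinv-≤ (Labeling.perm (labelings-sound n x σ∈)))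
    (increasing , labelings-complete n x increasing-labeling , tdinv-increasing)

  height : ℕ → ℕ
  height c = Σ< n (λ i → ι (at x i ≤ᵇ c))

  height-> : ∀ {i c} → i < n → at x i ≤ c → i < height c
  height-> {i} {c} i<n h = begin
    suc i ≡⟨ sym (Σ-upTo-1 (suc i)) ⟩
    Σ< (suc i) (λ _ → 1) ≡⟨ Σ-upTo-cong (suc i) (λ k<i → cong ι (sym (≤⇒≤ᵇ≡ (mono (≤-pred k<i) i<n ≤∙ h)))) ⟩
    Σ< (suc i) (λ k → ι (at x k ≤ᵇ c)) ≤⟨ m≤m+n _ _ ⟩
    Σ< (suc i) (λ k → ι (at x k ≤ᵇ c)) + Σ< (n ∸ suc i) (λ k → ι (at x (suc i + k) ≤ᵇ c))
                                                    ≡⟨ sym (Σ-upTo-+ (suc i) (n ∸ suc i) _) ⟩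
    Σ< (suc i + (n ∸ suc i)) (λ k → ι (at x k ≤ᵇ c)) ≡⟨ cong (λ k → Σ< k (λ k → ι (at x k ≤ᵇ c))) (m+[n∸m]≡n i<n) ⟩
    height c ∎
    where open ≤-Reasoning

  height-split : ∀ {i c} → i < n → c < at x i → height c ≡ Σ< i (λ k → ι (at x k ≤ᵇ c))
  height-split {i} {c} i<n h = cong (λ k → Σ< k (λ k → ι (at x k ≤ᵇ c))) (sym (m+[n∸m]≡n (<⇒≤ i<n)))
    ∙ Σ-upTo-+ i (n ∸ i) _
    ∙ cong (Σ< i (λ k → ι (at x k ≤ᵇ c)) +_) (Σ-upTo-vanish (n ∸ i) λ {k} k< → cong ι (≰⇒≤ᵇ≡ (<-≤-trans h (mono (m≤m+n i k) (<-≤-trans (+-monoʳ-< i k<) (≤-reflexive (m+[n∸m]≡n (<⇒≤ i<n))))))))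
    ∙ +-identityʳ _

  height-≤ : ∀ {i c} → i < n → c < at x i → height c ≤ i
  height-≤ {i} {c} i<n h = ≤-reflexive (height-split i<n h) ≤∙
    Σ-mono (upTo i) (λ {k} _ → ι≤1 (at x k ≤ᵇ c)) ≤∙ ≤-reflexive (Σ-upTo-1 i)

  height≤n : ∀ c → height c ≤ n
  height≤n c = Σ-mono (upTo n) (λ {k} _ → ι≤1 (at x k ≤ᵇ c)) ≤∙ ≤-reflexive (Σ-upTo-1 n)

  <height⇒ : ∀ {i c} → i < n → i < height c → at x i ≤ c
  <height⇒ {i} {c} i<n h = ≮⇒≥ λ lt → <⇒≱ h (height-≤ i<n lt)

  height-diag : ∀ {c} → c < m → n * suc c ≤ m * height c
  height-diag {c} c<m with height c <? n
  ... | yes h = *-monoʳ-≤ n (≰⇒> λ le → <-irrefl refl (height-> h le)) ≤∙ diag h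
  ... | no h rewrite ≤-antisym (height≤n c) (≮⇒≥ h) = *-monoʳ-≤ n c<m ≤∙ ≤-reflexive (*-comm n m)

  east : ℕ → ℕ
  east c = m * height c ∸ n * c

  east-eq : ∀ {c} → c < m → east c + n * c ≡ m * height c
  east-eq {c} c<m = m∸n+n≡m (*-monoʳ-≤ n (n≤1+n c) ≤∙ height-diag c<m)

  n≤east : ∀ {c} → c < m → n ≤ east c
  n≤east {c} c<m = ≤-reflexive (sym (m+n∸n≡m n (n * c))) ≤∙ ∸-monoˡ-≤ (n * c) (≤-reflexive (sym (*-suc n c)) ≤∙ height-diag c<m)

  height-run : ∀ {j c} → suc j < n → at x j ≤ c → c < at x (suc j) → height c ≡ suc j
  height-run {j} h a b = ≤-antisym (height-≤ h b) (height-> (<-trans (n<1+n j) h) a)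

  Σ-run : ∀ j (g : ℕ → ℕ) → suc j < n → Σ< (at x (suc j)) g ≡ Σ< (at x j) g + Σ< (at x (suc j) ∸ at x j) (λ t → g (at x j + t))
  Σ-run j g h = cong (λ k → Σ< k g) (sym (m+[n∸m]≡n (step h))) ∙ Σ-upTo-+ (at x j) (at x (suc j) ∸ at x j) g

  run-height : ∀ {j t} → suc j < n → t < at x (suc j) ∸ at x j → height (at x j + t) ≡ suc j
  run-height {j} {t} h t< = height-run h (m≤m+n _ t) (<-≤-trans (+-monoʳ-< (at x j) t<) (≤-reflexive (m+[n∸m]≡n (step h))))

  telescope : ∀ (φ : ℕ → ℕ) j → j < n →
    φ 0 + Σ< j (λ i → φ (level i + m)) + Σ< (at x j) (λ c → φ (east c ∸ n)) ≡
    φ (level j) + Σ< j (λ i → φ (level i)) + Σ< (at x j) (λ c → φ (east c))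
  telescope φ zero h = cong₂ _+_ (cong (λ l → φ l + 0) (sym level-0))
    (cong (λ k → Σ< k (λ c → φ (east c ∸ n))) start ∙ cong (λ k → Σ< k (λ c → φ (east c))) (sym start))
  telescope φ (suc j) h = cong₂ (λ u v → φ 0 + u + v) (Σ-upTo-snoc j _) (Σ-run j _ h)
    ∙ cong (λ z → φ 0 + (U + φ (level j + m)) + (V + z)) (Σ-upTo-cong Δ λ t< → cong (λ e → φ (e ∸ n)) (run t<) ∙ cong φ (next _))
    ∙ cong (λ z → φ 0 + (U + z) + (V + Σ< Δ (ψ ∘ suc))) (sym ψ0)
    ∙ eq1 (φ 0) U (ψ 0) V _
    ∙ cong₂ _+_ (telescope φ j (<-trans (n<1+n j) h)) (Σ-telescope Δ ψ)
    ∙ eq2 (φ (level j)) U' V' (ψ Δ) _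
    ∙ cong₂ (λ u v → u + (U' + φ (level j)) + (V' + v)) ψΔ (Σ-upTo-cong Δ λ t< → cong φ (sym (run t<)))
    ∙ cong₂ (λ u v → φ (level (suc j)) + u + v) (sym (Σ-upTo-snoc j _)) (sym (Σ-run j _ h))
    where
    Δ = at x (suc j) ∸ at x j
    U = Σ< j (λ i → φ (level i + m))
    V = Σ< (at x j) (λ c → φ (east c ∸ n))
    U' = Σ< j (λ i → φ (level i))
    V' = Σ< (at x j) (λ c → φ (east c))
    ψ : ℕ → ℕ
    ψ t = φ (m * suc j ∸ n * (at x j + t))
    run : ∀ {t} → t < Δ → east (at x j + t) ≡ m * suc j ∸ n * (at x j + t)
    run {t} t< = cong (λ y → m * y ∸ n * (at x j + t)) (run-height h t<)
    next : ∀ t → m * suc j ∸ n * (at x j + t) ∸ n ≡ m * suc j ∸ n * (at x j + suc t)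
    next t = ∸-+-assoc (m * suc j) (n * (at x j + t)) n ∙ cong (m * suc j ∸_) (arith n (at x j) t)
      where
      arith : ∀ n a t → n * (a + t) + n ≡ n * (a + suc t)
      arith = solve-∀
    ψ0 : ψ 0 ≡ φ (level j + m)
    ψ0 = cong φ (cong₂ (λ u v → u ∸ n * v) (*-suc m j ∙ +-comm m _) (+-identityʳ (at x j))
      ∙ +-∸-comm m (diag (<-trans (n<1+n j) h)))
    ψΔ : ψ Δ ≡ φ (level (suc j))
    ψΔ = cong (λ c → φ (m * suc j ∸ n * c)) (m+[n∸m]≡n (step h))
    eq1 : ∀ a u p v s → a + (u + p) + (v + s) ≡ (a + u + v) + (p + s)
    eq1 = solve-∀
    eq2 : ∀ l u v p s → (l + u + v) + (p + s) ≡ p + (u + l) + (v + s)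
    eq2 = solve-∀

  -- Up- and down-crossings of the line above L ≥ level j balance before row j.
  crossings : ∀ {j L} → j < n → level j ≤ L →
    Σ< (at x j) (λ c → window L (L + n) (east c)) ≡ Σ< j (λ i → crossing L m (level i))
  crossings {j} {L} j<n h = +-cancelʳ-≡ (S + W) _ _ (eq1 _ S W
    ∙ cong (S +_) wins
    ∙ cong (λ z → z + S + Σ< (at x j) (λ c → above L (east c))) (sym zero2)
    ∙ sym (telescope (above L) j j<n)
    ∙ cong (_+ W) (sym crs)
    ∙ +-assoc _ S W)
    where
    S = Σ< j (λ i → above L (level i))
    W = Σ< (at x j) (λ c → above L (east c ∸ n))
    zero2 : above L (level j) ≡ 0
    zero2 = cong ι (≮⇒<ᵇ≡ h)
    wins : Σ< (at x j) (λ c → window L (L + n) (east c)) + W ≡ Σ< (at x j) (λ c → above L (east c))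
    wins = sym (Σ-+ _ _ (upTo (at x j))) ∙ (Σ-cong (upTo (at x j)) λ c →
      trans (cong (window L (L + n) (east c) +_) (sym (above-∸ L n (east c)))) (window-above (east c) (m≤m+n L n)))
    crs : Σ< j (λ i → crossing L m (level i)) + S ≡ Σ< j (λ i → above L (level i + m))
    crs = sym (Σ-+ _ _ (upTo j)) ∙ (Σ-cong (upTo j) λ i → crossing-above L m (level i))
    eq1 : ∀ a s w → a + (s + w) ≡ s + (a + w)
    eq1 = solve-∀

  pairs≡ : ∀ {j c} → j < n → c < at x j →
    let leg = Σ< j (λ k → ι (c <ᵇ at x k)) ; arm = at x j ∸ suc c in
    (arm * n ≤ᵇ m * suc leg) ∧ ((leg ≡ᵇ 0) ∨ (m * leg <ᵇ n * suc arm)) ≡ (level j <ᵇ east c) ∧ (east c ≤ᵇ level j + (m + n))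
  pairs≡ {j} {c} j<n c<x = bool-ext to from
    where
    leg = Σ< j (λ k → ι (c <ᵇ at x k))
    arm = at x j ∸ suc c
    c<m : c < m
    c<m = <-trans c<x (col j<n)
    arm-eq : suc c + arm ≡ at x j
    arm-eq = m+[n∸m]≡n c<x
    leg-eq : height c + leg ≡ j
    leg-eq = cong (_+ leg) (height-split j<n c<x)
      ∙ sym (Σ-+ _ _ (upTo j))
      ∙ Σ-cong (upTo j) (λ k → cong (λ b → ι b + ι (c <ᵇ at x k)) (not-≤ (at x k) c) ∙ one (c <ᵇ at x k))
      ∙ Σ-upTo-1 j
      where
      one : ∀ b → ι (not b) + ι b ≡ 1
      one true = refl
      one false = refl
    h = height c
    key : level j + n * suc arm ≡ east c + m * leg
    key = +-cancelʳ-≡ (n * c) _ _ (arith1 (level j) n arm c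
      ∙ cong (λ z → level j + n * z) arm-eq
      ∙ level-eq j<n
      ∙ cong (m *_) (sym leg-eq)
      ∙ *-distribˡ-+ m h leg
      ∙ cong (_+ m * leg) (sym (east-eq c<m))
      ∙ arith2 (east c) (n * c) (m * leg))
      where
      arith1 : ∀ l n a c → l + n * suc a + n * c ≡ l + n * (suc c + a)
      arith1 = solve-∀
      arith2 : ∀ e a b → e + a + b ≡ e + b + a
      arith2 = solve-∀
    second : m * leg < n * suc arm → level j < east c
    second lt = +-cancelʳ-< (m * leg) (level j) (east c) (<-≤-trans (+-monoʳ-< (level j) lt) (≤-reflexive key))
    second' : level j < east c → m * leg < n * suc arm
    second' lt = +-cancelˡ-< (level j) (m * leg) (n * suc arm) (<-≤-trans (+-monoˡ-< (m * leg) lt) (≤-reflexive (sym key)))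
    first : arm * n ≤ m * suc leg → east c ≤ level j + (m + n)
    first le = +-cancelʳ-≤ (m * leg) (east c) _ (begin
      east c + m * leg ≡⟨ sym key ⟩
      level j + n * suc arm ≡⟨ arith (level j) n arm ⟩
      level j + n + arm * n ≤⟨ +-monoʳ-≤ (level j + n) le ⟩
      level j + n + m * suc leg ≡⟨ arith' (level j) n m leg ⟩
      level j + (m + n) + m * leg ∎)
      where
      open ≤-Reasoning
      arith : ∀ l n a → l + n * suc a ≡ l + n + a * n
      arith = solve-∀
      arith' : ∀ l n m g → l + n + m * suc g ≡ l + (m + n) + m * g
      arith' = solve-∀
    first' : east c ≤ level j + (m + n) → arm * n ≤ m * suc leg
    first' le = +-cancelˡ-≤ (level j + n) (arm * n) _ (begin
      level j + n + arm * n ≡⟨ arith (level j) n arm ⟩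
      level j + n * suc arm ≡⟨ key ⟩
      east c + m * leg ≤⟨ +-monoˡ-≤ (m * leg) le ⟩
      level j + (m + n) + m * leg ≡⟨ arith' (level j) n m leg ⟩
      level j + n + m * suc leg ∎)
      where
      open ≤-Reasoning
      arith : ∀ l n a → l + n + a * n ≡ l + n * suc a
      arith = solve-∀
      arith' : ∀ l n m g → l + (m + n) + m * g ≡ l + n + m * suc g
      arith' = solve-∀
    to : (arm * n ≤ᵇ m * suc leg) ∧ ((leg ≡ᵇ 0) ∨ (m * leg <ᵇ n * suc arm)) ≡ true → (level j <ᵇ east c) ∧ (east c ≤ᵇ level j + (m + n)) ≡ true
    to t with ∧-elim {arm * n ≤ᵇ m * suc leg} t
    ... | p , q = ∧-intro (<⇒<ᵇ≡ (second (sec (∨-elim {leg ≡ᵇ 0} q)))) (≤⇒≤ᵇ≡ (first (≤ᵇ≡⇒≤ p)))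
      where
      sec : (leg ≡ᵇ 0) ≡ true ⊎ (m * leg <ᵇ n * suc arm) ≡ true → m * leg < n * suc arm
      sec (inj₁ e) = subst (λ z → m * z < n * suc arm) (sym (≡ᵇ≡⇒≡ e)) (subst (_< n * suc arm) (sym (*-zeroʳ m)) (<-≤-trans n>0 (m≤m*n n (suc arm))))
      sec (inj₂ e) = <ᵇ≡⇒< e
    from : (level j <ᵇ east c) ∧ (east c ≤ᵇ level j + (m + n)) ≡ true → (arm * n ≤ᵇ m * suc leg) ∧ ((leg ≡ᵇ 0) ∨ (m * leg <ᵇ n * suc arm)) ≡ true
    from t with ∧-elim {level j <ᵇ east c} t
    ... | p , q = ∧-intro (≤⇒≤ᵇ≡ (first' (≤ᵇ≡⇒≤ q))) (or (leg ≡ᵇ 0) (<⇒<ᵇ≡ (second' (<ᵇ≡⇒< p))))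
      where
      or : ∀ b {b'} → b' ≡ true → b ∨ b' ≡ true
      or true _ = refl
      or false e = e

  pdinv≡ : pdinv m n x ≡ Σ< n (λ j → Σ< (at x j) (λ c → window (level j) (level j + (m + n)) (east c)))
  pdinv≡ = (Σ-upTo-cong n λ {i} i<n → count≡Σ _ (upTo (lamRow n x i)) ∙ row i<n) ∙
    Σ-upTo-reverse n (λ j → Σ< (at x j) (λ c → window (level j) (level j + (m + n)) (east c)))
    where
    leg-flip : ∀ {i} c → i < n → count (λ i' → (i <ᵇ i') ∧ (c <ᵇ lamRow n x i')) (upTo n) ≡ Σ< (n ∸ suc i) (λ k → ι (c <ᵇ at x k))
    leg-flip {i} c i<n = count≡Σ _ (upTo n)
      ∙ Σ-upTo-cong n (λ {i'} i'<n → cong (λ b → ι (b ∧ (c <ᵇ at x (n ∸ suc i')))) (<ᵇ-cong (λ h → ∸-monoʳ-< (s≤s h) i'<n) (λ h → ≰⇒> λ le → <⇒≱ h (∸-monoʳ-≤ n (s≤s le)))))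
      ∙ Σ-upTo-reverse n (λ k → ι ((k <ᵇ n ∸ suc i) ∧ (c <ᵇ at x k)))
      ∙ cong (λ z → Σ< z (λ k → ι ((k <ᵇ n ∸ suc i) ∧ (c <ᵇ at x k)))) (sym (m∸n+n≡m i<n))
      ∙ Σ-upTo-+ (n ∸ suc i) (suc i) _
      ∙ cong₂ _+_ (Σ-upTo-cong (n ∸ suc i) λ {k} k< → cong (λ b → ι (b ∧ (c <ᵇ at x k))) (<⇒<ᵇ≡ k<)) (Σ-upTo-vanish (suc i) λ {k} _ → cong (λ b → ι (b ∧ (c <ᵇ at x (n ∸ suc i + k)))) (≮⇒<ᵇ≡ (m≤m+n (n ∸ suc i) k)))
      ∙ +-identityʳ _
    row : ∀ {i} → i < n →
      Σ< (lamRow n x i) (λ c → ι (((lamRow n x i ∸ suc c) * n ≤ᵇ m * suc (count (λ i' → (i <ᵇ i') ∧ (c <ᵇ lamRow n x i')) (upTo n)))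
        ∧ ((count (λ i' → (i <ᵇ i') ∧ (c <ᵇ lamRow n x i')) (upTo n) ≡ᵇ 0) ∨ (m * count (λ i' → (i <ᵇ i') ∧ (c <ᵇ lamRow n x i')) (upTo n) <ᵇ n * suc (lamRow n x i ∸ suc c))))) ≡
      Σ< (at x (n ∸ suc i)) (λ c → window (level (n ∸ suc i)) (level (n ∸ suc i) + (m + n)) (east c))
    row {i} i<n = Σ-upTo-cong (at x (n ∸ suc i)) λ {c} c< → trans
      (cong (λ leg → ι (((lamRow n x i ∸ suc c) * n ≤ᵇ m * suc leg) ∧ ((leg ≡ᵇ 0) ∨ (m * leg <ᵇ n * suc (lamRow n x i ∸ suc c))))) (leg-flip c i<n))
      (cong ι (pairs≡ (∸-monoʳ-< (s≤s z≤n) i<n) c<))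

-- Parking functions with hook descent composition

valley : List ℕ → ℕ → Bool
valley x zero = false
valley x (suc j) = at x j <ᵇ at x (suc j)

-- A set of rows is a 0/1 list s.
valleySet : ℕ → List ℕ → List ℕ → Bool
valleySet n x s = allᵇ (λ j → (at s j ≡ᵇ 0) ∨ valley x j) (upTo n)

rowAttack : ℕ → ℕ → List ℕ → ℕ → ℕ → Bool
rowAttack m n x i j = (cellRank m n (at x i) i <ᵇ cellRank m n (at x j) j) ∧ (cellRank m n (at x j) j <ᵇ cellRank m n (at x i) i + m)

lost : ℕ → ℕ → List ℕ → List ℕ → ℕ
lost m n x s = Σ< n (λ j → at s j * Σ< n (λ i → ι (rowAttack m n x i j)))

valleys : ℕ → ℕ → List ℕ → List (List ℕ)
valleys p n x = filterᵇ (λ s → valleySet n x s ∧ (Σ< n (at s) ≡ᵇ p)) (words n 2)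

<ᵇ-suc : ∀ p i → (p <ᵇ suc i) ≡ (p ≤ᵇ i)
<ᵇ-suc zero i = refl
<ᵇ-suc (suc p) i = refl

applyUpTo-true : ∀ (b : ℕ → Bool) r → applyUpTo b r ≡ replicate r true → ∀ {i} → i < r → b i ≡ true
applyUpTo-true b (suc r) e {zero} _ = ∷-head-injective e
applyUpTo-true b (suc r) e {suc i} (s≤s h) = applyUpTo-true (b ∘ suc) r (∷-tail-injective e) h

true-applyUpTo : ∀ (b : ℕ → Bool) r → (∀ {i} → i < r → b i ≡ true) → applyUpTo b r ≡ replicate r true
true-applyUpTo b zero h = refl
true-applyUpTo b (suc r) h = cong₂ _∷_ (h (s≤s z≤n)) (true-applyUpTo (b ∘ suc) r (h ∘ s≤s))

step-elim : ∀ (b : ℕ → Bool) p r → applyUpTo b (p + r) ≡ replicate p false ++ replicate r true → ∀ {i} → i < p + r → b i ≡ (p ≤ᵇ i)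
step-elim b zero r e h = applyUpTo-true b r e h
step-elim b (suc p) r e {zero} h = ∷-head-injective e
step-elim b (suc p) r e {suc i} (s≤s h) = step-elim (b ∘ suc) p r (∷-tail-injective e) h ∙ sym (<ᵇ-suc p i)

step-intro : ∀ (b : ℕ → Bool) p r → (∀ {i} → i < p + r → b i ≡ (p ≤ᵇ i)) → applyUpTo b (p + r) ≡ replicate p false ++ replicate r true
step-intro b zero r h = true-applyUpTo b r h
step-intro b (suc p) r h = cong₂ _∷_ (h (s≤s z≤n)) (step-intro (b ∘ suc) p r λ {i} i< → h (s≤s i<) ∙ <ᵇ-suc p i)

hook-split : ∀ p r bs → compOf bs ≡ suc p ∷ replicate r 1 → bs ≡ replicate p false ++ replicate r true
hook-split p zero bs e with compFrom-single 1 bs (sym (compOf≡compFrom bs) ∙ e)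
... | refl , e' = e' ∙ sym (List.++-identityʳ _)
hook-split p (suc r) bs e with compFrom-split 1 bs (sym (compOf≡compFrom bs) ∙ e) (λ ())
... | j , bs' , refl , refl , e' = cong (λ l → replicate p false ++ true ∷ l) (compFrom-ones bs' r e')

hook-join : ∀ p r → compOf (replicate p false ++ replicate r true) ≡ suc p ∷ replicate r 1
hook-join p zero = compOf≡compFrom (replicate p false ++ []) ∙ cong (compFrom 1) (List.++-identityʳ (replicate p false)) ∙ compFrom-false 1 p
hook-join p (suc r) = compOf≡compFrom (replicate p false ++ replicate (suc r) true) ∙ compFrom-join 1 p (replicate r true) ∙ cong (suc p ∷_) (compFrom-true r)

flagged-≡ : ∀ b u v → u ≤ b → v ≤ b → b ∸ u ≡ b ∸ v → u ≡ v
flagged-≡ b u v h h' e = ∸-cancelˡ-≡ h h' e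

flagged-< : ∀ b u v → b ∸ u < suc (b + v)
flagged-< b u v = s≤s (m∸n≤m b u ≤∙ m≤m+n b v)

flagged-reflects : ∀ b u v → b ∸ u < b ∸ v → v < u
flagged-reflects b u v h = ∸-cancelʳ-< h

module Hook (m n : ℕ) (x : List ℕ) (m>0 : 0 < m) (n>0 : 0 < n) (D : Dyck m n x) (p r : ℕ) (n≡ : n ≡ suc (p + r)) where
  open Path m n x m>0 n>0 D

  p<n : p < n
  p<n = subst (p <_) (sym n≡) (s≤s (m≤m+n p r))

  carR : List ℕ → ℕ → ℕ
  carR σ c = rank (indexOf σ c)

  IsHook : List ℕ → Set
  IsHook σ = pides m n x σ ≡ suc p ∷ replicate r 1

  record VShape (σ : List ℕ) : Set where
    field
      falling : ∀ {c} → suc c < n → c < p → carR σ (suc c) < carR σ c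
      rising : ∀ {c} → suc c < n → p ≤ c → carR σ c < carR σ (suc c)

  rises : List ℕ → ℕ → Bool
  rises σ i = carRank m n x σ i <ᵇ carRank m n x σ (suc i)

  n∸1≡ : n ∸ 1 ≡ p + r
  n∸1≡ = cong (_∸ 1) n≡

  hook⇒step : ∀ {σ} → IsHook σ → ∀ {i} → suc i < n → rises σ i ≡ (p ≤ᵇ i)
  hook⇒step {σ} h {i} i< = step-elim (rises σ) p r
    (cong (applyUpTo (rises σ)) (sym n∸1≡) ∙ sym (List.map-applyUpTo id (rises σ) (n ∸ 1)) ∙ hook-split p r (map (rises σ) (upTo (n ∸ 1))) h)
    (subst (i <_) n∸1≡ (⇒<∸1 n i<))

  step⇒hook : ∀ {σ} → (∀ {i} → suc i < n → rises σ i ≡ (p ≤ᵇ i)) → IsHook σ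
  step⇒hook {σ} h = cong compOf (List.map-applyUpTo id (rises σ) (n ∸ 1) ∙ cong (applyUpTo (rises σ)) n∸1≡ ∙
    (step-intro (rises σ) p r λ {i} i< → h (<∸1⇒ n (subst (i <_) (sym n∸1≡) i<)))) ∙ hook-join p r

  carR-injective : ∀ {σ} → Perm n σ → ∀ {c c'} → c < n → c' < n → carR σ c ≡ carR σ c' → c ≡ c'
  carR-injective {σ} P {c} {c'} c<n c'<n e = sym (at-index c<n) ∙ cong (at σ) (rank-injective {index c} {index c'} (index-bound c<n) (index-bound c'<n) e) ∙ at-index c'<n
    where open Permutation P

  hook⇒V : ∀ {σ} → Perm n σ → IsHook σ → VShape σ
  hook⇒V {σ} P h = record
    { falling = λ {c} sc<n c<p → ≤∧≢⇒< (<ᵇ≡false⇒≥ {carR σ c} {carR σ (suc c)} (hook⇒step {σ} h {c} sc<n ∙ ≰⇒≤ᵇ≡ c<p))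
        (λ e → contradiction (carR-injective {σ} P {suc c} {c} sc<n (<-trans (n<1+n c) sc<n) e) λ ())
    ; rising = λ {c} sc<n p≤c → <ᵇ≡⇒< {carR σ c} {carR σ (suc c)} (hook⇒step {σ} h {c} sc<n ∙ ≤⇒≤ᵇ≡ p≤c)
    }

  V⇒hook : ∀ {σ} → VShape σ → IsHook σ
  V⇒hook {σ} V = step⇒hook {σ} λ {i} si<n → bool-ext {rises σ i} {p ≤ᵇ i}
    (λ t → ≤⇒≤ᵇ≡ (≮⇒≥ λ i<p → <-asym (<ᵇ≡⇒< {carR σ i} {carR σ (suc i)} t) (VShape.falling V si<n i<p)))
    (λ t → <⇒<ᵇ≡ {carR σ i} {carR σ (suc i)} (VShape.rising V si<n (≤ᵇ≡⇒≤ t)))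

  V-falling : ∀ {σ} → VShape σ → ∀ {c c'} → c < c' → c' ≤ p → carR σ c' < carR σ c
  V-falling {σ} V {c} c<c' c'≤p with m≤n⇒∃[o]m+o≡n c<c'
  ... | k , refl = go k c'≤p
    where
    go : ∀ k → suc c + k ≤ p → carR σ (suc c + k) < carR σ c
    go zero h rewrite +-identityʳ c = VShape.falling V (≤-<-trans h p<n) h
    go (suc k) h rewrite +-suc c k = <-trans (VShape.falling V (≤-<-trans h p<n) h) (go k (n≤1+n _ ≤∙ h))

  V-rising : ∀ {σ} → VShape σ → ∀ {c c'} → p ≤ c → c < c' → c' < n → carR σ c < carR σ c'
  V-rising {σ} V {c} p≤c c<c' c'<n with m≤n⇒∃[o]m+o≡n c<c'
  ... | k , refl = go k c'<n
    where
    go : ∀ k → suc c + k < n → carR σ c < carR σ (suc c + k)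
    go zero h rewrite +-identityʳ c = VShape.rising V h p≤c
    go (suc k) h rewrite +-suc c k = <-trans (go k (<-trans (n<1+n _) h)) (VShape.rising V h (p≤c ≤∙ m≤m+n c k ≤∙ n≤1+n _))

  big : ℕ
  big = Σ< n rank

  rank≤big : ∀ {j} → j < n → rank j ≤ big
  rank≤big j<n = term≤Σ rank (upTo n) (∈-upTo⁺ j<n)

  -- Cars on s come first, by decreasing rank, then the others by increasing rank.
  keyOf : Bool → ℕ → ℕ
  keyOf true ρ = big ∸ ρ
  keyOf false ρ = suc (big + ρ)

  key : List ℕ → ℕ → ℕ
  key s j = keyOf (at s j ≡ᵇ 1) (rank j)

  key-injective : ∀ s {i j} → i < n → j < n → key s i ≡ key s j → i ≡ j
  key-injective s {i} {j} i<n j<n e with at s i ≡ᵇ 1 | at s j ≡ᵇ 1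
  ... | true | true = rank-injective {i} {j} i<n j<n (flagged-≡ big (rank i) (rank j) (rank≤big i<n) (rank≤big j<n) e)
  ... | false | false = rank-injective {i} {j} i<n j<n (+-cancelˡ-≡ (suc big) (rank i) (rank j) e)
  ... | true | false = contradiction e (<⇒≢ (flagged-< big (rank i) (rank j)))
  ... | false | true = contradiction (sym e) (<⇒≢ (flagged-< big (rank j) (rank i)))

  module Forward {σ} (L : Labeling n x σ) (h : IsHook σ) where
    open Labeling L
    open Perm perm hiding (size)
    open Permutation perm
    V = hook⇒V perm h

    rows : List ℕ
    rows = applyUpTo (λ j → ι (at σ j <ᵇ p)) n

    at-rows : ∀ {j} → j < n → at rows j ≡ ι (at σ j <ᵇ p)
    at-rows j<n = at-applyUpTo _ n j<n

    carR-at : ∀ {j} → j < n → carR σ (at σ j) ≡ rank j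
    carR-at j<n = cong rank (index-at j<n)

    small-valley : ∀ {j} → j < n → at σ j < p → valley x j ≡ true
    small-valley {zero} j<n lt = contradiction below (<-asym (rank-0-min (n≢0⇒n>0 ne) (index-bound p<n)))
      where
      below : rank (index p) < rank 0
      below = subst (carR σ p <_) (carR-at j<n) (V-falling V lt ≤-refl)
      ne : index p ≢ 0
      ne e = <-irrefl (cong rank e) below
    small-valley {suc j} j<n lt = <⇒<ᵇ≡ (≤∧≢⇒< (step j<n) λ e → <-asym (rank-column j<n e)
      (subst₂ _<_ (carR-at j<n) (carR-at j<n') (V-falling V (column j<n e) (<⇒≤ lt))))
      where j<n' = <-trans (n<1+n j) j<n

    rows-∈ : rows ∈ valleys p n x
    rows-∈ = filterᵇ-∈⁺ _ (words n 2)
      (words-complete n 2 rows (List.length-applyUpTo _ n) λ j<n → subst (_< 2) (sym (at-rows j<n)) (s≤s (ι≤1 _)))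
      (∧-intro (allᵇ-upTo-intro n λ {j} j<n → test j<n) (≡⇒≡ᵇ≡ count-p))
      where
      test : ∀ {j} → j < n → (at rows j ≡ᵇ 0) ∨ valley x j ≡ true
      test {j} j<n rewrite at-rows j<n with at σ j <ᵇ p in eq
      ... | true = small-valley j<n (<ᵇ≡⇒< eq)
      ... | false = refl
      count-p : Σ< n (at rows) ≡ p
      count-p = Σ-upTo-cong n at-rows ∙ Σ-at-perm (λ c → ι (c <ᵇ p)) ∙ Σ-upTo-< n (<⇒≤ p<n)

    σ≡std : σ ≡ std n (key rows)
    σ≡std = Standardize.std-unique n (key rows) (key-injective rows) perm λ {i} {j} i<n j<n lt → mono' i<n j<n lt
      where
      flag : ∀ {j} → j < n → (at rows j ≡ᵇ 1) ≡ (at σ j <ᵇ p)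
      flag {j} j<n rewrite at-rows j<n with at σ j <ᵇ p
      ... | true = refl
      ... | false = refl
      mono' : ∀ {i j} → i < n → j < n → key rows i < key rows j → at σ i < at σ j
      mono' {i} {j} i<n j<n lt rewrite flag i<n | flag j<n with at σ i <ᵇ p in ei | at σ j <ᵇ p in ej
      ... | true | false = <-≤-trans (<ᵇ≡⇒< {at σ i} {p} ei) (<ᵇ≡false⇒≥ {at σ j} {p} ej)
      ... | false | true = contradiction lt (<-asym (flagged-< big (rank j) (rank i)))
      ... | true | true = ≰⇒> λ le → case m≤n⇒m<n∨m≡n le of λ where
        (inj₁ gt) → <-asym (flagged-reflects big (rank i) (rank j) lt) (subst₂ _<_ (carR-at i<n) (carR-at j<n) (V-falling V gt (<⇒≤ (<ᵇ≡⇒< {at σ i} {p} ei))))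
        (inj₂ e) → <-irrefl (cong rank (injective j<n i<n e)) (flagged-reflects big (rank i) (rank j) lt)
      ... | false | false = ≰⇒> λ le → case m≤n⇒m<n∨m≡n le of λ where
        (inj₁ gt) → <-asym (+-cancelˡ-< (suc big) (rank i) (rank j) lt) (subst₂ _<_ (carR-at j<n) (carR-at i<n) (V-rising V (<ᵇ≡false⇒≥ {at σ j} {p} ej) gt (bound i<n)))
        (inj₂ e) → <-irrefl (cong rank (sym (injective j<n i<n e))) (+-cancelˡ-< (suc big) (rank i) (rank j) lt)

    tdinv+lost : tdinv m n x σ + lost m n x rows ≡ total
    tdinv+lost = cong₂ _+_ (tdinv≡Σ σ) lost≡
      ∙ sym ((Σ-cong (upTo n) λ c → Σ-+ _ _ (upTo n)) ∙ Σ-+ _ _ (upTo n))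
      ∙ Σ-upTo-cong n (λ c<n → Σ-upTo-cong n λ c'<n → pointwise c<n c'<n)
      ∙ total-cars perm
      where
      lost≡ : lost m n x rows ≡ Σ< n (λ c → Σ< n (λ c' → ι (c' <ᵇ p) * ι (carAttack σ c c')))
      lost≡ = Σ-upTo-cong n (λ {j} j<n → cong₂ _*_ (at-rows j<n) (sym (Σ-index λ i → ι (attack i j)) ∙ (Σ-cong (upTo n) λ c → cong (λ z → ι (attack (index c) z)) (sym (index-at j<n)))))
        ∙ Σ-at-perm (λ c' → ι (c' <ᵇ p) * Σ< n (λ c → ι (carAttack σ c c')))
        ∙ Σ-cong (upTo n) (λ c' → sym (Σ-*ˡ (ι (c' <ᵇ p)) _ (upTo n)))
        ∙ Σ-swap _ (upTo n) (upTo n)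
      pointwise : ∀ {c c'} → c < n → c' < n → ι (c <ᵇ c') * ι (carAttack σ c c') + ι (c' <ᵇ p) * ι (carAttack σ c c') ≡ ι (carAttack σ c c')
      pointwise {c} {c'} c<n c'<n with carAttack σ c c' in eq
      ... | false = cong₂ _+_ (*-zeroʳ (ι (c <ᵇ c'))) (*-zeroʳ (ι (c' <ᵇ p)))
      ... | true with c' <? p
      ... | yes c'<p rewrite <⇒<ᵇ≡ c'<p | ≮⇒<ᵇ≡ (≮⇒≥ λ c<c' → <-asym (<ᵇ≡⇒< {carR σ c} {carR σ c'} (proj₁ (∧-elim eq))) (V-falling V c<c' (<⇒≤ c'<p))) = refl
      ... | no c'≮p rewrite ≮⇒<ᵇ≡ (≮⇒≥ c'≮p) | <⇒<ᵇ≡ {c} {c'} (≰⇒> λ c'≤c → case m≤n⇒m<n∨m≡n c'≤c of λ where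
                (inj₁ c'<c) → <-asym (<ᵇ≡⇒< {carR σ c} {carR σ c'} (proj₁ (∧-elim eq))) (V-rising V (≮⇒≥ c'≮p) c'<c c<n)
                (inj₂ refl) → <-irrefl refl (<ᵇ≡⇒< {carR σ c} {carR σ c'} (proj₁ (∧-elim eq)))) = refl

  module Backward {s} (s∈ : s ∈ valleys p n x) where
    parts = filterᵇ-∈⁻ (λ s → valleySet n x s ∧ (Σ< n (at s) ≡ᵇ p)) (words n 2) s∈
    sound = words-sound n 2 (proj₁ parts)
    tests = ∧-elim {valleySet n x s} (proj₂ parts)

    module K = Standardize n (key s) (key-injective s)

    σ : List ℕ
    σ = std n (key s)

    open Permutation K.std-perm

    binary : ∀ {j} → j < n → at s j ≡ ι (at s j ≡ᵇ 1)
    binary {j} j<n with at s j | proj₂ sound j<n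
    ... | 0 | _ = refl
    ... | 1 | _ = refl
    ... | suc (suc _) | s≤s (s≤s ())

    flagged-valley : ∀ {j} → j < n → (at s j ≡ᵇ 1) ≡ true → valley x j ≡ true
    flagged-valley {j} j<n e with ∨-elim {at s j ≡ᵇ 0} (allᵇ-upTo-elim n (proj₁ tests) j<n)
    ... | inj₂ v = v
    ... | inj₁ z = contradiction (sym (≡ᵇ≡⇒≡ {at s j} {0} z) ∙ ≡ᵇ≡⇒≡ {at s j} {1} e) λ ()

    size-p : Σ< n (λ j → ι (at s j ≡ᵇ 1)) ≡ p
    size-p = sym (Σ-upTo-cong n binary) ∙ ≡ᵇ≡⇒≡ (proj₂ tests)

    at-σ : ∀ {j} → j < n → at σ j ≡ K.rank j
    at-σ j<n = at-std n (key s) j<n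

    flagged-first : ∀ {i j} → (at s i ≡ᵇ 1) ≡ true → (at s j ≡ᵇ 1) ≡ false → key s i < key s j
    flagged-first {i} {j} e e' rewrite e | e' = flagged-< big (rank i) (rank j)

    σ-small : ∀ {j} → j < n → at σ j < p → (at s j ≡ᵇ 1) ≡ true
    σ-small {j} j<n lt with at s j ≡ᵇ 1 in e
    ... | true = refl
    ... | false = contradiction lt (≤⇒≯ (begin
      p ≡⟨ sym size-p ⟩
      Σ< n (λ i → ι (at s i ≡ᵇ 1)) ≤⟨ Σ-mono (upTo n) (λ {i} _ → pt i) ⟩
      K.rank j ≡⟨ sym (at-σ j<n) ⟩
      at σ j ∎))
      where
      open ≤-Reasoning
      pt : ∀ i → ι (at s i ≡ᵇ 1) ≤ ι (key s i <ᵇ key s j)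
      pt i with at s i ≡ᵇ 1 in ei
      ... | false = z≤n
      ... | true = ≤-reflexive (cong ι (sym (<⇒<ᵇ≡ {keyOf true (rank i)} {key s j} (subst (λ b → keyOf b (rank i) < key s j) ei (flagged-first {i} {j} ei e)))))

    small-σ : ∀ {j} → j < n → (at s j ≡ᵇ 1) ≡ true → at σ j < p
    small-σ {j} j<n e = begin
      suc (at σ j) ≡⟨ cong suc (at-σ j<n) ⟩
      suc (K.rank j) ≡⟨ cong (_+ K.rank j) (sym (Σ-upTo-δ n (λ _ → 1) j<n)) ⟩
      Σ< n (λ k → ι (j ≡ᵇ k) * 1) + K.rank j ≡⟨ sym (Σ-+ _ _ (upTo n)) ⟩
      Σ< n (λ k → ι (j ≡ᵇ k) * 1 + ι (key s k <ᵇ key s j)) ≤⟨ Σ-mono (upTo n) (λ {k} _ → pt k) ⟩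
      Σ< n (λ k → ι (at s k ≡ᵇ 1)) ≡⟨ size-p ⟩
      p ∎
      where
      open ≤-Reasoning
      pt : ∀ k → ι (j ≡ᵇ k) * 1 + ι (key s k <ᵇ key s j) ≤ ι (at s k ≡ᵇ 1)
      pt k with j ≟ k
      ... | yes refl rewrite ≡⇒≡ᵇ≡ {j} refl | ≮⇒<ᵇ≡ (≤-refl {key s j}) | e = ≤-refl
      ... | no j≢k rewrite ≢⇒≡ᵇ≡ j≢k = smaller k
        where
        smaller : ∀ k → ι (key s k <ᵇ key s j) ≤ ι (at s k ≡ᵇ 1)
        smaller k with at s k ≡ᵇ 1 in ek
        ... | true = ι≤1 _
        ... | false = ≤-reflexive (cong ι (≮⇒<ᵇ≡ {keyOf false (rank k)} {key s j} (<⇒≤ (subst (λ b → key s j < keyOf b (rank k)) ek (flagged-first {j} {k} e ek)))))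

    labeling : Labeling n x σ
    labeling = record { perm = K.std-perm ; column = col' }
      where
      col' : ∀ {j} → suc j < n → at x j ≡ at x (suc j) → at σ j < at σ (suc j)
      col' {j} h e = subst₂ _<_ (sym (at-σ j<n)) (sym (at-σ h)) (K.rank-mono j<n key<)
        where
        j<n = <-trans (n<1+n j) h
        unflagged : (at s (suc j) ≡ᵇ 1) ≡ false
        unflagged = ≢true⇒false λ t → <⇒≢ (<ᵇ≡⇒< {at x j} (flagged-valley h t)) e
        key< : key s j < key s (suc j)
        key< with at s j ≡ᵇ 1 in ej
        ... | true = subst (λ b → keyOf b (rank j) < key s (suc j)) ej (flagged-first {j} {suc j} ej unflagged)
        ... | false rewrite unflagged = s≤s (+-monoʳ-< big (rank-column h e))

    V : VShape σ
    V = record { falling = fall ; rising = rise }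
      where
      consecutive : ∀ {c} → suc c < n → key s (index c) < key s (index (suc c))
      consecutive {c} h = K.rank-reflects (index-bound h) (subst₂ _<_
        (sym (at-index c<n) ∙ at-σ (index-bound c<n)) (sym (at-index h) ∙ at-σ (index-bound h)) (n<1+n c))
        where c<n = <-trans (n<1+n c) h
      unfl : ∀ {c} → c < n → p ≤ c → (at s (index c) ≡ᵇ 1) ≡ false
      unfl c<n p≤c = ≢true⇒false λ t → <⇒≱ (subst (_< p) (at-index c<n) (small-σ (index-bound c<n) t)) p≤c
      fl : ∀ {c} → c < n → c < p → (at s (index c) ≡ᵇ 1) ≡ true
      fl c<n c<p = σ-small (index-bound c<n) (subst (_< p) (sym (at-index c<n)) c<p)
      rise : ∀ {c} → suc c < n → p ≤ c → rank (index c) < rank (index (suc c))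
      rise {c} h p≤c with consecutive h
      ... | lt rewrite unfl (<-trans (n<1+n c) h) p≤c | unfl h (p≤c ≤∙ n≤1+n c) = +-cancelˡ-< (suc big) (rank (index c)) (rank (index (suc c))) lt
      fall : ∀ {c} → suc c < n → c < p → rank (index (suc c)) < rank (index c)
      fall {c} h c<p with suc c <? p
      ... | yes sc<p with consecutive h
      ... | lt rewrite fl (<-trans (n<1+n c) h) c<p | fl h sc<p = flagged-reflects big (rank (index c)) (rank (index (suc c))) lt
      fall {c} h c<p | no sc≮p = subst (λ j → rank j < rank (index c)) (sym bottom) (rank-0-min (n≢0⇒n>0 ne) (index-bound c<n))
        where
        c<n = <-trans (n<1+n c) h
        sc≡p : suc c ≡ p
        sc≡p = ≤-antisym c<p (≮⇒≥ sc≮p)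
        zero-unflagged : (at s 0 ≡ᵇ 1) ≡ false
        zero-unflagged = ≢true⇒false λ t → true≢false (sym (flagged-valley n>0 t))
        ne : index c ≢ 0
        ne e = true≢false (sym (fl c<n c<p) ∙ cong (λ j → at s j ≡ᵇ 1) e ∙ zero-unflagged)
        σ0≥p : p ≤ at σ 0
        σ0≥p = ≮⇒≥ λ lt → true≢false (sym (σ-small n>0 lt) ∙ zero-unflagged)
        bottom : index (suc c) ≡ 0
        bottom with index (suc c) ≟ 0
        ... | yes e = e
        ... | no ne' = contradiction σ0≥p (<⇒≱ (subst₂ _<_ (sym (at-σ n>0)) (sym (at-σ (index-bound h)) ∙ at-index h ∙ sc≡p) (K.rank-mono n>0 key<)))
          where
          key< : key s 0 < key s (index (suc c))
          key< rewrite zero-unflagged | unfl h (≮⇒≥ sc≮p) = s≤s (+-monoʳ-< big (rank-0-min (n≢0⇒n>0 ne') (index-bound h)))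

    rows≡ : applyUpTo (λ j → ι (at σ j <ᵇ p)) n ≡ s
    rows≡ = at-ext _ s (List.length-applyUpTo _ n ∙ sym (proj₁ sound)) λ {j} j< →
      let j<n = subst (j <_) (List.length-applyUpTo _ n) j< in
      trans (at-applyUpTo _ n j<n) (cong ι (bool-ext (λ t → σ-small j<n (<ᵇ≡⇒< t)) (λ t → <⇒<ᵇ≡ (small-σ j<n t))) ∙ sym (binary j<n))

  Σ-hook : ∀ (G G' : ℕ → ℕ) → (∀ t l → t + l ≡ total → G t ≡ G' l) →
    Σ (labelings n x) (λ σ → ι (eqList (pides m n x σ) (suc p ∷ replicate r 1)) * G (tdinv m n x σ)) ≡
    Σ (valleys p n x) (λ s → G' (lost m n x s))
  Σ-hook G G' GG' = sym (Σ-filter isHook (G ∘ tdinv m n x) (labelings n x)) ∙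
    Σ-bij (G ∘ tdinv m n x) (G' ∘ lost m n x) (λ σ → applyUpTo (λ j → ι (at σ j <ᵇ p)) n) (λ s → std n (key s))
      (filterᵇ isHook (labelings n x)) (valleys p n x)
      (filterᵇ-unique isHook _ (filterᵇ-unique _ _ (words-unique n n))) (filterᵇ-unique _ _ (words-unique n 2))
      to from
    where
    isHook : List ℕ → Bool
    isHook σ = eqList (pides m n x σ) (suc p ∷ replicate r 1)
    to : ∀ {σ} → σ ∈ filterᵇ isHook (labelings n x) → G (tdinv m n x σ) ≢ 0 → _
    to {σ} σ∈ _ with filterᵇ-∈⁻ isHook (labelings n x) σ∈
    ... | l∈ , h = rows-∈ , sym (GG' _ _ tdinv+lost) , sym σ≡std
      where open Forward (labelings-sound n x l∈) (eqList⇒≡ h)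
    from : ∀ {s} → s ∈ valleys p n x → G' (lost m n x s) ≢ 0 → _
    from {s} s∈ _ = filterᵇ-∈⁺ isHook _ (labelings-complete n x labeling) (≡⇒eqList hook) ,
      trans (GG' _ _ tdinv+lost) (cong (λ z → G' (lost m n x z)) rows≡) , rows≡
      where
      open Backward s∈
      hook = V⇒hook V
      open Forward labeling hook using (tdinv+lost)

-- The terms of [ret]_{1/t} t^area q^δ with exponents (a , b).
weight : ℕ → ℕ → List ℕ → ℤ → ℤ → ℤ → ℕ
weight m n x δ a b = Σ< (ret m n x) (λ j → ι (eqℤ δ a ∧ eqℤ (pos (area m n x) Int.- pos j) b))

hikita-hook : ∀ m n p r a b → 0 < m → n ≡ suc (p + r) → hikitaCoeff m n (suc p ∷ replicate r 1) a b ≡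
  Σ (dyckPaths m n) (λ x → Σ (valleys p n x) (λ s → weight m n x (pos (pdinv m n x) Int.- pos (lost m n x s)) a b))
hikita-hook m n p r a b m>0 n≡ = Σ-cong-∈ (dyckPaths m n) λ {x} x∈ → trans
  (Σ-cong (labelings n x) λ σ → count≡Σ _ (upTo (ret m n x)) ∙ trans
     (Σ-cong (upTo (ret m n x)) λ j → ι-∧ (eqList (pides m n x σ) (suc p ∷ replicate r 1)) _)
     (Σ-*ˡ (ι (eqList (pides m n x σ) (suc p ∷ replicate r 1))) _ (upTo (ret m n x))))
  (Hook.Σ-hook m n x m>0 (subst (0 <_) (sym n≡) (s≤s z≤n)) (dyckPaths-sound m n x∈) p r n≡
    (λ t → weight m n x ((pos t Int.+ pos (pdinv m n x)) Int.- pos (maxdinv m n x)) a b)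
    (λ l → weight m n x (pos (pdinv m n x) Int.- pos l) a b)
    (λ t l e → cong (λ δ → weight m n x δ a b) (δ≡ {x} x∈ t l e)))
  where
  δ≡ : ∀ {x} (x∈ : x ∈ dyckPaths m n) t l → t + l ≡ Path.total m n x m>0 (subst (0 <_) (sym n≡) (s≤s z≤n)) (dyckPaths-sound m n x∈) →
    (pos t Int.+ pos (pdinv m n x)) Int.- pos (maxdinv m n x) ≡ pos (pdinv m n x) Int.- pos l
  δ≡ {x} x∈ t l e = cong (λ z → (pos t Int.+ pos (pdinv m n x)) Int.- z)
    (cong pos (Path.maxdinv≡total m n x m>0 (subst (0 <_) (sym n≡) (s≤s z≤n)) (dyckPaths-sound m n x∈) ∙ sym e) ∙ ℤₚ.pos-+ t l) ∙
    arith (pos t) (pos (pdinv m n x)) (pos l)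
    where
    arith : ∀ t p l → (t Int.+ p) Int.- (t Int.+ l) ≡ p Int.- l
    arith = ℤSolver.solve-∀

-- The first return

first : (ℕ → Bool) → ℕ → List ℕ → ℕ
first p k [] = k
first p k (i ∷ is) = if p i then suc i else first p k is

first-unique : (p : ℕ → Bool) (k : ℕ) (g : List ℕ → ℕ) → g [] ≡ k →
  (∀ i is → g (i ∷ is) ≡ (if p i then suc i else g is)) → ∀ is → g is ≡ first p k is
first-unique p k g a b [] = a
first-unique p k g a b (i ∷ is) rewrite b i is | first-unique p k g a b is = refl

mutual
  ret-search : ℕ → ℕ → List ℕ → List ℕ → ℕ
  ret-search = _

  ret≡first : ∀ m n x → ret m n x ≡
    first (λ i → onPath m n x (suc i * divℕ m (gcd m n)) (suc i * divℕ n (gcd m n))) (gcd m n) (upTo (gcd m n))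
  ret≡first m n x with upTo (gcd m n)
  ... | xs = first-unique _ _ (ret-search m n x) refl (λ _ _ → refl) xs

first-cong : ∀ {p q : ℕ → Bool} k is → (∀ {i} → i ∈ is → p i ≡ q i) → first p k is ≡ first q k is
first-cong k [] h = refl
first-cong {p} {q} k (i ∷ is) h rewrite h (here refl) = cong (if q i then suc i else_) (first-cong k is (h ∘ there))

divℕ-* : ∀ a d → 0 < d → d ∣ a → divℕ a d * d ≡ a
divℕ-* a (suc d) _ h = DivMod.m/n*n≡m h

touch : ℕ → ℕ → List ℕ → ℕ → ℕ → Bool
touch m n x X Y = (Y ≡ᵇ n) ∨ (X ≤ᵇ at x Y)

module Diagonal (m n : ℕ) (m>0 : 0 < m) (n>0 : 0 < n) where
  d = gcd m n
  m0 = divℕ m d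
  n0 = divℕ n d

  d>0 : 0 < d
  d>0 = n≢0⇒n>0 λ e → <⇒≢ m>0 (sym (GCD.gcd[m,n]≡0⇒m≡0 e))

  m0-eq : m0 * d ≡ m
  m0-eq = divℕ-* m d d>0 (gcd[m,n]∣m m n)

  n0-eq : n0 * d ≡ n
  n0-eq = divℕ-* n d d>0 (gcd[m,n]∣n m n)

  n0>0 : 0 < n0
  n0>0 = n≢0⇒n>0 λ e → <⇒≢ n>0 (sym (cong (_* d) e) ∙ n0-eq)

  m0>0 : 0 < m0
  m0>0 = n≢0⇒n>0 λ e → <⇒≢ m>0 (sym (cong (_* d) e) ∙ m0-eq)

  on-diagonal : ∀ i → m * (i * n0) ≡ n * (i * m0)
  on-diagonal i = cong (_* (i * n0)) (sym m0-eq)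
    ∙ arith m0 d i n0
    ∙ cong (_* (i * m0)) n0-eq
    where
    arith : ∀ a d i b → a * d * (i * b) ≡ b * d * (i * a)
    arith = solve-∀

  Y≤n : ∀ {i} → i < d → suc i * n0 ≤ n
  Y≤n {i} h = *-monoˡ-≤ n0 h ≤∙ ≤-reflexive (*-comm d n0 ∙ n0-eq)

  Y>0 : ∀ i → 0 < suc i * n0
  Y>0 i = <-≤-trans n0>0 (m≤m+n n0 (i * n0))

  X>0 : ∀ i → 0 < suc i * m0
  X>0 i = <-≤-trans m0>0 (m≤m+n m0 (i * m0))

  module _ {x : List ℕ} (D : Dyck m n x) where
    open Path m n x m>0 n>0 D using (diag; height; height-≤; height->; height≤n)

    left-of : ∀ X y → y < n → m * suc y ≡ n * X → at x y ≤ X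
    left-of X y y<n e = *-cancelˡ-≤ n {{>-nonZero n>0}} (diag y<n ≤∙ *-monoʳ-≤ m (n≤1+n y) ≤∙ ≤-reflexive e)

    onPath-touch : ∀ X Y → 0 < Y → Y ≤ n → m * Y ≡ n * X → onPath m n x X Y ≡ touch m n x X Y
    onPath-touch X (suc y) _ Y≤ e rewrite ≤⇒≤ᵇ≡ {at x y} {X} (left-of X y Y≤ e) with suc y ≡ᵇ n in eq
    ... | false = refl
    ... | true = ≤⇒≤ᵇ≡ (≤-reflexive (*-cancelˡ-≡ X m n {{>-nonZero n>0}} (sym e ∙ cong (m *_) (≡ᵇ≡⇒≡ {suc y} eq) ∙ *-comm m n)))

    touch-height : ∀ X Y → Y ≤ n → touch m n x (suc X) Y ≡ (height X ≤ᵇ Y)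
    touch-height X Y Y≤n with Y ≡ᵇ n in eq
    ... | true rewrite ≡ᵇ≡⇒≡ {Y} eq = sym (≤⇒≤ᵇ≡ (height≤n X))
    ... | false = bool-ext (λ t → ≤⇒≤ᵇ≡ (height-≤ Y<n (≤ᵇ≡⇒≤ {suc X} t)))
                    (λ t → ≤⇒≤ᵇ≡ {suc X} (≰⇒> λ le → <⇒≱ (height-> Y<n le) (≤ᵇ≡⇒≤ t)))
      where
      Y<n : Y < n
      Y<n = ≤∧≢⇒< Y≤n λ e → true≢false (sym (≡⇒≡ᵇ≡ e) ∙ eq)

    ret-touch : ret m n x ≡ first (λ i → touch m n x (suc i * m0) (suc i * n0)) d (upTo d)
    ret-touch = ret≡first m n x ∙ (first-cong d (upTo d) λ {i} i∈ →
      onPath-touch (suc i * m0) (suc i * n0) (Y>0 i) (Y≤n (∈-upTo⁻ i∈)) (on-diagonal (suc i)))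

area≡ : ∀ m n x → area m n x ≡ Σ< n (λ y → Σ< m (λ c → ι ((at x y ≤ᵇ c) ∧ (n * suc c ≤ᵇ m * y))))
area≡ m n x = Σ-cong (upTo n) λ y → count≡Σ _ (upTo m)

valleys-∈⁻ : ∀ p n x {s} → s ∈ valleys p n x → s ∈ words n 2 × (∀ {j} → j < n → at s j ≡ 0 ⊎ valley x j ≡ true) × Σ< n (at s) ≡ p
valleys-∈⁻ p n x {s} s∈ with filterᵇ-∈⁻ (λ s → valleySet n x s ∧ (Σ< n (at s) ≡ᵇ p)) (words n 2) s∈
... | w∈ , t with ∧-elim {valleySet n x s} t
... | v , c = w∈ , (λ {j} j<n → test j (allᵇ-upTo-elim n v j<n)) , ≡ᵇ≡⇒≡ c
  where
  test : ∀ j → (at s j ≡ᵇ 0) ∨ valley x j ≡ true → at s j ≡ 0 ⊎ valley x j ≡ true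
  test j t with ∨-elim {at s j ≡ᵇ 0} t
  ... | inj₁ z = inj₁ (≡ᵇ≡⇒≡ z)
  ... | inj₂ v = inj₂ v

valleys-∈⁺ : ∀ p n x {s} → s ∈ words n 2 → (∀ {j} → j < n → at s j ≡ 0 ⊎ valley x j ≡ true) → Σ< n (at s) ≡ p → s ∈ valleys p n x
valleys-∈⁺ p n x {s} w∈ v c = filterᵇ-∈⁺ _ (words n 2) w∈ (∧-intro (allᵇ-upTo-intro n λ {j} j<n → test j (v j<n)) (≡⇒≡ᵇ≡ c))
  where
  test : ∀ j → at s j ≡ 0 ⊎ valley x j ≡ true → (at s j ≡ᵇ 0) ∨ valley x j ≡ true
  test j (inj₁ e) rewrite e = refl
  test j (inj₂ e) rewrite e = ∨-true (at s j ≡ᵇ 0)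
    where
    ∨-true : ∀ b → b ∨ true ≡ true
    ∨-true true = refl
    ∨-true false = refl

divℕ-+ : ∀ a b d → 0 < d → d ∣ b → divℕ (a + b) d ≡ divℕ a d + divℕ b d
divℕ-+ a b (suc d) _ h = DivMod.+-distrib-/-∣ʳ a h

weight-cong : ∀ {m n m' n' x x'} δ a b → ret m n x ≡ ret m' n' x' → area m n x ≡ area m' n' x' → weight m n x δ a b ≡ weight m' n' x' δ a b
weight-cong δ a b = cong₂ (λ r A → Σ< r (λ j → ι (eqℤ δ a ∧ eqℤ (pos A Int.- pos j) b)))

-- Parking functions as functions from cars to columns

inverse : ℕ → List ℕ → List ℕ
inverse n σ = applyUpTo (indexOf σ) n

module Inverse {n σ} (P : Perm n σ) where
  open Perm P
  open Permutation P

  at-inverse : ∀ {c} → c < n → at (inverse n σ) c ≡ index c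
  at-inverse = at-applyUpTo (indexOf σ) n

  inverse-perm : Perm n (inverse n σ)
  inverse-perm = record
    { size = List.length-applyUpTo (indexOf σ) n
    ; bound = λ c<n → subst (_< n) (sym (at-inverse c<n)) (index-bound c<n)
    ; injective = λ {c} {c'} c<n c'<n e → sym (at-index c<n) ∙ cong (at σ) (sym (at-inverse c<n) ∙ e ∙ at-inverse c'<n) ∙ at-index c'<n
    }

  index-inverse : ∀ {j} → j < n → indexOf (inverse n σ) j ≡ at σ j
  index-inverse {j} j<n = cong (indexOf (inverse n σ)) (sym (at-inverse (bound j<n) ∙ index-at j<n)) ∙
    Permutation.index-at inverse-perm (bound j<n)

  inverse-inverse : inverse n (inverse n σ) ≡ σ
  inverse-inverse = at-ext _ σ (List.length-applyUpTo _ n ∙ sym size) λ {j} j< →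
    let j<n = subst (j <_) (List.length-applyUpTo (indexOf (inverse n σ)) n) j< in
    trans (at-applyUpTo (indexOf (inverse n σ)) n j<n) (index-inverse j<n)

-- Cars in the order of their rows: by column, then by label.
carKey : ℕ → List ℕ → ℕ → ℕ
carKey n f i = at f i * n + i

lex-elim : ∀ n {a b i j} → i < n → a * n + i < b * n + j → a < b ⊎ (a ≡ b × i < j) ⊎ (b ≡ a × j ≤ i × i < j) ⊎ (n ≤ j)
lex-elim n {a} {b} {i} {j} i<n lt with <-cmp a b
... | tri< a<b _ _ = inj₁ a<b
... | tri≈ _ refl _ = inj₂ (inj₁ (refl , +-cancelˡ-< (a * n) i j lt))
... | tri> _ _ b<a = inj₂ (inj₂ (inj₂ (+-cancelˡ-≤ (b * n) n j (begin
  b * n + n ≡⟨ +-comm (b * n) n ⟩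
  suc b * n ≤⟨ *-monoˡ-≤ n b<a ⟩
  a * n ≤⟨ m≤m+n (a * n) i ⟩
  a * n + i ≤⟨ <⇒≤ lt ⟩
  b * n + j ∎))))
  where open ≤-Reasoning

lex-< : ∀ n {a b i j} → i < n → a < b → a * n + i < b * n + j
lex-< n {a} {b} {i} {j} i<n a<b = begin-strict
  a * n + i <⟨ +-monoʳ-< (a * n) i<n ⟩
  a * n + n ≡⟨ +-comm (a * n) n ⟩
  suc a * n ≤⟨ *-monoˡ-≤ n a<b ⟩
  b * n ≤⟨ m≤m+n (b * n) j ⟩
  b * n + j ∎
  where open ≤-Reasoning

carKey-elim : ∀ n f {i j} → i < n → j < n → carKey n f i < carKey n f j → at f i < at f j ⊎ (at f i ≡ at f j × i < j)
carKey-elim n f i<n j<n lt with lex-elim n i<n lt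
... | inj₁ h = inj₁ h
... | inj₂ (inj₁ h) = inj₂ h
... | inj₂ (inj₂ (inj₁ (_ , a , b))) = contradiction b (≤⇒≯ a)
... | inj₂ (inj₂ (inj₂ h)) = contradiction j<n (≤⇒≯ h)

carKey-injective : ∀ n f {i j} → i < n → j < n → carKey n f i ≡ carKey n f j → i ≡ j
carKey-injective n f {i} {j} i<n j<n e with <-cmp (at f i) (at f j)
... | tri< h _ _ = contradiction e (<⇒≢ (lex-< n i<n h))
... | tri≈ _ h _ = +-cancelˡ-≡ (at f i * n) i j (e ∙ cong (λ c → c * n + j) (sym h))
... | tri> _ _ h = contradiction (sym e) (<⇒≢ (lex-< n j<n h))

module Cars (m n : ℕ) (f : List ℕ) where
  private module S = Standardize n (carKey n f) (carKey-injective n f)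

  row : ℕ → ℕ
  row = S.rank

  σ : List ℕ
  σ = inverse n (std n (carKey n f))

  x : List ℕ
  x = applyUpTo (λ j → at f (at σ j)) n

  private module I = Inverse S.std-perm

  row-bound : ∀ {i} → i < n → row i < n
  row-bound = S.rank-bound

  σ-perm : Perm n σ
  σ-perm = I.inverse-perm

  indexOf-σ : ∀ {i} → i < n → indexOf σ i ≡ row i
  indexOf-σ i<n = I.index-inverse i<n ∙ at-std n (carKey n f) i<n

  at-σ-row : ∀ {i} → i < n → at σ (row i) ≡ i
  at-σ-row i<n = cong (at σ) (sym (indexOf-σ i<n)) ∙ Permutation.at-index σ-perm i<n

  row-at-σ : ∀ {j} → j < n → row (at σ j) ≡ j
  row-at-σ j<n = sym (indexOf-σ (Perm.bound σ-perm j<n)) ∙ Permutation.index-at σ-perm j<n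

  at-x : ∀ {j} → j < n → at x j ≡ at f (at σ j)
  at-x = at-applyUpTo (λ j → at f (at σ j)) n

  at-x-row : ∀ {i} → i < n → at x (row i) ≡ at f i
  at-x-row i<n = at-x (row-bound i<n) ∙ cong (at f) (at-σ-row i<n)

  Σ-rows : ∀ (F : ℕ → ℕ) → Σ< n F ≡ Σ< n (λ i → F (row i))
  Σ-rows F = sym (Permutation.Σ-index σ-perm F) ∙ (Σ-upTo-cong n λ i<n → cong F (indexOf-σ i<n))

  row-order : ∀ {i k} → i < n → k < n → row i < row k → at f i < at f k ⊎ (at f i ≡ at f k × i < k)
  row-order i<n k<n lt = carKey-elim n f i<n k<n (S.rank-reflects k<n lt)

  σ-order : ∀ {j k} → j < k → k < n → at f (at σ j) < at f (at σ k) ⊎ (at f (at σ j) ≡ at f (at σ k) × at σ j < at σ k)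
  σ-order {j} {k} j<k k<n = row-order (Perm.bound σ-perm j<n) (Perm.bound σ-perm k<n) (subst₂ _<_ (sym (row-at-σ j<n)) (sym (row-at-σ k<n)) j<k)
    where j<n = <-trans j<k k<n

  x-step : ∀ {j} → suc j < n → at x j ≤ at x (suc j)
  x-step {j} h with σ-order (n<1+n j) h
  ... | inj₁ lt = subst₂ _≤_ (sym (at-x (<-trans (n<1+n j) h))) (sym (at-x h)) (<⇒≤ lt)
  ... | inj₂ (e , _) = ≤-reflexive (at-x (<-trans (n<1+n j) h) ∙ e ∙ sym (at-x h))

  labeling : Labeling n x σ
  labeling = record { perm = σ-perm ; column = col }
    where
    col : ∀ {j} → suc j < n → at x j ≡ at x (suc j) → at σ j < at σ (suc j)
    col {j} h e with σ-order (n<1+n j) h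
    ... | inj₁ lt = contradiction (sym (at-x (<-trans (n<1+n j) h)) ∙ e ∙ at-x h) (<⇒≢ lt)
    ... | inj₂ (_ , lt) = lt

  smaller : ℕ → ℕ
  smaller c = Σ< n (λ k → ι (at f k <ᵇ c))

  earlier : ℕ → ℕ
  earlier i = Σ< n (λ k → ι ((k <ᵇ i) ∧ (at f k ≡ᵇ at f i)))

  row≡ : ∀ {i} → i < n → row i ≡ smaller (at f i) + earlier i
  row≡ {i} i<n = (Σ-upTo-cong n λ {k} k<n → pointwise k k<n) ∙ Σ-+ _ _ (upTo n)
    where
    pointwise : ∀ k → k < n → ι (carKey n f k <ᵇ carKey n f i) ≡ ι (at f k <ᵇ at f i) + ι ((k <ᵇ i) ∧ (at f k ≡ᵇ at f i))
    pointwise k k<n with <-cmp (at f k) (at f i)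
    ... | tri< h ne _ rewrite <⇒<ᵇ≡ (lex-< n {at f k} {at f i} {k} {i} k<n h) | <⇒<ᵇ≡ h | ≢⇒≡ᵇ≡ ne = cong suc (sym (∧-0 (k <ᵇ i)))
      where
      ∧-0 : ∀ b → ι (b ∧ false) ≡ 0
      ∧-0 true = refl
      ∧-0 false = refl
    ... | tri> _ ne h rewrite ≮⇒<ᵇ≡ (<⇒≤ (lex-< n {at f i} {at f k} {i} {k} i<n h)) | ≮⇒<ᵇ≡ (<⇒≤ h) | ≢⇒≡ᵇ≡ ne = sym (∧-0 (k <ᵇ i))
      where
      ∧-0 : ∀ b → ι (b ∧ false) ≡ 0
      ∧-0 true = refl
      ∧-0 false = refl
    ... | tri≈ _ h _ rewrite h | ≮⇒<ᵇ≡ (≤-refl {at f i}) | ≡⇒≡ᵇ≡ {at f i} refl =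
      trans (cong ι (<ᵇ-cong (+-cancelˡ-< (at f i * n) k i) (+-monoʳ-< (at f i * n)))) (sym (∧-1 (k <ᵇ i)))
      where
      ∧-1 : ∀ b → ι (b ∧ true) ≡ ι b
      ∧-1 true = refl
      ∧-1 false = refl

  Parking : Set
  Parking = ∀ {i} → i < n → n * at f i ≤ m * row i

  Dyck⇒parking : Dyck m n x → Parking
  Dyck⇒parking D {i} i<n = subst (λ c → n * c ≤ m * row i) (at-x-row i<n) (Dyck.diag D (row-bound i<n))

  parking⇒Dyck : (∀ {i} → i < n → at f i < m) → Parking → Dyck m n x
  parking⇒Dyck b p = record
    { size = List.length-applyUpTo (λ j → at f (at σ j)) n
    ; col = λ j<n → subst (_< m) (sym (at-x j<n)) (b (Perm.bound σ-perm j<n))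
    ; step = x-step
    ; diag = λ {j} j<n → subst₂ (λ c r → n * c ≤ m * r) (sym (at-x j<n)) (row-at-σ j<n) (p (Perm.bound σ-perm j<n))
    }

  height≡ : ∀ c → Σ< n (λ j → ι (at x j ≤ᵇ c)) ≡ Σ< n (λ i → ι (at f i ≤ᵇ c))
  height≡ c = Σ-rows (λ j → ι (at x j ≤ᵇ c)) ∙ (Σ-upTo-cong n λ i<n → cong (λ z → ι (z ≤ᵇ c)) (at-x-row i<n))

-- (x , σ) is recovered from the function sending a car to its column.
module FromLabeling (m n : ℕ) (x σ : List ℕ) (m>0 : 0 < m) (n>0 : 0 < n) (D : Dyck m n x) (L : Labeling n x σ) where
  open Path m n x m>0 n>0 D using (mono; size; col; step)
  open Labeling L
  open Permutation perm
  private module I = Inverse perm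

  f : List ℕ
  f = applyUpTo (λ i → at x (indexOf σ i)) n

  at-f : ∀ {i} → i < n → at f i ≡ at x (index i)
  at-f = at-applyUpTo (λ i → at x (indexOf σ i)) n

  f-∈ : f ∈ words n m
  f-∈ = words-complete n m f (List.length-applyUpTo (λ i → at x (indexOf σ i)) n) λ i<n → subst (_< m) (sym (at-f i<n)) (col (index-bound i<n))

  column-order : ∀ {j k} → j < k → k < n → at x j ≡ at x k → at σ j < at σ k
  column-order {j} j<k k<n e with m≤n⇒∃[o]m+o≡n j<k
  ... | o , refl = go o k<n e
    where
    go : ∀ o → suc j + o < n → at x j ≡ at x (suc j + o) → at σ j < at σ (suc j + o)
    go zero h e rewrite +-identityʳ j = column h e
    go (suc o) h e rewrite +-suc j o = <-trans (go o h' e1) (column h (sym e1 ∙ e))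
      where
      h' = <-trans (n<1+n _) h
      e1 : at x j ≡ at x (suc (j + o))
      e1 = ≤-antisym (mono (m≤m+n j o ≤∙ n≤1+n _) h') (step h ≤∙ ≤-reflexive (sym e))

  open Cars m n f using (row) renaming (σ to σ'; x to x'; σ-perm to σ'-perm)

  inverse≡std : inverse n σ ≡ std n (carKey n f)
  inverse≡std = Standardize.std-unique n (carKey n f) (carKey-injective n f) I.inverse-perm λ {i} {k} i<n k<n lt →
    subst₂ _<_ (sym (I.at-inverse i<n)) (sym (I.at-inverse k<n)) (order i<n k<n (carKey-elim n f i<n k<n lt))
    where
    order : ∀ {i k} → i < n → k < n → at f i < at f k ⊎ (at f i ≡ at f k × i < k) → index i < index k
    order i<n k<n (inj₁ lt) = ≰⇒> λ le → <⇒≱ (subst₂ _<_ (at-f i<n) (at-f k<n) lt) (mono le (index-bound i<n))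
    order {i} {k} i<n k<n (inj₂ (e , lt)) = ≰⇒> λ le → case m≤n⇒m<n∨m≡n le of λ where
      (inj₁ gt) → <-asym lt (subst₂ _<_ (at-index k<n) (at-index i<n) (column-order gt (index-bound i<n) (sym (at-f k<n) ∙ sym e ∙ at-f i<n)))
      (inj₂ e') → <-irrefl (sym (at-index i<n) ∙ cong (at σ) (sym e') ∙ at-index k<n) lt

  σ'≡σ : σ' ≡ σ
  σ'≡σ = cong (inverse n) (sym inverse≡std) ∙ I.inverse-inverse

  x'≡x : x' ≡ x
  x'≡x = at-ext x' x (List.length-applyUpTo (λ j → at f (at σ' j)) n ∙ sym size) λ {j} j< →
    let j<n = subst (j <_) (List.length-applyUpTo (λ j → at f (at σ' j)) n) j< in
    trans (Cars.at-x m n f j<n) (cong (λ τ → at f (at τ j)) σ'≡σ ∙ at-f (Perm.bound perm j<n) ∙ cong (at x) (index-at j<n))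

Σ-parking : ∀ m n → 0 < m → 0 < n → (W : List ℕ → List ℕ → ℕ) →
  Σ (dyckPaths m n) (λ x → Σ (labelings n x) (W x)) ≡ Σ (words n m) (λ f → ι (isDyck m n (Cars.x m n f)) * W (Cars.x m n f) (Cars.σ m n f))
Σ-parking m n m>0 n>0 W = Σ-cong (dyckPaths m n) (λ x → sym (Σ-map W' (x ,_) (labelings n x)))
  ∙ sym (Σ-concatMap W' (λ x → map (x ,_) (labelings n x)) (dyckPaths m n))
  ∙ Σ-bij W' G (λ { (x , σ) → applyUpTo (λ i → at x (indexOf σ i)) n }) (λ f → Cars.x m n f , Cars.σ m n f) pairs (words n m) (concatMap-unique _ proj₁ (dyckPaths m n) (filterᵇ-unique _ _ (words-unique n m)) (λ x → Uniqueₚ.map⁺ (cong proj₂) (filterᵇ-unique _ _ (words-unique n n))) tag) (words-unique n m) to from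
  where
  W' : List ℕ × List ℕ → ℕ
  W' (x , σ) = W x σ
  G : List ℕ → ℕ
  G f = ι (isDyck m n (Cars.x m n f)) * W (Cars.x m n f) (Cars.σ m n f)
  pairs = concatMap (λ x → map (x ,_) (labelings n x)) (dyckPaths m n)
  tag : ∀ {x y} → y ∈ map (x ,_) (labelings n x) → proj₁ y ≡ x
  tag i with ∈-map⁻ _ i
  ... | _ , _ , refl = refl
  isDyck⁺ : ∀ {x} → Dyck m n x → isDyck m n x ≡ true
  isDyck⁺ D = proj₂ (filterᵇ-∈⁻ (isDyck m n) (words n m) (dyckPaths-complete m n D))
  to : ∀ {y} → y ∈ pairs → W' y ≢ 0 → _
  to {x , σ} i _ with ∈-concat⁻′ (map (λ x → map (x ,_) (labelings n x)) (dyckPaths m n)) i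
  ... | ys , y∈ , ys∈ with ∈-map⁻ (λ x → map (x ,_) (labelings n x)) ys∈
  ... | x , x∈ , refl with ∈-map⁻ (x ,_) y∈
  ... | σ , σ∈ , refl = f-∈ , weight≡ , cong₂ _,_ x'≡x σ'≡σ
    where
    D = dyckPaths-sound m n x∈
    open FromLabeling m n x σ m>0 n>0 D (labelings-sound n x σ∈)
    weight≡ : G f ≡ W x σ
    weight≡ = cong₂ (λ y τ → ι (isDyck m n y) * W y τ) x'≡x σ'≡σ ∙ cong (λ b → ι b * W x σ) (isDyck⁺ D) ∙ *-identityˡ _
  from : ∀ {f} → f ∈ words n m → G f ≢ 0 → _
  from {f} f∈ ne = concatMap-complete (λ x → map (x ,_) (labelings n x)) x∈ (∈-map⁺ (x ,_) (labelings-complete n x labeling)) ,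
    sym (cong (λ b → ι b * W x σ) dy ∙ *-identityˡ _) ,
    at-ext _ f (List.length-applyUpTo _ n ∙ sym (proj₁ sound)) λ {i} i< →
      let i<n = subst (i <_) (List.length-applyUpTo (λ i → at x (indexOf σ i)) n) i< in
      trans (at-applyUpTo (λ i → at x (indexOf σ i)) n i<n) (cong (at x) (indexOf-σ i<n) ∙ at-x-row i<n)
    where
    open Cars m n f
    sound = words-sound n m f∈
    dy = ι≢0 (proj₁ (*-≢0 {ι (isDyck m n x)} ne))
    x∈ : x ∈ dyckPaths m n
    x∈ = filterᵇ-∈⁺ (isDyck m n) (words n m) (words-complete n m x (List.length-applyUpTo (λ j → at f (at σ j)) n)
      λ j<n → subst (_< m) (sym (at-x j<n)) (proj₂ sound (Perm.bound σ-perm j<n))) dy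

-- Removing the bottom car of every column

gcd-peel : ∀ m n → gcd m (m + n) ≡ gcd m n
gcd-peel m n = ∣-antisym
  (gcd-greatest (gcd[m,n]∣m m (m + n)) (∣m+n∣m⇒∣n (gcd[m,n]∣n m (m + n)) (gcd[m,n]∣m m (m + n))))
  (gcd-greatest (gcd[m,n]∣m m n) (∣m∣n⇒∣m+n (gcd[m,n]∣m m n) (gcd[m,n]∣n m n)))

window-shift : ∀ k a b e → window (a + k) (b + k) (e + k) ≡ window a b e
window-shift k a b e = cong ι (cong₂ _∧_ (<ᵇ-+ʳ k a e) (≤ᵇ-+ʳ k e b))

Σ-cut : ∀ {n β} (g : ℕ → ℕ) → β ≤ n → Σ< n (λ i → ι (i <ᵇ β) * g i) ≡ Σ< β g
Σ-cut {n} {β} g β≤n with m≤n⇒∃[o]m+o≡n β≤n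
... | k , refl = Σ-upTo-+ β k _ ∙ cong₂ _+_
  (Σ-upTo-cong β λ {i} h → cong (λ b → ι b * g i) (<⇒<ᵇ≡ h) ∙ *-identityˡ (g i))
  (Σ-upTo-vanish k λ {i} _ → cong (λ b → ι b * g (β + i)) (≮⇒<ᵇ≡ (m≤m+n β i))) ∙ +-identityʳ _

δ-shift : ∀ {t q M t' q' M'} F B → t ≡ F + t' → q ≡ q' + B → M ≡ F + M' + B →
  (pos t Int.+ pos q) Int.- pos M ≡ (pos t' Int.+ pos q') Int.- pos M'
δ-shift {t' = t'} {q'} {M'} F B refl refl refl
  rewrite ℤₚ.pos-+ (F + M') B | ℤₚ.pos-+ F M' | ℤₚ.pos-+ F t' | ℤₚ.pos-+ q' B = arith (pos F) (pos t') (pos q') (pos B) (pos M')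
  where
  arith : ∀ F t q b T → ((F Int.+ t) Int.+ (q Int.+ b)) Int.- ((F Int.+ T) Int.+ b) ≡ (t Int.+ q) Int.- T
  arith = ℤSolver.solve-∀

-- f is a list of all columns followed by f'.
module Peel (m n' : ℕ) (m>0 : 0 < m) (n'>0 : 0 < n') (p f' : List ℕ) (Pp : Perm m p)
  (len' : length f' ≡ n') (bound' : ∀ {i} → i < n' → at f' i < m) where

  n = m + n'
  f = p ++ f'
  open Permutation Pp
  private module Pm = Perm Pp
  module C = Cars m n f
  module C' = Cars m n' f'

  n>0 : 0 < n
  n>0 = <-≤-trans m>0 (m≤m+n m n')

  at-head : ∀ {b} → b < m → at f b ≡ at p b
  at-head b<m = at-++ˡ p f' (subst (_ <_) (sym Pm.size) b<m)

  at-rest : ∀ i → at f (m + i) ≡ at f' i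
  at-rest i = cong (λ k → at f (k + i)) (sym Pm.size) ∙ at-++ʳ p f' i

  head<n : ∀ {b} → b < m → b < n
  head<n b<m = <-≤-trans b<m (m≤m+n m n')

  Σ-f : ∀ (F : ℕ → ℕ) → Σ< n (λ i → F (at f i)) ≡ Σ< m F + Σ< n' (λ i → F (at f' i))
  Σ-f F = Σ-upTo-+ m n' _ ∙ cong₂ _+_ ((Σ-upTo-cong m λ b<m → cong F (at-head b<m)) ∙ Σ-at-perm F) (Σ-cong (upTo n') λ i → cong F (at-rest i))

  smaller≡ : ∀ {c} → c ≤ m → C.smaller c ≡ c + C'.smaller c
  smaller≡ {c} c≤m = Σ-f (λ k → ι (k <ᵇ c)) ∙ cong (_+ C'.smaller c) (Σ-upTo-< m c≤m)

  earlier-head : ∀ {b} → b < m → C.earlier b ≡ 0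
  earlier-head {b} b<m = Σ-upTo-vanish n λ {k} k<n → zero' k
    where
    zero' : ∀ k → ι ((k <ᵇ b) ∧ (at f k ≡ᵇ at f b)) ≡ 0
    zero' k with k <ᵇ b in e1 | at f k ≡ᵇ at f b in e2
    ... | false | _ = refl
    ... | true | false = refl
    ... | true | true = contradiction (Pm.injective k<m b<m (sym (at-head k<m) ∙ ≡ᵇ≡⇒≡ {at f k} {at f b} e2 ∙ at-head b<m)) (<⇒≢ (<ᵇ≡⇒< {k} {b} e1))
      where k<m = <-trans (<ᵇ≡⇒< {k} {b} e1) b<m

  earlier-rest : ∀ {i} → i < n' → C.earlier (m + i) ≡ suc (C'.earlier i)
  earlier-rest {i} i<n' = Σ-upTo-+ m n' _ ∙ cong₂ _+_
    ((Σ-upTo-cong m λ {k} k<m → cong (λ b → ι (b ∧ (at f k ≡ᵇ at f (m + i)))) (<⇒<ᵇ≡ (<-≤-trans k<m (m≤m+n m i))) ∙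
        cong ι (cong₂ _≡ᵇ_ (at-head k<m) (at-rest i) ∙ ≡ᵇ-sym (at p k) (at f' i)) ∙ sym (*-identityʳ (ι (at f' i ≡ᵇ at p k)))) ∙
      Σ-at-perm (λ c → ι (at f' i ≡ᵇ c) * 1) ∙ Σ-upTo-δ m (λ _ → 1) (bound' i<n'))
    (Σ-cong (upTo n') λ k → cong ι (cong₂ _∧_ (cong₂ _<ᵇ_ (+-comm m k) (+-comm m i) ∙ <ᵇ-+ʳ m k i) (cong₂ _≡ᵇ_ (at-rest k) (at-rest i))))
    where
    ≡ᵇ-sym : ∀ a b → (a ≡ᵇ b) ≡ (b ≡ᵇ a)
    ≡ᵇ-sym a b = bool-ext (λ t → ≡⇒≡ᵇ≡ (sym (≡ᵇ≡⇒≡ {a} {b} t))) (λ t → ≡⇒≡ᵇ≡ (sym (≡ᵇ≡⇒≡ {b} {a} t)))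

  bottom : ℕ → ℕ
  bottom c = c + C'.smaller c

  row-head : ∀ {b} → b < m → C.row b ≡ bottom (at p b)
  row-head {b} b<m = C.row≡ (head<n b<m)
    ∙ cong₂ (λ u v → C.smaller u + v) (at-head b<m) (earlier-head b<m)
    ∙ +-identityʳ _
    ∙ smaller≡ (<⇒≤ (Pm.bound b<m))

  row-rest : ∀ {i} → i < n' → C.row (m + i) ≡ suc (at f' i) + C'.row i
  row-rest {i} i<n' = C.row≡ (+-monoʳ-< m i<n')
    ∙ cong₂ (λ u v → C.smaller u + v) (at-rest i) (earlier-rest i<n')
    ∙ cong (_+ suc (C'.earlier i)) (smaller≡ (<⇒≤ (bound' i<n')))
    ∙ arith (at f' i) (C'.smaller (at f' i)) (C'.earlier i)
    ∙ cong (suc (at f' i) +_) (sym (C'.row≡ i<n'))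
    where
    arith : ∀ a s e → a + s + suc e ≡ suc a + (s + e)
    arith = solve-∀

  scale : ∀ c s → (m + n') * c ≤ m * (c + s) → n' * c ≤ m * s
  scale c s h = +-cancelˡ-≤ (m * c) _ _ (subst₂ _≤_ (*-distribʳ-+ c m n') (*-distribˡ-+ m c s) h)

  unscale : ∀ c s → n' * c ≤ m * s → (m + n') * c ≤ m * (c + s)
  unscale c s h = subst₂ _≤_ (sym (*-distribʳ-+ c m n')) (sym (*-distribˡ-+ m c s)) (+-monoʳ-≤ (m * c) h)

  parking⇒ : C.Parking → C'.Parking
  parking⇒ pk {i} i<n' = scale c (C'.smaller c) (subst₂ (λ u v → n * u ≤ m * v) (at-head b<m ∙ at-index c<m) (row-head b<m ∙ cong bottom (at-index c<m)) (pk (head<n b<m))) ≤∙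
    *-monoʳ-≤ m (m≤m+n (C'.smaller c) (C'.earlier i) ≤∙ ≤-reflexive (sym (C'.row≡ i<n')))
    where
    c = at f' i
    c<m = bound' i<n'
    b<m = index-bound c<m

  module Peeled (pk' : C'.Parking) where
    D' : Dyck m n' C'.x
    D' = C'.parking⇒Dyck bound' pk'

    module P' = Path m n' C'.x m>0 n'>0 D'

    smaller-height : ∀ k → C'.smaller (suc k) ≡ P'.height k
    smaller-height k = (Σ-cong (upTo n') λ i → cong ι (<ᵇ-suc (at f' i) k)) ∙ sym (C'.height≡ k)

    bottom-diag : ∀ c → c ≤ m → n' * c ≤ m * C'.smaller c
    bottom-diag zero _ = ≤-reflexive (*-zeroʳ n') ≤∙ z≤n
    bottom-diag (suc k) h = P'.height-diag h ≤∙ ≤-reflexive (cong (m *_) (sym (smaller-height k)))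

    pk : C.Parking
    pk {i} i<n with i <? m
    ... | yes b<m = subst₂ (λ u v → n * u ≤ m * v) (sym (at-head b<m)) (sym (row-head b<m)) (unscale (at p i) _ (bottom-diag (at p i) (<⇒≤ (Pm.bound b<m))))
    ... | no i≮m with m≤n⇒∃[o]m+o≡n (≮⇒≥ i≮m)
    ... | k , refl = subst₂ (λ u v → n * u ≤ m * v) (sym (at-rest k)) (sym (row-rest k<n' ∙ sym (+-suc (at f' k) (C'.row k))))
              (unscale (at f' k) (suc (C'.row k)) (pk' k<n' ≤∙ *-monoʳ-≤ m (n≤1+n _)))
      where k<n' = +-cancelˡ-< m k n' i<n

    bound : ∀ {i} → i < n → at f i < m
    bound {i} i<n with i <? m
    ... | yes b<m = subst (_< m) (sym (at-head b<m)) (Pm.bound b<m)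
    ... | no i≮m with m≤n⇒∃[o]m+o≡n (≮⇒≥ i≮m)
    ... | k , refl = subst (_< m) (sym (at-rest k)) (bound' (+-cancelˡ-< m k n' i<n))

    D : Dyck m n C.x
    D = C.parking⇒Dyck bound pk

    module P = Path m n C.x m>0 n>0 D

    shift-∸ : ∀ c s → n' * c ≤ m * s → m * (suc c + s) ∸ (m + n') * c ≡ (m * s ∸ n' * c) + m
    shift-∸ c s h = cong₂ _∸_ (arith1 m c s) (*-distribʳ-+ c m n')
      ∙ [m+n]∸[m+o]≡n∸o (m * c) _ _
      ∙ +-∸-comm m h
      where
      arith1 : ∀ m c s → m * (suc c + s) ≡ m * c + (m * s + m)
      arith1 = solve-∀

    level-rest : ∀ {i} → i < n' → P.level (C.row (m + i)) ≡ P'.level (C'.row i) + m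
    level-rest {i} i<n' = cong₂ (λ r c → m * r ∸ n * c) (row-rest i<n') (C.at-x-row (+-monoʳ-< m i<n') ∙ at-rest i) ∙
      shift-∸ (at f' i) (C'.row i) (pk' i<n') ∙ cong (λ c → m * C'.row i ∸ n' * c + m) (sym (C'.at-x-row i<n'))

    rank-rest : ∀ {i} → i < n' → P.rank (C.row (m + i)) ≡ P'.rank (C'.row i) + m
    rank-rest {i} i<n' = cong₂ _+_ (level-rest i<n') (cong₂ (λ c d → divℕ (c * d) m) (C.at-x-row (+-monoʳ-< m i<n') ∙ at-rest i ∙ sym (C'.at-x-row i<n')) (gcd-peel m n')) ∙
      arith (P'.level (C'.row i)) m _
      where
      arith : ∀ a b c → a + b + c ≡ a + c + b
      arith = solve-∀

    height≡ : ∀ {c} → c < m → P.height c ≡ suc c + P'.height c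
    height≡ {c} c<m = C.height≡ c ∙ Σ-f (λ k → ι (k ≤ᵇ c)) ∙ cong₂ _+_
      ((Σ-cong (upTo m) λ k → cong ι (sym (<ᵇ-suc k c))) ∙ Σ-upTo-< m c<m) (sym (C'.height≡ c))

    east≡ : ∀ {c} → c < m → P.east c ≡ P'.east c + m
    east≡ {c} c<m = cong (λ h → m * h ∸ n * c) (height≡ c<m) ∙ shift-∸ c (P'.height c) (*-monoʳ-≤ n' (n≤1+n c) ≤∙ P'.height-diag c<m)

    bottom-row : ∀ {c} → c < m → bottom c < n × at C.x (bottom c) ≡ c
    bottom-row {c} c<m = subst (_< n) r≡ (C.row-bound (head<n b<m)) , cong (at C.x) (sym r≡) ∙ C.at-x-row (head<n b<m) ∙ at-head b<m ∙ at-index c<m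
      where
      b<m = index-bound c<m
      r≡ = row-head b<m ∙ cong bottom (at-index c<m)

    bottom-height : ∀ {k} → suc k < m → bottom (suc k) ≡ P.height k
    bottom-height {k} h = cong (suc k +_) (smaller-height k) ∙ sym (height≡ (<-trans (n<1+n k) h))

    bottom-level : ∀ {k} → suc k < m → P.level (bottom (suc k)) ≡ P.east k ∸ n
    bottom-level {k} h = cong₂ (λ r c → m * r ∸ n * c) (bottom-height h) (proj₂ (bottom-row h))
      ∙ cong (m * P.height k ∸_) (*-suc n k ∙ +-comm n _)
      ∙ sym (∸-+-assoc (m * P.height k) (n * k) n)

    bottom-0 : bottom 0 ≡ 0
    bottom-0 = Σ-0 (upTo n')


    Up : ℕ → ℕ
    Up β = Σ< (at C.x β) (λ k → window (P.level β) (P.level β + n) (P.east k))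

    Down : ℕ → ℕ
    Down i = Σ< (at C.x i) (λ k → window (P.level i + n) (P.level i + n + m) (P.east k))

    attacked : ∀ {β} → β < n → Σ< n (λ i → ι (P.attack i β)) ≡ Up β + Σ< n (λ i → ι (β <ᵇ i) * window (P.level i) (P.level i + m) (P.level β))
    attacked {β} β<n = Σ-upTo-cong n pt ∙ Σ-+ _ _ (upTo n) ∙ cong (_+ Σ< n (λ i → ι (β <ᵇ i) * window (P.level i) (P.level i + m) (P.level β)))
      (Σ-cut (λ i → crossing (P.level β) m (P.level i)) (<⇒≤ β<n) ∙ sym (P.crossings β<n ≤-refl))
      where
      pt : ∀ {i} → i < n → ι (P.attack i β) ≡ ι (i <ᵇ β) * crossing (P.level β) m (P.level i) + ι (β <ᵇ i) * window (P.level i) (P.level i + m) (P.level β)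
      pt {i} i<n with <-cmp i β
      ... | tri< h _ _ rewrite <⇒<ᵇ≡ h | ≮⇒<ᵇ≡ (<⇒≤ h) = P.attack-up h β<n ∙ sym (+-identityʳ _ ∙ *-identityˡ _)
      ... | tri≈ _ refl _ rewrite ≮⇒<ᵇ≡ (≤-refl {i}) = P.attack-self i
      ... | tri> _ _ h rewrite <⇒<ᵇ≡ h | ≮⇒<ᵇ≡ (<⇒≤ h) = P.attack-down h i<n ∙ sym (*-identityˡ _)

    down≡ : ∀ {i} → i < n → Σ< m (λ c → ι (bottom c <ᵇ i) * window (P.level i) (P.level i + m) (P.level (bottom c))) ≡ Down i
    down≡ {i} i<n = Σ-upTo-cong m (λ {c} c<m → below c<m)
      ∙ Σ-cut w (P.col i<n)
      ∙ Σ-upTo-suc (at C.x i) w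
      ∙ cong₂ _+_ w0 (Σ-upTo-cong (at C.x i) λ {k} k< → step k (<-≤-trans (s≤s k<) (P.col i<n)))
      where
      a = P.level i
      w : ℕ → ℕ
      w c = window a (a + m) (P.level (bottom c))
      w0 : w 0 ≡ 0
      w0 rewrite trans (cong P.level bottom-0) P.level-0 = refl
      step : ∀ k → suc k < m → w (suc k) ≡ window (a + n) (a + n + m) (P.east k)
      step k h = cong (window a (a + m)) (bottom-level h) ∙ sym (window-shift n a (a + m) (P.east k ∸ n)) ∙
        cong₂ (window (a + n)) (arith a m n) (m∸n+n≡m (P.n≤east (<-trans (n<1+n k) h)))
        where
        arith : ∀ a b c → a + b + c ≡ a + c + b
        arith = solve-∀
      same : ∀ c → c < m → c ≤ at C.x i → i ≤ bottom c → bottom c ≡ i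
      same zero _ _ i≤ = bottom-0 ∙ sym (n≤0⇒n≡0 (subst (i ≤_) bottom-0 i≤))
      same (suc k) c<m h i≤ = ≤-antisym (≤-reflexive (bottom-height c<m) ≤∙ P.height-≤ i<n h) i≤
      w-self : ∀ z → z * window a (a + m) a ≡ 0
      w-self z rewrite ≮⇒<ᵇ≡ (≤-refl {a}) = *-zeroʳ z
      below : ∀ {c} → c < m → ι (bottom c <ᵇ i) * w c ≡ ι (c <ᵇ suc (at C.x i)) * w c
      below {c} c<m with bottom c <? i | bottom-row c<m
      ... | yes lt | _ , e rewrite <⇒<ᵇ≡ lt | <⇒<ᵇ≡ (s≤s (subst (_≤ at C.x i) e (P.mono (<⇒≤ lt) i<n))) = refl
      ... | no nlt | b<n , e with c ≤? at C.x i
      ... | no h rewrite ≮⇒<ᵇ≡ (≮⇒≥ nlt) | ≮⇒<ᵇ≡ (≰⇒> h) = refl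
      ... | yes h rewrite same c c<m h (≮⇒≥ nlt) = w-self (ι (i <ᵇ i)) ∙ sym (w-self (ι (c <ᵇ suc (at C.x i))))

    Attacks : ℕ → ℕ → ℕ
    Attacks c c' = ι (P.attack (C.row c) (C.row c'))

    toBottom : ℕ
    toBottom = Σ< m (λ b → Σ< n (λ c → Attacks c b))

    toBottom≡ : toBottom ≡ Σ< m (λ b → Up (C.row b)) + Σ< n Down
    toBottom≡ = Σ-upTo-cong m (λ {b} b<m → sym (C.Σ-rows (λ i → ι (P.attack i (C.row b)))) ∙ attacked (C.row-bound (head<n b<m)))
      ∙ Σ-+ _ _ (upTo m)
      ∙ cong (Σ< m (λ b → Up (C.row b)) +_) ((Σ-upTo-cong m λ b<m → cong (λ β → Σ< n (λ i → ι (β <ᵇ i) * window (P.level i) (P.level i + m) (P.level β))) (row-head b<m)) ∙ Σ-at-perm (λ c → Σ< n (λ i → ι (bottom c <ᵇ i) * window (P.level i) (P.level i + m) (P.level (bottom c)))) ∙ Σ-swap _ (upTo m) (upTo n) ∙ Σ-upTo-cong n down≡)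

    pdinv-peel : pdinv m n C.x ≡ pdinv m n' C'.x + toBottom
    pdinv-peel = P.pdinv≡
      ∙ Σ-cong (upTo n) (λ j → (Σ-cong (upTo (at C.x j)) λ c → cong (λ z → window (P.level j) z (P.east c)) (arith (P.level j) m n) ∙ window-split (P.east c) (m≤m+n (P.level j) n) (m≤m+n (P.level j + n) m)) ∙ Σ-+ _ _ (upTo (at C.x j)))
      ∙ Σ-+ _ _ (upTo n) ∙ cong (_+ Σ< n Down) (C.Σ-rows Up ∙ Σ-upTo-+ m n' _)
      ∙ cong (λ z → Σ< m (λ b → Up (C.row b)) + z + Σ< n Down) rest
      ∙ arith' (Σ< m (λ b → Up (C.row b))) _ _
      ∙ cong (pdinv m n' C'.x +_) (sym toBottom≡)
      where
      arith : ∀ a b c → a + (b + c) ≡ a + c + b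
      arith = solve-∀
      arith' : ∀ a b c → a + b + c ≡ b + (a + c)
      arith' = solve-∀
      rest : Σ< n' (λ i → Up (C.row (m + i))) ≡ pdinv m n' C'.x
      rest = sym (P'.pdinv≡ ∙ C'.Σ-rows (λ j → Σ< (at C'.x j) (λ c → window (P'.level j) (P'.level j + (m + n')) (P'.east c))) ∙
        (Σ-upTo-cong n' λ {i} i<n' → sym (cong (λ z → Σ< z (λ k → window (P.level (C.row (m + i))) (P.level (C.row (m + i)) + n) (P.east k)))
            (C.at-x-row (+-monoʳ-< m i<n') ∙ at-rest i ∙ sym (C'.at-x-row i<n')) ∙
          (Σ-upTo-cong (at C'.x (C'.row i)) λ {k} k< → cong₂ (λ l e → window l (l + n) e) (level-rest i<n') (east≡ (<-trans k< (P'.col (C'.row-bound i<n')))) ∙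
            cong (λ z → window (P'.level (C'.row i) + m) z (P'.east k + m)) (swap (P'.level (C'.row i)) m n) ∙ window-shift m (P'.level (C'.row i)) (P'.level (C'.row i) + n) (P'.east k)))))
        where
        swap : ∀ a b c → a + b + c ≡ a + c + b
        swap = solve-∀

    attack-rest : ∀ {i k} → i < n' → k < n' → Attacks (m + i) (m + k) ≡ ι (P'.attack (C'.row i) (C'.row k))
    attack-rest {i} {k} i<n' k<n' = cong ι (cong₂ _∧_
      (cong₂ _<ᵇ_ (rank-rest i<n') (rank-rest k<n') ∙ <ᵇ-+ʳ m (P'.rank (C'.row i)) (P'.rank (C'.row k)))
      (cong₂ (λ u v → u <ᵇ v + m) (rank-rest k<n') (rank-rest i<n') ∙ <ᵇ-+ʳ m (P'.rank (C'.row k)) (P'.rank (C'.row i) + m)))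

    ΣΣ-split : ∀ (F : ℕ → ℕ → ℕ) → Σ< n (λ c → Σ< n (F c)) ≡
      Σ< m (λ b → Σ< m (F b)) + Σ< m (λ b → Σ< n' (λ i → F b (m + i))) +
      (Σ< n' (λ i → Σ< m (F (m + i))) + Σ< n' (λ i → Σ< n' (λ k → F (m + i) (m + k))))
    ΣΣ-split F = Σ-upTo-+ m n' _ ∙ cong₂ _+_
      ((Σ-cong (upTo m) λ b → Σ-upTo-+ m n' (F b)) ∙ Σ-+ _ _ (upTo m))
      ((Σ-cong (upTo n') λ i → Σ-upTo-+ m n' (F (m + i))) ∙ Σ-+ _ _ (upTo n'))

    fromBottom : ℕ
    fromBottom = Σ< m (λ b → Σ< n' (λ i → Attacks b (m + i)))

    total-peel : P.total ≡ fromBottom + P'.total + toBottom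
    total-peel = sym (P.total-cars C.σ-perm)
      ∙ Σ-upTo-cong n (λ c<n → Σ-upTo-cong n λ c'<n → cong₂ (λ u v → ι (P.attack u v)) (C.indexOf-σ c<n) (C.indexOf-σ c'<n))
      ∙ ΣΣ-split Attacks
      ∙ arith BB fromBottom CB CC
      ∙ cong₂ (λ u v → fromBottom + u + v) cc≡ (sym tb≡)
      where
      BB = Σ< m (λ b → Σ< m (Attacks b))
      CB = Σ< n' (λ i → Σ< m (Attacks (m + i)))
      CC = Σ< n' (λ i → Σ< n' (λ k → Attacks (m + i) (m + k)))
      arith : ∀ a b c d → a + b + (c + d) ≡ b + d + (a + c)
      arith = solve-∀
      cc≡ : CC ≡ P'.total
      cc≡ = (Σ-upTo-cong n' λ i< → Σ-upTo-cong n' λ k< → attack-rest i< k< ∙ sym (cong₂ (λ u v → ι (P'.attack u v)) (C'.indexOf-σ i<) (C'.indexOf-σ k<))) ∙ P'.total-cars C'.σ-perm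
      tb≡ : toBottom ≡ BB + CB
      tb≡ = (Σ-cong (upTo m) λ b → Σ-upTo-+ m n' (λ c → Attacks c b)) ∙ Σ-+ _ _ (upTo m) ∙ cong₂ _+_ (Σ-swap (λ b c → Attacks c b) (upTo m) (upTo m)) (Σ-swap (λ b i → Attacks (m + i) b) (upTo m) (upTo n'))

    R : ℕ → ℕ
    R i = P.rank (C.row i)

    module Falling (fall : ∀ {b b'} → b < b' → b' < m → R b' < R b) where

      tdinv-peel = P.tdinv≡Σ C.σ
        ∙ Σ-upTo-cong n (λ {c} c<n → Σ-upTo-cong n λ {c'} c'<n → cong₂ (λ u v → ι (c <ᵇ c') * ι (P.attack u v)) (C.indexOf-σ c<n) (C.indexOf-σ c'<n))
        ∙ ΣΣ-split (λ c c' → ι (c <ᵇ c') * Attacks c c')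
        ∙ cong₂ _+_ (cong₂ _+_ bb bc) (cong₂ _+_ cb cc)
        where
        bb : Σ< m (λ b → Σ< m (λ b' → ι (b <ᵇ b') * Attacks b b')) ≡ 0
        bb = Σ-upTo-vanish m λ {b} b<m → Σ-upTo-vanish m λ {b'} b'<m → none b b' b'<m
          where
          none : ∀ b b' → b' < m → ι (b <ᵇ b') * Attacks b b' ≡ 0
          none b b' b'<m with b <ᵇ b' in e
          ... | false = refl
          ... | true rewrite ≮⇒<ᵇ≡ {R b} {R b'} (<⇒≤ (fall (<ᵇ≡⇒< {b} {b'} e) b'<m)) = refl
        bc : Σ< m (λ b → Σ< n' (λ i → ι (b <ᵇ m + i) * Attacks b (m + i))) ≡ fromBottom
        bc = Σ-upTo-cong m λ {b} b<m → Σ-cong (upTo n') λ i → cong (λ z → ι z * Attacks b (m + i)) (<⇒<ᵇ≡ (<-≤-trans b<m (m≤m+n m i))) ∙ *-identityˡ _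
        cb : Σ< n' (λ i → Σ< m (λ b → ι (m + i <ᵇ b) * Attacks (m + i) b)) ≡ 0
        cb = Σ-upTo-vanish n' λ {i} _ → Σ-upTo-vanish m λ {b} b<m → cong (λ z → ι z * Attacks (m + i) b) (≮⇒<ᵇ≡ (<⇒≤ b<m ≤∙ m≤m+n m i))
        cc : Σ< n' (λ i → Σ< n' (λ k → ι (m + i <ᵇ m + k) * Attacks (m + i) (m + k))) ≡ tdinv m n' C'.x C'.σ
        cc = sym (P'.tdinv≡Σ C'.σ ∙ (Σ-upTo-cong n' λ {i} i< → Σ-upTo-cong n' λ {k} k< →
          cong₂ _*_ (cong ι (sym (cong₂ _<ᵇ_ (+-comm m i) (+-comm m k) ∙ <ᵇ-+ʳ m i k)))
            (cong₂ (λ u v → ι (P'.attack u v)) (C'.indexOf-σ i<) (C'.indexOf-σ k<) ∙ sym (attack-rest i< k<))))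

      δ-peel : (pos (tdinv m n C.x C.σ) Int.+ pos (pdinv m n C.x)) Int.- pos (maxdinv m n C.x) ≡ (pos (tdinv m n' C'.x C'.σ) Int.+ pos (pdinv m n' C'.x)) Int.- pos (maxdinv m n' C'.x)
      δ-peel = δ-shift fromBottom toBottom tdinv-peel pdinv-peel (P.maxdinv≡total ∙ total-peel ∙ cong (λ T → fromBottom + T + toBottom) (sym P'.maxdinv≡total))

    area-peel : area m n C.x ≡ area m n' C'.x
    area-peel = area-columns {n} {C.x} P.<height⇒ P.height-> ∙ (Σ-upTo-cong m λ {c} c<m → column c c<m) ∙ sym (area-columns {n'} {C'.x} P'.<height⇒ P'.height->)
      where
      area-columns : ∀ {n x} → (∀ {y c} → y < n → y < Σ< n (λ i → ι (at x i ≤ᵇ c)) → at x y ≤ c) → (∀ {y c} → y < n → at x y ≤ c → y < Σ< n (λ i → ι (at x i ≤ᵇ c))) →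
        area m n x ≡ Σ< m (λ c → Σ< n (λ y → ι ((y <ᵇ Σ< n (λ i → ι (at x i ≤ᵇ c))) ∧ (n * suc c ≤ᵇ m * y))))
      area-columns {n} {x} h1 h2 = area≡ m n x ∙ Σ-swap _ (upTo n) (upTo m) ∙ (Σ-cong (upTo m) λ c → Σ-upTo-cong n λ {y} y<n →
        cong (λ b → ι (b ∧ (n * suc c ≤ᵇ m * y))) (bool-ext (λ t → <⇒<ᵇ≡ (h2 y<n (≤ᵇ≡⇒≤ {at x y} t))) (λ t → ≤⇒≤ᵇ≡ (h1 y<n (<ᵇ≡⇒< {y} t)))))
      column : ∀ c → c < m → Σ< n (λ y → ι ((y <ᵇ P.height c) ∧ (n * suc c ≤ᵇ m * y))) ≡ Σ< n' (λ y → ι ((y <ᵇ P'.height c) ∧ (n' * suc c ≤ᵇ m * y)))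
      column c c<m = cong (λ k → Σ< k F) (cong (_+ n') (sym (m+[n∸m]≡n c<m)) ∙ arith (suc c) (m ∸ suc c) n')
        ∙ Σ-upTo-+ (suc c) (n' + (m ∸ suc c)) F
        ∙ cong₂ _+_ (Σ-upTo-vanish (suc c) λ {y} y< → ι-∧ (y <ᵇ P.height c) _ ∙ cong (λ b → ι (y <ᵇ P.height c) * ι b) (≰⇒≤ᵇ≡ (<-≤-trans (*-monoʳ-< m {{>-nonZero m>0}} y<) (*-monoˡ-≤ (suc c) (m≤m+n m n')))) ∙ *-zeroʳ (ι (y <ᵇ P.height c))) (Σ-cong (upTo (n' + (m ∸ suc c))) shifted)
        ∙ Σ-upTo-+ n' (m ∸ suc c) G
        ∙ cong (Σ< n' G +_) (Σ-upTo-vanish (m ∸ suc c) λ {y} _ → cong (λ b → ι (b ∧ (n' * suc c ≤ᵇ m * (n' + y)))) (≮⇒<ᵇ≡ (P'.height≤n c ≤∙ m≤m+n n' y)))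
        ∙ +-identityʳ _
        where
        F G : ℕ → ℕ
        F y = ι ((y <ᵇ P.height c) ∧ (n * suc c ≤ᵇ m * y))
        G y = ι ((y <ᵇ P'.height c) ∧ (n' * suc c ≤ᵇ m * y))
        arith : ∀ a b c → a + b + c ≡ a + (c + b)
        arith = solve-∀
        shifted : ∀ y → F (suc c + y) ≡ G y
        shifted y = cong ι (cong₂ _∧_
          (cong₂ _<ᵇ_ (+-comm (suc c) y) (height≡ c<m ∙ +-comm (suc c) _) ∙ <ᵇ-+ʳ (suc c) y (P'.height c))
          (cong₂ _≤ᵇ_ (*-distribʳ-+ (suc c) m n') (*-distribˡ-+ m (suc c) y) ∙ ≤ᵇ-+ˡ (m * suc c) (n' * suc c) (m * y)))

    ret-peel : ret m n C.x ≡ ret m n' C'.x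
    ret-peel = Diagonal.ret-touch m n m>0 n>0 D ∙ cong (λ d → first (λ i → touch m n C.x (suc i * divℕ m d) (suc i * divℕ n d)) d (upTo d)) (gcd-peel m n') ∙
      (first-cong d (upTo d) λ {i} i∈ → same i (∈-upTo⁻ i∈)) ∙ sym (ret-touch D')
      where
      open Diagonal m n' m>0 n'>0 hiding (ret-touch; touch-height)
      open Diagonal m n' m>0 n'>0 using (ret-touch)
      n0≡ : divℕ n d ≡ m0 + n0
      n0≡ = divℕ-+ m n' d P'.d>0 (gcd[m,n]∣n m n')
      same : ∀ i → i < d → touch m n C.x (suc i * m0) (suc i * divℕ n d) ≡ touch m n' C'.x (suc i * m0) (suc i * n0)
      same i i<d with suc i * m0 in eX
      ... | zero = contradiction (sym eX) (<⇒≢ (X>0 i))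
      ... | suc X = Diagonal.touch-height m n m>0 n>0 D X (suc i * divℕ n d) Yn ∙ cong₂ _≤ᵇ_ (height≡ X<m) Y≡ ∙ ≤ᵇ-+ˡ (suc X) _ _ ∙
          sym (Diagonal.touch-height m n' m>0 n'>0 D' X (suc i * n0) (Y≤n i<d))
        where
        Y≡ : suc i * divℕ n d ≡ suc X + suc i * n0
        Y≡ = cong (suc i *_) n0≡ ∙ *-distribˡ-+ (suc i) m0 n0 ∙ cong (_+ suc i * n0) eX
        X≤m : suc X ≤ m
        X≤m = ≤-reflexive (sym eX) ≤∙ *-monoˡ-≤ m0 i<d ≤∙ ≤-reflexive (*-comm d m0 ∙ m0-eq)
        X<m = X≤m
        Yn : suc i * divℕ n d ≤ n
        Yn = ≤-reflexive Y≡ ≤∙ +-mono-≤ X≤m (Y≤n i<d)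

applyUpTo-++ : ∀ (b : ℕ → A) j k → applyUpTo b (j + k) ≡ applyUpTo b j ++ applyUpTo (λ i → b (j + i)) k
applyUpTo-++ b zero k = refl
applyUpTo-++ b (suc j) k = cong (b 0 ∷_) (applyUpTo-++ (b ∘ suc) j k)

applyUpTo-false : ∀ (b : ℕ → Bool) j → (∀ {i} → i < j → b i ≡ false) → applyUpTo b j ≡ replicate j false
applyUpTo-false b zero h = refl
applyUpTo-false b (suc j) h = cong₂ _∷_ (h (s≤s z≤n)) (applyUpTo-false (b ∘ suc) j (h ∘ s≤s))

prefix-false : ∀ (b : ℕ → Bool) N j {bs} → applyUpTo b N ≡ replicate j false ++ bs → j ≤ N × (∀ {i} → i < j → b i ≡ false) × bs ≡ applyUpTo (λ i → b (j + i)) (N ∸ j)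
prefix-false b N zero e = z≤n , (λ ()) , sym e
prefix-false b (suc N) (suc j) e with prefix-false (b ∘ suc) N j (∷-tail-injective e)
... | l , h , r = s≤s l , (λ { {zero} _ → ∷-head-injective e ; {suc i} (s≤s lt) → h lt }) , r

compFrom-prefix : ∀ k bs {p α} → compFrom k bs ≡ p ∷ α → ∃ λ j → ∃ λ rest → p ≡ k + j × bs ≡ replicate j false ++ rest
compFrom-prefix k [] refl = 0 , [] , sym (+-identityʳ k) , refl
compFrom-prefix k (true ∷ bs) refl = 0 , true ∷ bs , sym (+-identityʳ k) , refl
compFrom-prefix k (false ∷ bs) e with compFrom-prefix (suc k) bs e
... | j , rest , refl , refl = suc j , rest , sym (+-suc k j) , refl

module _ (m n : ℕ) (x σ : List ℕ) where
  rising : ℕ → Bool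
  rising i = carRank m n x σ i <ᵇ carRank m n x σ (suc i)

  pides≡ : pides m n x σ ≡ compFrom 1 (applyUpTo rising (n ∸ 1))
  pides≡ = cong compOf (List.map-applyUpTo id rising (n ∸ 1)) ∙ compOf≡compFrom (applyUpTo rising (n ∸ 1))

chain-> : ∀ (R : ℕ → ℕ) k → (∀ {i} → i < k → R (suc i) < R i) → ∀ {i j} → i < j → j ≤ k → R j < R i
chain-> R k h {i} i<j j≤k with m≤n⇒∃[o]m+o≡n i<j
... | o , refl = go o j≤k
  where
  go : ∀ o → suc i + o ≤ k → R (suc i + o) < R i
  go zero le rewrite +-identityʳ i = h le
  go (suc o) le rewrite +-suc i o = <-trans (h le) (go o (n≤1+n _ ≤∙ le))

dinvOf : ℕ → ℕ → List ℕ → List ℕ → ℤ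
dinvOf m n x σ = (pos (tdinv m n x σ) Int.+ pos (pdinv m n x)) Int.- pos (maxdinv m n x)

term : ℕ → ℕ → List ℕ → ℤ → ℤ → List ℕ → List ℕ → ℕ
term m n α a b x σ = ι (eqList (pides m n x σ) α) * weight m n x (dinvOf m n x σ) a b

hikita≡term : ∀ m n α a b → hikitaCoeff m n α a b ≡ Σ (dyckPaths m n) (λ x → Σ (labelings n x) (term m n α a b x))
hikita≡term m n α a b = Σ-cong (dyckPaths m n) λ x → Σ-cong (labelings n x) λ σ → count≡Σ _ (upTo (ret m n x)) ∙ trans
  (Σ-cong (upTo (ret m n x)) λ j → ι-∧ (eqList (pides m n x σ) α) _) (Σ-*ˡ (ι (eqList (pides m n x σ) α)) _ (upTo (ret m n x)))

isDyck⁺ : ∀ {m n x} → Dyck m n x → isDyck m n x ≡ true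
isDyck⁺ {m} {n} D = proj₂ (filterᵇ-∈⁻ (isDyck m n) (words n m) (dyckPaths-complete m n D))

isDyck⁻ : ∀ {m n x} → x ∈ words n m → isDyck m n x ≡ true → Dyck m n x
isDyck⁻ {m} {n} x∈ t = dyckPaths-sound m n (filterᵇ-∈⁺ (isDyck m n) (words n m) x∈ t)

Cars-x-∈ : ∀ m n f → (∀ {i} → i < n → at f i < m) → Cars.x m n f ∈ words n m
Cars-x-∈ m n f b = words-complete n m (Cars.x m n f) (List.length-applyUpTo (λ j → at f (at (Cars.σ m n f) j)) n)
  λ j<n → subst (_< m) (sym (Cars.at-x m n f j<n)) (b (Perm.bound (Cars.σ-perm m n f) j<n))

same-column : ∀ m n f {i k} → i < n → at f i ≡ at f k → i < k → Cars.row m n f i < Cars.row m n f k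
same-column m n f {i} {k} i<n e i<k = Standardize.rank-mono n (carKey n f) (carKey-injective n f) i<n
  (subst (λ c → at f i * n + i < c * n + k) e (+-monoʳ-< (at f i * n) i<k))

-- No row of decreasing cars is longer than the number of columns.
hikita-wide : ∀ m n p α a b → 0 < m → 0 < n → m < p → hikitaCoeff m n (p ∷ α) a b ≡ 0
hikita-wide m n p α a b m>0 n>0 m<p = hikita≡term m n (p ∷ α) a b ∙ (Σ-vanish (dyckPaths m n) λ {x} x∈ → Σ-vanish (labelings n x) λ {σ} σ∈ →
  cong (λ z → ι z * weight m n x (dinvOf m n x σ) a b) (≢true⇒false λ t → impossible x σ (dyckPaths-sound m n x∈) (labelings-sound n x σ∈) (eqList⇒≡ t)))
  where
  impossible : ∀ x σ → Dyck m n x → Labeling n x σ → pides m n x σ ≢ p ∷ α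
  impossible x σ D L e with compFrom-prefix 1 (applyUpTo (rising m n x σ) (n ∸ 1)) (sym (pides≡ m n x σ) ∙ e)
  ... | j , rest , refl , e' with prefix-false (rising m n x σ) (n ∸ 1) j e'
  ... | j≤ , low , _ = <-irrefl refl (begin-strict
    m <⟨ n<1+n m ⟩
    suc m ≡⟨ sym (Σ-upTo-1 (suc m)) ⟩
    Σ< (suc m) (λ _ → 1) ≤⟨ Σ-inj-≤ (λ _ → 1) (λ _ → 1) (λ i → at x (index i)) (upTo (suc m)) (upTo m) (Uniqueₚ.upTo⁺ (suc m))
                                        (λ i∈ _ → ∈-upTo⁺ (P.col (index-bound (small (∈-upTo⁻ i∈)))) , ≤-refl) (λ i∈ k∈ _ _ → distinct-columns (∈-upTo⁻ i∈) (∈-upTo⁻ k∈)) ⟩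
    Σ< m (λ _ → 1) ≡⟨ Σ-upTo-1 m ⟩
    m ∎)
    where
    open ≤-Reasoning
    module P = Path m n x m>0 n>0 D
    open Permutation (Labeling.perm L)
    small : ∀ {i} → i < suc m → i < n
    small i≤m = ≤-<-trans (≤-pred i≤m ≤∙ ≤-pred m<p) (≤-<-trans j≤ (≤-reflexive (m∸1+1 n n>0)))
      where
      m∸1+1 : ∀ n → 0 < n → suc (n ∸ 1) ≡ n
      m∸1+1 (suc n) _ = refl
    R : ℕ → ℕ
    R i = P.rank (index i)
    down : ∀ {i} → i < m → R (suc i) < R i
    down {i} i<m = ≤∧≢⇒< (<ᵇ≡false⇒≥ {R i} {R (suc i)} (low (<-≤-trans i<m (≤-pred m<p)))) λ e → <⇒≢ (n<1+n i)
      (sym (at-index i<n) ∙ cong (at σ) (P.rank-injective {index i} {index (suc i)} (index-bound i<n) (index-bound si<n) (sym e)) ∙ at-index si<n)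
      where
      i<n = small (<-trans i<m (n<1+n m))
      si<n = small (s≤s i<m)
    apart : ∀ {i k} → i < k → k < suc m → at x (index i) ≢ at x (index k)
    apart {i} {k} i<k k≤m e with <-cmp (index i) (index k)
    ... | tri< lt _ _ = <-asym (chain-> R m down i<k (≤-pred k≤m)) (P.rank-up lt (index-bound (small k≤m)) (subst (λ c → m * index i ∸ n * at x (index i) ≤ m * index k ∸ n * c) e (∸-monoˡ-≤ (n * at x (index i)) (*-monoʳ-≤ m (<⇒≤ lt)))))
    ... | tri≈ _ eq _ = <-irrefl (cong P.rank (sym eq)) (chain-> R m down i<k (≤-pred k≤m))
    ... | tri> _ _ gt = <-asym i<k (subst₂ _<_ (at-index (small k≤m)) (at-index (small (<-trans i<k k≤m))) (FromLabeling.column-order m n x σ m>0 n>0 D L gt (index-bound (small (<-trans i<k k≤m))) (sym e)))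
    distinct-columns : ∀ {i k} → i < suc m → k < suc m → at x (index i) ≡ at x (index k) → i ≡ k
    distinct-columns {i} {k} i≤ k≤ e with <-cmp i k
    ... | tri< lt _ _ = contradiction e (apart lt k≤)
    ... | tri≈ _ eq _ = eq
    ... | tri> _ _ gt = contradiction (sym e) (apart gt i≤)

-- The bottom cars are labeled by decreasing rank, which determines them.
bottomRank : ℕ → ℕ → List ℕ → ℕ → ℕ
bottomRank m n' f' c = cellRank m (m + n') c (c + Cars.smaller m n' f' c)

bottomKey : ℕ → ℕ → List ℕ → ℕ → ℕ
bottomKey m n' f' c = Σ< m (bottomRank m n' f') ∸ bottomRank m n' f' c

bottomCars : ℕ → ℕ → List ℕ → List ℕ
bottomCars m n' f' = inverse m (std m (bottomKey m n' f'))

module HikitaPeel (m1 n1 : ℕ) (α : List ℕ) (α≢ : α ≢ []) (a b : ℤ) where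
  m = suc m1
  n' = suc n1
  n = m + n'
  m>0 : 0 < m
  m>0 = s≤s z≤n
  n'>0 : 0 < n'
  n'>0 = s≤s z≤n

  F G : List ℕ → ℕ
  F f = ι (isDyck m n (Cars.x m n f)) * term m n (m ∷ α) a b (Cars.x m n f) (Cars.σ m n f)
  G f = ι (isDyck m n' (Cars.x m n' f)) * term m n' α a b (Cars.x m n' f) (Cars.σ m n' f)

  module Agree (p f' : List ℕ) (Pp : Perm m p) (len' : length f' ≡ n') (bound' : ∀ {i} → i < n' → at f' i < m) (pk' : Cars.Parking m n' f') where
    open Peel m n' m>0 n'>0 p f' Pp len' bound' hiding (n)
    open Peeled pk'

    R-bottom : ∀ {i} → i < m → R i ≡ bottomRank m n' f' (at p i)
    R-bottom {i} i<m = cong (λ c → cellRank m n c (C.row i)) (C.at-x-row (head<n i<m) ∙ at-head i<m) ∙ cong (cellRank m n (at p i)) (row-head i<m)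

    carRank≡ : ∀ {i} → i < n → carRank m n C.x C.σ i ≡ R i
    carRank≡ i<n = cong P.rank (C.indexOf-σ i<n)

    R-injective : ∀ {i k} → i < n → k < n → R i ≡ R k → i ≡ k
    R-injective {i} {k} i<n k<n e = sym (C.at-σ-row i<n) ∙ cong (at C.σ) (P.rank-injective {C.row i} {C.row k} (C.row-bound i<n) (C.row-bound k<n) e) ∙ C.at-σ-row k<n

    module _ (fall : ∀ {i k} → i < k → k < m → R k < R i) where
      last-rises : R m1 < R m
      last-rises = subst (λ j → P.rank j < R m) (sym row0) (P.rank-0-min m-row (C.row-bound (m<m+n m n'>0)))
        where
        open Permutation Pp
        b0 = index 0
        b0<m = index-bound m>0
        row-b0 : C.row b0 ≡ 0
        row-b0 = row-head b0<m ∙ cong bottom (at-index m>0) ∙ bottom-0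
        b0≡ : b0 ≡ m1
        b0≡ = ≤-antisym (≤-pred b0<m) (≮⇒≥ λ lt → case C.row m1 ≟ 0 of λ where
          (yes e) → <-irrefl (cong P.rank (e ∙ sym row-b0)) (fall lt ≤-refl)
          (no ne) → <-asym (fall lt ≤-refl) (subst (λ j → P.rank j < R m1) (sym row-b0) (P.rank-0-min (n≢0⇒n>0 ne) (C.row-bound (head<n ≤-refl)))))
        row0 : C.row m1 ≡ 0
        row0 = cong C.row (sym b0≡) ∙ row-b0
        m-row : 0 < C.row m
        m-row = subst (λ k → 0 < C.row k) (+-identityʳ m) (subst (0 <_) (sym (row-rest n'>0)) (s≤s z≤n))

      pides-peel : pides m n C.x C.σ ≡ m ∷ pides m n' C'.x C'.σ
      pides-peel = pides≡ m n C.x C.σ ∙ cong (compFrom 1) list≡ ∙ compFrom-join 1 m1 _ ∙ cong (m ∷_) (sym (pides≡ m n' C'.x C'.σ))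
        where
        rs = rising m n C.x C.σ
        rs≡ : ∀ {i} → suc i < n → rs i ≡ (R i <ᵇ R (suc i))
        rs≡ h = cong₂ _<ᵇ_ (carRank≡ (<-trans (n<1+n _) h)) (carRank≡ h)
        list≡ = applyUpTo-++ rs m1 n' ∙ cong₂ _++_
          (applyUpTo-false rs m1 λ {i} i< → rs≡ (s≤s i< ≤∙ m≤m+n m n') ∙ ≮⇒<ᵇ≡ (<⇒≤ (fall (n<1+n i) (s≤s i<))))
          (cong₂ _∷_ (cong rs (+-identityʳ m1) ∙ rs≡ (m<m+n m n'>0) ∙ <⇒<ᵇ≡ last-rises)
            (at-extᵇ n1 λ {i} i< → cong rs (+-suc m1 i) ∙ rs≡ (subst (_< n) (+-suc m i) (+-monoʳ-< m (s≤s i<))) ∙ pt i (s≤s i<)))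
          where
          at-extᵇ : ∀ k {b b' : ℕ → Bool} → (∀ {i} → i < k → b i ≡ b' i) → applyUpTo b k ≡ applyUpTo b' k
          at-extᵇ zero h = refl
          at-extᵇ (suc k) h = cong₂ _∷_ (h (s≤s z≤n)) (at-extᵇ k (h ∘ s≤s))
          pt : ∀ i → suc i < n' → (R (suc (m1 + i)) <ᵇ R (suc (suc (m1 + i)))) ≡ rising m n' C'.x C'.σ i
          pt i h = cong₂ _<ᵇ_ (rank-rest (<-trans (n<1+n i) h)) (cong R (sym (+-suc m i)) ∙ rank-rest h) ∙
            <ᵇ-+ʳ m (P'.rank (C'.row i)) (P'.rank (C'.row (suc i))) ∙ sym (cong₂ (λ u v → P'.rank u <ᵇ P'.rank v) (C'.indexOf-σ (<-trans (n<1+n i) h)) (C'.indexOf-σ h))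

      F≡G : F (p ++ f') ≡ G f'
      F≡G = cong (λ t → ι t * term m n (m ∷ α) a b C.x C.σ) (isDyck⁺ D) ∙ cong (1 *_) (cong₂ _*_
          (cong ι (cong (λ l → eqList l (m ∷ α)) pides-peel ∙ cong (_∧ eqList (pides m n' C'.x C'.σ) α) (≡⇒≡ᵇ≡ {m} refl)))
          (cong (λ δ → weight m n C.x δ a b) (Falling.δ-peel fall) ∙ weight-cong {m} {n} {m} {n'} {C.x} {C'.x} (dinvOf m n' C'.x C'.σ) a b ret-peel area-peel)) ∙
        sym (cong (λ t → ι t * term m n' α a b C'.x C'.σ) (isDyck⁺ D'))

  module Bottom (f' : List ℕ) (len' : length f' ≡ n') (bound' : ∀ {i} → i < n' → at f' i < m) (pk' : Cars.Parking m n' f') where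
    identity : List ℕ
    identity = applyUpTo id m

    identity-perm : Perm m identity
    identity-perm = record
      { size = List.length-applyUpTo id m
      ; bound = λ i<m → subst (_< m) (sym (at-applyUpTo id m i<m)) i<m
      ; injective = λ i<m k<m e → sym (at-applyUpTo id m i<m) ∙ e ∙ at-applyUpTo id m k<m
      }

    bottomRank-injective : ∀ {c c'} → c < m → c' < m → bottomRank m n' f' c ≡ bottomRank m n' f' c' → c ≡ c'
    bottomRank-injective {c} {c'} h h' e = A.R-injective (h ≤∙ m≤m+n m n') (h' ≤∙ m≤m+n m n') (at-R h ∙ e ∙ sym (at-R h'))
      where
      module A = Agree identity f' identity-perm len' bound' pk'
      module Q = Peel.Peeled m n' m>0 n'>0 identity f' identity-perm len' bound' pk'
      at-R : ∀ {c} → c < m → Q.R c ≡ bottomRank m n' f' c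
      at-R h = A.R-bottom h ∙ cong (bottomRank m n' f') (at-applyUpTo id m h)

    key = bottomKey m n' f'
    big = Σ< m (bottomRank m n' f')

    below-big : ∀ {c} → c < m → bottomRank m n' f' c ≤ big
    below-big h = term≤Σ (bottomRank m n' f') (upTo m) (∈-upTo⁺ h)

    key-injective : ∀ {c c'} → c < m → c' < m → key c ≡ key c' → c ≡ c'
    key-injective {c} {c'} h h' e = bottomRank-injective h h' (flagged-≡ big (bottomRank m n' f' c) (bottomRank m n' f' c') (below-big h) (below-big h') e)

    module K = Standardize m key key-injective
    module I = Inverse K.std-perm

    p = bottomCars m n' f'

    p-perm : Perm m p
    p-perm = I.inverse-perm

    module A = Agree p f' p-perm len' bound' pk'
    open Peel.Peeled m n' m>0 n'>0 p f' p-perm len' bound' pk' using (R)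

    fall : ∀ {i k} → i < k → k < m → R k < R i
    fall {i} {k} i<k k<m = subst₂ _<_ (sym (A.R-bottom k<m)) (sym (A.R-bottom i<m)) (flagged-reflects big (bottomRank m n' f' (at p i)) (bottomRank m n' f' (at p k))
      (K.rank-reflects {at p i} {at p k} (Perm.bound p-perm k<m) (subst₂ _<_ (sym (rank-p i<m)) (sym (rank-p k<m)) i<k)))
      where
      i<m = <-trans i<k k<m
      rank-p : ∀ {i} → i < m → K.rank (at p i) ≡ i
      rank-p i<m = sym (at-std m key (Perm.bound p-perm i<m)) ∙ cong (at (std m key)) (I.at-inverse i<m) ∙ Permutation.at-index K.std-perm i<m

  module Split (p f' : List ℕ) (lenp : length p ≡ m) (len' : length f' ≡ n') (bound : ∀ {i} → i < n → at (p ++ f') i < m)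
    (D : Dyck m n (Cars.x m n (p ++ f'))) (e : pides m n (Cars.x m n (p ++ f')) (Cars.σ m n (p ++ f')) ≡ m ∷ α) where
    f = p ++ f'
    module C = Cars m n f
    module P = Path m n C.x m>0 (s≤s z≤n) D

    R : ℕ → ℕ
    R i = P.rank (C.row i)

    carRank≡ : ∀ {i} → i < n → carRank m n C.x C.σ i ≡ R i
    carRank≡ i<n = cong P.rank (C.indexOf-σ i<n)

    small : ∀ {i} → i < m → i < n
    small h = <-≤-trans h (m≤m+n m n')

    at-f : ∀ {i} → i < m → at f i ≡ at p i
    at-f h = at-++ˡ p f' (subst (_ <_) (sym lenp) h)

    at-rest : ∀ i → at f (m + i) ≡ at f' i
    at-rest i = cong (λ k → at f (k + i)) (sym lenp) ∙ at-++ʳ p f' i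

    bound' : ∀ {i} → i < n' → at f' i < m
    bound' {i} h = subst (_< m) (at-rest i) (bound (+-monoʳ-< m h))

    down : ∀ {i} → i < m1 → R (suc i) < R i
    down {i} h with compFrom-split 1 _ (sym (pides≡ m n C.x C.σ) ∙ e) α≢
    ... | j , bs , refl , e' , _ with prefix-false (rising m n C.x C.σ) (n ∸ 1) j e'
    ... | _ , low , _ = ≤∧≢⇒< (<ᵇ≡false⇒≥ {R i} {R (suc i)} (sym (cong₂ _<ᵇ_ (carRank≡ i<n) (carRank≡ si<n)) ∙ low h))
      λ e → <⇒≢ (n<1+n i) (sym (C.at-σ-row i<n) ∙ cong (at C.σ) (P.rank-injective {C.row i} {C.row (suc i)} (C.row-bound i<n) (C.row-bound si<n) (sym e)) ∙ C.at-σ-row si<n)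
      where
      i<n = small (<-trans h (n<1+n m1))
      si<n = small (s≤s h)

    fall : ∀ {i k} → i < k → k < m → R k < R i
    fall i<k k<m = chain-> R m1 down i<k (≤-pred k<m)

    apart : ∀ {i k} → i < k → k < m → at p i ≢ at p k
    apart {i} {k} i<k k<m e = <-asym (fall i<k k<m) (P.rank-up r< (C.row-bound (small k<m))
      (subst (λ c → m * C.row i ∸ n * at C.x (C.row i) ≤ m * C.row k ∸ n * c) x≡ (∸-monoˡ-≤ (n * at C.x (C.row i)) (*-monoʳ-≤ m (<⇒≤ r<)))))
      where
      i<m = <-trans i<k k<m
      f≡ : at f i ≡ at f k
      f≡ = at-f i<m ∙ e ∙ sym (at-f k<m)
      x≡ : at C.x (C.row i) ≡ at C.x (C.row k)
      x≡ = C.at-x-row (small i<m) ∙ f≡ ∙ sym (C.at-x-row (small k<m))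
      r< : C.row i < C.row k
      r< = same-column m n f (small i<m) f≡ i<k

    p-perm : Perm m p
    p-perm = record { size = lenp ; bound = λ h → subst (_< m) (at-f h) (bound (small h)) ; injective = inj }
      where
      inj : ∀ {i k} → i < m → k < m → at p i ≡ at p k → i ≡ k
      inj {i} {k} i<m k<m e with <-cmp i k
      ... | tri< lt _ _ = contradiction e (apart lt k<m)
      ... | tri≈ _ eq _ = eq
      ... | tri> _ _ gt = contradiction (sym e) (apart gt i<m)

    pk' : Cars.Parking m n' f'
    pk' = Peel.parking⇒ m n' m>0 n'>0 p f' p-perm len' bound' (C.Dyck⇒parking D)

    module Bt = Bottom f' len' bound' pk'
    module A = Agree p f' p-perm len' bound' pk'

    p≡ : p ≡ bottomCars m n' f'
    p≡ = sym I.inverse-inverse ∙ cong (inverse m) (Bt.K.std-unique I.inverse-perm λ {c} {c'} h h' lt →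
      subst₂ _<_ (sym (I.at-inverse h)) (sym (I.at-inverse h')) (order h h' (flagged-reflects Bt.big (bottomRank m n' f' c) (bottomRank m n' f' c') lt)))
      where
      module I = Inverse p-perm
      open Permutation p-perm
      R≡ : ∀ {c} → c < m → R (index c) ≡ bottomRank m n' f' c
      R≡ h = A.R-bottom (index-bound h) ∙ cong (bottomRank m n' f') (at-index h)
      order : ∀ {c c'} → c < m → c' < m → bottomRank m n' f' c' < bottomRank m n' f' c → index c < index c'
      order {c} {c'} h h' lt = ≰⇒> λ le → case m≤n⇒m<n∨m≡n le of λ where
        (inj₁ gt) → <-asym lt (subst₂ _<_ (R≡ h) (R≡ h') (fall gt (index-bound h)))
        (inj₂ eq) → <-irrefl (sym (R≡ h') ∙ cong R eq ∙ R≡ h) lt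

  hikita-peel : hikitaCoeff m n (m ∷ α) a b ≡ hikitaCoeff m n' α a b
  hikita-peel = hikita≡term m n (m ∷ α) a b ∙ Σ-parking m n m>0 (s≤s z≤n) (term m n (m ∷ α) a b) ∙ trans
    (Σ-bij F G (drop m) (λ f' → bottomCars m n' f' ++ f') (words n m) (words n' m) (words-unique n m) (words-unique n' m) to from)
    (sym (hikita≡term m n' α a b ∙ Σ-parking m n' m>0 n'>0 (term m n' α a b)))
    where
    parts : ∀ p f' → length p ≡ m → length f' ≡ n' → (p ++ f') ∈ words n m → F (p ++ f') ≢ 0 →
      f' ∈ words n' m × G f' ≡ F (p ++ f') × bottomCars m n' f' ++ f' ≡ p ++ f'
    parts p f' lenp len' f∈ ne = words-complete n' m f' len' S.bound' , sym (S.A.F≡G S.fall) , cong (_++ f') (sym S.p≡)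
      where
      bound = proj₂ (words-sound n m f∈)
      ne1 = *-≢0 {ι (isDyck m n (Cars.x m n (p ++ f')))} ne
      D = isDyck⁻ (Cars-x-∈ m n (p ++ f') bound) (ι≢0 (proj₁ ne1))
      module S = Split p f' lenp len' bound D (eqList⇒≡ (ι≢0 (proj₁ (*-≢0 {ι (eqList (pides m n (Cars.x m n (p ++ f')) (Cars.σ m n (p ++ f'))) (m ∷ α))} (proj₂ ne1)))))
    to : ∀ {f} → f ∈ words n m → F f ≢ 0 → drop m f ∈ words n' m × G (drop m f) ≡ F f × bottomCars m n' (drop m f) ++ drop m f ≡ f
    to {f} f∈ ne = subst (λ g → drop m f ∈ words n' m × G (drop m f) ≡ F g × bottomCars m n' (drop m f) ++ drop m f ≡ g) split
      (parts (take m f) (drop m f) lt ld (subst (_∈ words n m) (sym split) f∈) (subst (λ g → F g ≢ 0) (sym split) ne))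
      where
      split = List.take++drop≡id m f
      len = proj₁ (words-sound n m f∈)
      lt : length (take m f) ≡ m
      lt = List.length-take m f ∙ m≤n⇒m⊓n≡m (m≤m+n m n' ≤∙ ≤-reflexive (sym len))
      ld : length (drop m f) ≡ n'
      ld = List.length-drop m f ∙ cong (_∸ m) len ∙ m+n∸m≡n m n'
    from : ∀ {f'} → f' ∈ words n' m → G f' ≢ 0 → (bottomCars m n' f' ++ f') ∈ words n m × F (bottomCars m n' f' ++ f') ≡ G f' × drop m (bottomCars m n' f' ++ f') ≡ f'
    from {f'} f'∈ ne = words-complete n m _ (List.length-++ Bt.p ∙ cong₂ _+_ (Perm.size Bt.p-perm) len') Q.bound , Bt.A.F≡G Bt.fall , dropped Bt.p (Perm.size Bt.p-perm)
      where
      len' = proj₁ (words-sound n' m f'∈)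
      bound' = proj₂ (words-sound n' m f'∈)
      D' = isDyck⁻ (Cars-x-∈ m n' f' bound') (ι≢0 (proj₁ (*-≢0 {ι (isDyck m n' (Cars.x m n' f'))} ne)))
      pk' : Cars.Parking m n' f'
      pk' = Cars.Dyck⇒parking m n' f' D'
      module Bt = Bottom f' len' bound' pk'
      module Q = Peel.Peeled m n' m>0 n'>0 Bt.p f' Bt.p-perm len' bound' pk'
      dropped : ∀ {k} p → length p ≡ k → drop k (p ++ f') ≡ f'
      dropped [] refl = refl
      dropped (y ∷ p) refl = dropped p refl

Expands : ℕ → ℕ → (List ℕ → ℤ → ℤ → ℤ) → Set
Expands m n d = ∀ p α a b → pos (hikitaCoeff m n (p ∷ α) a b) ≡ expansion n (λ lam → d lam a b) (p ∷ α)

tail-expands : ∀ m1 n1 d → Expands (suc m1) (suc m1 + suc n1) d → Expands (suc m1) (suc n1) (λ μ a b → tail (suc m1) (λ lam → d lam a b) μ)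
tail-expands m1 n1 d e p α a b = cong pos (sym (HikitaPeel.hikita-peel m1 n1 (p ∷ α) (λ ()) a b))
  ∙ e m (p ∷ α) a b
  ∙ expansion-peel m1 n' (λ lam → d lam a b) (s≤s z≤n) (λ ()) large
  where
  m = suc m1
  n' = suc n1
  large : ∀ lam → IsPartition lam → sum lam ≡ m + n' → m < at lam 0 → d lam a b ≡ Int.0ℤ
  large = expansion-injective (m + n') m (λ lam → d lam a b) λ q β m<q →
    trans (sym (e q β a b)) (cong pos (hikita-wide m (m + n') q β a b (s≤s z≤n) (s≤s z≤n) m<q))

partB' : ∀ m1 A n → A * suc m1 < n → ∀ lam → IsPartition lam → sum lam ≡ n ∸ A * suc m1 → All (_≤ suc m1) lam →
  ∀ d d' → Expands (suc m1) n d → Expands (suc m1) (n ∸ A * suc m1) d' → ∀ a b → d (replicate A (suc m1) ++ lam) a b ≡ d' lam a b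
partB' m1 zero n h lam P S B d d' e e' a b = expansion-unique n (λ lam → d lam a b) (λ lam → d' lam a b) h (λ p α → sym (e p α a b) ∙ e' p α a b) lam P S
partB' m1 (suc A) n h lam P S B d d' e e' a b = sym (bounded-≤ (λ μ → d (m ∷ μ) a b) (replicate A m ++ lam) (head≤ A)) ∙
  subst Goal (sym n≡) step e e' S h
  where
  m = suc m1
  n1 = n ∸ suc m
  big : suc m ≤ n
  big = s≤s (m≤m+n m (A * m)) ≤∙ h
  n≡ : n ≡ m + suc n1
  n≡ = sym (m+[n∸m]≡n big) ∙ sym (+-suc m n1)
  head≤ : ∀ A → at (replicate A m ++ lam) 0 ≤ m
  head≤ zero = partition-at-head lam B
  head≤ (suc A) = ≤-refl
  Goal : ℕ → Set
  Goal n = Expands m n d → Expands m (n ∸ (m + A * m)) d' → sum lam ≡ n ∸ (m + A * m) → m + A * m < n → tail m (λ lam → d lam a b) (replicate A m ++ lam) ≡ d' lam a b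
  step : Goal (m + suc n1)
  step e e' S h = partB' m1 A (suc n1) (+-cancelˡ-< m (A * m) (suc n1) h) lam P (S ∙ [m+n]∸[m+o]≡n∸o m (suc n1) (A * m)) B
    (λ μ a b → tail m (λ lam → d lam a b) μ) d' (tail-expands m1 n1 d e) (subst (λ k → Expands m k d') ([m+n]∸[m+o]≡n∸o m (suc n1) (A * m)) e') a b

partB : ∀ m n → 1 ≤ m → ∀ A → A * m < n → ∀ lam → IsPartition lam → sum lam ≡ n ∸ A * m → All (_≤ m) lam →
  ∀ (d d' : List ℕ → ℤ → ℤ → ℤ) → IsSchurExpansion m n d → IsSchurExpansion m (n ∸ A * m) d' → ∀ a b → d (replicate A m ++ lam) a b ≡ d' lam a b
partB (suc m1) n _ A h lam P S B d d' e e' = partB' m1 A n h lam P S B d d' (λ p α → e (p ∷ α)) (λ p α → e' (p ∷ α))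

-- Coefficients and classes of weighted sums

-- A polynomial in q with coefficients in ℕ is determined by its values.
Σ-coefficients : ∀ (xs : List A) (ys : List B) (x : A → ℕ) (y : B → ℕ) (e : A → ℕ) (e' : B → ℕ) →
  (∀ q → 0 < q → Σ xs (λ a → x a * q ^ e a) ≡ Σ ys (λ b → y b * q ^ e' b)) →
  ∀ k → Σ xs (λ a → ι (e a ≡ᵇ k) * x a) ≡ Σ ys (λ b → ι (e' b ≡ᵇ k) * y b)
Σ-coefficients {A} {B} xs ys x y e e' h = go
  where
  const : ∀ {A : Set} → List A → (A → ℕ) → (A → ℕ) → ℕ
  const xs x e = Σ xs (λ a → ι (e a ≡ᵇ 0) * x a)
  rest : ∀ {A : Set} → List A → (A → ℕ) → (A → ℕ) → ℕ → ℕ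
  rest xs x e q = Σ xs (λ a → ι (0 <ᵇ e a) * x a * q ^ pred (e a))
  horner : ∀ {A : Set} (xs : List A) (x e : A → ℕ) q → Σ xs (λ a → x a * q ^ e a) ≡ const xs x e + q * rest xs x e q
  horner xs x e q = Σ-cong xs pt ∙ Σ-+ _ _ xs ∙ cong (const xs x e +_) (Σ-*ˡ q _ xs)
    where
    pt : ∀ a → x a * q ^ e a ≡ ι (e a ≡ᵇ 0) * x a + q * (ι (0 <ᵇ e a) * x a * q ^ pred (e a))
    pt a with e a
    ... | zero = arith (x a) q
      where
      arith : ∀ x q → x * 1 ≡ 1 * x + q * 0
      arith = solve-∀
    ... | suc k = arith (x a) q (q ^ k)
      where
      arith : ∀ x q p → x * (q * p) ≡ 0 + q * (1 * x * p)
      arith = solve-∀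
  digit : ∀ a b q r s → a < q → b < q → a + q * r ≡ b + q * s → a ≡ b
  digit a b q r s a<q b<q eq with <-cmp r s
  ... | tri≈ _ refl _ = +-cancelʳ-≡ (q * r) a b eq
  ... | tri< r<s _ _ = contradiction eq (<⇒≢ (<-≤-trans (+-monoˡ-< (q * r) a<q) (≤-reflexive (sym (*-suc q r)) ≤∙ *-monoʳ-≤ q r<s ≤∙ m≤n+m _ b)))
  ... | tri> _ _ s<r = contradiction (sym eq) (<⇒≢ (<-≤-trans (+-monoˡ-< (q * s) b<q) (≤-reflexive (sym (*-suc q s)) ≤∙ *-monoʳ-≤ q s<r ≤∙ m≤n+m _ a)))
  c0 = const xs x e
  d0 = const ys y e'
  same : ∀ q → 0 < q → c0 + q * rest xs x e q ≡ d0 + q * rest ys y e' q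
  same q q>0 = sym (horner xs x e q) ∙ h q q>0 ∙ horner ys y e' q
  c0≡d0 : c0 ≡ d0
  c0≡d0 = digit c0 d0 (suc (c0 + d0)) (rest xs x e (suc (c0 + d0))) (rest ys y e' (suc (c0 + d0))) (s≤s (m≤m+n c0 d0)) (s≤s (m≤n+m d0 c0)) (same (suc (c0 + d0)) (s≤s z≤n))
  go : ∀ k → Σ xs (λ a → ι (e a ≡ᵇ k) * x a) ≡ Σ ys (λ b → ι (e' b ≡ᵇ k) * y b)
  go zero = c0≡d0
  go (suc k) = shift xs x e ∙ Σ-coefficients xs ys (λ a → ι (0 <ᵇ e a) * x a) (λ b → ι (0 <ᵇ e' b) * y b) (pred ∘ e) (pred ∘ e') (λ q q>0 →
      *-cancelˡ-≡ (rest xs x e q) (rest ys y e' q) q {{>-nonZero q>0}} (+-cancelˡ-≡ c0 (q * rest xs x e q) (q * rest ys y e' q) (same q q>0 ∙ cong (_+ q * rest ys y e' q) (sym c0≡d0)))) k ∙ sym (shift ys y e')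
    where
    shift : ∀ {A : Set} (xs : List A) (x e : A → ℕ) → Σ xs (λ a → ι (e a ≡ᵇ suc k) * x a) ≡ Σ xs (λ a → ι (pred (e a) ≡ᵇ k) * (ι (0 <ᵇ e a) * x a))
    shift xs x e = Σ-cong xs pt
      where
      pt : ∀ a → ι (e a ≡ᵇ suc k) * x a ≡ ι (pred (e a) ≡ᵇ k) * (ι (0 <ᵇ e a) * x a)
      pt a with e a
      ... | zero = sym (*-zeroʳ (ι (0 ≡ᵇ k)))
      ... | suc j = cong (ι (j ≡ᵇ k) *_) (sym (*-identityˡ (x a)))

Σ-classes : ∀ {A B : Set} (xs : List A) (ys : List B) (x : A → ℕ) (y : B → ℕ) (class : A → List ℕ) (class' : B → List ℕ) (φ : A → ℕ) (φ' : B → ℕ) →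
  (∀ c → Σ xs (λ a → ι (eqList (class a) c) * x a) ≡ Σ ys (λ b → ι (eqList (class' b) c) * y b)) →
  (∀ {a b} → a ∈ xs → b ∈ ys → x a ≢ 0 → y b ≢ 0 → class a ≡ class' b → φ a ≡ φ' b) →
  Σ xs (λ a → φ a * x a) ≡ Σ ys (λ b → φ' b * y b)
Σ-classes {A} {B} xs ys x y class class' φ φ' h compatible = spread xs class φ x (λ a∈ → ∈-++⁺ˡ (∈-map⁺ class a∈))
  ∙ Σ-cong cs per-class
  ∙ sym (spread ys class' φ' y (λ b∈ → ∈-++⁺ʳ (map class xs) (∈-map⁺ class' b∈)))
  where
  _≟ᴸ_ = List.≡-dec _≟_
  all-classes = map class xs ++ map class' ys
  cs = deduplicate _≟ᴸ_ all-classes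
  unique-cs : Unique cs
  unique-cs = UniqueDecₚ.deduplicate-! _≟ᴸ_ all-classes
  once : ∀ {c} (ds : List (List ℕ)) → Unique ds → c ∈ ds → Σ ds (λ d → ι (eqList c d)) ≡ 1
  once {c} (d ∷ ds) (d∉ ∷ u) (here refl) = cong₂ _+_ (cong ι (≡⇒eqList {c} refl)) (Σ-vanish ds λ {z} z∈ → cong ι (≢true⇒false λ t → All.lookup d∉ z∈ (eqList⇒≡ t)))
  once {c} (d ∷ ds) (d∉ ∷ u) (there c∈) = cong₂ _+_ (cong ι (≢true⇒false λ t → All.lookup d∉ c∈ (sym (eqList⇒≡ t)))) (once ds u c∈)
  spread : ∀ {A : Set} (xs : List A) (class : A → List ℕ) (φ x : A → ℕ) → (∀ {a} → a ∈ xs → class a ∈ all-classes) →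
    Σ xs (λ a → φ a * x a) ≡ Σ cs (λ c → Σ xs (λ a → ι (eqList (class a) c) * (φ a * x a)))
  spread xs class φ x mem = (Σ-cong-∈ xs λ {a} a∈ → sym (*-identityˡ _) ∙ cong (_* (φ a * x a)) (sym (once cs unique-cs (∈-deduplicate⁺ _≟ᴸ_ (mem a∈)))) ∙
    sym (Σ-*ʳ (φ a * x a) _ cs)) ∙ Σ-swap _ xs cs
  scale : ∀ {A : Set} (xs : List A) (class : A → List ℕ) (φ x : A → ℕ) c k → (∀ {a} → a ∈ xs → x a ≢ 0 → class a ≡ c → φ a ≡ k) →
    Σ xs (λ a → ι (eqList (class a) c) * (φ a * x a)) ≡ k * Σ xs (λ a → ι (eqList (class a) c) * x a)
  scale xs class φ x c k φ≡ = (Σ-cong-∈ xs λ {a} a∈ → pt a a∈) ∙ Σ-*ˡ k _ xs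
    where
    arith : ∀ i k x → i * (k * x) ≡ k * (i * x)
    arith = solve-∀
    pt : ∀ a → a ∈ xs → ι (eqList (class a) c) * (φ a * x a) ≡ k * (ι (eqList (class a) c) * x a)
    pt a a∈ with x a ≟ 0 | eqList (class a) c in eq
    ... | yes e | b rewrite e = cong (ι b *_) (*-zeroʳ (φ a)) ∙ *-zeroʳ (ι b) ∙ sym (cong (k *_) (*-zeroʳ (ι b)) ∙ *-zeroʳ k)
    ... | no ne | false = sym (*-zeroʳ k)
    ... | no ne | true rewrite φ≡ a∈ ne (eqList⇒≡ eq) = arith 1 k (x a)
  per-class : ∀ c → Σ xs (λ a → ι (eqList (class a) c) * (φ a * x a)) ≡ Σ ys (λ b → ι (eqList (class' b) c) * (φ' b * y b))
  per-class c with Σ xs (λ a → ι (eqList (class a) c) * x a) ≟ 0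
  ... | yes z = empty xs class φ x z ∙ sym (empty ys class' φ' y (sym (h c) ∙ z))
    where
    empty : ∀ {A : Set} (xs : List A) (class : A → List ℕ) (φ x : A → ℕ) → Σ xs (λ a → ι (eqList (class a) c) * x a) ≡ 0 → Σ xs (λ a → ι (eqList (class a) c) * (φ a * x a)) ≡ 0
    empty xs class φ x z = Σ-vanish xs λ {a} a∈ → pt a (n≤0⇒n≡0 (term≤Σ (λ a → ι (eqList (class a) c) * x a) xs a∈ ≤∙ ≤-reflexive z))
      where
      arith : ∀ i k x → i * (k * x) ≡ k * (i * x)
      arith = solve-∀
      pt : ∀ a → ι (eqList (class a) c) * x a ≡ 0 → ι (eqList (class a) c) * (φ a * x a) ≡ 0
      pt a e = arith (ι (eqList (class a) c)) (φ a) (x a) ∙ cong (φ a *_) e ∙ *-zeroʳ (φ a)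
  ... | no ne with Σ≢0⇒∃ xs ne | Σ≢0⇒∃ ys (λ z → ne (h c ∙ z))
  ... | a0 , a0∈ , e0 | b0 , b0∈ , f0 = trans
    (scale xs class φ x c (φ' b0) λ a∈ xa≢ ca → compatible a∈ b0∈ xa≢ yb0 (ca ∙ sym cb0))
    (cong (φ' b0 *_) (h c) ∙ sym (scale ys class' φ' y c (φ' b0) λ b∈ yb≢ cb →
      trans (sym (compatible a0∈ b∈ xa0 yb≢ (ca0 ∙ sym cb))) (compatible a0∈ b0∈ xa0 yb0 (ca0 ∙ sym cb0))))
    where
    ca0 = eqList⇒≡ (ι≢0 (proj₁ (*-≢0 {ι (eqList (class a0) c)} e0)))
    xa0 = proj₂ (*-≢0 {ι (eqList (class a0) c)} e0)
    cb0 = eqList⇒≡ (ι≢0 (proj₁ (*-≢0 {ι (eqList (class' b0) c)} f0)))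
    yb0 = proj₂ (*-≢0 {ι (eqList (class' b0) c)} f0)

-- q-multinomial coefficients

module QAnalog (q : ℕ) where

  [_] : ℕ → ℕ
  [ zero ] = 0
  [ suc k ] = 1 + q * [ k ]

  [_]! : ℕ → ℕ
  [ zero ]! = 1
  [ suc k ]! = [ suc k ] * [ k ]!

  []-+ : ∀ a b → [ a + b ] ≡ [ a ] + q ^ a * [ b ]
  []-+ zero b = sym (+-identityʳ [ b ])
  []-+ (suc a) b = cong (λ z → 1 + q * z) ([]-+ a b) ∙ arith q [ a ] (q ^ a) [ b ]
    where
    arith : ∀ q a p b → 1 + q * (a + p * b) ≡ (1 + q * a) + q * p * b
    arith = solve-∀

  []!>0 : ∀ k → 0 < [ k ]!
  []!>0 zero = s≤s z≤n
  []!>0 (suc k) = *-mono-≤ {1} {[ suc k ]} (s≤s z≤n) ([]!>0 k)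

  binomial : ℕ → ℕ → ℕ
  binomial zero b = 1
  binomial (suc a) zero = 1
  binomial (suc a) (suc b) = q ^ suc b * binomial a (suc b) + binomial (suc a) b

  binomial-0 : ∀ a → binomial a 0 ≡ 1
  binomial-0 zero = refl
  binomial-0 (suc a) = refl

  binomial-! : ∀ a b → binomial a b * [ a ]! * [ b ]! ≡ [ a + b ]!
  binomial-! zero b = +-identityʳ _
  binomial-! (suc a) zero = arith [ suc a ]! ∙ cong [_]! (sym (+-identityʳ (suc a)))
    where
    arith : ∀ x → 1 * x * 1 ≡ x
    arith = solve-∀
  binomial-! (suc a) (suc b) = arith (q ^ suc b) (binomial a (suc b)) (binomial (suc a) b) [ suc a ] [ a ]! [ suc b ] [ b ]!
    ∙ cong₂ (λ u v → q ^ suc b * [ suc a ] * u + [ suc b ] * v) (binomial-! a (suc b) ∙ cong [_]! (+-suc a b)) (binomial-! (suc a) b)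
    ∙ arith' (q ^ suc b * [ suc a ]) [ suc b ] [ suc (a + b) ]!
    ∙ cong (_* [ suc (a + b) ]!) (sym ([]-+ (suc b) (suc a)) ∙ cong [_] (+-comm (suc b) (suc a) ∙ cong suc (+-suc a b)))
    ∙ cong [_]! (cong suc (sym (+-suc a b)))
    where
    arith : ∀ p x y a f b g → (p * x + y) * (a * f) * (b * g) ≡ p * a * (x * f * (b * g)) + b * (y * (a * f) * g)
    arith = solve-∀
    arith' : ∀ p b f → p * f + b * f ≡ (b + p) * f
    arith' = solve-∀

  multinomial : ℕ → ℕ → ℕ → ℕ
  multinomial a d b = binomial a (d + b) * binomial d b

  multinomial-! : ∀ a d b → multinomial a d b * ([ a ]! * [ d ]! * [ b ]!) ≡ [ a + (d + b) ]!
  multinomial-! a d b = arith (binomial a (d + b)) (binomial d b) [ a ]! [ d ]! [ b ]! ∙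
    cong (binomial a (d + b) * [ a ]! *_) (binomial-! d b) ∙ binomial-! a (d + b)
    where
    arith : ∀ x y a d b → x * y * (a * d * b) ≡ x * a * (y * d * b)
    arith = solve-∀

  positive : ℕ → ℕ → ℕ
  positive zero z = 0
  positive (suc _) z = z

  multinomial-step : ∀ a d b → 0 < a + (d + b) → multinomial a d b ≡
    positive a (q ^ (d + b) * multinomial (pred a) d b) + (positive d (q ^ b * multinomial a (pred d) b) + positive b (multinomial a d (pred b)))
  multinomial-step zero zero zero ()
  multinomial-step zero zero (suc b) _ = refl
  multinomial-step zero (suc d) zero _ rewrite binomial-0 d = refl
  multinomial-step zero (suc d) (suc b) _ = arith (q ^ suc b) (binomial d (suc b)) (binomial (suc d) b)
    where
    arith : ∀ p x y → 1 * (p * x + y) ≡ p * (1 * x) + 1 * y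
    arith = solve-∀
  multinomial-step (suc a) zero zero _ rewrite binomial-0 a = refl
  multinomial-step (suc a) zero (suc b) _ = arith (q ^ suc b) (binomial a (suc b)) (binomial (suc a) b)
    where
    arith : ∀ p x y → (p * x + y) * 1 ≡ p * (x * 1) + y * 1
    arith = solve-∀
  multinomial-step (suc a) (suc d) zero _ rewrite +-identityʳ d | binomial-0 d = arith (q ^ suc d) (binomial a (suc d)) (binomial (suc a) d)
    where
    arith : ∀ p x y → (p * x + y) * 1 ≡ p * (x * 1) + (1 * (y * 1) + 0)
    arith = solve-∀
  multinomial-step (suc a) (suc d) (suc b) _ = trans
    (arith (q ^ suc (d + suc b)) (binomial a (suc (d + suc b))) (binomial (suc a) (d + suc b)) (q ^ suc b) (binomial d (suc b)) (binomial (suc d) b))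
    (cong (λ k → q ^ suc (d + suc b) * (binomial a (suc (d + suc b)) * binomial (suc d) (suc b)) + (q ^ suc b * (binomial (suc a) (d + suc b) * binomial d (suc b)) + binomial (suc a) k * binomial (suc d) b)) (+-suc d b))
    where
    arith : ∀ p x y r u v → (p * x + y) * (r * u + v) ≡ p * (x * (r * u + v)) + (r * (y * u) + y * v)
    arith = solve-∀

-- Walks on levels

-- A step is indexed by the lower of its end points, shifted so that no subtraction is needed:
-- N ℓ goes from ℓ to ℓ + m, E ℓ from ℓ + n to ℓ, and D ℓ, a marked valley E ℓ N ℓ, from ℓ + n to ℓ + m.
data Letter : Set where
  N D E : Letter

Step : Set
Step = Letter × ℕ

Graph : Set
Graph = Letter → ℕ → ℕ

eqLetter : Letter → Letter → Bool
eqLetter N N = true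
eqLetter D D = true
eqLetter E E = true
eqLetter _ _ = false

eqStep : Step → Step → Bool
eqStep (k , i) (l , j) = eqLetter k l ∧ (i ≡ᵇ j)

eqLetter⇒≡ : ∀ {k l} → eqLetter k l ≡ true → k ≡ l
eqLetter⇒≡ {N} {N} _ = refl
eqLetter⇒≡ {D} {D} _ = refl
eqLetter⇒≡ {E} {E} _ = refl

eqStep⇒≡ : ∀ {s t} → eqStep s t ≡ true → s ≡ t
eqStep⇒≡ {k , i} {l , j} e = cong₂ _,_ (eqLetter⇒≡ (proj₁ (∧-elim {eqLetter k l} e))) (≡ᵇ≡⇒≡ (proj₂ (∧-elim {eqLetter k l} e)))

eqStep-refl : ∀ s → eqStep s s ≡ true
eqStep-refl (N , i) = ≡⇒≡ᵇ≡ {i} refl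
eqStep-refl (D , i) = ≡⇒≡ᵇ≡ {i} refl
eqStep-refl (E , i) = ≡⇒≡ᵇ≡ {i} refl

swapL : Letter → Letter
swapL N = E
swapL D = D
swapL E = N

swapS : Step → Step
swapS (l , ℓ) = swapL l , ℓ

swapL-involutive : ∀ l → swapL (swapL l) ≡ l
swapL-involutive N = refl
swapL-involutive D = refl
swapL-involutive E = refl

transpose : Graph → Graph
transpose M l = M (swapL l)

mult : List Step → Graph
mult w l ℓ = Σ w (λ s → ι (eqStep s (l , ℓ)))

mult-swap : ∀ w l ℓ → mult (map swapS w) l ℓ ≡ mult w (swapL l) ℓ
mult-swap w l ℓ = Σ-map _ swapS w ∙ (Σ-cong w λ s → cong ι (pt s l))
  where
  pt : ∀ s l → eqStep (swapS s) (l , ℓ) ≡ eqStep s (swapL l , ℓ)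
  pt (N , i) N = refl
  pt (N , i) D = refl
  pt (N , i) E = refl
  pt (D , i) N = refl
  pt (D , i) D = refl
  pt (D , i) E = refl
  pt (E , i) N = refl
  pt (E , i) D = refl
  pt (E , i) E = refl

Σ-mult : ∀ (f : Step → ℕ) u v → (∀ l ℓ → mult u l ℓ ≡ mult v l ℓ) → Σ u f ≡ Σ v f
Σ-mult f [] [] h = refl
Σ-mult f [] (s ∷ v) h = contradiction (h (proj₁ s) (proj₂ s)) λ e → case trans e (cong (λ b → ι b + mult v (proj₁ s) (proj₂ s)) (eqStep-refl s)) of λ ()
Σ-mult f (s ∷ u) v h with Σ≢0⇒∃ v (λ e → case trans (sym (h (proj₁ s) (proj₂ s) ∙ e)) (cong (λ b → ι b + mult u (proj₁ s) (proj₂ s)) (eqStep-refl s)) of λ ())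
... | t , t∈ , ne with eqStep⇒≡ {t} (ι≢0 ne) | ∈-∃++ t∈
... | refl | v1 , v2 , refl = cong (f s +_) (Σ-mult f u (v1 ++ v2) rest)
  ∙ cong (f s +_) (Σ-++ f v1 v2)
  ∙ arith (f s) (Σ v1 f) (Σ v2 f)
  ∙ sym (Σ-++ f v1 (s ∷ v2))
  where
  arith : ∀ a b c → a + (b + c) ≡ b + (a + c)
  arith = solve-∀
  rest : ∀ l ℓ → mult u l ℓ ≡ mult (v1 ++ v2) l ℓ
  rest l ℓ = +-cancelˡ-≡ (δ s) _ _ (h l ℓ ∙ Σ-++ δ v1 (s ∷ v2) ∙ sym (arith (δ s) (Σ v1 δ) (Σ v2 δ)) ∙ cong (δ s +_) (sym (Σ-++ δ v1 v2)))
    where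
    δ : Step → ℕ
    δ t = ι (eqStep t (l , ℓ))

delay : ℕ → (ℕ → ℕ) → ℕ → ℕ
delay k f v = if k ≤ᵇ v then f (v ∸ k) else 0

delay-+ : ∀ k f v → delay k f (v + k) ≡ f v
delay-+ k f v rewrite ≤⇒≤ᵇ≡ (m≤n+m k v) | m+n∸n≡m v k = refl

delay-< : ∀ k f {v} → v < k → delay k f v ≡ 0
delay-< k f v<k rewrite ≰⇒≤ᵇ≡ v<k = refl

delay-cong : ∀ k {f g : ℕ → ℕ} v → (∀ i → f i ≡ g i) → delay k f v ≡ delay k g v
delay-cong k v h with k ≤ᵇ v
... | true = h (v ∸ k)
... | false = refl

delay-linear : ∀ k (f g : ℕ → ℕ) v → delay k (λ i → f i + g i) v ≡ delay k f v + delay k g v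
delay-linear k f g v with k ≤ᵇ v
... | true = refl
... | false = refl

delay-split : ∀ k v → v < k ⊎ ∃ λ i → v ≡ i + k
delay-split k v with v <? k
... | yes h = inj₁ h
... | no h with m≤n⇒∃[o]m+o≡n (≮⇒≥ h)
... | i , refl = inj₂ (i , +-comm k i)

delay-vanish : ∀ k f b {v} → (∀ i → b ≤ i → f i ≡ 0) → b + k ≤ v → delay k f v ≡ 0
delay-vanish k f b {v} z h with delay-split k v
... | inj₁ lt = delay-< k f lt
... | inj₂ (i , refl) = delay-+ k f i ∙ z i (+-cancelʳ-≤ k b i h)

∏ : ℕ → (ℕ → ℕ) → ℕ
∏ zero f = 1
∏ (suc b) f = ∏ b f * f b

∏-cong : ∀ b {f g : ℕ → ℕ} → (∀ v → v < b → f v ≡ g v) → ∏ b f ≡ ∏ b g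
∏-cong zero h = refl
∏-cong (suc b) h = cong₂ _*_ (∏-cong b λ v v<b → h v (<-trans v<b (n<1+n b))) (h b ≤-refl)

∏-* : ∀ b f g → ∏ b (λ v → f v * g v) ≡ ∏ b f * ∏ b g
∏-* zero f g = refl
∏-* (suc b) f g rewrite ∏-* b f g = arith (∏ b f) (∏ b g) (f b) (g b)
  where
  arith : ∀ a c f g → a * c * (f * g) ≡ a * f * (c * g)
  arith = solve-∀

∏-1 : ∀ b {f : ℕ → ℕ} → (∀ v → v < b → f v ≡ 1) → ∏ b f ≡ 1
∏-1 zero h = refl
∏-1 (suc b) h rewrite ∏-1 b (λ v v<b → h v (<-trans v<b (n<1+n b))) | h b ≤-refl = refl

∏-+ : ∀ a b f → ∏ (a + b) f ≡ ∏ a f * ∏ b (λ v → f (a + v))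
∏-+ a zero f = cong (λ k → ∏ k f) (+-identityʳ a) ∙ sym (*-identityʳ _)
∏-+ a (suc b) f = cong (λ k → ∏ k f) (+-suc a b) ∙ cong (_* f (a + b)) (∏-+ a b f) ∙ *-assoc (∏ a f) _ _

∏>0 : ∀ b {f : ℕ → ℕ} → (∀ v → 0 < f v) → 0 < ∏ b f
∏>0 zero h = s≤s z≤n
∏>0 (suc b) h = *-mono-≤ (∏>0 b h) (h b)

∏-extract : ∀ b f {u} → u < b → ∏ b f ≡ f u * ∏ b (λ v → if v ≡ᵇ u then 1 else f v)
∏-extract (suc b) f {u} u<b with b ≟ u
... | yes refl rewrite ≡⇒≡ᵇ≡ {b} refl = *-comm (∏ b f) (f b) ∙ cong (f b *_) ((∏-cong b λ v v<b → cong (λ t → if t then 1 else f v) (sym (≢⇒≡ᵇ≡ (<⇒≢ v<b)))) ∙ sym (*-identityʳ _))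
... | no b≢u rewrite ≢⇒≡ᵇ≡ b≢u = cong (_* f b) (∏-extract b f (≤∧≢⇒< (≤-pred u<b) (λ e → b≢u (sym e)))) ∙ *-assoc (f u) _ _

∏-delay : ∀ (F : ℕ → ℕ) b k j f → F 0 ≡ 1 → (∀ i → b ≤ i → f i ≡ 0) → ∏ (b + (j + k)) (λ v → F (delay k f v)) ≡ ∏ b (λ i → F (f i))
∏-delay F b k j f F0 z = cong (λ c → ∏ c (λ v → F (delay k f v))) (arith b j k)
  ∙ ∏-+ k (b + j) _
  ∙ cong₂ _*_ (∏-1 k λ v v<k → cong F (delay-< k f v<k) ∙ F0) (∏-cong (b + j) λ v _ → cong F (cong (delay k f) (+-comm k v) ∙ delay-+ k f v))
  ∙ *-identityˡ _
  ∙ ∏-+ b j _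
  ∙ cong (∏ b (λ v → F (f v)) *_) (∏-1 j λ v _ → cong F (z (b + v) (m≤m+n b v)) ∙ F0)
  ∙ *-identityʳ _
  where
  arith : ∀ b j k → b + (j + k) ≡ k + (b + j)
  arith = solve-∀

_⊖_ : Graph → Step → Graph
(M ⊖ s) l ℓ = M l ℓ ∸ ι (eqStep s (l , ℓ))

_≐_ : Graph → Graph → Set
M ≐ M' = ∀ l ℓ → M l ℓ ≡ M' l ℓ

_at'_ : Graph → Step → ℕ
M at' (l , ℓ) = M l ℓ

-- y ↦ Σ_{t ≥ 1} g (y - t m)
ladder : ℕ → (ℕ → ℕ) → ℕ → ℕ
ladder m g y = Σ< y (λ t → ι (suc t * m ≤ᵇ y) * g (y ∸ suc t * m))

ladder-< : ∀ m g {y} → y < m → ladder m g y ≡ 0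
ladder-< m g {y} y<m = Σ-upTo-vanish y λ {t} _ → cong (λ b → ι b * g (y ∸ suc t * m)) (≰⇒≤ᵇ≡ (<-≤-trans y<m (m≤m+n m (t * m))))

ladder-+ : ∀ m g y → 0 < m → ladder m g (y + m) ≡ ladder m g y + g y
ladder-+ (suc m1) g y _ = cong (λ k → Σ< k F) (+-suc y m1)
  ∙ Σ-upTo-suc (y + m1) F
  ∙ cong₂ _+_ F0 (Σ-cong (upTo (y + m1)) Fs ∙ Σ-upTo-+ y m1 G)
  ∙ cong (λ z → g y + (Σ< y G + z)) (Σ-upTo-vanish m1 λ {i} _ → cong (λ b → ι b * g (y ∸ suc (y + i) * m)) (≰⇒≤ᵇ≡ (<-≤-trans (s≤s (m≤m+n y i)) (m≤m*n (suc (y + i)) m))))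
  ∙ arith (g y) (Σ< y G)
  where
  m = suc m1
  F G : ℕ → ℕ
  F t = ι (suc t * m ≤ᵇ y + m) * g (y + m ∸ suc t * m)
  G t = ι (suc t * m ≤ᵇ y) * g (y ∸ suc t * m)
  arith : ∀ a b → a + (b + 0) ≡ b + a
  arith = solve-∀
  F0 : F 0 ≡ g y
  F0 = cong₂ (λ b z → ι b * g z) (≤⇒≤ᵇ≡ (≤-reflexive (+-identityʳ m) ≤∙ m≤n+m m y)) (cong (y + m ∸_) (+-identityʳ m) ∙ m+n∸n≡m y m) ∙ *-identityˡ (g y)
  Fs : ∀ t → F (suc t) ≡ G t
  Fs t = cong₂ (λ b z → ι b * g z) (cong (_≤ᵇ y + m) (+-comm m (suc t * m)) ∙ ≤ᵇ-+ʳ m (suc t * m) y)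
    (cong (y + m ∸_) (+-comm m (suc t * m)) ∙ [m+n]∸[o+n]≡m∸o y m (suc t * m))
    where
    [m+n]∸[o+n]≡m∸o : ∀ a b c → a + b ∸ (c + b) ≡ a ∸ c
    [m+n]∸[o+n]≡m∸o a b c = cong₂ _∸_ (+-comm a b) (+-comm c b) ∙ [m+n]∸[m+o]≡n∸o b a c

words3 : ℕ → List (List Letter)
words3 zero = [] ∷ []
words3 (suc j) = concatMap (λ ls → (N ∷ ls) ∷ (D ∷ ls) ∷ (E ∷ ls) ∷ []) (words3 j)

Σ-words3 : ∀ j (F : List Letter → ℕ) → Σ (words3 (suc j)) F ≡ Σ (words3 j) (λ ls → F (N ∷ ls)) + (Σ (words3 j) (λ ls → F (D ∷ ls)) + Σ (words3 j) (λ ls → F (E ∷ ls)))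
Σ-words3 j F = Σ-concatMap F _ (words3 j) ∙ (Σ-cong (words3 j) λ ls → cong (λ z → F (N ∷ ls) + (F (D ∷ ls) + z)) (+-identityʳ _)) ∙
  Σ-+ _ _ (words3 j) ∙ cong (Σ (words3 j) (λ ls → F (N ∷ ls)) +_) (Σ-+ _ _ (words3 j))

delay-0 : ∀ k v → delay k (λ _ → 0) v ≡ 0
delay-0 k v with k ≤ᵇ v
... | true = refl
... | false = refl

≡ᵇ-+ʳ : ∀ k a b → (a + k ≡ᵇ b + k) ≡ (a ≡ᵇ b)
≡ᵇ-+ʳ k a b = bool-ext (λ t → ≡⇒≡ᵇ≡ {a} (+-cancelʳ-≡ k a b (≡ᵇ≡⇒≡ {a + k} t))) (λ t → ≡⇒≡ᵇ≡ {a + k} (cong (_+ k) (≡ᵇ≡⇒≡ {a} t)))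

≡ᵇ-< : ∀ k a {v} → v < k → (a + k ≡ᵇ v) ≡ false
≡ᵇ-< k a lt = ≢⇒≡ᵇ≡ λ e → <⇒≱ lt (m≤n+m k a ≤∙ ≤-reflexive e)

delay-≡ᵇ : ∀ k ℓ v → delay k (λ i → ι (ℓ ≡ᵇ i)) v ≡ ι (ℓ + k ≡ᵇ v)
delay-≡ᵇ k ℓ v with delay-split k v
... | inj₁ lt = delay-< k (λ i → ι (ℓ ≡ᵇ i)) lt ∙ cong ι (sym (≡ᵇ-< k ℓ lt))
... | inj₂ (i , refl) = delay-+ k (λ i → ι (ℓ ≡ᵇ i)) i ∙ cong ι (sym (≡ᵇ-+ʳ k ℓ i))

delay-∸ : ∀ k f ℓ v → delay k (λ i → f i ∸ ι (ℓ ≡ᵇ i)) v ≡ delay k f v ∸ ι (ℓ + k ≡ᵇ v)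
delay-∸ k f ℓ v with delay-split k v
... | inj₁ lt = delay-< k (λ i → f i ∸ ι (ℓ ≡ᵇ i)) lt ∙ sym (cong (_∸ ι (ℓ + k ≡ᵇ v)) (delay-< k f lt) ∙ 0∸n≡0 (ι (ℓ + k ≡ᵇ v)))
... | inj₂ (i , refl) = delay-+ k (λ i → f i ∸ ι (ℓ ≡ᵇ i)) i ∙ sym (cong₂ (λ x b → x ∸ ι b) (delay-+ k f i) (≡ᵇ-+ʳ k ℓ i))

_⊞_ : Graph → Graph → Graph
(M ⊞ M') l ℓ = M l ℓ + M' l ℓ

single : Step → Graph
single s l ℓ = ι (eqStep s (l , ℓ))

single-swap : ∀ s l ℓ → single (swapS s) l ℓ ≡ single s (swapL l) ℓ
single-swap s l ℓ = sym (+-identityʳ _) ∙ mult-swap (s ∷ []) l ℓ ∙ +-identityʳ _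

mult-++ : ∀ u v → mult (u ++ v) ≐ (mult u ⊞ mult v)
mult-++ u v l ℓ = Σ-++ (λ s → ι (eqStep s (l , ℓ))) u v

_∖_ : Graph → List Step → Graph
(M ∖ w) l ℓ = M l ℓ ∸ mult w l ℓ

single-refl : ∀ s → single s at' s ≡ 1
single-refl s = cong ι (eqStep-refl s)

⊖-split : ∀ M s → 0 < M at' s → M ≐ (single s ⊞ (M ⊖ s))
⊖-split M s h l ℓ = sym (m+[n∸m]≡n le)
  where
  le : ι (eqStep s (l , ℓ)) ≤ M l ℓ
  le with eqStep s (l , ℓ) in e
  ... | false = z≤n
  ... | true with eqStep⇒≡ {s} {l , ℓ} e
  ... | refl = h

fits : Graph → List Step → Bool
fits M [] = true
fits M (s ∷ w) = (0 <ᵇ M at' s) ∧ fits (M ⊖ s) w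

fits⇒mult≤ : ∀ M w → fits M w ≡ true → ∀ l ℓ → mult w l ℓ ≤ M l ℓ
fits⇒mult≤ M [] h l ℓ = z≤n
fits⇒mult≤ M (s ∷ w) h l ℓ = +-monoʳ-≤ (single s l ℓ) (fits⇒mult≤ (M ⊖ s) w (proj₂ (∧-elim {0 <ᵇ M at' s} h)) l ℓ) ≤∙
  ≤-reflexive (sym (⊖-split M s (<ᵇ≡⇒< {0} (proj₁ (∧-elim {0 <ᵇ M at' s} h))) l ℓ))

mult≤⇒fits : ∀ M w → (∀ l ℓ → mult w l ℓ ≤ M l ℓ) → fits M w ≡ true
mult≤⇒fits M [] h = refl
mult≤⇒fits M (s ∷ w) h = ∧-intro (<⇒<ᵇ≡ {0} (≤-reflexive (sym (single-refl s)) ≤∙ m≤m+n _ _ ≤∙ h (proj₁ s) (proj₂ s)))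
  (mult≤⇒fits (M ⊖ s) w λ l ℓ → m+n≤o⇒n≤o∸m (single s l ℓ) (h l ℓ))
  where
  m+n≤o⇒n≤o∸m : ∀ a {b c} → a + b ≤ c → b ≤ c ∸ a
  m+n≤o⇒n≤o∸m a {b} {c} h = m+n≤o⇒m≤o∸n b (≤-reflexive (+-comm b a) ≤∙ h)

module Walks (m n : ℕ) where

  src tgt : Step → ℕ
  src (N , ℓ) = ℓ
  src (D , ℓ) = ℓ + n
  src (E , ℓ) = ℓ + n
  tgt (N , ℓ) = ℓ + m
  tgt (D , ℓ) = ℓ + m
  tgt (E , ℓ) = ℓ

  step : Letter → ℕ → Step
  step N u = N , u
  step D u = D , u ∸ n
  step E u = E , u ∸ n

  allowed : Letter → ℕ → Bool
  allowed N u = true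
  allowed D u = n ≤ᵇ u
  allowed E u = n ≤ᵇ u

  src-step : ∀ l {u} → allowed l u ≡ true → src (step l u) ≡ u
  src-step N _ = refl
  src-step D {u} h = m∸n+n≡m (≤ᵇ≡⇒≤ {n} {u} h)
  src-step E {u} h = m∸n+n≡m (≤ᵇ≡⇒≤ {n} {u} h)

  locate : ℕ → List Letter → List Step
  locate u [] = []
  locate u (l ∷ ls) = step l u ∷ locate (tgt (step l u)) ls

  length-locate : ∀ u ls → length (locate u ls) ≡ length ls
  length-locate u [] = refl
  length-locate u (l ∷ ls) = cong suc (length-locate _ ls)

  valid : ℕ → List Letter → Bool
  valid u [] = u ≡ᵇ 0
  valid u (l ∷ ls) = allowed l u ∧ valid (tgt (step l u)) ls

  Walk : ℕ → List Step → ℕ → Set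
  Walk u [] v = u ≡ v
  Walk u (s ∷ w) v = src s ≡ u × Walk (tgt s) w v

  valid⇒walk : ∀ u ls → valid u ls ≡ true → Walk u (locate u ls) 0
  valid⇒walk u [] h = ≡ᵇ≡⇒≡ {u} h
  valid⇒walk u (l ∷ ls) h = src-step l (proj₁ (∧-elim {allowed l u} h)) , valid⇒walk _ ls (proj₂ (∧-elim {allowed l u} h))

  base-bound : ∀ u ls → ∀ {s} → s ∈ locate u ls → proj₂ s ≤ u + length ls * (m + n)
  base-bound u (l ∷ ls) (here refl) = base l ≤∙ m≤m+n u _
    where
    base : ∀ l → proj₂ (step l u) ≤ u
    base N = ≤-refl
    base D = m∸n≤m u n
    base E = m∸n≤m u n
  base-bound u (l ∷ ls) {s} (there i) = base-bound _ ls i ≤∙ +-monoˡ-≤ (length ls * (m + n)) (tgt≤ l) ≤∙ ≤-reflexive (+-assoc u (m + n) _)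
    where
    tgt≤ : ∀ l → tgt (step l u) ≤ u + (m + n)
    tgt≤ N = +-monoʳ-≤ u (m≤m+n m n)
    tgt≤ D = +-mono-≤ (m∸n≤m u n) (m≤m+n m n)
    tgt≤ E = m∸n≤m u n ≤∙ m≤m+n u _

  telescopeʷ : ∀ (φ : ℕ → ℕ) {u v} w → Walk u w v → φ u + Σ w (φ ∘ tgt) ≡ φ v + Σ w (φ ∘ src)
  telescopeʷ φ [] refl = refl
  telescopeʷ φ {v = v} (s ∷ w) (refl , W) = cong (φ (src s) +_) (telescopeʷ φ w W) ∙ arith (φ (src s)) (φ v) (Σ w (φ ∘ src))
    where
    arith : ∀ a b c → a + (b + c) ≡ b + (a + c)
    arith = solve-∀

  -- Steps leaving the same vertex are ordered N < D < E; κ s M counts the smaller steps of M.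
  κ : Step → Graph → ℕ
  κ (N , ℓ) M = 0
  κ (D , ℓ) M = M N (ℓ + n)
  κ (E , ℓ) M = M D ℓ + M N (ℓ + n)

  κ-cong : ∀ s {M M'} → M ≐ M' → κ s M ≡ κ s M'
  κ-cong (N , ℓ) h = refl
  κ-cong (D , ℓ) h = h N (ℓ + n)
  κ-cong (E , ℓ) h = cong₂ _+_ (h D ℓ) (h N (ℓ + n))

  κ-⊞ : ∀ s M M' → κ s (M ⊞ M') ≡ κ s M + κ s M'
  κ-⊞ (N , ℓ) M M' = refl
  κ-⊞ (D , ℓ) M M' = refl
  κ-⊞ (E , ℓ) M M' = arith (M D ℓ) _ _ _
    where
    arith : ∀ a b c d → (a + b) + (c + d) ≡ (a + c) + (b + d)
    arith = solve-∀

  κ-single : ∀ s → κ s (single s) ≡ 0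
  κ-single (N , ℓ) = refl
  κ-single (D , ℓ) = refl
  κ-single (E , ℓ) = refl

  inv : List Step → ℕ
  inv [] = 0
  inv (s ∷ w) = κ s (mult w) + inv w

  inv-++ : ∀ v w → inv (v ++ w) ≡ inv v + inv w + Σ v (λ s → κ s (mult w))
  inv-++ [] w = sym (+-identityʳ _)
  inv-++ (s ∷ v) w = cong₂ _+_ (κ-cong s (mult-++ v w) ∙ κ-⊞ s (mult v) (mult w)) (inv-++ v w) ∙ arith (κ s (mult v)) (κ s (mult w)) (inv v) (inv w) _
    where
    arith : ∀ a b c d e → (a + b) + (c + d + e) ≡ (a + c) + d + (b + e)
    arith = solve-∀

  energy : Graph → List Step → ℕ
  energy M [] = 0
  energy M (s ∷ w) = κ s M + energy (M ⊖ s) w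

  energy-split : ∀ w {M C} → M ≐ (mult w ⊞ C) → energy M w ≡ inv w + Σ w (λ s → κ s C)
  energy-split [] h = refl
  energy-split (s ∷ w) {M} {C} h = trans
    (cong₂ _+_ (κ-cong s h' ∙ κ-⊞ s (single s) (mult w ⊞ C) ∙ cong₂ _+_ (κ-single s) (κ-⊞ s (mult w) C)) (energy-split w {M ⊖ s} {C} rest))
    (arith (κ s (mult w)) (κ s C) (inv w) _)
    where
    arith : ∀ a b c d → (0 + (a + b)) + (c + d) ≡ (a + c) + (b + d)
    arith = solve-∀
    h' : M ≐ (single s ⊞ (mult w ⊞ C))
    h' l ℓ = h l ℓ ∙ +-assoc (single s l ℓ) (mult w l ℓ) (C l ℓ)
    rest : (M ⊖ s) ≐ (mult w ⊞ C)
    rest l ℓ = cong (_∸ single s l ℓ) (h' l ℓ) ∙ m+n∸m≡n (single s l ℓ) _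

  cnt : Graph → Letter → ℕ → ℕ
  cnt M N v = M N v
  cnt M D v = delay n (M D) v
  cnt M E v = delay n (M E) v

  cnt-cong : ∀ {M M'} l v → M ≐ M' → cnt M l v ≡ cnt M' l v
  cnt-cong N v h = h N v
  cnt-cong D v h = delay-cong n v (h D)
  cnt-cong E v h = delay-cong n v (h E)

  cnt-⊖ : ∀ M s l v → cnt (M ⊖ s) l v ≡ cnt M l v ∸ ι (eqLetter (proj₁ s) l ∧ (src s ≡ᵇ v))
  cnt-⊖ M (N , ℓ) N v = refl
  cnt-⊖ M (N , ℓ) D v = refl
  cnt-⊖ M (N , ℓ) E v = refl
  cnt-⊖ M (D , ℓ) N v = refl
  cnt-⊖ M (D , ℓ) D v = delay-∸ n (M D) ℓ v
  cnt-⊖ M (D , ℓ) E v = refl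
  cnt-⊖ M (E , ℓ) N v = refl
  cnt-⊖ M (E , ℓ) D v = refl
  cnt-⊖ M (E , ℓ) E v = delay-∸ n (M E) ℓ v

  present : ∀ M l u → ι (allowed l u) * ι (0 <ᵇ M at' step l u) ≡ ι (0 <ᵇ cnt M l u)
  present M N u = *-identityˡ _
  present M D u with n ≤ᵇ u
  ... | true = *-identityˡ _
  ... | false = refl
  present M E u with n ≤ᵇ u
  ... | true = *-identityˡ _
  ... | false = refl

  present⇒ : ∀ M l u → 0 < cnt M l u → allowed l u ≡ true × 0 < M at' step l u
  present⇒ M N u h = refl , h
  present⇒ M D u h with n ≤ᵇ u
  ... | true = refl , h
  ... | false = contradiction h λ ()
  present⇒ M E u h with n ≤ᵇ u
  ... | true = refl , h
  ... | false = contradiction h λ ()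

  out inn : Graph → ℕ → ℕ
  out M v = delay n (M E) v + (delay n (M D) v + M N v)
  inn M v = delay m (M N) v + (delay m (M D) v + M E v)

  cnt≤out : ∀ M l v → cnt M l v ≤ out M v
  cnt≤out M N v = m≤n+m _ _ ≤∙ m≤n+m _ (delay n (M E) v)
  cnt≤out M D v = m≤m+n _ _ ≤∙ m≤n+m _ (delay n (M E) v)
  cnt≤out M E v = m≤m+n _ _

  Balanced : Graph → Set
  Balanced M = ∀ v → out M v ≡ inn M v

  out-⊞ : ∀ M M' v → out (M ⊞ M') v ≡ out M v + out M' v
  out-⊞ M M' v = cong₂ (λ a b → a + (b + (M N v + M' N v))) (delay-linear n (M E) (M' E) v) (delay-linear n (M D) (M' D) v) ∙
    arith (delay n (M E) v) _ (delay n (M D) v) _ (M N v) _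
    where
    arith : ∀ a b c d e f → (a + b) + ((c + d) + (e + f)) ≡ a + (c + e) + (b + (d + f))
    arith = solve-∀

  out-cong : ∀ {M M'} v → M ≐ M' → out M v ≡ out M' v
  out-cong v h = cong₂ _+_ (delay-cong n v (h E)) (cong₂ _+_ (delay-cong n v (h D)) (h N v))

  out-single : ∀ s v → out (single s) v ≡ ι (src s ≡ᵇ v)
  out-single (N , ℓ) v = cong₂ _+_ (delay-0 n v) (cong (_+ ι (ℓ ≡ᵇ v)) (delay-0 n v))
  out-single (D , ℓ) v = cong₂ _+_ (delay-0 n v) (cong (_+ 0) (delay-≡ᵇ n ℓ v)) ∙ +-identityʳ _
  out-single (E , ℓ) v = cong₂ _+_ (delay-≡ᵇ n ℓ v) (cong (_+ 0) (delay-0 n v)) ∙ +-identityʳ _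

  out-mult : ∀ w v → out (mult w) v ≡ Σ w (λ s → ι (src s ≡ᵇ v))
  out-mult [] v = cong₂ _+_ (delay-0 n v) (cong (_+ 0) (delay-0 n v))
  out-mult (s ∷ w) v = out-⊞ (single s) (mult w) v ∙ cong₂ _+_ (out-single s v) (out-mult w v)

swapS-involutive : ∀ s → swapS (swapS s) ≡ s
swapS-involutive (l , ℓ) = cong (_, ℓ) (swapL-involutive l)

module Transposition (m n : ℕ) where

  module W = Walks m n
  module W' = Walks n m

  src-swap : ∀ s → W'.src (swapS s) ≡ W.tgt s
  src-swap (N , ℓ) = refl
  src-swap (D , ℓ) = refl
  src-swap (E , ℓ) = refl

  tgt-swap : ∀ s → W'.tgt (swapS s) ≡ W.src s
  tgt-swap (N , ℓ) = refl
  tgt-swap (D , ℓ) = refl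
  tgt-swap (E , ℓ) = refl

  inn-⊞ : ∀ M M' v → W.inn (M ⊞ M') v ≡ W.inn M v + W.inn M' v
  inn-⊞ M M' v = W'.out-⊞ (transpose M) (transpose M') v

  inn-cong : ∀ {M M'} v → M ≐ M' → W.inn M v ≡ W.inn M' v
  inn-cong v h = W'.out-cong v (λ l → h (swapL l))

  inn-single : ∀ s v → W.inn (single s) v ≡ ι (W.tgt s ≡ᵇ v)
  inn-single s v = W'.out-cong v (λ l ℓ → sym (single-swap s l ℓ)) ∙ W'.out-single (swapS s) v ∙ cong (λ u → ι (u ≡ᵇ v)) (src-swap s)

  inn-mult : ∀ w v → W.inn (mult w) v ≡ Σ w (λ s → ι (W.tgt s ≡ᵇ v))
  inn-mult w v = W'.out-cong v (λ l ℓ → sym (mult-swap w l ℓ)) ∙ W'.out-mult (map swapS w) v ∙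
    Σ-map _ swapS w ∙ (Σ-cong w λ s → cong (λ u → ι (u ≡ᵇ v)) (src-swap s))

  walk-balanced : ∀ w → W.Walk 0 w 0 → W.Balanced (mult w)
  walk-balanced w walk v = W.out-mult w v ∙ sym (+-cancelˡ-≡ _ _ _ (W.telescopeʷ (λ u → ι (u ≡ᵇ v)) w walk)) ∙ sym (inn-mult w v)

  balanced-∖ : ∀ M w → W.Balanced M → W.Walk 0 w 0 → fits M w ≡ true → W.Balanced (M ∖ w)
  balanced-∖ M w bal walk fit v = +-cancelˡ-≡ (W.out (mult w) v) _ _
    (sym (W.out-⊞ (mult w) (M ∖ w) v) ∙ W.out-cong v whole ∙
      bal v ∙ inn-cong v (λ l ℓ → sym (whole l ℓ)) ∙ inn-⊞ (mult w) (M ∖ w) v ∙ cong (_+ W.inn (M ∖ w) v) (sym (walk-balanced w walk v)))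
    where
    whole : (mult w ⊞ (M ∖ w)) ≐ M
    whole l ℓ = m+[n∸m]≡n (fits⇒mult≤ M w fit l ℓ)

  -- The potential φ satisfies φ (v + m) = φ v + C D v + C E (v + m), and by balance also
  -- φ (v + n) = φ v + C D v + C N (v + n); along a closed walk its increments cancel.
  cross : 0 < m → 0 < n → ∀ C → W.Balanced C → ∀ w → W.Walk 0 w 0 → Σ w (λ s → W.κ s C) ≡ Σ w (λ s → W'.κ (swapS s) (transpose C))
  cross m>0 n>0 C bal w walk = +-cancelˡ-≡ (Σ w (λ s → φ (low s))) _ _ (sym (Σ-+ _ _ w)
    ∙ Σ-cong w down
    ∙ Σ-+ _ _ w
    ∙ cong (_+ Σ w rest) (sym (+-cancelˡ-≡ _ _ _ (W.telescopeʷ φ w walk)))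
    ∙ sym (Σ-+ _ _ w)
    ∙ Σ-cong w up
    ∙ Σ-+ _ _ w)
    where
    g φ : ℕ → ℕ
    g v = delay m (C D) v + C E v
    φ y = ladder m g (y + m)
    Φ : ℕ → ℕ
    Φ v = φ v + C D v
    φ-unroll : ∀ y → φ y ≡ C E y + delay m Φ y
    φ-unroll y with delay-split m y
    ... | inj₁ lt = ladder-+ m g y m>0 ∙ cong₂ _+_ (ladder-< m g lt) (cong (_+ C E y) (delay-< m (C D) lt)) ∙ sym (cong (C E y +_) (delay-< m Φ lt) ∙ +-identityʳ _)
    ... | inj₂ (v , refl) = ladder-+ m g (v + m) m>0 ∙ cong (λ z → φ v + (z + C E (v + m))) (delay-+ m (C D) v) ∙
      arith (φ v) (C D v) (C E (v + m)) ∙ cong (C E (v + m) +_) (sym (delay-+ m Φ v))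
      where
      arith : ∀ a b c → a + (b + c) ≡ c + (a + b)
      arith = solve-∀
    φ-m : ∀ v → φ (v + m) ≡ C E (v + m) + (φ v + C D v)
    φ-m v = φ-unroll (v + m) ∙ cong (C E (v + m) +_) (delay-+ m Φ v)
    swap-delay : ∀ y → delay n (λ u → C E u + delay m Φ u) y ≡ delay n (C E) y + delay n (delay m Φ) y
    swap-delay y = delay-linear n (C E) (delay m Φ) y
    φ-dual : ∀ y → φ y ≡ C N y + delay n Φ y
    φ-dual = <-rec _ λ y rec → +-cancelˡ-≡ (delay n (C E) y + delay n (C D) y) _ _ (cong (delay n (C E) y + delay n (C D) y +_) (φ-unroll y)
      ∙ cong (λ z → delay n (C E) y + delay n (C D) y + (C E y + z)) (unfold-m y rec)
      ∙ arith (delay n (C E) y) (delay n (C D) y) (C E y) (delay m (C N) y) (delay m (delay n Φ) y) (delay m (C D) y)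
      ∙ cong₂ (λ a b → a + (b + delay n (C E) y + delay n (C D) y)) (sym (bal y)) (commute y)
      ∙ arith' (delay n (C E) y) (delay n (C D) y) (C N y) (delay n (delay m Φ) y)
      ∙ cong (λ z → delay n (C E) y + delay n (C D) y + (C N y + z)) (sym (delay-linear n φ (C D) y ∙ cong (_+ delay n (C D) y) (delay-cong n y φ-unroll ∙ swap-delay y))))
      where
      arith : ∀ a b c d e f → a + b + (c + (d + e + f)) ≡ (d + (f + c)) + (e + a + b)
      arith = solve-∀
      arith' : ∀ a b c d → (a + (b + c)) + (d + a + b) ≡ a + b + (c + (a + d + b))
      arith' = solve-∀
      commute : ∀ y → delay m (delay n Φ) y ≡ delay n (delay m Φ) y
      commute y = join m n y ∙ cong (λ k → delay k Φ y) (+-comm n m) ∙ sym (join n m y)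
        where
        join : ∀ a b y → delay a (delay b Φ) y ≡ delay (b + a) Φ y
        join a b y with delay-split a y
        ... | inj₁ lt = delay-< a (delay b Φ) lt ∙ sym (delay-< (b + a) Φ (<-≤-trans lt (m≤n+m a b)))
        ... | inj₂ (u , refl) with delay-split b u
        ... | inj₁ lt = delay-+ a (delay b Φ) u ∙ delay-< b Φ lt ∙ sym (delay-< (b + a) Φ (+-monoˡ-< a lt))
        ... | inj₂ (t , refl) = delay-+ a (delay b Φ) (t + b) ∙ delay-+ b Φ t ∙ sym (cong (delay (b + a) Φ) (+-assoc t b a) ∙ delay-+ (b + a) Φ t)
      unfold-m : ∀ y → (∀ {u} → u < y → φ u ≡ C N u + delay n Φ u) → delay m Φ y ≡ delay m (C N) y + delay m (delay n Φ) y + delay m (C D) y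
      unfold-m y rec with delay-split m y
      ... | inj₁ lt = delay-< m Φ lt ∙ sym (cong₂ _+_ (cong₂ _+_ (delay-< m (C N) lt) (delay-< m (delay n Φ) lt)) (delay-< m (C D) lt))
      ... | inj₂ (u , refl) = delay-+ m Φ u ∙ cong (_+ C D u) (rec (m<m+n u m>0)) ∙ sym (cong₂ _+_ (cong₂ _+_ (delay-+ m (C N) u) (delay-+ m (delay n Φ) u)) (delay-+ m (C D) u))
    φ-n : ∀ v → φ (v + n) ≡ C N (v + n) + (φ v + C D v)
    φ-n v = φ-dual (v + n) ∙ cong (C N (v + n) +_) (delay-+ n Φ v)
    low : Step → ℕ
    low (N , ℓ) = ℓ
    low (D , ℓ) = ℓ + m
    low (E , ℓ) = ℓ
    rest : Step → ℕ
    rest (N , ℓ) = 0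
    rest (D , ℓ) = C E (ℓ + m)
    rest (E , ℓ) = 0
    down : ∀ s → φ (low s) + W.κ s C ≡ φ (W.src s) + rest s
    down (N , ℓ) = refl
    down (D , ℓ) = cong (_+ C N (ℓ + n)) (φ-m ℓ) ∙ arith (C E (ℓ + m)) (φ ℓ + C D ℓ) (C N (ℓ + n)) ∙ cong (_+ C E (ℓ + m)) (sym (φ-n ℓ))
      where
      arith : ∀ a b c → a + b + c ≡ c + b + a
      arith = solve-∀
    down (E , ℓ) = arith (φ ℓ) (C D ℓ) (C N (ℓ + n)) ∙ cong (_+ 0) (sym (φ-n ℓ))
      where
      arith : ∀ a b c → a + (b + c) ≡ c + (a + b) + 0
      arith = solve-∀
    up : ∀ s → φ (W.tgt s) + rest s ≡ φ (low s) + W'.κ (swapS s) (transpose C)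
    up (N , ℓ) = cong (_+ 0) (φ-m ℓ) ∙ arith (φ ℓ) (C D ℓ) (C E (ℓ + m))
      where
      arith : ∀ a b c → c + (a + b) + 0 ≡ a + (b + c)
      arith = solve-∀
    up (D , ℓ) = refl
    up (E , ℓ) = refl

Bounded : ℕ → Graph → Set
Bounded b M = ∀ l ℓ → b ≤ ℓ → M l ℓ ≡ 0

⊖-bounded : ∀ {b M} s → Bounded b M → Bounded b (M ⊖ s)
⊖-bounded s bd l ℓ h = cong (_∸ single s l ℓ) (bd l ℓ h) ∙ 0∸n≡0 (single s l ℓ)

-- The number of ways to route a balanced multigraph, by the product formula for q-multinomials at its vertices.
module Routing (q m n b : ℕ) where

  open Walks m n
  open QAnalog q
  open Transposition m n using (inn-⊞; inn-cong; inn-single; inn-mult)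

  top : ℕ
  top = b + (m + n)

  local : Graph → ℕ → ℕ
  local M v = multinomial (cnt M E v) (cnt M D v) (cnt M N v)

  H : Graph → ℕ
  H M = ∏ top (local M)

  H-cong : ∀ {M M'} → M ≐ M' → H M ≡ H M'
  H-cong {M} {M'} h = ∏-cong top λ v _ → cong3 (cnt-cong E v h) (cnt-cong D v h) (h N v)
    where
    cong3 : ∀ {x x' y y' z z'} → x ≡ x' → y ≡ y' → z ≡ z' → multinomial x y z ≡ multinomial x' y' z'
    cong3 refl refl refl = refl

  out-high : ∀ {M v} → Bounded b M → top ≤ v → out M v ≡ 0
  out-high {M} {v} bd h = cong₂ _+_ (delay-vanish n (M E) b (bd E) le) (cong₂ _+_ (delay-vanish n (M D) b (bd D) le) (bd N v (m≤m+n b (m + n) ≤∙ h)))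
    where
    le : b + n ≤ v
    le = +-monoʳ-≤ b (m≤n+m n m) ≤∙ h

  out>0⇒<top : ∀ {M v} → Bounded b M → 0 < out M v → v < top
  out>0⇒<top {M} {v} bd h = ≰⇒> λ le → <⇒≢ h (sym (out-high {M} bd le))

  branch : Graph → ℕ → (Graph → ℕ → ℕ) → Letter → ℕ
  branch M u F l = ι (0 <ᵇ cnt M l u) * (q ^ κ (step l u) M * F (M ⊖ step l u) (tgt (step l u)))

  branch-cong : ∀ M u l {F G : Graph → ℕ → ℕ} → (0 < cnt M l u → F (M ⊖ step l u) (tgt (step l u)) ≡ G (M ⊖ step l u) (tgt (step l u))) → branch M u F l ≡ branch M u G l
  branch-cong M u l h with 0 <ᵇ cnt M l u in e
  ... | false = refl
  ... | true = cong (λ z → 1 * (q ^ κ (step l u) M * z)) (h (<ᵇ≡⇒< {0} e))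

  branch-0 : ∀ M u F l → cnt M l u ≡ 0 → branch M u F l ≡ 0
  branch-0 M u F l e = cong (λ c → ι (0 <ᵇ c) * (q ^ κ (step l u) M * F (M ⊖ step l u) (tgt (step l u)))) e

  letter-step : ∀ l u → proj₁ (step l u) ≡ l
  letter-step N u = refl
  letter-step D u = refl
  letter-step E u = refl

  others : Graph → ℕ → ℕ
  others M u = ∏ top (λ v → if v ≡ᵇ u then 1 else local M v)

  removed : Letter → Letter → ℕ
  removed l k = ι (eqLetter l k)

  rest-local : Graph → ℕ → Letter → ℕ
  rest-local M u l = multinomial (cnt M E u ∸ removed l E) (cnt M D u ∸ removed l D) (cnt M N u ∸ removed l N)

  H-⊖ : ∀ M u l → u < top → 0 < cnt M l u → H (M ⊖ step l u) ≡ rest-local M u l * others M u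
  H-⊖ M u l u<top pos-l = ∏-extract top (local (M ⊖ s)) u<top ∙
    cong₂ _*_ (cong3 (at-u E) (at-u D) (at-u N)) (∏-cong top λ v _ → elsewhere v)
    where
    s = step l u
    cong3 : ∀ {x x' y y' z z'} → x ≡ x' → y ≡ y' → z ≡ z' → multinomial x y z ≡ multinomial x' y' z'
    cong3 refl refl refl = refl
    src-s : src s ≡ u
    src-s = src-step l (proj₁ (present⇒ M l u pos-l))
    at-u : ∀ k → cnt (M ⊖ s) k u ≡ cnt M k u ∸ removed l k
    at-u k = cnt-⊖ M s k u ∙ cong (cnt M k u ∸_) (ι-∧ (eqLetter (proj₁ s) k) (src s ≡ᵇ u) ∙
      cong₂ (λ a c → ι (eqLetter a k) * ι c) (letter-step l u) (≡⇒≡ᵇ≡ {src s} src-s) ∙ *-identityʳ (ι (eqLetter l k)))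
    away : ∀ k v → v ≢ u → cnt (M ⊖ s) k v ≡ cnt M k v
    away k v v≢u = cnt-⊖ M s k v ∙ cong (cnt M k v ∸_) (ι-∧ (eqLetter (proj₁ s) k) (src s ≡ᵇ v) ∙
      cong (λ c → ι (eqLetter (proj₁ s) k) * ι c) (≢⇒≡ᵇ≡ {src s} {v} λ e → v≢u (sym e ∙ src-s)) ∙ *-zeroʳ (ι (eqLetter (proj₁ s) k)))
    elsewhere : ∀ v → (if v ≡ᵇ u then 1 else local (M ⊖ s) v) ≡ (if v ≡ᵇ u then 1 else local M v)
    elsewhere v with v ≡ᵇ u in e
    ... | true = refl
    ... | false = cong3 (away E v ne) (away D v ne) (away N v ne)
      where
      ne : v ≢ u
      ne eq = true≢false (sym (≡⇒≡ᵇ≡ {v} eq) ∙ e)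

  κ-step : ∀ M l u → allowed l u ≡ true → κ (step l u) M ≡ ι (eqLetter l E) * (cnt M D u + cnt M N u) + ι (eqLetter l D) * cnt M N u
  κ-step M N u h = refl
  κ-step M D u h = cong (M N) (m∸n+n≡m (≤ᵇ≡⇒≤ {n} {u} h)) ∙ sym (*-identityˡ (M N u))
  κ-step M E u h = cong₂ _+_ (sym (cong (λ c → if c then M D (u ∸ n) else 0) h)) (cong (M N) (m∸n+n≡m (≤ᵇ≡⇒≤ {n} {u} h))) ∙ sym (+-identityʳ _ ∙ *-identityˡ _)

  positive≡ : ∀ c z → positive c z ≡ ι (0 <ᵇ c) * z
  positive≡ zero z = refl
  positive≡ (suc c) z = sym (*-identityˡ z)

  branch-H : ∀ M u l → u < top → branch M u (λ M' _ → H M') l ≡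
    ι (0 <ᵇ cnt M l u) * (q ^ (ι (eqLetter l E) * (cnt M D u + cnt M N u) + ι (eqLetter l D) * cnt M N u) * rest-local M u l) * others M u
  branch-H M u l u<top with 0 <ᵇ cnt M l u in e
  ... | false = refl
  ... | true = cong₂ (λ x y → 1 * (q ^ x * y)) (κ-step M l u (proj₁ (present⇒ M l u (<ᵇ≡⇒< {0} e)))) (H-⊖ M u l u<top (<ᵇ≡⇒< {0} e)) ∙
    arith (q ^ (ι (eqLetter l E) * (cnt M D u + cnt M N u) + ι (eqLetter l D) * cnt M N u)) (rest-local M u l) (others M u)
    where
    arith : ∀ a b c → 1 * (a * (b * c)) ≡ 1 * (a * b) * c
    arith = solve-∀

  H-step : ∀ M u → u < top → 0 < out M u →
    H M ≡ branch M u (λ M' _ → H M') N + (branch M u (λ M' _ → H M') D + branch M u (λ M' _ → H M') E)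
  H-step M u u<top h = ∏-extract top (local M) u<top
    ∙ cong (_* others M u) (multinomial-step cE cD cN h ∙ cong₂ _+_ (positive≡ cE _) (cong₂ _+_ (positive≡ cD _) (positive≡ cN _)))
    ∙ cong (_* others M u) (cong₂ _+_ (cong (ι (0 <ᵇ cE) *_) (cong₂ (λ x y → q ^ x * y) (e1 (cD + cN)) (cong (λ c → multinomial c cD cN) (pred≡ cE)))) (cong₂ _+_ (cong (ι (0 <ᵇ cD) *_) (cong₂ (λ x y → q ^ x * y) (sym (*-identityˡ cN)) (cong (λ c → multinomial cE c cN) (pred≡ cD)))) (cong (ι (0 <ᵇ cN) *_) (cong (multinomial cE cD) (pred≡ cN) ∙ sym (*-identityˡ (multinomial cE cD (cN ∸ 1)))))))
    ∙ arith gE gD gN (others M u)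
    ∙ sym (cong₂ _+_ (branch-H M u N u<top) (cong₂ _+_ (branch-H M u D u<top) (branch-H M u E u<top)))
    where
    cE = cnt M E u
    cD = cnt M D u
    cN = cnt M N u
    gE = ι (0 <ᵇ cE) * (q ^ (1 * (cD + cN) + 0) * multinomial (cE ∸ 1) cD cN)
    gD = ι (0 <ᵇ cD) * (q ^ (1 * cN) * multinomial cE (cD ∸ 1) cN)
    gN = ι (0 <ᵇ cN) * (1 * multinomial cE cD (cN ∸ 1))
    e1 : ∀ x → x ≡ 1 * x + 0
    e1 = solve-∀
    pred≡ : ∀ c → pred c ≡ c ∸ 1
    pred≡ zero = refl
    pred≡ (suc c) = refl
    arith : ∀ a b c r → (a + (b + c)) * r ≡ c * r + (b * r + a * r)
    arith = solve-∀

  size : Graph → ℕ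
  size M = Σ< top (out M)

  size-⊞ : ∀ M M' → size (M ⊞ M') ≡ size M + size M'
  size-⊞ M M' = Σ-cong (upTo top) (out-⊞ M M') ∙ Σ-+ (out M) (out M') (upTo top)

  size-cong : ∀ {M M'} → M ≐ M' → size M ≡ size M'
  size-cong h = Σ-cong (upTo top) λ v → out-cong v h

  size-single : ∀ s → src s < top → size (single s) ≡ 1
  size-single s h = (Σ-cong (upTo top) λ v → out-single s v ∙ sym (*-identityʳ _)) ∙ Σ-upTo-δ top (λ _ → 1) h

  size-mult : ∀ w → (∀ {s} → s ∈ w → src s < top) → size (mult w) ≡ length w
  size-mult [] h = Σ-upTo-vanish top λ {v} _ → out-mult [] v
  size-mult (s ∷ w) h = size-⊞ (single s) (mult w) ∙ cong₂ _+_ (size-single s (h (here refl))) (size-mult w (h ∘ there))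

  size-0 : ∀ {M} → Bounded b M → size M ≡ 0 → ∀ l ℓ → M l ℓ ≡ 0
  size-0 {M} bd z l ℓ with ℓ <? b
  ... | no h = bd l ℓ (≮⇒≥ h)
  ... | yes ℓ<b = n≤0⇒n≡0 (by l ≤∙ term≤Σ (out M) (upTo top) (∈-upTo⁺ (in-range l)) ≤∙ ≤-reflexive z)
    where
    vertex : Letter → ℕ
    vertex N = ℓ
    vertex D = ℓ + n
    vertex E = ℓ + n
    in-range : ∀ l → vertex l < top
    in-range N = <-≤-trans ℓ<b (m≤m+n b (m + n))
    in-range D = +-mono-<-≤ ℓ<b (m≤n+m n m)
    in-range E = +-mono-<-≤ ℓ<b (m≤n+m n m)
    by : ∀ l → M l ℓ ≤ out M (vertex l)
    by N = cnt≤out M N ℓ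
    by D = ≤-reflexive (sym (delay-+ n (M D) ℓ)) ≤∙ cnt≤out M D (ℓ + n)
    by E = ≤-reflexive (sym (delay-+ n (M E) ℓ)) ≤∙ cnt≤out M E (ℓ + n)

  τ : Graph → ℕ
  τ M = ι (M N 0 ≡ᵇ 0) * H M

  τ-cong : ∀ {M M'} → M ≐ M' → τ M ≡ τ M'
  τ-cong h = cong₂ (λ x y → ι (x ≡ᵇ 0) * y) (h N 0) (H-cong h)

  runs : ℕ → Graph → ℕ → ℕ
  runs i M u = Σ (words3 i) λ ls → ι (valid u ls) * (ι (fits M (locate u ls)) * (q ^ energy M (locate u ls) * τ (M ∖ locate u ls)))

  runs-suc : ∀ i M u → runs (suc i) M u ≡ branch M u (runs i) N + (branch M u (runs i) D + branch M u (runs i) E)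
  runs-suc i M u = Σ-words3 i _ ∙ cong₂ _+_ (part N) (cong₂ _+_ (part D) (part E))
    where
    part : ∀ l → Σ (words3 i) (λ ls → ι (valid u (l ∷ ls)) * (ι (fits M (locate u (l ∷ ls))) * (q ^ energy M (locate u (l ∷ ls)) * τ (M ∖ locate u (l ∷ ls))))) ≡ branch M u (runs i) l
    part l = Σ-cong (words3 i) pt ∙ Σ-*ˡ (ι (0 <ᵇ cnt M l u)) _ (words3 i) ∙ cong (ι (0 <ᵇ cnt M l u) *_) (Σ-*ˡ (q ^ κ s M) _ (words3 i))
      where
      s = step l u
      arith : ∀ a v p f x y t → a * v * (p * f * (x * y * t)) ≡ a * p * (x * (v * (f * (y * t))))
      arith = solve-∀
      pt : ∀ ls → _ ≡ ι (0 <ᵇ cnt M l u) * (q ^ κ s M * (ι (valid (tgt s) ls) * (ι (fits (M ⊖ s) (locate (tgt s) ls)) * (q ^ energy (M ⊖ s) (locate (tgt s) ls) * τ ((M ⊖ s) ∖ locate (tgt s) ls)))))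
      pt ls = cong₂ _*_ (ι-∧ (allowed l u) _) (cong₂ _*_ (ι-∧ (0 <ᵇ M at' s) _) (cong₂ _*_ (^-distribˡ-+-* q (κ s M) _) (τ-cong λ k ℓ → sym (∸-+-assoc (M k ℓ) (single s k ℓ) (mult w k ℓ)))))
        ∙ arith (ι (allowed l u)) (ι (valid (tgt s) ls)) (ι (0 <ᵇ M at' s)) (ι (fits (M ⊖ s) w)) (q ^ κ s M) (q ^ energy (M ⊖ s) w) (τ ((M ⊖ s) ∖ w))
        ∙ cong (_* (q ^ κ s M * (ι (valid (tgt s) ls) * (ι (fits (M ⊖ s) w) * (q ^ energy (M ⊖ s) w * τ ((M ⊖ s) ∖ w)))))) (present M l u)
        where
        w = locate (tgt s) ls

  BalancedFrom : ℕ → Graph → Set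
  BalancedFrom u M = ∀ v → out M v + ι (0 ≡ᵇ v) ≡ inn M v + ι (u ≡ᵇ v)

  balanced-step : ∀ {u M} l → BalancedFrom u M → 0 < cnt M l u → BalancedFrom (tgt (step l u)) (M ⊖ step l u)
  balanced-step {u} {M} l bal h v = +-cancelˡ-≡ (ι (u ≡ᵇ v)) _ _ (sym (+-assoc (ι (u ≡ᵇ v)) _ _)
    ∙ cong (λ x → ι (x ≡ᵇ v) + out (M ⊖ s) v + ι (0 ≡ᵇ v)) (sym (src-step l (proj₁ pr)))
    ∙ cong (λ x → x + out (M ⊖ s) v + ι (0 ≡ᵇ v)) (sym (out-single s v))
    ∙ cong (_+ ι (0 ≡ᵇ v)) (sym (out-cong v split ∙ out-⊞ (single s) (M ⊖ s) v))
    ∙ bal v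
    ∙ cong (_+ ι (u ≡ᵇ v)) (inn-cong v split ∙ inn-⊞ (single s) (M ⊖ s) v ∙ cong (_+ inn (M ⊖ s) v) (inn-single s v))
    ∙ arith (ι (tgt s ≡ᵇ v)) (inn (M ⊖ s) v) (ι (u ≡ᵇ v)))
    where
    s = step l u
    pr = present⇒ M l u h
    split = ⊖-split M s (proj₂ pr)
    arith : ∀ a b c → a + b + c ≡ c + (b + a)
    arith = solve-∀

  size-step : ∀ {j u M} l → Bounded b M → size M ≤ suc j → 0 < cnt M l u → size (M ⊖ step l u) ≤ j
  size-step {j} {u} {M} l bd le h = ≤-pred (≤-reflexive (sym (size-cong (⊖-split M s (proj₂ pr)) ∙ size-⊞ (single s) (M ⊖ s) ∙ cong (_+ size (M ⊖ s)) (size-single s src<))) ≤∙ le)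
    where
    s = step l u
    pr = present⇒ M l u h
    src< : src s < top
    src< = subst (_< top) (sym (src-step l (proj₁ pr))) (out>0⇒<top {M} bd (<-≤-trans h (cnt≤out M l u)))

  runs-0 : ∀ M u → runs 0 M u ≡ ι (u ≡ᵇ 0) * τ M
  runs-0 M u = arith (ι (u ≡ᵇ 0)) (τ M)
    where
    arith : ∀ a t → a * (1 * (1 * t)) + 0 ≡ a * t
    arith = solve-∀

  stuck : ∀ {M u} → 0 < n → BalancedFrom u M → out M u ≡ 0 → u ≡ 0 × τ M ≡ H M
  stuck {M} {u} n>0 bal z = sym (≡ᵇ≡⇒≡ {0} {u} (ι≢0 λ e → 1+n≢0 (+-comm 1 _ ∙ sym (bal u ∙ cong (λ c → inn M u + ι c) (≡⇒≡ᵇ≡ {u} refl)) ∙ cong₂ _+_ z e))) ,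
    trans (cong (λ c → ι (c ≡ᵇ 0) * H M) (n≤0⇒n≡0 (cnt≤out M N 0 ≤∙ ≤-reflexive (subst (λ v → out M v ≡ 0) (sym (≡ᵇ≡⇒≡ {0} {u} (ι≢0 λ e → 1+n≢0 (+-comm 1 _ ∙ sym (bal u ∙ cong (λ c → inn M u + ι c) (≡⇒≡ᵇ≡ {u} refl)) ∙ cong₂ _+_ z e)))) z)))) (*-identityˡ (H M))

  τ-blocked : ∀ {M} u → 0 < n → 0 < out M u → ι (u ≡ᵇ 0) * τ M ≡ 0
  τ-blocked {M} zero n>0 h = *-identityˡ _ ∙ cong (λ c → ι c * H M) (≢⇒≡ᵇ≡ (>⇒≢ (subst (0 <_) (cong₂ _+_ (delay-< n (M E) n>0) (cong (_+ M N 0) (delay-< n (M D) n>0))) h)))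
  τ-blocked (suc u) n>0 h = refl

  total-runs : 0 < n → ∀ j M u → Bounded b M → size M ≤ j → BalancedFrom u M → Σ< (suc j) (λ i → runs i M u) ≡ H M
  total-runs n>0 j M u bd le bal with out M u ≟ 0
  ... | yes z = Σ-upTo-suc j (λ i → runs i M u) ∙ cong₂ _+_ (runs-0 M u ∙ cong₂ (λ x y → ι (x ≡ᵇ 0) * y) (proj₁ st) (proj₂ st) ∙ *-identityˡ _)
      (Σ-upTo-vanish j λ {i} _ → runs-suc i M u ∙ cong₂ _+_ (none N i) (cong₂ _+_ (none D i) (none E i))) ∙ +-identityʳ _
    where
    st = stuck {M} n>0 bal z
    none : ∀ l i → branch M u (runs i) l ≡ 0
    none l i = branch-0 M u (runs i) l (n≤0⇒n≡0 (cnt≤out M l u ≤∙ ≤-reflexive z))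
  total-runs n>0 zero M u bd le bal | no nz = contradiction (n≤0⇒n≡0 (term≤Σ (out M) (upTo top) (∈-upTo⁺ (out>0⇒<top {M} bd (n≢0⇒n>0 nz))) ≤∙ le)) nz
  total-runs n>0 (suc j) M u bd le bal | no nz = Σ-upTo-suc (suc j) (λ i → runs i M u)
    ∙ cong₂ _+_ (runs-0 M u ∙ τ-blocked {M} u n>0 (n≢0⇒n>0 nz)) (Σ-cong (upTo (suc j)) λ i → runs-suc i M u)
    ∙ Σ-+ (λ i → branch M u (runs i) N) (λ i → branch M u (runs i) D + branch M u (runs i) E) (upTo (suc j)) ∙ cong₂ _+_ (part N) (Σ-+ (λ i → branch M u (runs i) D) (λ i → branch M u (runs i) E) (upTo (suc j)) ∙ cong₂ _+_ (part D) (part E))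
    ∙ sym (H-step M u (out>0⇒<top {M} bd (n≢0⇒n>0 nz)) (n≢0⇒n>0 nz))
    where
    part : ∀ l → Σ< (suc j) (λ i → branch M u (runs i) l) ≡ branch M u (λ M' _ → H M') l
    part l = Σ-*ˡ (ι (0 <ᵇ cnt M l u)) _ (upTo (suc j)) ∙ cong (ι (0 <ᵇ cnt M l u) *_) (Σ-*ˡ (q ^ κ (step l u) M) _ (upTo (suc j))) ∙
      (branch-cong M u l {λ M' u' → Σ< (suc j) (λ i → runs i M' u')} {λ M' _ → H M'} λ h →
        total-runs n>0 j (M ⊖ step l u) (tgt (step l u)) (⊖-bounded (step l u) bd) (size-step {j} {u} {M} l bd le h) (balanced-step {u} {M} l bal h))

words3-length : ∀ i {ls} → ls ∈ words3 i → length ls ≡ i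
words3-length zero (here refl) = refl
words3-length (suc i) ls∈ with ∈-concat⁻′ (map (λ ls → (N ∷ ls) ∷ (D ∷ ls) ∷ (E ∷ ls) ∷ []) (words3 i)) ls∈
... | xs , ls∈xs , xs∈ with ∈-map⁻ (λ ls → (N ∷ ls) ∷ (D ∷ ls) ∷ (E ∷ ls) ∷ []) xs∈
... | ls' , ls'∈ , refl with ls∈xs
... | here refl = cong suc (words3-length i ls'∈)
... | there (here refl) = cong suc (words3-length i ls'∈)
... | there (there (here refl)) = cong suc (words3-length i ls'∈)

enc : ℕ → Graph → List ℕ
enc zero M = []
enc (suc b) M = M N b ∷ M D b ∷ M E b ∷ enc b M

enc-cong : ∀ b {M M'} → M ≐ M' → enc b M ≡ enc b M'
enc-cong zero h = refl
enc-cong (suc b) h = cong₂ _∷_ (h N b) (cong₂ _∷_ (h D b) (cong₂ _∷_ (h E b) (enc-cong b h)))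

enc-injective : ∀ b {M M'} → Bounded b M → Bounded b M' → enc b M ≡ enc b M' → M ≐ M'
enc-injective b {M} {M'} bd bd' e l ℓ with ℓ <? b
... | no h = bd l ℓ (≮⇒≥ h) ∙ sym (bd' l ℓ (≮⇒≥ h))
... | yes h = go b e h
  where
  head3 : ∀ {x y z x' y' z' : ℕ} {xs xs' : List ℕ} → _≡_ {A = List ℕ} (x ∷ y ∷ z ∷ xs) (x' ∷ y' ∷ z' ∷ xs') → x ≡ x' × y ≡ y' × z ≡ z' × xs ≡ xs'
  head3 refl = refl , refl , refl , refl
  at-b : ∀ l {k} → M N k ≡ M' N k → M D k ≡ M' D k → M E k ≡ M' E k → M l k ≡ M' l k
  at-b N x y z = x
  at-b D x y z = y
  at-b E x y z = z
  go : ∀ k → enc k M ≡ enc k M' → ∀ {i} → i < k → M l i ≡ M' l i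
  go (suc k) e {i} i<k with head3 e | i ≟ k
  ... | x , y , z , _ | yes refl = at-b l x y z
  ... | _ , _ , _ , rest | no i≢k = go k rest (≤∧≢⇒< (≤-pred i<k) i≢k)

mult-bounded : ∀ b w → (∀ {s} → s ∈ w → proj₂ s < b) → Bounded b (mult w)
mult-bounded b w h l ℓ b≤ℓ = Σ-vanish w λ {s} s∈ → cong ι (≢true⇒false λ e → <⇒≱ (h s∈) (b≤ℓ ≤∙ ≤-reflexive (sym (cong proj₂ (eqStep⇒≡ {s} {l , ℓ} e)))))

transpose-bounded : ∀ {b M} → Bounded b M → Bounded b (transpose M)
transpose-bounded bd l = bd (swapL l)

transpose-transpose : ∀ M → transpose (transpose M) ≐ M
transpose-transpose M l ℓ = cong (λ k → M k ℓ) (swapL-involutive l)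

-- Both sides times the product of all [M l ℓ]! are the product of the q-factorials of the degrees.
H-transpose : ∀ q m n b M → Bounded b M → Walks.Balanced m n M → Routing.H q m n b M ≡ Routing.H q n m b (transpose M)
H-transpose q m n b M bd bal = *-cancelʳ-≡ _ _ facts {{>-nonZero facts>0}} (factorials m n M bd
  ∙ ∏-cong R.top (λ v _ → cong [_]! (bal v))
  ∙ cong (λ t → ∏ (b + t) (λ v → [ W.inn M v ]!)) (+-comm m n)
  ∙ sym (factorials n m (transpose M) (transpose-bounded bd))
  ∙ cong (R'.H (transpose M) *_) (arith (fact N) (fact D) (fact E)))
  where
  open QAnalog q
  module W = Walks m n
  module W' = Walks n m
  module R = Routing q m n b
  module R' = Routing q n m b
  fact : Letter → ℕ
  fact l = ∏ b (λ ℓ → [ M l ℓ ]!)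
  facts = fact E * fact D * fact N
  facts>0 : 0 < facts
  facts>0 = *-mono-≤ (*-mono-≤ (∏>0 b {λ ℓ → [ M E ℓ ]!} λ ℓ → []!>0 (M E ℓ)) (∏>0 b {λ ℓ → [ M D ℓ ]!} λ ℓ → []!>0 (M D ℓ))) (∏>0 b {λ ℓ → [ M N ℓ ]!} λ ℓ → []!>0 (M N ℓ))
  arith : ∀ x y z → x * y * z ≡ z * y * x
  arith = solve-∀
  factorials : ∀ m n M → Bounded b M → Routing.H q m n b M * (∏ b (λ ℓ → [ M E ℓ ]!) * ∏ b (λ ℓ → [ M D ℓ ]!) * ∏ b (λ ℓ → [ M N ℓ ]!)) ≡ ∏ (b + (m + n)) (λ v → [ Walks.out m n M v ]!)
  factorials m n M bd = cong (H *_) (sym (cong₂ _*_ (cong₂ _*_ (∏-delay [_]! b n m (M E) refl (bd E)) (∏-delay [_]! b n m (M D) refl (bd D))) (cong (λ t → ∏ (b + t) (λ v → [ M N v ]!)) (sym (+-identityʳ (m + n))) ∙ ∏-delay [_]! b 0 (m + n) (M N) refl (bd N))))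
    ∙ cong (H *_) (cong (_* ∏ t (λ v → [ M N v ]!)) (sym (∏-* t _ _)) ∙ sym (∏-* t _ _))
    ∙ sym (∏-* t _ _)
    ∙ ∏-cong t (λ v _ → multinomial-! (delay n (M E) v) (delay n (M D) v) (M N v))
    where
    H = Routing.H q m n b M
    t = b + (m + n)

size-transpose : ∀ q m n b M → Walks.Balanced m n M → Routing.size q n m b (transpose M) ≡ Routing.size q m n b M
size-transpose q m n b M bal = cong (λ t → Σ< (b + t) (Walks.inn m n M)) (+-comm n m) ∙ (Σ-cong (upTo (b + (m + n))) λ v → sym (bal v))

module ExactRuns (q m n b : ℕ) where

  open Walks m n
  open Routing q m n b

  κ-0 : ∀ s {C} → (∀ l ℓ → C l ℓ ≡ 0) → κ s C ≡ 0
  κ-0 (N , ℓ) z = refl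
  κ-0 (D , ℓ) z = z N (ℓ + n)
  κ-0 (E , ℓ) z = cong₂ _+_ (z D ℓ) (z N (ℓ + n))

  τ-0 : ∀ {C} → (∀ l ℓ → C l ℓ ≡ 0) → τ C ≡ 1
  τ-0 {C} z = τ-cong z ∙ *-identityˡ _ ∙ (∏-1 top λ v _ → cong₂ (λ x y → multinomial' x y) (delay-0 n v) (delay-0 n v))
    where
    multinomial' : ℕ → ℕ → ℕ
    multinomial' x y = QAnalog.multinomial q x y 0

  src-bound : ∀ s → proj₂ s < b → src s < top
  src-bound (N , ℓ) h = <-≤-trans h (m≤m+n b (m + n))
  src-bound (D , ℓ) h = +-mono-<-≤ h (m≤n+m n m)
  src-bound (E , ℓ) h = +-mono-<-≤ h (m≤n+m n m)

  transfer : Graph → List Letter → ℕ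
  transfer M ls = ι (fits M (locate 0 ls)) * (q ^ Σ (locate 0 ls) (λ s → κ s (M ∖ locate 0 ls)) * τ (M ∖ locate 0 ls))

  runs-transfer : ∀ i M → runs i M 0 ≡ Σ (words3 i) (λ ls → transfer M ls * (ι (valid 0 ls) * q ^ inv (locate 0 ls)))
  runs-transfer i M = Σ-cong (words3 i) pt
    where
    arith : ∀ v p x y t → v * (p * (x * y * t)) ≡ p * (y * t) * (v * x)
    arith = solve-∀
    pt : ∀ ls → ι (valid 0 ls) * (ι (fits M (locate 0 ls)) * (q ^ energy M (locate 0 ls) * τ (M ∖ locate 0 ls))) ≡ transfer M ls * (ι (valid 0 ls) * q ^ inv (locate 0 ls))
    pt ls with fits M (locate 0 ls) in e
    ... | false = *-zeroʳ (ι (valid 0 ls))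
    ... | true = cong (λ x → ι (valid 0 ls) * (1 * (x * τ (M ∖ w)))) (cong (q ^_) (energy-split w {M} {M ∖ w} λ l ℓ → sym (m+[n∸m]≡n (fits⇒mult≤ M w e l ℓ))) ∙ ^-distribˡ-+-* q (inv w) _) ∙
      arith (ι (valid 0 ls)) 1 (q ^ inv w) _ _
      where
      w = locate 0 ls

  exact-runs : ∀ i M (p : List Letter → Bool) → Bounded b M → size M ≡ i →
    (∀ {ls} → ls ∈ words3 i → ∀ {s} → s ∈ locate 0 ls → proj₂ s < b) →
    (∀ {ls} → ls ∈ words3 i → p ls ≡ true → mult (locate 0 ls) ≐ M) →
    (∀ {ls} → ls ∈ words3 i → mult (locate 0 ls) ≐ M → p ls ≡ true) →
    runs i M 0 ≡ Σ (words3 i) (λ ls → ι (p ls) * (ι (valid 0 ls) * q ^ inv (locate 0 ls)))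
  exact-runs i M p bd sz small sound complete = Σ-cong-∈ (words3 i) λ {ls} → pt ls
    where
    pt : ∀ ls → ls ∈ words3 i → ι (valid 0 ls) * (ι (fits M (locate 0 ls)) * (q ^ energy M (locate 0 ls) * τ (M ∖ locate 0 ls))) ≡ ι (p ls) * (ι (valid 0 ls) * q ^ inv (locate 0 ls))
    pt ls ls∈ with fits M (locate 0 ls) in e
    ... | false rewrite ≢true⇒false {p ls} (λ t → true≢false (sym (mult≤⇒fits M (locate 0 ls) λ l ℓ → ≤-reflexive (sound ls∈ t l ℓ)) ∙ e)) = *-zeroʳ (ι (valid 0 ls))
    ... | true = cong (ι (valid 0 ls) *_) (*-identityˡ _ ∙ cong₂ (λ x y → q ^ x * y) energy≡ (τ-0 K-0) ∙ *-identityʳ _) ∙ sym (cong (λ t → ι t * (ι (valid 0 ls) * q ^ inv w)) (complete ls∈ full) ∙ *-identityˡ _)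
      where
      w = locate 0 ls
      K = M ∖ w
      whole : (mult w ⊞ K) ≐ M
      whole l ℓ = m+[n∸m]≡n (fits⇒mult≤ M w e l ℓ)
      size-K : size K ≡ 0
      size-K = +-cancelˡ-≡ i _ _ (cong (_+ size K) (sym ((size-mult w λ {s} s∈ → src-bound s (small ls∈ s∈)) ∙ length-locate 0 ls ∙ words3-length i ls∈)) ∙ sym (size-⊞ (mult w) K) ∙ size-cong whole ∙ sz ∙ sym (+-identityʳ i))
      K-0 : ∀ l ℓ → K l ℓ ≡ 0
      K-0 = size-0 {K} (λ l ℓ h → cong (_∸ mult w l ℓ) (bd l ℓ h) ∙ 0∸n≡0 (mult w l ℓ)) size-K
      full : mult w ≐ M
      full l ℓ = sym (+-identityʳ _) ∙ cong (mult w l ℓ +_) (sym (K-0 l ℓ)) ∙ whole l ℓ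
      energy≡ : energy M w ≡ inv w
      energy≡ = (energy-split w {M} {K} λ l ℓ → sym (whole l ℓ)) ∙ cong (inv w +_) (Σ-vanish w λ {s} _ → κ-0 s {K} K-0) ∙ +-identityʳ _

module ClosedWalks (m n : ℕ) (m>0 : 0 < m) (n>0 : 0 < n) where

  module W = Walks m n
  module W' = Walks n m
  module T = Transposition m n
  module T' = Transposition n m

  loop : List Letter → List Step
  loop = W.locate 0

  loop' : List Letter → List Step
  loop' = W'.locate 0

  module _ (I : ℕ) where

    bound : ℕ
    bound = suc (I * (m + n))

    base< : ∀ ls → length ls ≤ I → ∀ {s} → s ∈ loop ls → proj₂ s < bound
    base< ls le s∈ = s≤s (W.base-bound 0 ls s∈ ≤∙ *-monoˡ-≤ (m + n) le)

    base<' : ∀ ls → length ls ≤ I → ∀ {s} → s ∈ loop' ls → proj₂ s < bound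
    base<' ls le s∈ = s≤s (W'.base-bound 0 ls s∈ ≤∙ ≤-reflexive (cong (length ls *_) (+-comm n m)) ≤∙ *-monoˡ-≤ (m + n) le)

    loop-bounded : ∀ ls → length ls ≤ I → Bounded bound (mult (loop ls))
    loop-bounded ls le = mult-bounded bound (loop ls) (base< ls le)

    loop'-bounded : ∀ ls → length ls ≤ I → Bounded bound (transpose (mult (loop' ls)))
    loop'-bounded ls le = transpose-bounded (mult-bounded bound (loop' ls) (base<' ls le))

    class class' : List Letter → List ℕ
    class ls = enc bound (mult (loop ls))
    class' ls = enc bound (transpose (mult (loop' ls)))

    class≡⇒≐ : ∀ {ls ls'} → length ls ≤ I → length ls' ≤ I → class ls ≡ class' ls' → mult (loop ls) ≐ transpose (mult (loop' ls'))
    class≡⇒≐ {ls} {ls'} le le' = enc-injective bound (loop-bounded ls le) (loop'-bounded ls' le')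

    lengths : ∀ {i ls} → i ≤ I → ls ∈ words3 i → length ls ≤ I
    lengths {i} le ls∈ = ≤-reflexive (words3-length i ls∈) ≤∙ le

    module Weighted (q : ℕ) where

      module R = Routing q m n bound
      module R' = Routing q n m bound
      module X = ExactRuns q m n bound
      module X' = ExactRuns q n m bound

      weight0 weight0' : List Letter → ℕ
      weight0 ls = ι (W.valid 0 ls) * q ^ W.inv (loop ls)
      weight0' ls = ι (W'.valid 0 ls) * q ^ W'.inv (loop' ls)

      Equidistributed : ℕ → Set
      Equidistributed i = ∀ c → Σ (words3 i) (λ ls → ι (eqList (class ls) c) * weight0 ls) ≡ Σ (words3 i) (λ ls → ι (eqList (class' ls) c) * weight0' ls)

      module _ (M : Graph) (bd : Bounded bound M) (bal : W.Balanced M) where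

        φ φ' : List Letter → ℕ
        φ = X.transfer M
        φ' = X'.transfer (transpose M)

        compatible : ∀ {ls ls'} → W.valid 0 ls ≡ true → mult (loop ls) ≐ transpose (mult (loop' ls')) → φ ls ≡ φ' ls'
        compatible {ls} {ls'} ok same with fits M (loop ls) in e
        ... | false rewrite ≢true⇒false {fits (transpose M) (loop' ls')} (λ t → true≢false (sym (mult≤⇒fits M (loop ls) λ l ℓ → ≤-reflexive (same l ℓ) ≤∙ fits⇒mult≤ (transpose M) (loop' ls') t (swapL l) ℓ ≤∙ ≤-reflexive (transpose-transpose M l ℓ)) ∙ e)) = refl
        ... | true rewrite mult≤⇒fits (transpose M) (loop' ls') (λ l ℓ → ≤-reflexive (cong (λ k → mult (loop' ls') k ℓ) (sym (swapL-involutive l)) ∙ sym (same (swapL l) ℓ)) ≤∙ fits⇒mult≤ M (loop ls) e (swapL l) ℓ) =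
          cong (1 *_) (cong₂ (λ x y → q ^ x * y) κ≡ τ≡)
          where
          w = loop ls
          w' = loop' ls'
          K = M ∖ w
          walk = W.valid⇒walk 0 ls ok
          K-balanced : W.Balanced K
          K-balanced = T.balanced-∖ M w bal walk e
          mult' : mult w' ≐ mult (map swapS w)
          mult' l ℓ = cong (λ k → mult w' k ℓ) (sym (swapL-involutive l)) ∙ sym (same (swapL l) ℓ) ∙ sym (mult-swap w l ℓ)
          K'≐ : (transpose M ∖ w') ≐ transpose K
          K'≐ l ℓ = cong (M (swapL l) ℓ ∸_) (mult' l ℓ ∙ mult-swap w l ℓ)
          κ≡ : Σ w (λ s → W.κ s K) ≡ Σ w' (λ s → W'.κ s (transpose M ∖ w'))
          κ≡ = T.cross m>0 n>0 K K-balanced w walk ∙ sym (Σ-map (λ s → W'.κ s (transpose K)) swapS w) ∙ (Σ-mult _ (map swapS w) w' λ l ℓ → sym (mult' l ℓ)) ∙ (Σ-cong w' λ s → W'.κ-cong s λ l ℓ → sym (K'≐ l ℓ))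
          τ≡ : R.τ K ≡ R'.τ (transpose M ∖ w')
          τ≡ = cong₂ (λ x y → ι (x ≡ᵇ 0) * y) at-0 (H-transpose q m n bound K (λ l ℓ h → cong (_∸ mult w l ℓ) (bd l ℓ h) ∙ 0∸n≡0 (mult w l ℓ)) K-balanced) ∙ sym (R'.τ-cong K'≐)
            where
            at-0 : K N 0 ≡ K E 0
            at-0 = sym (cong₂ _+_ (delay-< n (K E) n>0) (cong (_+ K N 0) (delay-< n (K D) n>0))) ∙ K-balanced 0 ∙ cong₂ _+_ (delay-< m (K N) m>0) (cong (_+ K E 0) (delay-< m (K D) m>0))

        equidistributed-class : ∀ i → i ≤ I → (∀ {j} → j < i → Equidistributed j) → R.size M ≡ i →
          Σ (words3 i) (λ ls → ι (eqList (class ls) (enc bound M)) * weight0 ls) ≡ Σ (words3 i) (λ ls → ι (eqList (class' ls) (enc bound M)) * weight0' ls)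
        equidistributed-class i i≤I rec sz = sym exact ∙ last ∙ exact'
          where
          sz' : R'.size (transpose M) ≡ i
          sz' = size-transpose q m n bound M bal ∙ sz
          balT : W'.Balanced (transpose M)
          balT v = sym (bal v)
          total : Σ< (suc i) (λ j → R.runs j M 0) ≡ Σ< (suc i) (λ j → R'.runs j (transpose M) 0)
          total = R.total-runs n>0 i M 0 bd (≤-reflexive sz) (λ v → cong (_+ ι (0 ≡ᵇ v)) (bal v)) ∙
            H-transpose q m n bound M bd bal ∙ sym (R'.total-runs m>0 i (transpose M) 0 (transpose-bounded bd) (≤-reflexive sz') (λ v → cong (_+ ι (0 ≡ᵇ v)) (balT v)))
          earlier : ∀ {j} → j < i → R.runs j M 0 ≡ R'.runs j (transpose M) 0
          earlier {j} j<i = X.runs-transfer j M ∙ (Σ-classes (words3 j) (words3 j) weight0 weight0' class class' φ φ' (rec j<i) λ {ls} {ls'} ls∈ ls'∈ ne ne' ce →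
            compatible {ls} {ls'} (ι≢0 (proj₁ (*-≢0 {ι (W.valid 0 ls)} ne))) (class≡⇒≐ {ls} {ls'} (lengths j≤I ls∈) (lengths j≤I ls'∈) ce)) ∙ sym (X'.runs-transfer j (transpose M))
            where
            j≤I = <⇒≤ j<i ≤∙ i≤I
          last : R.runs i M 0 ≡ R'.runs i (transpose M) 0
          last = +-cancelˡ-≡ (Σ< i (λ j → R.runs j M 0)) _ _ (sym (Σ-upTo-snoc i (λ j → R.runs j M 0)) ∙ total ∙ Σ-upTo-snoc i (λ j → R'.runs j (transpose M) 0) ∙ cong (_+ R'.runs i (transpose M) 0) (sym (Σ-upTo-cong i earlier)))
          exact : R.runs i M 0 ≡ _
          exact = X.exact-runs i M (λ ls → eqList (class ls) (enc bound M)) bd sz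
            (λ {ls} ls∈ → base< ls (lengths i≤I ls∈))
            (λ {ls} ls∈ t → enc-injective bound (loop-bounded ls (lengths i≤I ls∈)) bd (eqList⇒≡ t))
            (λ ls∈ h → ≡⇒eqList (enc-cong bound h))
          exact' : R'.runs i (transpose M) 0 ≡ _
          exact' = X'.exact-runs i (transpose M) (λ ls → eqList (class' ls) (enc bound M)) (transpose-bounded bd) sz'
            (λ {ls} ls∈ → base<' ls (lengths i≤I ls∈))
            (λ {ls} ls∈ t l ℓ → cong (λ k → mult (loop' ls) k ℓ) (sym (swapL-involutive l)) ∙ enc-injective bound (loop'-bounded ls (lengths i≤I ls∈)) bd (eqList⇒≡ t) (swapL l) ℓ)
            (λ {ls} ls∈ h → ≡⇒eqList (enc-cong bound λ l ℓ → h (swapL l) ℓ ∙ transpose-transpose M l ℓ))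

      equidistributed : ∀ i → i ≤ I → Equidistributed i
      equidistributed = <-rec _ λ i rec i≤I c → go i (λ j<i → rec j<i (<⇒≤ j<i ≤∙ i≤I)) i≤I c
        where
        go : ∀ i → (∀ {j} → j < i → Equidistributed j) → i ≤ I → Equidistributed i
        go i rec i≤I c with Σ (words3 i) (λ ls → ι (eqList (class ls) c) * weight0 ls) ≟ 0 | Σ (words3 i) (λ ls → ι (eqList (class' ls) c) * weight0' ls) ≟ 0
        ... | yes z | yes z' = z ∙ sym z'
        ... | no ne | _ with Σ≢0⇒∃ (words3 i) ne
        ... | ls , ls∈ , f with eqList⇒≡ {class ls} {c} (ι≢0 (proj₁ (*-≢0 {ι (eqList (class ls) c)} f)))
        ... | refl = equidistributed-class (mult (loop ls)) (loop-bounded ls (lengths i≤I ls∈)) (T.walk-balanced (loop ls) (W.valid⇒walk 0 ls ok)) i i≤I rec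
          (R.size-mult (loop ls) (λ {s} s∈ → X.src-bound s (base< ls (lengths i≤I ls∈) s∈)) ∙ W.length-locate 0 ls ∙ words3-length i ls∈)
          where
          ok = ι≢0 (proj₁ (*-≢0 {ι (W.valid 0 ls)} (proj₂ (*-≢0 {ι (eqList (class ls) c)} f))))
        go i rec i≤I c | yes _ | no ne with Σ≢0⇒∃ (words3 i) ne
        ... | ls , ls∈ , f with eqList⇒≡ {class' ls} {c} (ι≢0 (proj₁ (*-≢0 {ι (eqList (class' ls) c)} f)))
        ... | refl = equidistributed-class (transpose (mult (loop' ls))) (loop'-bounded ls (lengths i≤I ls∈)) (λ v → sym (bal' v)) i i≤I rec
          (size-transpose q n m bound (mult (loop' ls)) bal' ∙ R'.size-mult (loop' ls) (λ {s} s∈ → X'.src-bound s (base<' ls (lengths i≤I ls∈) s∈)) ∙ W'.length-locate 0 ls ∙ words3-length i ls∈)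
          where
          ok = ι≢0 (proj₁ (*-≢0 {ι (W'.valid 0 ls)} (proj₂ (*-≢0 {ι (eqList (class' ls) c)} f))))
          bal' : W'.Balanced (mult (loop' ls))
          bal' = T'.walk-balanced (loop' ls) (W'.valid⇒walk 0 ls ok)

    walk-classes : ∀ i → i ≤ I → ∀ c → Σ (words3 i) (λ ls → ι (eqList (W.inv (loop ls) ∷ class ls) c) * ι (W.valid 0 ls)) ≡ Σ (words3 i) (λ ls → ι (eqList (W'.inv (loop' ls) ∷ class' ls) c) * ι (W'.valid 0 ls))
    walk-classes i i≤I [] = Σ-0 (words3 i) ∙ sym (Σ-0 (words3 i))
    walk-classes i i≤I (k ∷ c) = split (λ ls → W.inv (loop ls)) class (W.valid 0) ∙ trans
      (Σ-coefficients (words3 i) (words3 i) (λ ls → ι (eqList (class ls) c) * ι (W.valid 0 ls)) (λ ls → ι (eqList (class' ls) c) * ι (W'.valid 0 ls)) (W.inv ∘ loop) (W'.inv ∘ loop')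
        (λ q _ → (Σ-cong (words3 i) λ ls → *-assoc (ι (eqList (class ls) c)) _ _) ∙ Weighted.equidistributed q i i≤I c ∙ (Σ-cong (words3 i) λ ls → sym (*-assoc (ι (eqList (class' ls) c)) _ _))) k)
      (sym (split (λ ls → W'.inv (loop' ls)) class' (W'.valid 0)))
      where
      split : ∀ (e : List Letter → ℕ) (cl : List Letter → List ℕ) (ok : List Letter → Bool) →
        Σ (words3 i) (λ ls → ι (eqList (e ls ∷ cl ls) (k ∷ c)) * ι (ok ls)) ≡ Σ (words3 i) (λ ls → ι (e ls ≡ᵇ k) * (ι (eqList (cl ls) c) * ι (ok ls)))
      split e cl ok = Σ-cong (words3 i) λ ls → cong (_* ι (ok ls)) (ι-∧ (e ls ≡ᵇ k) _) ∙ *-assoc (ι (e ls ≡ᵇ k)) _ _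

-- Statistics of walks

pairs : (Step → Step → ℕ) → List Step → ℕ
pairs K [] = 0
pairs K (s ∷ w) = Σ w (K s) + pairs K w

pairs-cong : ∀ {K L} w → (∀ s t → K s t ≡ L s t) → pairs K w ≡ pairs L w
pairs-cong [] h = refl
pairs-cong (s ∷ w) h = cong₂ _+_ (Σ-cong w (h s)) (pairs-cong w h)

pairs-+ : ∀ K L w → pairs (λ s t → K s t + L s t) w ≡ pairs K w + pairs L w
pairs-+ K L [] = refl
pairs-+ K L (s ∷ w) = cong₂ _+_ (Σ-+ (K s) (L s) w) (pairs-+ K L w) ∙ arith (Σ w (K s)) _ _ _
  where
  arith : ∀ a b c d → (a + b) + (c + d) ≡ (a + c) + (b + d)
  arith = solve-∀

pairs-map : ∀ K (f : Step → Step) w → pairs K (map f w) ≡ pairs (λ s t → K (f s) (f t)) w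
pairs-map K f [] = refl
pairs-map K f (s ∷ w) = cong₂ _+_ (Σ-map (K (f s)) f w) (pairs-map K f w)

pairs-++ : ∀ K u v → pairs K (u ++ v) ≡ pairs K u + pairs K v + Σ u (λ s → Σ v (K s))
pairs-++ K [] v = sym (+-identityʳ _)
pairs-++ K (s ∷ u) v = cong₂ _+_ (Σ-++ (K s) u v) (pairs-++ K u v) ∙ arith (Σ u (K s)) (Σ v (K s)) (pairs K u) _ _
  where
  arith : ∀ a b c d e → (a + b) + (c + d + e) ≡ (a + c) + d + (b + e)
  arith = solve-∀

Σ-reverse : ∀ (f : Step → ℕ) w → Σ (reverse w) f ≡ Σ w f
Σ-reverse f [] = refl
Σ-reverse f (s ∷ w) = cong (λ l → Σ l f) (List.unfold-reverse s w) ∙ Σ-++ f (reverse w) (s ∷ []) ∙ cong₂ _+_ (Σ-reverse f w) (+-identityʳ (f s)) ∙ +-comm (Σ w f) (f s)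

pairs-reverse : ∀ K w → pairs K (reverse w) ≡ pairs (λ s t → K t s) w
pairs-reverse K [] = refl
pairs-reverse K (s ∷ w) = cong (pairs K) (List.unfold-reverse s w) ∙ pairs-++ K (reverse w) (s ∷ []) ∙
  cong₂ (λ x y → x + 0 + y) (pairs-reverse K w) ((Σ-cong (reverse w) λ t → +-identityʳ (K t s)) ∙ Σ-reverse (λ t → K t s) w) ∙ arith (pairs (λ s t → K t s) w) _
  where
  arith : ∀ a b → a + 0 + b ≡ b + a
  arith = solve-∀

Σ-pairsʷ : ∀ K w → Σ w (λ s → Σ w (K s)) ≡ pairs K w + pairs (λ s t → K t s) w + Σ w (λ s → K s s)
Σ-pairsʷ K [] = refl
Σ-pairsʷ K (s ∷ w) = cong (K s s + Σ w (K s) +_) (Σ-+ (λ t → K t s) (λ t → Σ w (K t)) w ∙ cong (Σ w (λ t → K t s) +_) (Σ-pairsʷ K w)) ∙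
  arith (K s s) (Σ w (K s)) (Σ w (λ t → K t s)) (pairs K w) (pairs (λ s t → K t s) w) (Σ w (λ t → K t t))
  where
  arith : ∀ k a b p q d → k + a + (b + (p + q + d)) ≡ (a + p) + (b + q) + (k + d)
  arith = solve-∀

ΣΣ-mult : ∀ (K : Step → Step → ℕ) u v → mult u ≐ mult v → Σ u (λ s → Σ u (K s)) ≡ Σ v (λ s → Σ v (K s))
ΣΣ-mult K u v h = (Σ-cong u λ s → Σ-mult (K s) u v h) ∙ Σ-mult (λ s → Σ v (K s)) u v h

guard : Bool → ℕ → ℕ
guard true x = x
guard false x = 0

northish eastish marked : Step → Bool
northish (N , _) = true
northish (D , _) = true
northish (E , _) = false
eastish (N , _) = false
eastish (D , _) = true
eastish (E , _) = true
marked (N , _) = false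
marked (D , _) = true
marked (E , _) = false

base : Step → ℕ
base = proj₂

northish-swap : ∀ s → northish (swapS s) ≡ eastish s
northish-swap (N , _) = refl
northish-swap (D , _) = refl
northish-swap (E , _) = refl

eastish-swap : ∀ s → eastish (swapS s) ≡ northish s
eastish-swap (N , _) = refl
eastish-swap (D , _) = refl
eastish-swap (E , _) = refl

marked-swap : ∀ s → marked (swapS s) ≡ marked s
marked-swap (N , _) = refl
marked-swap (D , _) = refl
marked-swap (E , _) = refl

-- A marked step counts both as an E step and as an N step.
eastNorth : (Step → Step → ℕ) → List Step → ℕ
eastNorth k w = pairs (λ s t → guard (eastish s ∧ northish t) (k s t)) w

closed : ℕ → ℕ → ℕ → ℕ
closed a b y = ι ((a ≤ᵇ y) ∧ (y ≤ᵇ b))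

guard-∧ : ∀ p q x → guard (p ∧ q) x ≡ guard (q ∧ p) x
guard-∧ true true x = refl
guard-∧ true false x = refl
guard-∧ false true x = refl
guard-∧ false false x = refl

guard-cong : ∀ b {x y} → x ≡ y → guard b x ≡ guard b y
guard-cong b refl = refl

module Stats (m n : ℕ) where

  open Walks m n

  marks : List Step → ℕ
  marks w = Σ w (λ s → ι (marked s))

  pdʷ cʷ lostʷ lmʷ tvʷ ddʷ zʷ λʷ : List Step → ℕ
  pdʷ w = eastNorth (λ s t → window (base t) (base t + (m + n)) (base s + n)) w + marks w
  cʷ w = eastNorth (λ s t → closed (base t) (base t + (m + n)) (base s + n)) w + marks w
  λʷ w = eastNorth (λ _ _ → 1) w + marks w
  lostʷ w = pairs (λ s t → guard (northish s ∧ marked t) (crossing (base t) m (base s)) + guard (marked s ∧ northish t) (window (base t) (base t + m) (base s))) w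
  tvʷ w = Σ w (λ s → Σ w (λ t → guard (northish s ∧ marked t) (window (base s) (base s + m) (base t))))
  ddʷ w = pairs (λ s t → guard (marked s ∧ marked t) (ι (base t ≡ᵇ base s))) w
  zʷ w = Σ w (λ t → guard (marked t) (ι (base t ≡ᵇ 0)))
  lmʷ w = tvʷ w + ddʷ w + zʷ w

  inv-pairs : ∀ w → inv w ≡ pairs (λ s t → κ s (single t)) w
  inv-pairs [] = refl
  inv-pairs (s ∷ w) = cong₂ _+_ (κ-mult s w) (inv-pairs w)
    where
    κ-mult : ∀ s w → κ s (mult w) ≡ Σ w (λ t → κ s (single t))
    κ-mult (N , ℓ) w = sym (Σ-0 w)
    κ-mult (D , ℓ) w = refl
    κ-mult (E , ℓ) w = sym (Σ-+ (λ t → single t D ℓ) (λ t → single t N (ℓ + n)) w)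

  telescope-pairs : ∀ (Φ : Step → ℕ → ℕ) {u v} w → Walk u w v →
    Σ w (λ t → Φ t u) + pairs (λ s t → Φ t (tgt s)) w ≡ Σ w (λ t → Φ t (src t)) + pairs (λ s t → Φ t (src s)) w
  telescope-pairs Φ [] _ = refl
  telescope-pairs Φ (s ∷ w) (refl , W) = arith1 (Φ s (src s)) (Σ w (λ t → Φ t (src s))) (Σ w (λ t → Φ t (tgt s))) (pairs (λ s t → Φ t (tgt s)) w) ∙ cong (Φ s (src s) + Σ w (λ t → Φ t (src s)) +_) (telescope-pairs Φ w W) ∙ arith2 (Φ s (src s)) (Σ w (λ t → Φ t (src s))) (Σ w (λ t → Φ t (src t))) (pairs (λ s t → Φ t (src s)) w)
    where
    arith1 : ∀ a b c d → a + b + (c + d) ≡ (a + b) + (c + d)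
    arith1 = solve-∀
    arith2 : ∀ a b c d → (a + b) + (c + d) ≡ (a + c) + (b + d)
    arith2 = solve-∀

  ≡ᵇ-sym : ∀ a b → (a ≡ᵇ b) ≡ (b ≡ᵇ a)
  ≡ᵇ-sym a b = bool-ext (λ t → ≡⇒≡ᵇ≡ {b} (sym (≡ᵇ≡⇒≡ {a} t))) (λ t → ≡⇒≡ᵇ≡ {a} (sym (≡ᵇ≡⇒≡ {b} t)))

  upcross : ∀ a b → window a (a + m) b + ι (b ≡ᵇ a) ≡ crossing b m a + ι (b ≡ᵇ a + m)
  upcross a b with <-cmp b a | <-cmp b (a + m)
  ... | tri< lt ne _ | _ rewrite ≮⇒<ᵇ≡ {a} {b} (<⇒≤ lt) | ≢⇒≡ᵇ≡ ne | ≰⇒≤ᵇ≡ {a} {b} lt | ≢⇒≡ᵇ≡ (<⇒≢ (<-≤-trans lt (m≤m+n a m))) = refl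
  ... | tri≈ _ refl _ | tri< lt ne _ rewrite ≮⇒<ᵇ≡ {b} {b} ≤-refl | ≡⇒≡ᵇ≡ {b} {b} refl | ≤⇒≤ᵇ≡ {b} {b} ≤-refl | <⇒<ᵇ≡ lt | ≢⇒≡ᵇ≡ ne = refl
  ... | tri≈ _ refl _ | tri≈ ¬lt eq _ rewrite ≮⇒<ᵇ≡ {b} {b} ≤-refl | ≤⇒≤ᵇ≡ {b} {b} ≤-refl | ≡⇒≡ᵇ≡ {b} {b} refl | ≮⇒<ᵇ≡ {b} {b + m} (≤-reflexive (sym eq)) | ≡⇒≡ᵇ≡ {b} {b + m} eq = refl
  ... | tri≈ _ refl _ | tri> _ _ gt = contradiction gt (≤⇒≯ (m≤m+n b m))
  ... | tri> _ ne gt | tri< lt ne' _ rewrite <⇒<ᵇ≡ gt | ≤⇒≤ᵇ≡ (<⇒≤ lt) | ≢⇒≡ᵇ≡ ne | ≤⇒≤ᵇ≡ (<⇒≤ gt) | <⇒<ᵇ≡ lt | ≢⇒≡ᵇ≡ ne' = refl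
  ... | tri> _ ne gt | tri≈ _ refl _ rewrite <⇒<ᵇ≡ gt | ≤⇒≤ᵇ≡ {a + m} {a + m} ≤-refl | ≢⇒≡ᵇ≡ ne | ≤⇒≤ᵇ≡ (<⇒≤ gt) | ≮⇒<ᵇ≡ {a + m} {a + m} ≤-refl | ≡⇒≡ᵇ≡ {a + m} {a + m} refl = refl
  ... | tri> _ ne gt | tri> _ ne' gt' rewrite <⇒<ᵇ≡ gt | ≰⇒≤ᵇ≡ {b} {a + m} gt' | ≢⇒≡ᵇ≡ ne | ≤⇒≤ᵇ≡ (<⇒≤ gt) | ≮⇒<ᵇ≡ {b} {a + m} (<⇒≤ gt') | ≢⇒≡ᵇ≡ ne' = refl

  closed-window : ∀ b k y → window b (b + k) y + ι (b ≡ᵇ y) ≡ closed b (b + k) y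
  closed-window b k y with <-cmp b y
  ... | tri< lt ne _ rewrite <⇒<ᵇ≡ lt | ≢⇒≡ᵇ≡ ne | ≤⇒≤ᵇ≡ (<⇒≤ lt) = +-identityʳ _
  ... | tri≈ _ refl _ rewrite ≮⇒<ᵇ≡ {b} {b} ≤-refl | ≡⇒≡ᵇ≡ {b} refl | ≤⇒≤ᵇ≡ {b} ≤-refl | ≤⇒≤ᵇ≡ (m≤m+n b k) = refl
  ... | tri> ¬lt ne gt rewrite ≮⇒<ᵇ≡ {b} {y} (<⇒≤ gt) | ≢⇒≡ᵇ≡ ne | ≰⇒≤ᵇ≡ {b} {y} gt = refl

  -- For a marked valley at ℓ, telescoping [level = ℓ] over the steps before it trades the rows at level ℓ
  -- for the E steps ending or starting at ℓ.
  dinv-identity : 0 < n → ∀ w {v} → Walk 0 w v → pdʷ w + inv w + lmʷ w ≡ cʷ w + lostʷ w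
  dinv-identity n>0 w walk = +-cancelʳ-≡ (pairs Kt w) _ _ (cong₂ (λ x y → pd + M + x + (y + dd + zʷ w) + pairs Kt w) (inv-pairs w) tv≡
    ∙ arith1 pd M (pairs Ki w) (pairs V w) (pairs Vᵒ w) dd (zʷ w) (pairs Kt w)
    ∙ cong (λ x → pd + pairs Ki w + pairs V w + pairs Vᵒ w + dd + x + M) (telescope-pairs Φ w walk ∙ cong (_+ pairs Ks w) (Σ-vanish w λ {t} _ → Φ-src t))
    ∙ cong (_+ M) (sym (pairs-+ _ Ks w ∙ cong (_+ pairs Ks w) (pairs-+ _ Kd w ∙ cong (_+ dd) (pairs-+ _ Vᵒ w ∙ cong (_+ pairs Vᵒ w) (pairs-+ _ V w ∙ cong (_+ pairs V w) (pairs-+ Kp Ki w))))))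
    ∙ cong (_+ M) (pairs-cong w pointwise)
    ∙ cong (_+ M) (pairs-+ _ Kt w ∙ cong (_+ pairs Kt w) (pairs-+ Kc Kl w))
    ∙ arith2 (pairs Kc w) (lostʷ w) (pairs Kt w) M)
    where
    Φ : Step → ℕ → ℕ
    Φ t v = guard (marked t) (ι (base t ≡ᵇ v))
    Kp Ki V Vᵒ Kd Ks Kt Kc Kl : Step → Step → ℕ
    Kp s t = guard (eastish s ∧ northish t) (window (base t) (base t + (m + n)) (base s + n))
    Ki s t = κ s (single t)
    V s t = guard (northish s ∧ marked t) (window (base s) (base s + m) (base t))
    Vᵒ s t = V t s
    Kd s t = guard (marked s ∧ marked t) (ι (base t ≡ᵇ base s))
    Ks s t = Φ t (src s)
    Kt s t = Φ t (tgt s)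
    Kc s t = guard (eastish s ∧ northish t) (closed (base t) (base t + (m + n)) (base s + n))
    Kl s t = guard (northish s ∧ marked t) (crossing (base t) m (base s)) + guard (marked s ∧ northish t) (window (base t) (base t + m) (base s))
    pd = pairs Kp w
    dd = ddʷ w
    M = marks w
    V-self : ∀ s → V s s ≡ 0
    V-self (N , ℓ) = refl
    V-self (D , ℓ) = cong (λ b → ι (b ∧ (ℓ ≤ᵇ ℓ + m))) (≮⇒<ᵇ≡ {ℓ} {ℓ} ≤-refl)
    V-self (E , ℓ) = refl
    tv≡ : tvʷ w ≡ pairs V w + pairs Vᵒ w
    tv≡ = Σ-pairsʷ V w ∙ cong (pairs V w + pairs Vᵒ w +_) (Σ-vanish w λ {s} _ → V-self s) ∙ +-identityʳ _
    Φ-src : ∀ t → Φ t (src t) ≡ 0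
    Φ-src (N , ℓ) = refl
    Φ-src (D , ℓ) = cong ι (≢⇒≡ᵇ≡ (<⇒≢ (m<m+n ℓ n>0)))
    Φ-src (E , ℓ) = refl
    arith1 : ∀ p M i v v' d z k → p + M + i + (v + v' + d + z) + k ≡ p + i + v + v' + d + (z + k) + M
    arith1 = solve-∀
    arith2 : ∀ a b c d → a + b + c + d ≡ a + d + b + c
    arith2 = solve-∀
    pointwise : ∀ s t → Kp s t + Ki s t + V s t + Vᵒ s t + Kd s t + Ks s t ≡ Kc s t + Kl s t + Kt s t
    pointwise (N , a) (N , b) = refl
    pointwise (N , a) (E , b) = refl
    pointwise (N , a) (D , b) = arith (window a (a + m) b) (ι (b ≡ᵇ a)) ∙ upcross a b ∙ sym (arith' (crossing b m a) (ι (b ≡ᵇ a + m)))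
      where
      arith : ∀ x y → x + 0 + 0 + y ≡ x + y
      arith = solve-∀
      arith' : ∀ x y → x + 0 + y ≡ x + y
      arith' = solve-∀
    pointwise (D , a) (N , b) = arith (window b (b + (m + n)) (a + n)) (ι (b ≡ᵇ a + n)) (window b (b + m) a) ∙ cong (_+ window b (b + m) a) (closed-window b (m + n) (a + n)) ∙ sym (+-identityʳ _)
      where
      arith : ∀ x y z → x + y + 0 + z + 0 + 0 ≡ x + y + z
      arith = solve-∀
    pointwise (D , a) (D , b) = arith (window b (b + (m + n)) (a + n)) (window a (a + m) b) (window b (b + m) a) (ι (b ≡ᵇ a)) (ι (b ≡ᵇ a + n)) ∙
      cong₂ (λ x y → x + (y + window b (b + m) a)) (closed-window b (m + n) (a + n)) (upcross a b) ∙ arith' (closed b (b + (m + n)) (a + n)) (crossing b m a) _ _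
      where
      arith : ∀ p v v' d s → p + 0 + v + v' + d + s ≡ (p + s) + ((v + d) + v')
      arith = solve-∀
      arith' : ∀ c x k v → c + ((x + k) + v) ≡ c + (x + v) + k
      arith' = solve-∀
    pointwise (D , a) (E , b) = refl
    pointwise (E , a) (N , b) = arith (window b (b + (m + n)) (a + n)) (ι (b ≡ᵇ a + n)) ∙ closed-window b (m + n) (a + n) ∙ sym (arith' _)
      where
      arith : ∀ x y → x + y + 0 + 0 + 0 + 0 ≡ x + y
      arith = solve-∀
      arith' : ∀ x → x + 0 + 0 ≡ x
      arith' = solve-∀
    pointwise (E , a) (D , b) = arith (window b (b + (m + n)) (a + n)) (ι (b ≡ᵇ a)) (ι (b ≡ᵇ a + n)) ∙ cong (_+ ι (b ≡ᵇ a)) (closed-window b (m + n) (a + n)) ∙ cong (_+ ι (b ≡ᵇ a)) (sym (+-identityʳ _))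
      where
      arith : ∀ x y z → x + (y + 0) + 0 + 0 + 0 + z ≡ x + z + y
      arith = solve-∀
    pointwise (E , a) (E , b) = refl

Σlev : ℕ → ℕ → ℕ → ℕ
Σlev m r zero = 0
Σlev m r (suc k) = m * r + Σlev m (suc r) k

norths : List Step → ℕ
norths w = Σ w (λ s → ι (northish s))

easts : List Step → ℕ
easts w = Σ w (λ s → ι (eastish s))

northBase : Step → ℕ
northBase s = guard (northish s) (base s)

norths-mult : ∀ u v → mult u ≐ mult v → norths u ≡ norths v
norths-mult = Σ-mult (λ s → ι (northish s))

rowTail : (ℕ → ℕ → ℕ) → ℕ → ℕ → ℕ → ℕ → ℕ
rowTail g m i r zero = 0
rowTail g m i r (suc k) = g (m * i) (m * r) + rowTail g m i (suc r) k

rowPairs : (ℕ → ℕ → ℕ) → ℕ → ℕ → ℕ → ℕ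
rowPairs g m r zero = 0
rowPairs g m r (suc k) = rowTail g m r (suc r) k + rowPairs g m (suc r) k

double-injective : ∀ {a b} → a + a ≡ b + b → a ≡ b
double-injective {a} {b} e = *-cancelˡ-≡ a b 2 (cong (a +_) (+-identityʳ a) ∙ e ∙ cong (b +_) (sym (+-identityʳ b)))

module MultiplicityOnly (m n : ℕ) (n>0 : 0 < n) where

  open Walks m n
  open Stats m n

  -- The number of t with a ≤ y - t n ≤ a + m + n.
  F : ℕ → ℕ → ℕ
  F y a = ladder n (closed a (a + (m + n))) (y + n)

  W : ℕ → ℕ → ℕ
  W a y = closed a (a + (m + n)) y

  W-shift : ∀ a k y → W (a + k) (y + k) ≡ W a y
  W-shift a k y = cong ι (cong₂ _∧_ (≤ᵇ-+ʳ k a y) (cong (y + k ≤ᵇ_) (arith a k m n) ∙ ≤ᵇ-+ʳ k y (a + (m + n))))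
    where
    arith : ∀ a k m n → a + k + (m + n) ≡ a + (m + n) + k
    arith = solve-∀

  F-n : ∀ y a → F (y + n) a ≡ F y a + W a (y + n)
  F-n y a = ladder-+ n (W a) (y + n) n>0

  F-a : ∀ y a → F y a ≡ F y (a + n) + W a y
  F-a y a = ladder-+ n (W a) y n>0 ∙ cong (_+ W a y) (sym (shifted y))
    where
    shifted : ∀ y → F y (a + n) ≡ ladder n (W a) y
    shifted = <-rec _ go
      where
      go : ∀ y → (∀ {z} → z < y → F z (a + n) ≡ ladder n (W a) z) → F y (a + n) ≡ ladder n (W a) y
      go y rec with delay-split n y
      ... | inj₁ lt = ladder-+ n (W (a + n)) y n>0 ∙ cong₂ _+_ (ladder-< n (W (a + n)) lt) (cong (λ b → ι (b ∧ (y ≤ᵇ a + n + (m + n)))) (≰⇒≤ᵇ≡ {a + n} {y} (<-≤-trans lt (m≤n+m n a)))) ∙ sym (ladder-< n (W a) lt)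
      ... | inj₂ (z , refl) = F-n z (a + n) ∙ cong₂ _+_ (rec (m<m+n z n>0)) (W-shift a n z) ∙ sym (ladder-+ n (W a) z n>0)

  g : ℕ → ℕ → ℕ
  g a b = F (a + m) b + F b a

  flip-W : ∀ a b → W b (a + (m + n)) ≡ W a b
  flip-W a b = cong ι (cong ((b ≤ᵇ a + (m + n)) ∧_) (≤ᵇ-+ʳ (m + n) a b) ∙ ∧-comm (b ≤ᵇ a + (m + n)) (a ≤ᵇ b))

  flip-W' : ∀ a b → W a (b + m) ≡ W b (a + n)
  flip-W' a b = cong ι (cong₂ _∧_ (sym (cong (a + n ≤ᵇ_) (arith b m n) ∙ ≤ᵇ-+ʳ n a (b + m))) (sym (sym (≤ᵇ-+ʳ m b (a + n)) ∙ cong (b + m ≤ᵇ_) (arith' a m n))) ∙ ∧-comm (a + n ≤ᵇ b + (m + n)) (b ≤ᵇ a + n))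
    where
    arith : ∀ b m n → b + (m + n) ≡ b + m + n
    arith = solve-∀
    arith' : ∀ a m n → a + n + m ≡ a + (m + n)
    arith' = solve-∀

  -- g a b - g b a is n-periodic in both arguments.
  g-periodic : ∀ a b → g (a + n) b + g b a ≡ g b (a + n) + g a b
  g-periodic a b = cong₂ (λ x y → (x + F b (a + n)) + (y + F a b)) (cong (λ z → F z b) (arith a n m) ∙ F-n (a + m) b) (F-a (b + m) a)
    ∙ cong₂ (λ x y → (F (a + m) b + x + F b (a + n)) + (F (b + m) (a + n) + y + F a b)) (cong (W b) (+-assoc a m n) ∙ flip-W a b) (flip-W' a b)
    ∙ arith' (F (a + m) b) (W a b) (F b (a + n)) (F (b + m) (a + n)) (W b (a + n)) (F a b)
    ∙ cong₂ (λ x y → (F (b + m) (a + n) + x) + (F (a + m) b + y)) (sym (F-n a b)) (sym (F-a b a))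
    where
    arith : ∀ a n m → a + n + m ≡ a + m + n
    arith = solve-∀
    arith' : ∀ p q r s t u → (p + q + r) + (s + t + u) ≡ (s + (u + t)) + (p + (r + q))
    arith' = solve-∀

  g-shift1 : ∀ a b x → g (a + x * n) b + g b a ≡ g b (a + x * n) + g a b
  g-shift1 a b zero rewrite +-identityʳ a = +-comm (g a b) (g b a)
  g-shift1 a b (suc x) = +-cancelʳ-≡ (g b a') _ _ (cong (λ u → g u b + g b a + g b a') (arith a n (x * n))
    ∙ perm1 (g (a' + n) b) (g b a) (g b a')
    ∙ cong (_+ g b a) (g-periodic a' b)
    ∙ +-assoc (g b (a' + n)) _ _
    ∙ cong (g b (a' + n) +_) (g-shift1 a b x)
    ∙ perm2 (g b (a' + n)) (g b a') (g a b)
    ∙ cong (λ u → g b u + g a b + g b a') (sym (arith a n (x * n))))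
    where
    a' = a + x * n
    arith : ∀ b n z → b + (n + z) ≡ b + z + n
    arith = solve-∀
    perm1 : ∀ x y z → x + y + z ≡ (x + z) + y
    perm1 = solve-∀
    perm2 : ∀ x y z → x + (y + z) ≡ x + z + y
    perm2 = solve-∀

  g-shift : ∀ a b x y → g (a + x * n) (b + y * n) + g b a ≡ g (b + y * n) (a + x * n) + g a b
  g-shift a b x y = +-cancelʳ-≡ (g b' a + g a b') _ _ (arith1 (g a' b') (g b a) (g b' a) (g a b') ∙
    cong₂ _+_ (g-shift1 a b' x) (sym (g-shift1 b a y)) ∙ arith2 (g b' a') (g a b') (g b' a) (g a b))
    where
    a' = a + x * n
    b' = b + y * n
    arith1 : ∀ p q r s → p + q + (r + s) ≡ (p + r) + (s + q)
    arith1 = solve-∀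
    arith2 : ∀ p q r s → (p + q) + (r + s) ≡ p + s + (r + q)
    arith2 = solve-∀

  f fᵒ : Step → Step → ℕ
  f s t = guard (northish s ∧ northish t) (g (base s) (base t))
  fᵒ s t = f t s

  next-cur : Step → ℕ → ℕ
  next-cur s cur = ι (eastish s) + cur

  next-row : Step → ℕ → ℕ
  next-row s r = ι (northish s) + r

  next : ∀ s {cur r} → src s + cur * n ≡ m * r → tgt s + next-cur s cur * n ≡ m * next-row s r
  next (N , ℓ) {cur} {r} e = arith ℓ m (cur * n) ∙ cong (m +_) e ∙ sym (*-suc m r)
    where
    arith : ∀ ℓ m c → ℓ + m + c ≡ m + (ℓ + c)
    arith = solve-∀
  next (D , ℓ) {cur} {r} e = arith ℓ m n (cur * n) ∙ cong (m +_) e ∙ sym (*-suc m r)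
    where
    arith : ∀ ℓ m n c → ℓ + m + (n + c) ≡ m + (ℓ + n + c)
    arith = solve-∀
  next (E , ℓ) {cur} e = sym (+-assoc ℓ n (cur * n)) ∙ e

  at-north : ∀ t {cur r} → src t + cur * n ≡ m * r → northish t ≡ true → ∃ λ x → base t + x * n ≡ m * r
  at-north (N , ℓ) {cur} e _ = cur , e
  at-north (D , ℓ) {cur} e _ = suc cur , sym (+-assoc ℓ n (cur * n)) ∙ e

  antisymmetric-row : ∀ a i x w {u v cur r} → a + x * n ≡ m * i → Walk u w v → u + cur * n ≡ m * r →
    Σ w (λ t → guard (northish t) (g (base t) a)) + rowTail g m i r (norths w) ≡
    Σ w (λ t → guard (northish t) (g a (base t))) + rowTail (λ a b → g b a) m i r (norths w)
  antisymmetric-row a i x [] ea walk e = refl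
  antisymmetric-row a i x (t ∷ w) {cur = cur} {r} ea (refl , walk) e with northish t in nt | next t {cur} {r} e
  ... | false | e' = antisymmetric-row a i x w {cur = next-cur t cur} ea walk e'
  ... | true | e' with at-north t {cur} {r} e nt
  ... | y , et = arith (g (base t) a) (Σ w (λ t → guard (northish t) (g (base t) a))) (g (m * i) (m * r)) (rowTail g m i (suc r) (norths w)) ∙
    cong₂ _+_ one (antisymmetric-row a i x w {cur = next-cur t cur} ea walk e') ∙
      sym (arith (g a (base t)) (Σ w (λ t → guard (northish t) (g a (base t)))) (g (m * r) (m * i)) (rowTail (λ a b → g b a) m i (suc r) (norths w)))
    where
    arith : ∀ a b c d → a + b + (c + d) ≡ (c + a) + (b + d)
    arith = solve-∀
    one = subst₂ (λ p q → g p q + g (base t) a ≡ g q p + g a (base t)) ea et (g-shift a (base t) x y)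

  antisymmetric : ∀ w {u v cur r} → Walk u w v → u + cur * n ≡ m * r →
    pairs fᵒ w + rowPairs g m r (norths w) ≡ pairs f w + rowPairs (λ a b → g b a) m r (norths w)
  antisymmetric [] walk e = refl
  antisymmetric (s ∷ w) {cur = cur} {r} (refl , walk) e with northish s in ns | next s {cur} {r} e
  ... | false | e' = cong (λ z → z + pairs fᵒ w + rowPairs g m r (norths w)) (Σ-vanish w λ {t} _ → guard-∧ (northish t) false (g (base t) (base s))) ∙
    antisymmetric w {cur = next-cur s cur} walk e' ∙ cong (λ z → z + pairs f w + rowPairs (λ a b → g b a) m r (norths w)) (sym (Σ-0 w))
  ... | true | e' with at-north s {cur} {r} e ns
  ... | x , es = arith (Σ w (λ t → guard (northish t ∧ true) (g (base t) (base s)))) (pairs fᵒ w) (rowTail g m r (suc r) (norths w)) (rowPairs g m (suc r) (norths w)) ∙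
    cong₂ _+_ (cong (_+ rowTail g m r (suc r) (norths w)) (Σ-cong w λ t → guard-∧ (northish t) true (g (base t) (base s))) ∙ antisymmetric-row (base s) r x w {cur = next-cur s cur} es walk e') (antisymmetric w {cur = next-cur s cur} walk e') ∙
      sym (arith (Σ w (λ t → guard (northish t) (g (base s) (base t)))) (pairs f w) (rowTail (λ a b → g b a) m r (suc r) (norths w)) (rowPairs (λ a b → g b a) m (suc r) (norths w)))
    where
    arith : ∀ a b c d → a + b + (c + d) ≡ (a + c) + (b + d)
    arith = solve-∀

  f-mult : ∀ u v → Walk 0 u 0 → Walk 0 v 0 → mult u ≐ mult v → pairs f u ≡ pairs f v
  f-mult u v wu wv h = double-injective (+-cancelʳ-≡ K _ _ (arith (pairs f u) (pairs f u) K
    ∙ cong (λ k → pairs f u + (pairs f u + rowPairs (λ a b → g b a) m 0 k)) (sym ku)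
    ∙ cong (pairs f u +_) (sym (antisymmetric u {cur = 0} wu start))
    ∙ sym (+-assoc (pairs f u) _ _)
    ∙ cong₂ _+_ both (cong (rowPairs g m 0) ku)
    ∙ +-assoc (pairs f v) _ _
    ∙ cong (pairs f v +_) (antisymmetric v {cur = 0} wv start)
    ∙ sym (arith (pairs f v) (pairs f v) K)))
    where
    ku = norths-mult u v h
    K = rowPairs (λ a b → g b a) m 0 (norths v)
    start : 0 + 0 * n ≡ m * 0
    start = sym (*-zeroʳ m)
    arith : ∀ a b c → a + b + c ≡ a + (b + c)
    arith = solve-∀
    both : pairs f u + pairs fᵒ u ≡ pairs f v + pairs fᵒ v
    both = +-cancelʳ-≡ (Σ u (λ s → f s s)) _ _ (sym (Σ-pairsʷ f u) ∙ ΣΣ-mult f u v h ∙ Σ-pairsʷ f v ∙ cong (pairs f v + pairs fᵒ v +_) (sym (Σ-mult (λ s → f s s) u v h)))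

  Φ : Step → ℕ → ℕ
  Φ t v = guard (northish t) (F v (base t))

  G G⁺ Gᵒ : Step → Step → ℕ
  G s t = guard (northish s ∧ northish t) (F (base s) (base t))
  G⁺ s t = guard (northish s ∧ northish t) (F (base s + m) (base t))
  Gᵒ s t = G t s

  Kc : Step → Step → ℕ
  Kc s t = guard (eastish s ∧ northish t) (W (base t) (base s + n))

  telescoped : ∀ s t → Φ t (src s) + G⁺ s t ≡ Φ t (tgt s) + (Kc s t + G s t)
  telescoped (N , a) (N , b) = +-comm (F a b) _
  telescoped (N , a) (D , b) = +-comm (F a b) _
  telescoped (N , a) (E , b) = refl
  telescoped (D , a) (N , b) = cong (_+ F (a + m) b) (F-n a b) ∙ arith (F a b) (W b (a + n)) _
    where
    arith : ∀ x y z → x + y + z ≡ z + (y + x)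
    arith = solve-∀
  telescoped (D , a) (D , b) = cong (_+ F (a + m) b) (F-n a b) ∙ arith (F a b) (W b (a + n)) _
    where
    arith : ∀ x y z → x + y + z ≡ z + (y + x)
    arith = solve-∀
  telescoped (D , a) (E , b) = refl
  telescoped (E , a) (N , b) = cong (_+ 0) (F-n a b) ∙ arith (F a b) (W b (a + n))
    where
    arith : ∀ x y → x + y + 0 ≡ x + (y + 0)
    arith = solve-∀
  telescoped (E , a) (D , b) = cong (_+ 0) (F-n a b) ∙ arith (F a b) (W b (a + n))
    where
    arith : ∀ x y → x + y + 0 ≡ x + (y + 0)
    arith = solve-∀
  telescoped (E , a) (E , b) = refl

  c-formula : ∀ w → Walk 0 w 0 → Σ w (λ t → Φ t 0) + pairs f w + Σ w (λ s → G s s) ≡ Σ w (λ t → Φ t (src t)) + pairs Kc w + Σ w (λ s → Σ w (G s))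
  c-formula w walk = +-cancelʳ-≡ (pairs (λ s t → Φ t (tgt s)) w) _ _ (cong (λ z → Φ0 + z + dg + pt) (pairs-cong w f-split ∙ pairs-+ G⁺ Gᵒ w)
    ∙ arith1 Φ0 (pairs G⁺ w) (pairs Gᵒ w) dg pt
    ∙ cong (λ z → z + pairs G⁺ w + pairs Gᵒ w + dg) (telescope-pairs Φ w walk)
    ∙ cong (λ z → z + pairs Gᵒ w + dg) (+-assoc Φs ps (pairs G⁺ w) ∙ cong (Φs +_) (sym (pairs-+ (λ s t → Φ t (src s)) G⁺ w) ∙ pairs-cong w telescoped ∙ pairs-+ (λ s t → Φ t (tgt s)) (λ s t → Kc s t + G s t) w ∙ cong (pt +_) (pairs-+ Kc G w)))
    ∙ arith2 Φs pt (pairs Kc w) (pairs G w) (pairs Gᵒ w) dg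
    ∙ cong (λ z → Φs + pairs Kc w + z + pt) (sym (Σ-pairsʷ G w)))
    where
    Φ0 = Σ w (λ t → Φ t 0)
    Φs = Σ w (λ t → Φ t (src t))
    ps = pairs (λ s t → Φ t (src s)) w
    pt = pairs (λ s t → Φ t (tgt s)) w
    dg = Σ w (λ s → G s s)
    f-split : ∀ s t → f s t ≡ G⁺ s t + Gᵒ s t
    f-split s t with northish s | northish t
    ... | true | true = refl
    ... | true | false = refl
    ... | false | true = refl
    ... | false | false = refl
    arith1 : ∀ a b c d e → a + (b + c) + d + e ≡ (a + e) + b + c + d
    arith1 = solve-∀
    arith2 : ∀ a p k g o d → a + (p + (k + g)) + o + d ≡ a + k + (g + o + d) + p
    arith2 = solve-∀

  marks-mult : ∀ u v → mult u ≐ mult v → marks u ≡ marks v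
  marks-mult = Σ-mult (λ s → ι (marked s))

  cʷ-mult : ∀ u v → Walk 0 u 0 → Walk 0 v 0 → mult u ≐ mult v → cʷ u ≡ cʷ v
  cʷ-mult u v wu wv h = cong₂ _+_ (+-cancelˡ-≡ (Σ u (λ t → Φ t (src t))) _ _ (+-cancelʳ-≡ (Σ u (λ s → Σ u (G s))) _ _ (sym (c-formula u wu)
    ∙ cong₂ _+_ (cong₂ _+_ (Σ-mult (λ t → Φ t 0) u v h) (f-mult u v wu wv h)) (Σ-mult (λ s → G s s) u v h)
    ∙ c-formula v wv
    ∙ cong₂ (λ x y → x + pairs Kc v + y) (sym (Σ-mult (λ t → Φ t (src t)) u v h)) (sym (ΣΣ-mult G u v h))))) (marks-mult u v h)

  lmʷ-mult : ∀ u v → mult u ≐ mult v → lmʷ u ≡ lmʷ v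
  lmʷ-mult u v h = cong₂ _+_ (cong₂ _+_ (ΣΣ-mult _ u v h) dd) (Σ-mult (λ t → guard (marked t) (ι (base t ≡ᵇ 0))) u v h)
    where
    K : Step → Step → ℕ
    K s t = guard (marked s ∧ marked t) (ι (base t ≡ᵇ base s))
    K-sym : ∀ s t → K t s ≡ K s t
    K-sym s t = guard-∧ (marked t) (marked s) _ ∙ guard-cong (marked s ∧ marked t) (cong ι (bool-ext (λ e → ≡⇒≡ᵇ≡ {base t} (sym (≡ᵇ≡⇒≡ {base s} e))) (λ e → ≡⇒≡ᵇ≡ {base s} (sym (≡ᵇ≡⇒≡ {base t} e)))))
    twice : ∀ w → Σ w (λ s → Σ w (K s)) ≡ pairs K w + pairs K w + Σ w (λ s → K s s)
    twice w = Σ-pairsʷ K w ∙ cong (λ z → pairs K w + z + Σ w (λ s → K s s)) (pairs-cong w K-sym)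
    dd : ddʷ u ≡ ddʷ v
    dd = double-injective (+-cancelʳ-≡ (Σ u (λ s → K s s)) _ _ (sym (twice u) ∙ ΣΣ-mult K u v h ∙ twice v ∙ cong (pairs K v + pairs K v +_) (sym (Σ-mult (λ s → K s s) u v h))))

  pairs-eastNorth : ∀ w {u v cur r} → Walk u w v → u + cur * n ≡ m * r →
    n * eastNorth (λ _ _ → 1) w + cur * n * norths w + n * marks w + Σ w northBase ≡ Σlev m r (norths w)
  pairs-eastNorth [] {cur = cur} walk e = arith n (cur * n)
    where
    arith : ∀ n c → n * 0 + c * 0 + n * 0 + 0 ≡ 0
    arith = solve-∀
  pairs-eastNorth ((N , ℓ) ∷ w) {cur = cur} {r} (refl , walk) e = cong (λ z → n * (z + eastNorth (λ _ _ → 1) w) + cur * n * suc (norths w) + n * marks w + (ℓ + B0)) (Σ-0 w) ∙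
    arith n (eastNorth (λ _ _ → 1) w) cur (norths w) (marks w) ℓ B0 ∙ cong₂ _+_ e (pairs-eastNorth w {cur = next-cur (N , ℓ) cur} walk (next (N , ℓ) {cur} {r} e))
    where
    B0 = Σ w northBase
    arith : ∀ n p c k d ℓ b → n * (0 + p) + c * n * suc k + n * d + (ℓ + b) ≡ (ℓ + c * n) + (n * p + c * n * k + n * d + b)
    arith = solve-∀
  pairs-eastNorth ((D , ℓ) ∷ w) {cur = cur} {r} (refl , walk) e = cong (λ z → n * (z + eastNorth (λ _ _ → 1) w) + cur * n * suc (norths w) + n * suc (marks w) + (ℓ + B0)) (Σ-cong w λ t → guard-1 (northish t)) ∙
    arith n (eastNorth (λ _ _ → 1) w) cur (norths w) (marks w) ℓ B0 ∙ cong₂ _+_ e (pairs-eastNorth w {cur = next-cur (D , ℓ) cur} walk (next (D , ℓ) {cur} {r} e))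
    where
    B0 = Σ w northBase
    guard-1 : ∀ b → guard b 1 ≡ ι b
    guard-1 true = refl
    guard-1 false = refl
    arith : ∀ n p c k d ℓ b → n * (k + p) + c * n * suc k + n * suc d + (ℓ + b) ≡ (ℓ + n + c * n) + (n * p + (suc c) * n * k + n * d + b)
    arith = solve-∀
  pairs-eastNorth ((E , ℓ) ∷ w) {cur = cur} {r} (refl , walk) e = cong (λ z → n * (z + eastNorth (λ _ _ → 1) w) + cur * n * norths w + n * marks w + B0) (Σ-cong w λ t → guard-1 (northish t)) ∙
    arith n (eastNorth (λ _ _ → 1) w) cur (norths w) (marks w) B0 ∙ pairs-eastNorth w {cur = next-cur (E , ℓ) cur} walk (next (E , ℓ) {cur} {r} e)
    where
    B0 = Σ w northBase
    guard-1 : ∀ b → guard b 1 ≡ ι b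
    guard-1 true = refl
    guard-1 false = refl
    arith : ∀ n p c k d b → n * (k + p) + c * n * k + n * d + b ≡ n * p + (suc c) * n * k + n * d + b
    arith = solve-∀

  λʷ-mult : ∀ u v → Walk 0 u 0 → Walk 0 v 0 → mult u ≐ mult v → λʷ u ≡ λʷ v
  λʷ-mult u v wu wv h = *-cancelˡ-≡ (λʷ u) (λʷ v) n {{>-nonZero n>0}} (+-cancelʳ-≡ (Σ v northBase) _ _
    (cong (n * λʷ u +_) (sym (Σ-mult northBase u v h)) ∙ total u wu ∙ cong (Σlev m 0) (norths-mult u v h) ∙ sym (total v wv)))
    where
    arith : ∀ n p d b k → n * (p + d) + b ≡ n * p + 0 * n * k + n * d + b
    arith = solve-∀
    total : ∀ w → Walk 0 w 0 → n * λʷ w + Σ w northBase ≡ Σlev m 0 (norths w)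
    total w walk = arith n (eastNorth (λ _ _ → 1) w) (marks w) (Σ w northBase) (norths w) ∙ pairs-eastNorth w {cur = 0} walk (sym (*-zeroʳ m))

module StatTransposition (m n : ℕ) (n>0 : 0 < n) (m>0 : 0 < m) where

  module W = Walks m n
  module W' = Walks n m
  module S = Stats m n
  module S' = Stats n m
  module T' = Transposition n m
  open MultiplicityOnly m n n>0 using (cʷ-mult; lmʷ-mult; λʷ-mult)

  rev : List Step → List Step
  rev w = reverse (map swapS w)

  walk-snoc : ∀ u w {v} s → W.Walk u w v → W.src s ≡ v → W.Walk u (w ++ s ∷ []) (W.tgt s)
  walk-snoc u [] s refl e = e , refl
  walk-snoc u (t ∷ w) s (e' , walk) e = e' , walk-snoc (W.tgt t) w s walk e

  walk-rev : ∀ {u v} w → W'.Walk u w v → W.Walk v (rev w) u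
  walk-rev [] refl = refl
  walk-rev {v = v} (s ∷ w) (refl , walk) = subst₂ (λ l u → W.Walk v l u) (sym (List.unfold-reverse (swapS s) (map swapS w))) (T'.tgt-swap s)
    (walk-snoc v (rev w) (swapS s) (walk-rev w walk) (T'.src-swap s))

  mult-rev : ∀ w → mult (rev w) ≐ transpose (mult w)
  mult-rev w l ℓ = Σ-reverse (λ s → ι (eqStep s (l , ℓ))) (map swapS w) ∙ mult-swap w l ℓ

  Σ-rev : ∀ (f : Step → ℕ) w → Σ (rev w) f ≡ Σ w (f ∘ swapS)
  Σ-rev f w = Σ-reverse f (map swapS w) ∙ Σ-map f swapS w

  pairs-rev : ∀ K w → pairs K (rev w) ≡ pairs (λ s t → K (swapS t) (swapS s)) w
  pairs-rev K w = pairs-reverse K (map swapS w) ∙ pairs-map (λ s t → K t s) swapS w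

  marks-rev : ∀ w → S.marks (rev w) ≡ S'.marks w
  marks-rev w = Σ-rev (λ s → ι (marked s)) w ∙ (Σ-cong w λ s → cong ι (marked-swap s))

  eastNorth-rev : ∀ {k k'} w → (∀ s t → k (swapS t) (swapS s) ≡ k' s t) → eastNorth k (rev w) ≡ eastNorth k' w
  eastNorth-rev {k} {k'} w h = pairs-rev (λ s t → guard (eastish s ∧ northish t) (k s t)) w ∙ (pairs-cong w λ s t →
    trans (cong₂ (λ a b → guard (a ∧ b) (k (swapS t) (swapS s))) (eastish-swap t) (northish-swap s)) (guard-∧ (northish t) (eastish s) _ ∙ guard-cong (eastish s ∧ northish t) (h s t)))

  c-rev : ∀ w → S.cʷ (rev w) ≡ S'.cʷ w
  c-rev w = cong₂ _+_ (eastNorth-rev w λ s t → turn (base s) (base t)) (marks-rev w)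
    where
    turn : ∀ a b → closed a (a + (m + n)) (b + n) ≡ closed b (b + (n + m)) (a + m)
    turn a b = cong ι (cong₂ _∧_ (sym (cong (a + m ≤ᵇ_) (arith b n m) ∙ ≤ᵇ-+ʳ m a (b + n))) (cong (b + n ≤ᵇ_) (arith' a m n) ∙ ≤ᵇ-+ʳ n b (a + m)) ∙ ∧-comm (a + m ≤ᵇ b + (n + m)) (b ≤ᵇ a + m))
      where
      arith : ∀ b n m → b + (n + m) ≡ b + n + m
      arith = solve-∀
      arith' : ∀ a m n → a + (m + n) ≡ a + m + n
      arith' = solve-∀

  λ-rev : ∀ w → S.λʷ (rev w) ≡ S'.λʷ w
  λ-rev w = cong₂ _+_ (eastNorth-rev w λ s t → refl) (marks-rev w)

  ≤-window : ∀ b a k → ι (b ≤ᵇ a + k) ≡ ι (b ≤ᵇ a) + window a (a + k) b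
  ≤-window b a k with b ≤? a
  ... | yes h rewrite ≤⇒≤ᵇ≡ h | ≤⇒≤ᵇ≡ (h ≤∙ m≤m+n a k) | ≮⇒<ᵇ≡ {a} {b} h = refl
  ... | no h rewrite ≰⇒≤ᵇ≡ {b} {a} (≰⇒> h) | <⇒<ᵇ≡ (≰⇒> h) = refl

  up-down : ∀ b w → W'.Walk 0 w 0 → Σ w (λ s → guard (eastish s) (window (base s) (base s + m) b)) ≡ Σ w (λ s → guard (northish s) (window (base s) (base s + n) b))
  up-down b w walk = +-cancelˡ-≡ (Σ w (φ ∘ W'.tgt)) _ _ (sym (Σ-+ (φ ∘ W'.tgt) _ w) ∙ Σ-cong w pt ∙ Σ-+ (φ ∘ W'.src) _ w ∙ cong (_+ _) (sym (+-cancelˡ-≡ (φ 0) _ _ (W'.telescopeʷ φ w walk))))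
    where
    φ : ℕ → ℕ
    φ v = ι (b ≤ᵇ v)
    pt : ∀ s → φ (W'.tgt s) + guard (eastish s) (window (base s) (base s + m) b) ≡ φ (W'.src s) + guard (northish s) (window (base s) (base s + n) b)
    pt (N , ℓ) = +-identityʳ _ ∙ ≤-window b ℓ n
    pt (D , ℓ) = cong (_+ window ℓ (ℓ + m) b) (≤-window b ℓ n) ∙ arith (φ ℓ) _ _ ∙ cong (_+ window ℓ (ℓ + n) b) (sym (≤-window b ℓ m))
      where
      arith : ∀ a b c → a + b + c ≡ a + c + b
      arith = solve-∀
    pt (E , ℓ) = sym (≤-window b ℓ m) ∙ sym (+-identityʳ _)

  lm-rev : ∀ w → W'.Walk 0 w 0 → S.lmʷ (rev w) ≡ S'.lmʷ w
  lm-rev w walk = cong₂ _+_ (cong₂ _+_ tv dd) z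
    where
    tv : S.tvʷ (rev w) ≡ S'.tvʷ w
    tv = Σ-rev _ w ∙ (Σ-cong w λ s → Σ-rev _ w ∙ (Σ-cong w λ t → cong₂ (λ a b → guard (a ∧ b) (window (base s) (base s + m) (base t))) (northish-swap s) (marked-swap t)))
      ∙ Σ-swap (λ s t → guard (eastish s ∧ marked t) (window (base s) (base s + m) (base t))) w w
      ∙ Σ-cong w (λ t → (Σ-cong w λ s → guard-split (eastish s) (marked t) _) ∙ Σ-guard (marked t) (λ s → guard (eastish s) (window (base s) (base s + m) (base t))) ∙ cong (guard (marked t)) (up-down (base t) w walk) ∙ sym (Σ-guard (marked t) (λ s → guard (northish s) (window (base s) (base s + n) (base t)))) ∙ (Σ-cong w λ s → sym (guard-split (northish s) (marked t) _)))
      ∙ sym (Σ-swap (λ s t → guard (northish s ∧ marked t) (window (base s) (base s + n) (base t))) w w)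
      where
      guard-split : ∀ p q x → guard (p ∧ q) x ≡ guard q (guard p x)
      guard-split true true x = refl
      guard-split true false x = refl
      guard-split false true x = refl
      guard-split false false x = refl
      Σ-guard : ∀ q (h : Step → ℕ) → Σ w (λ s → guard q (h s)) ≡ guard q (Σ w h)
      Σ-guard true h = refl
      Σ-guard false h = Σ-0 w
    dd : S.ddʷ (rev w) ≡ S'.ddʷ w
    dd = pairs-rev _ w ∙ (pairs-cong w λ s t → cong₂ (λ a b → guard (a ∧ b) (ι (base s ≡ᵇ base t))) (marked-swap t) (marked-swap s) ∙
      guard-∧ (marked t) (marked s) _ ∙ guard-cong (marked s ∧ marked t) (cong ι (bool-ext (λ e → ≡⇒≡ᵇ≡ {base t} (sym (≡ᵇ≡⇒≡ {base s} e))) (λ e → ≡⇒≡ᵇ≡ {base s} (sym (≡ᵇ≡⇒≡ {base t} e))))))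
    z : S.zʷ (rev w) ≡ S'.zʷ w
    z = Σ-rev _ w ∙ (Σ-cong w λ t → cong (λ b → guard b (ι (base t ≡ᵇ 0))) (marked-swap t))

  module _ {w w'} (walk : W.Walk 0 w 0) (walk' : W'.Walk 0 w' 0) (same : mult w ≐ transpose (mult w')) where

    same' : mult w ≐ mult (rev w')
    same' l ℓ = same l ℓ ∙ sym (mult-rev w' l ℓ)

    walk-r = walk-rev w' walk'

    λ-transpose : S.λʷ w ≡ S'.λʷ w'
    λ-transpose = λʷ-mult w (rev w') walk walk-r same' ∙ λ-rev w'

    dinv-transpose : W.inv w ≡ W'.inv w' → S.pdʷ w + S'.lostʷ w' ≡ S'.pdʷ w' + S.lostʷ w
    dinv-transpose i = +-cancelʳ-≡ (W.inv w + S.lmʷ w + S.cʷ w) _ _ (arith1 (S.pdʷ w) (S'.lostʷ w') (W.inv w) (S.lmʷ w) (S.cʷ w)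
      ∙ cong₂ _+_ (S.dinv-identity n>0 w walk) (cong (_+ S'.lostʷ w') cc ∙ sym (S'.dinv-identity m>0 w' walk'))
      ∙ cong₂ (λ x y → (S.cʷ w + S.lostʷ w) + (S'.pdʷ w' + x + y)) (sym i) (sym ll)
      ∙ arith2 (S.cʷ w) (S.lostʷ w) (S'.pdʷ w') (W.inv w) (S.lmʷ w))
      where
      cc : S.cʷ w ≡ S'.cʷ w'
      cc = cʷ-mult w (rev w') walk walk-r same' ∙ c-rev w'
      ll : S.lmʷ w ≡ S'.lmʷ w'
      ll = lmʷ-mult w (rev w') same' ∙ lm-rev w' walk'
      arith1 : ∀ p l i k c → p + l + (i + k + c) ≡ (p + i + k) + (c + l)
      arith1 = solve-∀
      arith2 : ∀ c l p i k → (c + l) + (p + i + k) ≡ p + l + (i + k + c)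
      arith2 = solve-∀

-- Rows of a word

rows : ℕ → List Letter → List ℕ
rows cur [] = []
rows cur (N ∷ ls) = cur ∷ rows cur ls
rows cur (D ∷ ls) = suc cur ∷ rows (suc cur) ls
rows cur (E ∷ ls) = rows (suc cur) ls

bits : List Letter → List ℕ
bits [] = []
bits (N ∷ ls) = 0 ∷ bits ls
bits (D ∷ ls) = 1 ∷ bits ls
bits (E ∷ ls) = bits ls

northBases eastBases : List Step → List ℕ
northBases [] = []
northBases ((N , ℓ) ∷ w) = ℓ ∷ northBases w
northBases ((D , ℓ) ∷ w) = ℓ ∷ northBases w
northBases ((E , ℓ) ∷ w) = northBases w
eastBases [] = []
eastBases ((N , ℓ) ∷ w) = eastBases w
eastBases ((D , ℓ) ∷ w) = ℓ ∷ eastBases w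
eastBases ((E , ℓ) ∷ w) = ℓ ∷ eastBases w

length-northBases : ∀ w → length (northBases w) ≡ norths w
length-northBases [] = refl
length-northBases ((N , ℓ) ∷ w) = cong suc (length-northBases w)
length-northBases ((D , ℓ) ∷ w) = cong suc (length-northBases w)
length-northBases ((E , ℓ) ∷ w) = length-northBases w

cur≤rows : ∀ cur ls {j} → j < length (rows cur ls) → cur ≤ at (rows cur ls) j
cur≤rows cur (N ∷ ls) {zero} _ = ≤-refl
cur≤rows cur (N ∷ ls) {suc j} (s≤s h) = cur≤rows cur ls h
cur≤rows cur (D ∷ ls) {zero} _ = n≤1+n cur
cur≤rows cur (D ∷ ls) {suc j} (s≤s h) = n≤1+n cur ≤∙ cur≤rows (suc cur) ls h
cur≤rows cur (E ∷ ls) h = n≤1+n cur ≤∙ cur≤rows (suc cur) ls h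

rows-step : ∀ cur ls {j} → suc j < length (rows cur ls) → at (rows cur ls) j ≤ at (rows cur ls) (suc j)
rows-step cur (N ∷ ls) {zero} (s≤s h) = cur≤rows cur ls h
rows-step cur (N ∷ ls) {suc j} (s≤s h) = rows-step cur ls h
rows-step cur (D ∷ ls) {zero} (s≤s h) = cur≤rows (suc cur) ls h
rows-step cur (D ∷ ls) {suc j} (s≤s h) = rows-step (suc cur) ls h
rows-step cur (E ∷ ls) h = rows-step (suc cur) ls h

Σ-strict-pairs-suc : ∀ k (H : ℕ → ℕ → ℕ) → Σ< (suc k) (λ j → Σ< j (λ i → H i j)) ≡
  Σ< k (λ j → H 0 (suc j)) + Σ< k (λ j → Σ< j (λ i → H (suc i) (suc j)))
Σ-strict-pairs-suc k H = Σ-upTo-suc k (λ j → Σ< j (λ i → H i j)) ∙ (Σ-cong (upTo k) λ j → Σ-upTo-suc j (λ i → H i (suc j))) ∙ Σ-+ _ _ (upTo k)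

Σ-upTo-at : ∀ (F : ℕ → ℕ) P R → Σ< (length P) (λ c → F (at (P ++ R) c)) ≡ Σ P F
Σ-upTo-at F P R = (Σ-upTo-cong (length P) λ c< → cong F (at-++ˡ P R c<)) ∙ sym (Σ-at F P)

module Rows (m n : ℕ) where

  open Walks m n
  open Stats m n

  descend : ∀ {u} cur → (n ≤ᵇ u) ≡ true → u ∸ n + n * suc cur ≡ u + n * cur
  descend {u} cur h = cong (u ∸ n +_) (*-suc n cur) ∙ sym (+-assoc (u ∸ n) n (n * cur)) ∙ cong (_+ n * cur) (m∸n+n≡m (≤ᵇ≡⇒≤ {n} {u} h))

  ascend : ∀ {u c r} → u + c ≡ m * r → u + m + c ≡ m * suc r
  ascend {u} {c} {r} e = arith u m c ∙ cong (m +_) e ∙ sym (*-suc m r)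
    where
    arith : ∀ u m c → u + m + c ≡ m + (u + c)
    arith = solve-∀

  length-rows : ∀ cur u ls → length (rows cur ls) ≡ norths (locate u ls)
  length-rows cur u [] = refl
  length-rows cur u (N ∷ ls) = cong suc (length-rows cur _ ls)
  length-rows cur u (D ∷ ls) = cong suc (length-rows (suc cur) _ ls)
  length-rows cur u (E ∷ ls) = length-rows (suc cur) _ ls

  length-bits : ∀ u ls → length (bits ls) ≡ norths (locate u ls)
  length-bits u [] = refl
  length-bits u (N ∷ ls) = cong suc (length-bits _ ls)
  length-bits u (D ∷ ls) = cong suc (length-bits _ ls)
  length-bits u (E ∷ ls) = length-bits _ ls

  at-northBases : ∀ cur r u ls → valid u ls ≡ true → u + n * cur ≡ m * r → ∀ {j} → j < length (rows cur ls) →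
    at (northBases (locate u ls)) j + n * at (rows cur ls) j ≡ m * (r + j)
  at-northBases cur r u (N ∷ ls) ok e {zero} h = e ∙ cong (m *_) (sym (+-identityʳ r))
  at-northBases cur r u (N ∷ ls) ok e {suc j} (s≤s h) = at-northBases cur (suc r) (u + m) ls ok (ascend {u} e) h ∙ cong (m *_) (sym (+-suc r j))
  at-northBases cur r u (D ∷ ls) ok e {zero} h with ∧-elim {n ≤ᵇ u} ok
  ... | n≤u , _ = descend cur n≤u ∙ e ∙ cong (m *_) (sym (+-identityʳ r))
  at-northBases cur r u (D ∷ ls) ok e {suc j} (s≤s h) with ∧-elim {n ≤ᵇ u} ok
  ... | n≤u , ok' = at-northBases (suc cur) (suc r) (u ∸ n + m) ls ok'
      (ascend {u ∸ n} (descend cur n≤u ∙ e)) h ∙ cong (m *_) (sym (+-suc r j))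
  at-northBases cur r u (E ∷ ls) ok e h with ∧-elim {n ≤ᵇ u} ok
  ... | n≤u , ok' = at-northBases (suc cur) r (u ∸ n) ls ok' (descend cur n≤u ∙ e) h

  at-eastBases : ∀ cur r u ls → valid u ls ≡ true → u + n * cur ≡ m * r → ∀ {c} → c < easts (locate u ls) →
    at (eastBases (locate u ls)) c + n * (cur + suc c) ≡ m * (r + Σ< (length (rows cur ls)) (λ j → ι (at (rows cur ls) j ≤ᵇ cur + c)))
  at-eastBases cur r u (N ∷ ls) ok e {c} h = at-eastBases cur (suc r) (u + m) ls ok (ascend {u} e) h ∙
    cong (m *_) (sym (+-suc r _) ∙ cong (r +_) (sym (Σ-upTo-suc (length (rows cur ls)) (λ j → ι (at (cur ∷ rows cur ls) j ≤ᵇ cur + c)) ∙ cong (λ b → ι b + Σ< (length (rows cur ls)) (λ j → ι (at (rows cur ls) j ≤ᵇ cur + c))) (≤⇒≤ᵇ≡ (m≤m+n cur c)))))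
  at-eastBases cur r u (E ∷ ls) ok e {zero} h with ∧-elim {n ≤ᵇ u} ok
  ... | n≤u , ok' = cong (λ z → u ∸ n + n * z) (+-comm cur 1) ∙ descend cur n≤u ∙
      e ∙ cong (m *_) (sym (+-identityʳ r) ∙ cong (r +_) (sym (Σ-upTo-vanish (length (rows (suc cur) ls)) λ {j} j< → cong ι (≰⇒≤ᵇ≡ (<-≤-trans (s≤s (≤-reflexive (+-identityʳ cur))) (cur≤rows (suc cur) ls j<))))))
  at-eastBases cur r u (E ∷ ls) ok e {suc c} (s≤s h) with ∧-elim {n ≤ᵇ u} ok
  ... | n≤u , ok' = cong (λ z → at (eastBases (locate (u ∸ n) ls)) c + n * z) (+-suc cur (suc c)) ∙ at-eastBases (suc cur) r (u ∸ n) ls ok' (descend cur n≤u ∙ e) h ∙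
      cong (λ z → m * (r + Σ (upTo (length (rows (suc cur) ls))) (λ j → ι (at (rows (suc cur) ls) j ≤ᵇ z)))) (sym (+-suc cur c))
  at-eastBases cur r u (D ∷ ls) ok e {zero} h with ∧-elim {n ≤ᵇ u} ok
  ... | n≤u , ok' = cong (λ z → u ∸ n + n * z) (+-comm cur 1) ∙ descend cur n≤u ∙
      e ∙ cong (m *_) (sym (+-identityʳ r) ∙ cong (r +_) (sym (Σ-upTo-vanish (length (rows cur (D ∷ ls))) λ {j} j< → cong ι (≰⇒≤ᵇ≡ {at (rows cur (D ∷ ls)) j} {cur + 0} (<-≤-trans (s≤s (≤-reflexive (+-identityʳ cur))) (low j j<))))))
    where
    low : ∀ j → j < length (rows cur (D ∷ ls)) → suc cur ≤ at (rows cur (D ∷ ls)) j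
    low zero _ = ≤-refl
    low (suc j) (s≤s h) = cur≤rows (suc cur) ls h
  at-eastBases cur r u (D ∷ ls) ok e {suc c} (s≤s h) with ∧-elim {n ≤ᵇ u} ok
  ... | n≤u , ok' = cong (λ z → at (eastBases w) c + n * z) (+-suc cur (suc c))
    ∙ at-eastBases (suc cur) (suc r) (u ∸ n + m) ls ok' start h
    ∙ cong (m *_) (sym (+-suc r _) ∙ cong (λ z → r + suc (Σ< len (λ j → ι (at (rows (suc cur) ls) j ≤ᵇ z)))) (sym (+-suc cur c)))
    ∙ cong (λ b → m * (r + (ι b + Σ< len (λ j → ι (at (rows (suc cur) ls) j ≤ᵇ cur + suc c))))) (sym (≤⇒≤ᵇ≡ {suc cur} (s≤s (m≤m+n cur c) ≤∙ ≤-reflexive (sym (+-suc cur c)))))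
    ∙ cong (λ z → m * (r + z)) (sym (Σ-upTo-suc len (λ j → ι (at (suc cur ∷ rows (suc cur) ls) j ≤ᵇ cur + suc c))))
    where
    w = locate (u ∸ n + m) ls
    len = length (rows (suc cur) ls)
    start : u ∸ n + m + n * suc cur ≡ m * suc r
    start = ascend {u ∸ n} (descend cur n≤u ∙ e)

  rows-eastNorth : ∀ (k : ℕ → ℕ → ℕ) P u ls →
    Σ (upTo (length (rows (length P) ls))) (λ j → Σ (upTo (at (rows (length P) ls) j)) (λ c → k (at (northBases (locate u ls)) j) (at (P ++ eastBases (locate u ls)) c))) ≡
    Σ P (λ e → Σ (locate u ls) (λ t → guard (northish t) (k (base t) e))) + (eastNorth (λ s t → k (base t) (base s)) (locate u ls) + Σ (locate u ls) (λ s → guard (marked s) (k (base s) (base s))))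
  rows-eastNorth k P u [] = sym (+-identityʳ _ ∙ Σ-0 P)
  rows-eastNorth k P u (N ∷ ls) = Σ-upTo-suc len _
    ∙ cong₂ _+_ (Σ-upTo-at (k u) P (eastBases w)) (rows-eastNorth k P (u + m) ls)
    ∙ sym (+-assoc (Σ P (k u)) _ rest)
    ∙ cong₂ _+_ (sym (Σ-+ (k u) _ P)) (cong (λ z → z + eastNorth (λ s t → k (base t) (base s)) w + Σ w (λ s → guard (marked s) (k (base s) (base s)))) (sym (Σ-0 w)))
    where
    w = locate (u + m) ls
    len = length (rows (length P) ls)
    rest = eastNorth (λ s t → k (base t) (base s)) w + Σ w (λ s → guard (marked s) (k (base s) (base s)))
  rows-eastNorth k P u (E ∷ ls) = cong₂ (λ a l → Σ< (length (rows a ls)) (λ j → Σ< (at (rows a ls) j) (λ c → k (at (northBases w) j) (at l c)))) (sym (List.length-++ P ∙ +-comm (length P) 1)) (sym (List.++-assoc P (ℓ ∷ []) (eastBases w)))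
    ∙ rows-eastNorth k (P ++ ℓ ∷ []) ℓ ls
    ∙ cong (_+ (en + dg)) (Σ-++ Q P (ℓ ∷ []) ∙ cong (Σ P Q +_) (+-identityʳ (Q ℓ)))
    ∙ arith (Σ P Q) (Q ℓ) en dg
    where
    ℓ = u ∸ n
    w = locate ℓ ls
    Q : ℕ → ℕ
    Q e = Σ w (λ t → guard (northish t) (k (base t) e))
    en = eastNorth (λ s t → k (base t) (base s)) w
    dg = Σ w (λ s → guard (marked s) (k (base s) (base s)))
    arith : ∀ a b c d → a + b + (c + d) ≡ a + (b + c + d)
    arith = solve-∀
  rows-eastNorth k P u (D ∷ ls) = Σ-upTo-suc (length (rows (suc (length P)) ls)) _
    ∙ cong₂ (λ a l → Σ< a (λ c → k ℓ (at l c)) + Σ< (length (rows a ls)) (λ j → Σ< (at (rows a ls) j) (λ c → k (at (northBases w) j) (at l c)))) (sym (List.length-++ P ∙ +-comm (length P) 1)) (sym (List.++-assoc P (ℓ ∷ []) (eastBases w)))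
    ∙ cong₂ _+_ (Σ-upTo-at (k ℓ) (P ++ ℓ ∷ []) (eastBases w)) (rows-eastNorth k (P ++ ℓ ∷ []) (ℓ + m) ls)
    ∙ cong₂ (λ x y → x + (y + (en + dg))) (Σ-++ (k ℓ) P (ℓ ∷ []) ∙ cong (Σ P (k ℓ) +_) (+-identityʳ (k ℓ ℓ))) (Σ-++ Q P (ℓ ∷ []) ∙ cong (Σ P Q +_) (+-identityʳ (Q ℓ)))
    ∙ arith (Σ P (k ℓ)) (k ℓ ℓ) (Σ P Q) (Q ℓ) en dg
    ∙ cong (_+ (Q ℓ + en + (k ℓ ℓ + dg))) (sym (Σ-+ (k ℓ) Q P))
    where
    ℓ = u ∸ n
    w = locate (ℓ + m) ls
    Q : ℕ → ℕ
    Q e = Σ w (λ t → guard (northish t) (k (base t) e))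
    en = eastNorth (λ s t → k (base t) (base s)) w
    dg = Σ w (λ s → guard (marked s) (k (base s) (base s)))
    arith : ∀ a b c d e f → a + b + (c + d + (e + f)) ≡ a + c + (d + e + (b + f))
    arith = solve-∀

  Σ-northBases : ∀ (h : ℕ → ℕ → ℕ) u ls → Σ< (length (bits ls)) (λ j → h (at (bits ls) j) (at (northBases (locate u ls)) j)) ≡ Σ (locate u ls) (λ t → guard (northish t) (h (ι (marked t)) (base t)))
  Σ-northBases h u [] = refl
  Σ-northBases h u (N ∷ ls) = Σ-upTo-suc (length (bits ls)) _ ∙ cong (h 0 u +_) (Σ-northBases h (u + m) ls)
  Σ-northBases h u (D ∷ ls) = Σ-upTo-suc (length (bits ls)) _ ∙ cong (h 1 (u ∸ n) +_) (Σ-northBases h (u ∸ n + m) ls)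
  Σ-northBases h u (E ∷ ls) = Σ-northBases h (u ∸ n) ls

  Σ-northPairs : ∀ (h : ℕ → ℕ → ℕ → ℕ → ℕ) u ls →
    Σ< (length (bits ls)) (λ j → Σ< j (λ i → h (at (bits ls) i) (at (northBases (locate u ls)) i) (at (bits ls) j) (at (northBases (locate u ls)) j))) ≡
    pairs (λ s t → guard (northish s) (guard (northish t) (h (ι (marked s)) (base s) (ι (marked t)) (base t)))) (locate u ls)
  Σ-northPairs h u [] = refl
  Σ-northPairs h u (N ∷ ls) = Σ-strict-pairs-suc (length (bits ls)) (λ i j → h (at (0 ∷ bits ls) i) (at (u ∷ northBases (locate (u + m) ls)) i) (at (0 ∷ bits ls) j) (at (u ∷ northBases (locate (u + m) ls)) j)) ∙
    cong₂ _+_ (Σ-northBases (h 0 u) (u + m) ls) (Σ-northPairs h (u + m) ls)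
  Σ-northPairs h u (D ∷ ls) = Σ-strict-pairs-suc (length (bits ls)) (λ i j → h (at (1 ∷ bits ls) i) (at (u ∸ n ∷ northBases (locate (u ∸ n + m) ls)) i) (at (1 ∷ bits ls) j) (at (u ∸ n ∷ northBases (locate (u ∸ n + m) ls)) j)) ∙
    cong₂ _+_ (Σ-northBases (h 1 (u ∸ n)) (u ∸ n + m) ls) (Σ-northPairs h (u ∸ n + m) ls)
  Σ-northPairs h u (E ∷ ls) = Σ-northPairs h (u ∸ n) ls ∙ cong (_+ pairs (λ s t → guard (northish s) (guard (northish t) (h (ι (marked s)) (base s) (ι (marked t)) (base t)))) (locate (u ∸ n) ls)) (sym (Σ-0 (locate (u ∸ n) ls)))

  norths+easts : ∀ w → norths w + easts w ≡ length w + marks w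
  norths+easts [] = refl
  norths+easts ((N , _) ∷ w) = cong suc (norths+easts w)
  norths+easts ((D , _) ∷ w) = cong suc (+-suc (norths w) (easts w)) ∙ cong (suc ∘ suc) (norths+easts w) ∙ cong suc (sym (+-suc (length w) (marks w)))
  norths+easts ((E , _) ∷ w) = +-suc (norths w) (easts w) ∙ cong suc (norths+easts w)

  walk-slope : ∀ {u v} w → Walk u w v → u + m * norths w ≡ v + n * easts w
  walk-slope {u} {v} w walk = go w walk
    where
    go : ∀ {u} w → Walk u w v → u + m * norths w ≡ v + n * easts w
    go [] refl = cong (v +_) (*-zeroʳ m ∙ sym (*-zeroʳ n))
    go ((N , ℓ) ∷ w) (refl , walk) = cong (ℓ +_) (*-suc m (norths w)) ∙ sym (+-assoc ℓ m _) ∙ go w walk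
    go ((D , ℓ) ∷ w) (refl , walk) = cong (ℓ + n +_) (*-suc m (norths w)) ∙ arith ℓ n m (m * norths w) ∙ cong (n +_) (go w walk) ∙ arith' n v (n * easts w) ∙ cong (v +_) (sym (*-suc n (easts w)))
      where
      arith : ∀ ℓ n m x → ℓ + n + (m + x) ≡ n + (ℓ + m + x)
      arith = solve-∀
      arith' : ∀ n v x → n + (v + x) ≡ v + (n + x)
      arith' = solve-∀
    go ((E , ℓ) ∷ w) (refl , walk) = arith ℓ n (m * norths w) ∙ cong (n +_) (go w walk) ∙ arith' n v (n * easts w) ∙ cong (v +_) (sym (*-suc n (easts w)))
      where
      arith : ∀ ℓ n x → ℓ + n + x ≡ n + (ℓ + x)
      arith = solve-∀
      arith' : ∀ n v x → n + (v + x) ≡ v + (n + x)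
      arith' = solve-∀

  norths≡n : 0 < m → ∀ w → Walk 0 w 0 → length w + marks w ≡ m + n → norths w ≡ n × easts w ≡ m
  norths≡n m>0 w walk len = nn , +-cancelˡ-≡ n _ _ (cong (_+ easts w) (sym nn) ∙ norths+easts w ∙ len ∙ +-comm m n)
    where
    nn : norths w ≡ n
    nn = *-cancelʳ-≡ (norths w) n (m + n) {{>-nonZero (<-≤-trans m>0 (m≤m+n m n))}} (arith (norths w) m n
      ∙ cong (_+ n * norths w) (walk-slope w walk)
      ∙ arith' n (easts w) (norths w)
      ∙ cong (n *_) (norths+easts w ∙ len))
      where
      arith : ∀ x m n → x * (m + n) ≡ m * x + n * x
      arith = solve-∀
      arith' : ∀ n e x → n * e + n * x ≡ n * (x + e)
      arith' = solve-∀

first-least : ∀ (p : ℕ → Bool) k i is js → (∀ {j} → j ∈ is → p j ≡ false) → p i ≡ true → first p k (is ++ i ∷ js) ≡ suc i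
first-least p k i [] js none hit rewrite hit = refl
first-least p k i (j ∷ is) js none hit rewrite none (here refl) = first-least p k i is js (none ∘ there) hit

first-upTo : ∀ (p : ℕ → Bool) d {i} → i < d → (∀ {j} → j < i → p j ≡ false) → p i ≡ true → first p d (upTo d) ≡ suc i
first-upTo p d {i} i<d none hit with m≤n⇒∃[o]m+o≡n i<d
... | k , e = cong (first p d) (cong upTo (sym (+-suc i k ∙ e)) ∙ applyUpTo-++ id i (suc k)) ∙
  cong (λ z → first p d (upTo i ++ z ∷ applyUpTo (λ j → i + suc j) k)) (+-identityʳ i) ∙ first-least p d i (upTo i) _ (λ j∈ → none (∈-upTo⁻ j∈)) hit

-- The lattice path of a closed walk

module WalkPath (m n : ℕ) (m>0 : 0 < m) (n>0 : 0 < n) (ls : List Letter)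
  (ok : Walks.valid m n 0 ls ≡ true) (len : length ls + Stats.marks m n (Walks.locate m n 0 ls) ≡ m + n) where

  open Walks m n using (locate; Walk; valid⇒walk; length-locate)
  open Stats m n
  open Rows m n

  w : List Step
  w = locate 0 ls

  walk : Walk 0 w 0
  walk = valid⇒walk 0 ls ok

  counts : norths w ≡ n × easts w ≡ m
  counts = norths≡n m>0 w walk (cong (_+ marks w) (length-locate 0 ls) ∙ len)

  x s : List ℕ
  x = rows 0 ls
  s = bits ls

  size-x : length x ≡ n
  size-x = length-rows 0 0 ls ∙ proj₁ counts

  in-x : ∀ {j} → j < n → j < length x
  in-x h = subst (_ <_) (sym size-x) h

  start : 0 + n * 0 ≡ m * 0
  start = *-zeroʳ n ∙ sym (*-zeroʳ m)

  base-level : ∀ {j} → j < n → at (northBases w) j + n * at x j ≡ m * j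
  base-level h = at-northBases 0 0 0 ls ok start (in-x h)

  dyck : Dyck m n x
  dyck = record
    { size = size-x
    ; col = λ {j} h → *-cancelˡ-< n _ _ (≤-<-trans (m≤n+m _ (at (northBases w) j) ≤∙ ≤-reflexive (base-level h)) (<-≤-trans (*-monoʳ-< m {{>-nonZero m>0}} h) (≤-reflexive (*-comm m n))))
    ; step = λ {j} h → rows-step 0 ls (in-x h)
    ; diag = λ {j} h → m≤n+m _ (at (northBases w) j) ≤∙ ≤-reflexive (base-level h)
    }

  open Path m n x m>0 n>0 dyck using (level; level-eq; attack-up; attack-down; attack-self; attack; height; east; east-eq; pdinv≡; diag; col)

  level≡ : ∀ {j} → j < n → level j ≡ at (northBases w) j
  level≡ {j} h = +-cancelʳ-≡ (n * at x j) _ _ (level-eq h ∙ sym (base-level h))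

  east≡ : ∀ {c} → c < m → east c ≡ at (eastBases w) c + n
  east≡ {c} h = +-cancelʳ-≡ (n * c) _ _ (east-eq h ∙ sym (+-assoc _ n (n * c) ∙ cong (at (eastBases w) c +_) (sym (*-suc n c)) ∙
    at-eastBases 0 0 0 ls ok start (subst (c <_) (sym (proj₂ counts)) h) ∙ cong (λ k → m * Σ< k (λ j → ι (at x j ≤ᵇ c))) size-x))

  rows-sum : ∀ (k : ℕ → ℕ → ℕ) → Σ< n (λ j → Σ< (at x j) (λ c → k (at (northBases w) j) (at (eastBases w) c))) ≡
    eastNorth (λ s t → k (base t) (base s)) w + Σ w (λ s → guard (marked s) (k (base s) (base s)))
  rows-sum k = cong (λ z → Σ< z (λ j → Σ< (at x j) (λ c → k (at (northBases w) j) (at (eastBases w) c)))) (sym size-x) ∙ rows-eastNorth k [] 0 ls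

  marks≡ : ∀ (h : Step → ℕ) → (∀ ℓ → h (D , ℓ) ≡ 1) → ∀ w → Σ w (λ s → guard (marked s) (h s)) ≡ marks w
  marks≡ h e w = Σ-cong w pt
    where
    pt : ∀ s → guard (marked s) (h s) ≡ ι (marked s)
    pt (N , _) = refl
    pt (D , ℓ) = e ℓ
    pt (E , _) = refl

  pdinv≡pdʷ : pdinv m n x ≡ pdʷ w
  pdinv≡pdʷ = pdinv≡
    ∙ Σ-upTo-cong n (λ {j} j<n → Σ-upTo-cong (at x j) λ {c} c< → cong₂ (λ a e → window a (a + (m + n)) e) (level≡ j<n) (east≡ (<-trans c< (col j<n))))
    ∙ rows-sum (λ a e → window a (a + (m + n)) (e + n))
    ∙ cong (eastNorth (λ s t → window (base t) (base t + (m + n)) (base s + n)) w +_) (marks≡ (λ s → window (base s) (base s + (m + n)) (base s + n)) own w)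
    where
    own : ∀ ℓ → window ℓ (ℓ + (m + n)) (ℓ + n) ≡ 1
    own ℓ = cong ι (∧-intro (<⇒<ᵇ≡ (m<m+n ℓ n>0)) (≤⇒≤ᵇ≡ (+-monoʳ-≤ ℓ (m≤n+m n m))))

  Σ-rows≡λʷ : Σ< n (at x) ≡ λʷ w
  Σ-rows≡λʷ = (Σ-cong (upTo n) λ j → sym (Σ-upTo-1 (at x j))) ∙ rows-sum (λ _ _ → 1) ∙ cong (eastNorth (λ _ _ → 1) w +_) (marks≡ (λ _ → 1) (λ _ → refl) w)

  lost≡lostʷ : lost m n x s ≡ lostʷ w
  lost≡lostʷ = Σ-cong (upTo n) (λ j → sym (Σ-*ˡ (at s j) _ (upTo n)))
    ∙ Σ-pairs n (λ i j → at s j * ι (attack i j)) ∙ cong (Σ< n (λ j → Σ< j (λ i → at s j * ι (attack i j) + at s i * ι (attack j i))) +_) (Σ-vanish (upTo n) λ {j} _ → cong (at s j *_) (attack-self j) ∙ *-zeroʳ (at s j)) ∙ +-identityʳ _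
    ∙ Σ-upTo-cong n (λ {j} j<n → Σ-upTo-cong j λ {i} i<j → cong₂ _+_ (cong (at s j *_) (attack-up i<j j<n ∙ cong₂ (λ a b → crossing b m a) (level≡ (<-trans i<j j<n)) (level≡ j<n))) (cong (at s i *_) (attack-down i<j j<n ∙ cong₂ (λ a b → window b (b + m) a) (level≡ (<-trans i<j j<n)) (level≡ j<n))))
    ∙ cong (λ k → Σ< k (λ j → Σ< j (λ i → h (at s i) (at (northBases w) i) (at s j) (at (northBases w) j)))) (sym (length-bits 0 ls ∙ proj₁ counts))
    ∙ Σ-northPairs h 0 ls
    ∙ pairs-cong w pt
    where
    h : ℕ → ℕ → ℕ → ℕ → ℕ
    h σ a τ b = τ * crossing b m a + σ * window b (b + m) a
    pt : ∀ s t → guard (northish s) (guard (northish t) (h (ι (marked s)) (base s) (ι (marked t)) (base t))) ≡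
      guard (northish s ∧ marked t) (crossing (base t) m (base s)) + guard (marked s ∧ northish t) (window (base t) (base t + m) (base s))
    pt (N , a) (N , b) = refl
    pt (N , a) (D , b) = cong (_+ 0) (*-identityˡ (crossing b m a))
    pt (N , a) (E , b) = refl
    pt (D , a) (N , b) = *-identityˡ (window b (b + m) a)
    pt (D , a) (D , b) = cong₂ _+_ (*-identityˡ (crossing b m a)) (*-identityˡ (window b (b + m) a))
    pt (D , a) (E , b) = refl
    pt (E , a) (N , b) = refl
    pt (E , a) (D , b) = refl
    pt (E , a) (E , b) = refl

  diagonalCells : ℕ
  diagonalCells = Σ< n (λ y → Σ< m (λ c → ι (n * suc c ≤ᵇ m * y)))

  area+λ : area m n x + λʷ w ≡ diagonalCells
  area+λ = cong₂ _+_ (area≡ m n x) (sym Σ-rows≡λʷ)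
    ∙ sym (Σ-+ _ _ (upTo n))
    ∙ Σ-upTo-cong n row
    where
    row : ∀ {y} → y < n → Σ< m (λ c → ι ((at x y ≤ᵇ c) ∧ (n * suc c ≤ᵇ m * y))) + at x y ≡ Σ< m (λ c → ι (n * suc c ≤ᵇ m * y))
    row {y} y<n = cong (Σ< m (λ c → ι ((at x y ≤ᵇ c) ∧ (n * suc c ≤ᵇ m * y))) +_) (sym (Σ-upTo-< m (<⇒≤ (col y<n)))) ∙
      sym (Σ-+ _ _ (upTo m)) ∙ Σ-cong (upTo m) pt
      where
      pt : ∀ c → ι ((at x y ≤ᵇ c) ∧ (n * suc c ≤ᵇ m * y)) + ι (c <ᵇ at x y) ≡ ι (n * suc c ≤ᵇ m * y)
      pt c with at x y ≤? c
      ... | yes h rewrite ≤⇒≤ᵇ≡ h | ≮⇒<ᵇ≡ {c} {at x y} h = +-identityʳ _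
      ... | no h rewrite ≰⇒≤ᵇ≡ {at x y} {c} (≰⇒> h) | <⇒<ᵇ≡ (≰⇒> h) = cong ι (sym (≤⇒≤ᵇ≡ (*-monoʳ-≤ n (≰⇒> h) ≤∙ diag y<n)))

  module _ (Y X : ℕ) (Y>0 : 0 < Y) (Y≤ : Y ≤ n) (slope : m * Y ≡ n * X)
    (above : ∀ {j} → 0 < j → j < Y → 0 < at (northBases w) j) (back : Y < n → at (northBases w) Y ≡ 0) where

    open Diagonal m n m>0 n>0 using (d; m0; n0; m0-eq; n0-eq; m0>0; n0>0; on-diagonal; ret-touch) renaming (Y>0 to row>0)

    ret-first : ret m n x * n0 ≡ Y × ret m n x * m0 ≡ X
    ret-first with coprime-divisor {o = Y} (gcd≡1⇒coprime {n0} {m0} gcd≡1) (divides X (reduced ∙ *-comm n0 X))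
      where
      d>0 : 0 < d
      d>0 = n≢0⇒n>0 λ e → <⇒≢ n>0 (sym (sym n0-eq ∙ cong (n0 *_) e ∙ *-zeroʳ n0))
      gcd≡1 : gcd n0 m0 ≡ 1
      gcd≡1 = *-cancelˡ-≡ _ _ d {{>-nonZero d>0}} (GCD.c*gcd[m,n]≡gcd[cm,cn] d n0 m0 ∙ cong₂ gcd (*-comm d n0 ∙ n0-eq) (*-comm d m0 ∙ m0-eq) ∙ GCD.gcd-comm n m ∙ sym (*-identityʳ d))
      reduced : m0 * Y ≡ n0 * X
      reduced = *-cancelˡ-≡ _ _ d {{>-nonZero d>0}} (arith d m0 Y ∙ cong (_* Y) m0-eq ∙ slope ∙ cong (_* X) (sym n0-eq) ∙ sym (arith d n0 X))
        where
        arith : ∀ d a y → d * (a * y) ≡ a * d * y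
        arith = solve-∀
    ... | divides zero e = contradiction Y>0 (subst (λ z → ¬ 0 < z) (sym e) λ ())
    ... | divides (suc i) e = cong (_* n0) ret≡ ∙ sym e , cong (_* m0) ret≡ ∙ *-cancelˡ-≡ _ _ n {{>-nonZero n>0}} (sym (on-diagonal (suc i)) ∙ cong (m *_) (sym e) ∙ slope)
      where
      i<d : i < d
      i<d = *-cancelʳ-≤ (suc i) d n0 {{>-nonZero n0>0}} (≤-reflexive (sym e) ≤∙ Y≤ ≤∙ ≤-reflexive (sym n0-eq ∙ *-comm n0 d))
      off : ∀ {j} → j < i → touch m n x (suc j * m0) (suc j * n0) ≡ false
      off {j} j<i = ≢true⇒false λ t → case ∨-elim {suc j * n0 ≡ᵇ n} t of λ
        { (inj₁ e') → <⇒≢ j'<n (≡ᵇ≡⇒≡ {suc j * n0} e')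
        ; (inj₂ le) → <⇒≢ (above (row>0 j) j'<Y) (sym (n≤0⇒n≡0 (+-cancelʳ-≤ (n * at x (suc j * n0)) _ _ (≤-reflexive (base-level j'<n ∙ on-diagonal (suc j)) ≤∙ *-monoʳ-≤ n (≤ᵇ≡⇒≤ {suc j * m0} le)))))
        }
        where
        j'<Y : suc j * n0 < Y
        j'<Y = <-≤-trans (*-monoˡ-< n0 {{>-nonZero n0>0}} (s≤s j<i)) (≤-reflexive (sym e))
        j'<n = <-≤-trans j'<Y Y≤
      on : touch m n x (suc i * m0) (suc i * n0) ≡ true
      on with suc i * n0 ≟ n
      ... | yes h rewrite ≡⇒≡ᵇ≡ {suc i * n0} h = refl
      ... | no h rewrite ≢⇒≡ᵇ≡ h = ≤⇒≤ᵇ≡ (*-cancelˡ-≤ n {{>-nonZero n>0}} (≤-reflexive (sym (on-diagonal (suc i))) ≤∙ ≤-reflexive (sym (base-level Y'<n) ∙ cong (_+ n * at x (suc i * n0)) (subst (λ z → at (northBases w) z ≡ 0) e (back (subst (_< n) (sym e) Y'<n))))))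
        where
        Y'<n : suc i * n0 < n
        Y'<n = ≤∧≢⇒< (subst (_≤ n) e Y≤) h
      ret≡ : ret m n x ≡ suc i
      ret≡ = ret-touch dyck ∙ first-upTo (λ i → touch m n x (suc i * m0) (suc i * n0)) d i<d off on

  -- Row 0 is the only attacker of a further mark Y.
  lost-mark : ∀ s s' Y → 0 < Y → Y < n → at (northBases w) Y ≡ 0 → at (northBases w) 0 ≡ 0 → (∀ {j} → 0 < j → j < Y → 0 < at (northBases w) j) →
    (∀ {j} → j < n → at s' j ≡ ι (Y ≡ᵇ j) + at s j) → lost m n x s' ≡ suc (lost m n x s)
  lost-mark s s' Y Y>0 Y<n at-Y at-0 above bit = Σ-upTo-cong n (λ {j} j<n → cong (_* attackers j) (bit j<n) ∙ *-distribʳ-+ (attackers j) (ι (Y ≡ᵇ j)) (at s j))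
    ∙ Σ-+ _ _ (upTo n)
    ∙ cong (_+ lost m n x s) (Σ-upTo-δ n attackers Y<n ∙ one)
    where
    attackers : ℕ → ℕ
    attackers j = Σ< n (λ i → ι (attack i j))
    level-Y : level Y ≡ 0
    level-Y = level≡ Y<n ∙ at-Y
    pt : ∀ {i} → i < n → ι (attack i Y) ≡ ι (0 ≡ᵇ i) * 1
    pt {i} i<n with <-cmp i Y
    pt {zero} i<n | tri< lt _ _ = attack-up lt Y<n ∙ cong₂ (λ a b → crossing b m a) (level≡ i<n ∙ at-0) level-Y ∙ cong ι (<⇒<ᵇ≡ m>0)
    pt {suc i} i<n | tri< lt _ _ = attack-up lt Y<n ∙ cong (λ b → crossing b m (level (suc i))) level-Y ∙ cong (λ b → ι (b ∧ (0 <ᵇ level (suc i) + m))) (≰⇒≤ᵇ≡ {level (suc i)} {0} (subst (0 <_) (sym (level≡ i<n)) (above (s≤s z≤n) lt)))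
    pt {i} i<n | tri≈ _ refl _ = attack-self i ∙ sym (cong (λ b → ι b * 1) (≢⇒≡ᵇ≡ (<⇒≢ Y>0)))
    pt {i} i<n | tri> _ _ gt = attack-down gt i<n ∙ cong (window (level i) (level i + m)) level-Y ∙ sym (cong (λ b → ι b * 1) (≢⇒≡ᵇ≡ (<⇒≢ (<-trans Y>0 gt))))
    one : attackers Y ≡ 1
    one = Σ-upTo-cong n pt ∙ Σ-upTo-δ n (λ _ → 1) n>0

diagonalCells-swap : ∀ m n → Σ< n (λ y → Σ< m (λ c → ι (n * suc c ≤ᵇ m * y))) ≡ Σ< m (λ y → Σ< n (λ c → ι (m * suc c ≤ᵇ n * y)))
diagonalCells-swap m n = Σ-swap (λ y c → ι (n * suc c ≤ᵇ m * y)) (upTo n) (upTo m)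
  ∙ sym (Σ-upTo-reverse m (λ c → Σ< n (λ y → ι (n * suc c ≤ᵇ m * y))))
  ∙ Σ-cong (upTo m) (λ c → sym (Σ-upTo-reverse n (λ y → ι (n * suc (m ∸ suc c) ≤ᵇ m * y))))
  ∙ Σ-upTo-cong m (λ {c} c<m → Σ-upTo-cong n λ {y} y<n → cong ι (turn c<m y<n))
  where
  turn : ∀ {c y} → c < m → y < n → (n * suc (m ∸ suc c) ≤ᵇ m * (n ∸ suc y)) ≡ (m * suc y ≤ᵇ n * c)
  turn {c} {y} c<m y<n = sym (≤ᵇ-+ʳ (m * suc y + n * c) (n * suc c') (m * y')) ∙ cong₂ _≤ᵇ_ left right ∙ ≤ᵇ-+ʳ (n * m) (m * suc y) (n * c)
    where
    c' = m ∸ suc c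
    y' = n ∸ suc y
    arith : ∀ n c' c z → n * suc c' + (z + n * c) ≡ z + n * (c' + suc c)
    arith = solve-∀
    arith' : ∀ m y' y z → m * y' + (m * suc y + z) ≡ z + m * (y' + suc y)
    arith' = solve-∀
    left : n * suc c' + (m * suc y + n * c) ≡ m * suc y + n * m
    left = arith n c' c (m * suc y) ∙ cong (λ z → m * suc y + n * z) (m∸n+n≡m c<m)
    right : m * y' + (m * suc y + n * c) ≡ n * c + n * m
    right = arith' m y' y (n * c) ∙ cong (n * c +_) (cong (m *_) (m∸n+n≡m y<n) ∙ *-comm m n)

-- Words and marked lattice paths

markings : ℕ → ℕ → List ℕ → List (List ℕ × List ℕ)
markings p n x = map (x ,_) (valleys p n x)

words3-complete : ∀ ls → ls ∈ words3 (length ls)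
words3-complete [] = here refl
words3-complete (l ∷ ls) = ∈-concat⁺′ (pick l) (∈-map⁺ (λ ls → (N ∷ ls) ∷ (D ∷ ls) ∷ (E ∷ ls) ∷ []) (words3-complete ls))
  where
  pick : ∀ l → l ∷ ls ∈ (N ∷ ls) ∷ (D ∷ ls) ∷ (E ∷ ls) ∷ []
  pick N = here refl
  pick D = there (here refl)
  pick E = there (there (here refl))

words3-unique : ∀ j → Unique (words3 j)
words3-unique zero = [] ∷ []
words3-unique (suc j) = concatMap-unique (λ ls → (N ∷ ls) ∷ (D ∷ ls) ∷ (E ∷ ls) ∷ []) (drop 1) (words3 j) (words3-unique j)
  (λ ls → ((λ ()) ∷ (λ ()) ∷ []) ∷ ((λ ()) ∷ []) ∷ [] ∷ [])
  λ { (here refl) → refl ; (there (here refl)) → refl ; (there (there (here refl))) → refl }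

eastCount : List Letter → ℕ
eastCount [] = 0
eastCount (N ∷ ls) = eastCount ls
eastCount (D ∷ ls) = suc (eastCount ls)
eastCount (E ∷ ls) = suc (eastCount ls)

markCount : List Letter → ℕ
markCount ls = Σ (bits ls) (λ b → b)

bit : ℕ → Letter
bit zero = N
bit (suc _) = D

encode : ℕ → ℕ → List ℕ → List ℕ → List Letter
encode m cur [] bs = replicate (m ∸ cur) E
encode m cur (x ∷ xs) [] = []
encode m cur (x ∷ xs) (b ∷ bs) = replicate (x ∸ cur ∸ b) E ++ bit b ∷ encode m x xs bs

Marked : ℕ → List ℕ → List ℕ → Set
Marked cur [] [] = ⊤
Marked cur (x ∷ xs) (b ∷ bs) = cur + b ≤ x × b < 2 × Marked x xs bs
Marked cur _ _ = ⊥

marked-build : ∀ cur xs bs → length xs ≡ length bs → (∀ {j} → j < length xs → at bs j < 2) → (0 < length xs → cur + at bs 0 ≤ at xs 0) →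
  (∀ {j} → suc j < length xs → at xs j + at bs (suc j) ≤ at xs (suc j)) → Marked cur xs bs
marked-build cur [] [] e two hd st = tt
marked-build cur (x ∷ xs) (b ∷ bs) e two hd st = hd (s≤s z≤n) , two (s≤s z≤n) , marked-build x xs bs (suc-injective e) (λ h → two (s≤s h)) (λ h → st (s≤s h)) (λ h → st (s≤s h))

marked-bit : ∀ cur xs bs → Marked cur xs bs → ∀ {j} → j < length bs → at bs j < 2
marked-bit cur (x ∷ xs) (b ∷ bs) (_ , h , _) {zero} _ = h
marked-bit cur (x ∷ xs) (b ∷ bs) (_ , _ , M) {suc j} (s≤s h) = marked-bit x xs bs M h

marked-head : ∀ cur xs bs → Marked cur xs bs → 0 < length bs → cur + at bs 0 ≤ at xs 0
marked-head cur (x ∷ xs) (b ∷ bs) (h , _) _ = h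

marked-step : ∀ cur xs bs → Marked cur xs bs → ∀ {j} → suc j < length bs → at xs j + at bs (suc j) ≤ at xs (suc j)
marked-step cur (x ∷ xs) (b ∷ bs) (_ , _ , M) {zero} (s≤s h) = marked-head x xs bs M h
marked-step cur (x ∷ xs) (b ∷ bs) (_ , _ , M) {suc j} (s≤s h) = marked-step x xs bs M h

marked-weaken : ∀ cur xs bs → Marked (suc cur) xs bs → Marked cur xs bs
marked-weaken cur [] [] _ = tt
marked-weaken cur (x ∷ xs) (b ∷ bs) (h , h2 , M) = n≤1+n _ ≤∙ h , h2 , M

rows-marked : ∀ cur ls → Marked cur (rows cur ls) (bits ls)
rows-marked cur [] = tt
rows-marked cur (N ∷ ls) = ≤-reflexive (+-identityʳ cur) , s≤s z≤n , rows-marked cur ls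
rows-marked cur (D ∷ ls) = ≤-reflexive (+-comm cur 1) , s≤s (s≤s z≤n) , rows-marked (suc cur) ls
rows-marked cur (E ∷ ls) = marked-weaken cur _ _ (rows-marked (suc cur) ls)

rows-replicate : ∀ cur k ls → rows cur (replicate k E ++ ls) ≡ rows (k + cur) ls
rows-replicate cur zero ls = refl
rows-replicate cur (suc k) ls = rows-replicate (suc cur) k ls ∙ cong (λ z → rows z ls) (+-suc k cur)

bits-replicate : ∀ k ls → bits (replicate k E ++ ls) ≡ bits ls
bits-replicate zero ls = refl
bits-replicate (suc k) ls = bits-replicate k ls

gap : ∀ {cur x} b → cur + b ≤ x → x ∸ cur ∸ b + b + cur ≡ x
gap {cur} {x} b h = cong (_+ cur) (m∸n+n≡m (m+n≤o⇒m≤o∸n b (≤-reflexive (+-comm b cur) ≤∙ h))) ∙ m∸n+n≡m (m≤m+n cur b ≤∙ h)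

rows-encode : ∀ m cur xs bs → Marked cur xs bs → rows cur (encode m cur xs bs) ≡ xs
rows-encode m cur [] [] M = cong (rows cur) (sym (List.++-identityʳ (replicate (m ∸ cur) E))) ∙ rows-replicate cur (m ∸ cur) []
rows-encode m cur (x ∷ xs) (zero ∷ bs) (h , _ , M) = rows-replicate cur (x ∸ cur) (N ∷ encode m x xs bs) ∙
  cong (λ z → rows z (N ∷ encode m x xs bs)) (cong (_+ cur) (sym (+-identityʳ (x ∸ cur))) ∙ gap 0 h) ∙ cong (x ∷_) (rows-encode m x xs bs M)
rows-encode m cur (x ∷ xs) (suc zero ∷ bs) (h , _ , M) = rows-replicate cur (x ∸ cur ∸ 1) (D ∷ encode m x xs bs) ∙
  cong (λ z → z ∷ rows z (encode m x xs bs)) (cong (_+ cur) (+-comm 1 (x ∸ cur ∸ 1)) ∙ gap 1 h) ∙ cong (x ∷_) (rows-encode m x xs bs M)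
rows-encode m cur (x ∷ xs) (suc (suc b) ∷ bs) (_ , s≤s (s≤s ()) , _)

bits-encode : ∀ m cur xs bs → Marked cur xs bs → bits (encode m cur xs bs) ≡ bs
bits-encode m cur [] [] M = cong bits (sym (List.++-identityʳ (replicate (m ∸ cur) E))) ∙ bits-replicate (m ∸ cur) []
bits-encode m cur (x ∷ xs) (zero ∷ bs) (h , _ , M) = bits-replicate (x ∸ cur) (N ∷ encode m x xs bs) ∙ cong (0 ∷_) (bits-encode m x xs bs M)
bits-encode m cur (x ∷ xs) (suc zero ∷ bs) (h , _ , M) = bits-replicate (x ∸ cur ∸ 1) (D ∷ encode m x xs bs) ∙ cong (1 ∷_) (bits-encode m x xs bs M)
bits-encode m cur (x ∷ xs) (suc (suc b) ∷ bs) (_ , s≤s (s≤s ()) , _)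

encode-E : ∀ m cur xs bs → cur < m → Marked (suc cur) xs bs → encode m cur xs bs ≡ E ∷ encode m (suc cur) xs bs
encode-E m cur [] [] lt M = cong (λ k → replicate k E) (sym (sym (+-∸-assoc 1 lt) ∙ refl))
encode-E m cur (x ∷ xs) (b ∷ bs) lt (h , _) = cong (λ k → replicate k E ++ bit b ∷ encode m x xs bs) eq
  where
  eq : x ∸ cur ∸ b ≡ suc (x ∸ suc cur ∸ b)
  eq = +-cancelʳ-≡ (b + cur) _ _ (sym (+-assoc (x ∸ cur ∸ b) b cur) ∙ gap b (n≤1+n _ ≤∙ h) ∙ sym (gap b h) ∙ arith (x ∸ suc cur ∸ b) b cur)
    where
    arith : ∀ k b c → k + b + suc c ≡ suc k + (b + c)
    arith = solve-∀

encode-decode : ∀ m cur ls → cur + eastCount ls ≡ m → encode m cur (rows cur ls) (bits ls) ≡ ls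
encode-decode m cur [] e = cong (λ k → replicate k E) (cong (_∸ cur) (sym e ∙ +-identityʳ cur) ∙ n∸n≡0 cur)
encode-decode m cur (N ∷ ls) e = cong (λ k → replicate k E ++ N ∷ encode m cur (rows cur ls) (bits ls)) (n∸n≡0 cur) ∙ cong (N ∷_) (encode-decode m cur ls e)
encode-decode m cur (D ∷ ls) e = cong (λ k → replicate k E ++ D ∷ encode m (suc cur) (rows (suc cur) ls) (bits ls)) (cong (_∸ 1) (m+n∸n≡m 1 cur)) ∙ cong (D ∷_) (encode-decode m (suc cur) ls (sym (+-suc cur _) ∙ e))
encode-decode m cur (E ∷ ls) e = encode-E m cur (rows (suc cur) ls) (bits ls) (m≤m+n (suc cur) (eastCount ls) ≤∙ ≤-reflexive (sym (+-suc cur _) ∙ e)) (rows-marked (suc cur) ls) ∙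
  cong (E ∷_) (encode-decode m (suc cur) ls (sym (+-suc cur _) ∙ e))

length-encode : ∀ m cur xs bs → Marked cur xs bs → cur ≤ m → (∀ {j} → j < length xs → at xs j ≤ m) →
  length (encode m cur xs bs) + Σ bs (λ b → b) + cur ≡ m + length xs
length-encode m cur [] [] M le bd = cong (λ z → z + 0 + cur) (List.length-replicate (m ∸ cur)) ∙ cong (_+ cur) (+-identityʳ (m ∸ cur)) ∙ m∸n+n≡m le ∙ sym (+-identityʳ m)
length-encode m cur (x ∷ xs) (b ∷ bs) (h , _ , M) le bd = cong (λ z → z + (b + S) + cur) (List.length-++ (replicate k E) ∙ cong (_+ suc (length rest)) (List.length-replicate k))
  ∙ arith k (length rest) b S cur
  ∙ cong (λ z → suc (length rest + S + z)) (gap b h)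
  ∙ cong suc (length-encode m x xs bs M (bd {0} (s≤s z≤n)) (λ h → bd (s≤s h)))
  ∙ sym (+-suc m (length xs))
  where
  k = x ∸ cur ∸ b
  rest = encode m x xs bs
  S = Σ bs (λ b → b)
  arith : ∀ k l b s c → k + suc l + (b + s) + c ≡ suc (l + s + (k + b + c))
  arith = solve-∀

module Bijection (m n : ℕ) (m>0 : 0 < m) (n>0 : 0 < n) where

  open Walks m n hiding (step)
  open Stats m n
  open Rows m n

  easts-locate : ∀ u ls → easts (locate u ls) ≡ eastCount ls
  easts-locate u [] = refl
  easts-locate u (N ∷ ls) = easts-locate _ ls
  easts-locate u (D ∷ ls) = cong suc (easts-locate _ ls)
  easts-locate u (E ∷ ls) = cong suc (easts-locate _ ls)

  marks-locate : ∀ u ls → marks (locate u ls) ≡ markCount ls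
  marks-locate u [] = refl
  marks-locate u (N ∷ ls) = marks-locate _ ls
  marks-locate u (D ∷ ls) = cong suc (marks-locate _ ls)
  marks-locate u (E ∷ ls) = marks-locate _ ls

  valid-replicate : ∀ v k ls → valid (v + k * n) (replicate k E ++ ls) ≡ valid v ls
  valid-replicate v zero ls = cong (λ z → valid z ls) (+-identityʳ v)
  valid-replicate v (suc k) ls = cong₂ (λ b z → b ∧ valid z (replicate k E ++ ls)) (≤⇒≤ᵇ≡ {n} (m≤m+n n (k * n) ≤∙ m≤n+m _ v))
    (cong (_∸ n) (arith v n (k * n)) ∙ m+n∸n≡m (v + k * n) n) ∙ valid-replicate v k ls
    where
    arith : ∀ v n k → v + (n + k) ≡ v + k + n
    arith = solve-∀

  valid-encode : ∀ cur r u xs bs → Marked cur xs bs → (∀ {j} → j < length xs → n * at xs j ≤ m * (r + j)) → r + length xs ≡ n → cur ≤ m →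
    (∀ {j} → j < length xs → at xs j ≤ m) → u + n * cur ≡ m * r → valid u (encode m cur xs bs) ≡ true
  valid-encode cur r u [] [] M dg len le bd e = cong₂ (λ z l → valid z l) u≡ (sym (List.++-identityʳ (replicate (m ∸ cur) E))) ∙ valid-replicate 0 (m ∸ cur) []
    where
    u≡ : u ≡ (m ∸ cur) * n
    u≡ = +-cancelʳ-≡ (cur * n) _ _ (cong (u +_) (*-comm cur n) ∙ e ∙ cong (m *_) (sym (+-identityʳ r) ∙ len) ∙ sym (sym (*-distribʳ-+ n (m ∸ cur) cur) ∙ cong (_* n) (m∸n+n≡m le)))
  valid-encode cur r u (x ∷ xs) (b ∷ bs) (h , h2 , M) dg len le bd e = go b h h2
    where
    L = m * r ∸ n * x
    L-eq : L + n * x ≡ m * r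
    L-eq = m∸n+n≡m (dg {0} (s≤s z≤n) ≤∙ ≤-reflexive (cong (m *_) (+-identityʳ r)))
    rest : valid (L + m) (encode m x xs bs) ≡ true
    rest = valid-encode x (suc r) (L + m) xs bs M (λ {j} j< → dg (s≤s j<) ≤∙ ≤-reflexive (cong (m *_) (+-suc r j))) (sym (+-suc r _) ∙ len) (bd {0} (s≤s z≤n)) (λ j< → bd (s≤s j<))
      (arith L m (n * x) ∙ cong (m +_) L-eq ∙ sym (*-suc m r))
      where
      arith : ∀ l m x → l + m + x ≡ m + (l + x)
      arith = solve-∀
    u≡ : ∀ b → cur + b ≤ x → u ≡ L + b * n + (x ∸ cur ∸ b) * n
    u≡ b h = +-cancelʳ-≡ (n * cur) _ _ (e ∙ sym L-eq ∙ cong (λ z → L + n * z) (sym (gap b h)) ∙ arith L n (x ∸ cur ∸ b) b cur)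
      where
      arith : ∀ l n k b c → l + n * (k + b + c) ≡ l + b * n + k * n + n * c
      arith = solve-∀
    go : ∀ b → cur + b ≤ x → b < 2 → valid u (replicate (x ∸ cur ∸ b) E ++ bit b ∷ encode m x xs bs) ≡ true
    go zero h _ = cong (λ z → valid z (replicate (x ∸ cur) E ++ N ∷ encode m x xs bs)) (u≡ 0 h) ∙ valid-replicate (L + 0) (x ∸ cur) (N ∷ encode m x xs bs) ∙ cong (λ z → valid (z + m) (encode m x xs bs)) (+-identityʳ L) ∙ rest
    go (suc zero) h _ = cong (λ z → valid z (replicate (x ∸ cur ∸ 1) E ++ D ∷ encode m x xs bs)) (u≡ 1 h) ∙ valid-replicate (L + 1 * n) (x ∸ cur ∸ 1) (D ∷ encode m x xs bs) ∙
      ∧-intro (≤⇒≤ᵇ≡ {n} (≤-reflexive (sym (*-identityˡ n)) ≤∙ m≤n+m (1 * n) L)) (cong (λ z → valid (z + m) (encode m x xs bs)) (cong (λ z → L + z ∸ n) (*-identityˡ n) ∙ m+n∸n≡m L n) ∙ rest)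
    go (suc (suc b)) h (s≤s (s≤s ()))

  words-paths : ∀ p L → L + p ≡ m + n → ∀ (F : List ℕ → List ℕ → ℕ) →
    Σ (dyckPaths m n) (λ x → Σ (valleys p n x) (F x)) ≡ Σ (words3 L) (λ ls → ι (valid 0 ls) * (ι (markCount ls ≡ᵇ p) * F (rows 0 ls) (bits ls)))
  words-paths p L L+p F = (Σ-cong (dyckPaths m n) λ x → sym (Σ-map (λ y → F (proj₁ y) (proj₂ y)) (x ,_) (valleys p n x))) ∙ sym (Σ-concatMap (λ y → F (proj₁ y) (proj₂ y)) (markings p n) (dyckPaths m n)) ∙
    Σ-bij (λ y → F (proj₁ y) (proj₂ y)) G (λ y → encode m 0 (proj₁ y) (proj₂ y)) (λ ls → rows 0 ls , bits ls) (concatMap (markings p n) (dyckPaths m n)) (words3 L)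
      (concatMap-unique (markings p n) proj₁ (dyckPaths m n) (filterᵇ-unique _ _ (words-unique n m))
        (λ x → Uniqueₚ.map⁺ (λ e → cong proj₂ e) (filterᵇ-unique _ _ (words-unique n 2))) tag)
      (words3-unique L) to from
    where
    G : List Letter → ℕ
    G ls = ι (valid 0 ls) * (ι (markCount ls ≡ᵇ p) * F (rows 0 ls) (bits ls))
    tag : ∀ {x y} → y ∈ map (x ,_) (valleys p n x) → proj₁ y ≡ x
    tag i with ∈-map⁻ _ i
    ... | _ , _ , refl = refl
    to : ∀ {y} → y ∈ concatMap (markings p n) (dyckPaths m n) → F (proj₁ y) (proj₂ y) ≢ 0 →
      encode m 0 (proj₁ y) (proj₂ y) ∈ words3 L × G (encode m 0 (proj₁ y) (proj₂ y)) ≡ F (proj₁ y) (proj₂ y) × (rows 0 (encode m 0 (proj₁ y) (proj₂ y)) , bits (encode m 0 (proj₁ y) (proj₂ y))) ≡ y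
    to {y} y∈ _ with ∈-concat⁻′ (map (markings p n) (dyckPaths m n)) y∈
    ... | ys , y∈ys , ys∈ with ∈-map⁻ (markings p n) ys∈
    ... | x , x∈ , refl with ∈-map⁻ (x ,_) y∈ys
    ... | s , s∈ , refl = subst (λ k → ls ∈ words3 k) len (words3-complete ls) ,
      trans (cong₂ (λ b c → ι b * (ι c * F (rows 0 ls) (bits ls))) ok (≡⇒≡ᵇ≡ (cong (λ l → Σ l (λ b → b)) bits≡ ∙ Σs))) (*-identityˡ _ ∙ *-identityˡ _ ∙ cong₂ F rows≡ bits≡) ,
      cong₂ _,_ rows≡ bits≡
      where
      Dk = dyckPaths-sound m n x∈
      open Dyck Dk
      vs = valleys-∈⁻ p n x s∈
      s-words = words-sound n 2 (proj₁ vs)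
      ls = encode m 0 x s
      <n : ∀ {j} → j < length x → j < n
      <n h = subst (_ <_) size h
      hd : 0 < length x → 0 + at s 0 ≤ at x 0
      hd h with proj₁ (proj₂ vs) {0} (<n h)
      ... | inj₁ e = ≤-reflexive e ≤∙ z≤n
      ... | inj₂ ()
      st : ∀ {j} → suc j < length x → at x j + at s (suc j) ≤ at x (suc j)
      st {j} h with proj₁ (proj₂ vs) {suc j} (<n h)
      ... | inj₁ e = ≤-reflexive (cong (at x j +_) e ∙ +-identityʳ _) ≤∙ step (<n h)
      ... | inj₂ v = +-monoʳ-≤ (at x j) (≤-pred (proj₂ s-words (<n h))) ≤∙ ≤-reflexive (+-comm (at x j) 1) ≤∙ <ᵇ≡⇒< v
      M : Marked 0 x s
      M = marked-build 0 x s (size ∙ sym (proj₁ s-words)) (λ h → proj₂ s-words (<n h)) hd st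
      rows≡ = rows-encode m 0 x s M
      bits≡ = bits-encode m 0 x s M
      bd : ∀ {j} → j < length x → at x j ≤ m
      bd h = <⇒≤ (col (<n h))
      ok : valid 0 ls ≡ true
      ok = valid-encode 0 0 0 x s M (λ h → diag (<n h)) size z≤n bd (*-zeroʳ n ∙ sym (*-zeroʳ m))
      Σs : Σ s (λ b → b) ≡ p
      Σs = Σ-at (λ b → b) s ∙ cong (λ k → Σ< k (at s)) (proj₁ s-words) ∙ proj₂ (proj₂ vs)
      len : length ls ≡ L
      len = +-cancelʳ-≡ p _ _ (cong (length ls +_) (sym Σs) ∙ sym (+-identityʳ _) ∙ length-encode m 0 x s M z≤n bd ∙ cong (m +_) size ∙ sym L+p)
    from : ∀ {ls} → ls ∈ words3 L → G ls ≢ 0 →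
      (rows 0 ls , bits ls) ∈ concatMap (markings p n) (dyckPaths m n) × F (rows 0 ls) (bits ls) ≡ G ls × encode m 0 (rows 0 ls) (bits ls) ≡ ls
    from {ls} ls∈ ne = ∈-concat⁺′ (∈-map⁺ (rows 0 ls ,_) s∈) (∈-map⁺ (markings p n) (dyckPaths-complete m n dyck)) ,
      sym (cong₂ (λ b c → ι b * (ι c * F (rows 0 ls) (bits ls))) ok mk ∙ *-identityˡ _ ∙ *-identityˡ _) ,
      encode-decode m 0 ls (sym (easts-locate 0 ls) ∙ proj₂ counts)
      where
      ok : valid 0 ls ≡ true
      ok = ι≢0 (proj₁ (*-≢0 {ι (valid 0 ls)} ne))
      mk : (markCount ls ≡ᵇ p) ≡ true
      mk = ι≢0 (proj₁ (*-≢0 {ι (markCount ls ≡ᵇ p)} (proj₂ (*-≢0 {ι (valid 0 ls)} ne))))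
      open WalkPath m n m>0 n>0 ls ok (cong₂ _+_ (words3-length L ls∈) (marks-locate 0 ls ∙ ≡ᵇ≡⇒≡ {markCount ls} mk) ∙ L+p) using (dyck; counts)
      len-bits : length (bits ls) ≡ n
      len-bits = length-bits 0 ls ∙ proj₁ counts
      M = rows-marked 0 ls
      valley-bit : ∀ j → j < n → at (bits ls) j ≡ 0 ⊎ valley (rows 0 ls) j ≡ true
      valley-bit j j<n with at (bits ls) j in e
      ... | zero = inj₁ refl
      valley-bit zero j<n | suc b = contradiction (marked-head 0 (rows 0 ls) (bits ls) M (subst (0 <_) (sym len-bits) j<n)) λ h → <⇒≱ (s≤s z≤n ≤∙ ≤-reflexive (sym e)) (h ≤∙ ≤-reflexive (rows-0 (rows 0 ls) refl))
        where
        rows-0 : ∀ xs → rows 0 ls ≡ xs → at xs 0 ≡ 0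
        rows-0 xs refl = n≤0⇒n≡0 (*-cancelˡ-≤ n {{>-nonZero n>0}} (Dyck.diag dyck j<n ≤∙ ≤-reflexive (*-zeroʳ m ∙ sym (*-zeroʳ n))))
      valley-bit (suc j) j<n | suc b = inj₂ (<⇒<ᵇ≡ (≤-reflexive (+-comm 1 _) ≤∙ +-monoʳ-≤ (at (rows 0 ls) j) (s≤s z≤n ≤∙ ≤-reflexive (sym e)) ≤∙ marked-step 0 (rows 0 ls) (bits ls) M (subst (suc j <_) (sym len-bits) j<n)))
      s∈ : bits ls ∈ valleys p n (rows 0 ls)
      s∈ = valleys-∈⁺ p n (rows 0 ls) (words-complete n 2 (bits ls) len-bits λ j<n → marked-bit 0 (rows 0 ls) (bits ls) M (subst (_ <_) (sym len-bits) j<n)) (λ {j} j<n → valley-bit j j<n)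
        (cong (λ k → Σ< k (at (bits ls))) (sym len-bits) ∙ sym (Σ-at (λ b → b) (bits ls)) ∙ ≡ᵇ≡⇒≡ {markCount ls} mk)

-- Cutting a walk at its first return to level 0

dropLast : List Letter → List Letter
dropLast [] = []
dropLast (l ∷ []) = []
dropLast (l ∷ k ∷ ls) = l ∷ dropLast (k ∷ ls)

dropLast-snoc : ∀ ls l → dropLast (ls ++ l ∷ []) ≡ ls
dropLast-snoc [] l = refl
dropLast-snoc (k ∷ []) l = refl
dropLast-snoc (k ∷ j ∷ ls) l = cong (k ∷_) (dropLast-snoc (j ∷ ls) l)

-- Merges the last step E 0 of v and the first step N 0 of w into D 0.
glue : List Letter → List Letter → List Letter
glue v w = dropLast v ++ D ∷ drop 1 w

module FirstReturn (m n : ℕ) (m>0 : 0 < m) (n>0 : 0 < n) where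

  open Walks m n

  stay : ℕ → List Letter → Bool
  stay u [] = u ≡ᵇ n
  stay u (N ∷ ls) = stay (u + m) ls
  stay u (D ∷ ls) = (n <ᵇ u) ∧ stay (u ∸ n + m) ls
  stay u (E ∷ ls) = (n <ᵇ u) ∧ stay (u ∸ n) ls

  returns : ∀ (L : ℕ) (Θ : List Letter → ℕ) (u i : ℕ) → ℕ
  returns L Θ u i = Σ (words3 i) (λ ls1 → ι (stay u ls1) * Σ (words3 L) (λ ls2 → ι (valid 0 ls2) * Θ (ls1 ++ E ∷ ls2) + ι (valid m ls2) * Θ (ls1 ++ D ∷ ls2)))

  cut : ∀ L u (Θ : List Letter → ℕ) → 0 < u → Σ (words3 L) (λ ls → ι (valid u ls) * Θ ls) ≡ Σ< L (λ i → returns (L ∸ suc i) Θ u i)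
  cut zero u Θ u>0 = cong (λ b → ι b * Θ [] + 0) (≢⇒≡ᵇ≡ (>⇒≢ u>0))
  cut (suc L) u Θ u>0 = Σ-words3 L (λ ls → ι (valid u ls) * Θ ls)
    ∙ cong₂ _+_ (cut L (u + m) (Θ ∘ (N ∷_)) (<-≤-trans u>0 (m≤m+n u m))) (cong₂ _+_ part-D part-E)
    ∙ arith RN (ι (u ≡ᵇ n)) SD RD SE RE
    ∙ cong₂ _+_ (cong (λ z → ι (u ≡ᵇ n) * z + 0) (sym (Σ-+ _ _ (words3 L)))) (sym ((Σ-cong (upTo L) λ i → Σ-words3 i _) ∙ Σ-+ _ _ (upTo L) ∙ cong (RN +_) (Σ-+ _ _ (upTo L))))
    ∙ sym (Σ-upTo-suc L (λ i → returns (suc L ∸ suc i) Θ u i))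
    where
    SE = Σ (words3 L) (λ ls → ι (valid 0 ls) * Θ (E ∷ ls))
    SD = Σ (words3 L) (λ ls → ι (valid m ls) * Θ (D ∷ ls))
    inner : ℕ → (List Letter → List Letter) → List Letter → ℕ
    inner i f ls1 = Σ (words3 (L ∸ suc i)) (λ ls2 → ι (valid 0 ls2) * Θ (f (ls1 ++ E ∷ ls2)) + ι (valid m ls2) * Θ (f (ls1 ++ D ∷ ls2)))
    RN = Σ< L (λ i → Σ (words3 i) (λ ls1 → ι (stay (u + m) ls1) * inner i (N ∷_) ls1))
    RD = Σ< L (λ i → Σ (words3 i) (λ ls1 → ι ((n <ᵇ u) ∧ stay (u ∸ n + m) ls1) * inner i (D ∷_) ls1))
    RE = Σ< L (λ i → Σ (words3 i) (λ ls1 → ι ((n <ᵇ u) ∧ stay (u ∸ n) ls1) * inner i (E ∷_) ls1))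
    arith : ∀ a b c d e f → a + ((b * c + d) + (b * e + f)) ≡ b * (e + c) + 0 + (a + (d + f))
    arith = solve-∀
    zeros : ∀ (f : List Letter → List Letter) → Σ< L (λ i → Σ (words3 i) (λ ls1 → 0 * inner i f ls1)) ≡ 0
    zeros f = Σ-vanish (upTo L) λ {i} _ → Σ-0 (words3 i)
    part-D : Σ (words3 L) (λ ls → ι ((n ≤ᵇ u) ∧ valid (u ∸ n + m) ls) * Θ (D ∷ ls)) ≡ ι (u ≡ᵇ n) * SD + RD
    part-D with <-cmp n u
    ... | tri< lt ne _ rewrite ≤⇒≤ᵇ≡ (<⇒≤ lt) | <⇒<ᵇ≡ lt | ≢⇒≡ᵇ≡ {u} {n} (ne ∘ sym) = cut L (u ∸ n + m) (Θ ∘ (D ∷_)) (<-≤-trans m>0 (m≤n+m m (u ∸ n)))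
    ... | tri≈ _ refl _ rewrite ≤⇒≤ᵇ≡ (≤-refl {n}) | ≮⇒<ᵇ≡ (≤-refl {n}) | ≡⇒≡ᵇ≡ {n} refl | n∸n≡0 n = sym (+-identityʳ _) ∙ cong₂ _+_ (sym (*-identityˡ SD)) (sym (zeros (D ∷_)))
    ... | tri> _ ne gt rewrite ≰⇒≤ᵇ≡ {n} {u} gt | ≮⇒<ᵇ≡ {n} {u} (<⇒≤ gt) | ≢⇒≡ᵇ≡ {u} {n} (ne ∘ sym) = Σ-0 (words3 L) ∙ sym (zeros (D ∷_))
    part-E : Σ (words3 L) (λ ls → ι ((n ≤ᵇ u) ∧ valid (u ∸ n) ls) * Θ (E ∷ ls)) ≡ ι (u ≡ᵇ n) * SE + RE
    part-E with <-cmp n u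
    ... | tri< lt ne _ rewrite ≤⇒≤ᵇ≡ (<⇒≤ lt) | <⇒<ᵇ≡ lt | ≢⇒≡ᵇ≡ {u} {n} (ne ∘ sym) = cut L (u ∸ n) (Θ ∘ (E ∷_)) (m<n⇒0<n∸m lt)
    ... | tri≈ _ refl _ rewrite ≤⇒≤ᵇ≡ (≤-refl {n}) | ≮⇒<ᵇ≡ (≤-refl {n}) | ≡⇒≡ᵇ≡ {n} refl | n∸n≡0 n = sym (+-identityʳ _) ∙ cong₂ _+_ (sym (*-identityˡ SE)) (sym (zeros (E ∷_)))
    ... | tri> _ ne gt rewrite ≰⇒≤ᵇ≡ {n} {u} gt | ≮⇒<ᵇ≡ {n} {u} (<⇒≤ gt) | ≢⇒≡ᵇ≡ {u} {n} (ne ∘ sym) = Σ-0 (words3 L) ∙ sym (zeros (E ∷_))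

  loop : List Letter → List Step
  loop = locate 0

  valid-0 : ∀ K (Θ : List Letter → ℕ) → Σ (words3 (suc K)) (λ ls → ι (valid 0 ls) * Θ ls) ≡ Σ (words3 K) (λ ls → ι (valid m ls) * Θ (N ∷ ls))
  valid-0 K Θ = Σ-words3 K (λ ls → ι (valid 0 ls) * Θ ls) ∙ cong (Σ (words3 K) (λ ls → ι (valid m ls) * Θ (N ∷ ls)) +_)
    (cong₂ _+_ (Σ-vanish (words3 K) λ {ls} _ → cong (λ b → ι (b ∧ valid (0 ∸ n + m) ls) * Θ (D ∷ ls)) (≰⇒≤ᵇ≡ {n} n>0)) (Σ-vanish (words3 K) λ {ls} _ → cong (λ b → ι (b ∧ valid (0 ∸ n) ls) * Θ (E ∷ ls)) (≰⇒≤ᵇ≡ {n} n>0))) ∙ +-identityʳ _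

  prim : List Letter → Bool
  prim v = (mult (loop v) N 0 ≡ᵇ 1) ∧ (mult (loop v) D 0 ≡ᵇ 0)

  starts-N : ∀ l v → valid 0 (l ∷ v) ≡ true → l ≡ N
  starts-N N v ok = refl
  starts-N D v ok = contradiction (≤ᵇ≡⇒≤ {n} (proj₁ (∧-elim {n ≤ᵇ 0} ok))) (<⇒≱ n>0)
  starts-N E v ok = contradiction (≤ᵇ≡⇒≤ {n} (proj₁ (∧-elim {n ≤ᵇ 0} ok))) (<⇒≱ n>0)

  ends-E : ∀ u l v → valid u (l ∷ v) ≡ true → ∃ λ v1 → l ∷ v ≡ v1 ++ E ∷ []
  ends-E u N [] ok = contradiction (≡ᵇ≡⇒≡ {u + m} ok) (>⇒≢ (<-≤-trans m>0 (m≤n+m m u)))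
  ends-E u D [] ok = contradiction (≡ᵇ≡⇒≡ {u ∸ n + m} (proj₂ (∧-elim {n ≤ᵇ u} ok))) (>⇒≢ (<-≤-trans m>0 (m≤n+m m (u ∸ n))))
  ends-E u E [] ok = [] , refl
  ends-E u l (k ∷ v) ok with ends-E _ k v (proj₂ (∧-elim {allowed l u} ok))
  ... | v1 , e = l ∷ v1 , cong (l ∷_) e

  valid-++ : ∀ u v w → valid u v ≡ true → valid u (v ++ w) ≡ valid 0 w
  valid-++ u [] w ok = cong (λ z → valid z w) (≡ᵇ≡⇒≡ {u} ok)
  valid-++ u (l ∷ v) w ok with ∧-elim {allowed l u} ok
  ... | a , ok' rewrite a = valid-++ _ v w ok'

  locate-++ : ∀ u v w → valid u v ≡ true → locate u (v ++ w) ≡ locate u v ++ locate 0 w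
  locate-++ u [] w ok = cong (λ z → locate z w) (≡ᵇ≡⇒≡ {u} ok)
  locate-++ u (l ∷ v) w ok = cong (Walks.step m n l u ∷_) (locate-++ _ v w (proj₂ (∧-elim {allowed l u} ok)))

  locate-stay : ∀ u ls1 ls2 → stay u ls1 ≡ true → locate u (ls1 ++ ls2) ≡ locate u ls1 ++ locate n ls2
  locate-stay u [] ls2 st = cong (λ z → locate z ls2) (≡ᵇ≡⇒≡ {u} st)
  locate-stay u (N ∷ ls1) ls2 st = cong ((N , u) ∷_) (locate-stay (u + m) ls1 ls2 st)
  locate-stay u (D ∷ ls1) ls2 st = cong ((D , u ∸ n) ∷_) (locate-stay (u ∸ n + m) ls1 ls2 (proj₂ (∧-elim {n <ᵇ u} st)))
  locate-stay u (E ∷ ls1) ls2 st = cong ((E , u ∸ n) ∷_) (locate-stay (u ∸ n) ls1 ls2 (proj₂ (∧-elim {n <ᵇ u} st)))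

  stay-0 : ∀ u ls → 0 < u → stay u ls ≡ true → mult (locate u ls) N 0 ≡ 0 × mult (locate u ls) D 0 ≡ 0
  stay-0 u [] u>0 st = refl , refl
  stay-0 u (N ∷ ls) u>0 st with stay-0 (u + m) ls (<-≤-trans u>0 (m≤m+n u m)) st
  ... | a , b = cong₂ (λ x y → ι x + y) (≢⇒≡ᵇ≡ (>⇒≢ u>0)) a , b
  stay-0 u (D ∷ ls) u>0 st with ∧-elim {n <ᵇ u} st
  ... | lt , st' with stay-0 (u ∸ n + m) ls (<-≤-trans m>0 (m≤n+m m (u ∸ n))) st'
  ... | a , b = a , cong₂ (λ x y → ι x + y) (≢⇒≡ᵇ≡ (>⇒≢ (m<n⇒0<n∸m (<ᵇ≡⇒< {n} lt)))) b
  stay-0 u (E ∷ ls) u>0 st with ∧-elim {n <ᵇ u} st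
  ... | lt , st' = stay-0 (u ∸ n) ls (m<n⇒0<n∸m (<ᵇ≡⇒< {n} lt)) st'

  mult-cut : ∀ ls1 l ls2 k → stay m ls1 ≡ true → mult (loop (N ∷ ls1 ++ l ∷ ls2)) k 0 ≡ ι (eqStep (N , 0) (k , 0)) + (mult (locate m ls1) k 0 + mult (locate n (l ∷ ls2)) k 0)
  mult-cut ls1 l ls2 k st = cong (ι (eqStep (N , 0) (k , 0)) +_) (cong (λ w → mult w k 0) (locate-stay m ls1 (l ∷ ls2) st) ∙ mult-++ (locate m ls1) (locate n (l ∷ ls2)) k 0)

  prim-E : ∀ ls1 → stay m ls1 ≡ true → prim (N ∷ ls1 ++ E ∷ []) ≡ true
  prim-E ls1 st with stay-0 m ls1 m>0 st
  ... | a , b = ∧-intro (≡⇒≡ᵇ≡ (mult-cut ls1 E [] N st ∙ cong (λ z → 1 + (z + 0)) a)) (≡⇒≡ᵇ≡ (mult-cut ls1 E [] D st ∙ cong (λ z → z + 0) b))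

  prim-D : ∀ ls1 ls2 → stay m ls1 ≡ true → prim (N ∷ ls1 ++ D ∷ ls2) ≡ false
  prim-D ls1 ls2 st = ≢true⇒false λ t → contradiction (sym (mult-cut ls1 D ls2 D st ∙ cong (λ z → mult (locate m ls1) D 0 + (ι (z ≡ᵇ 0) + mult (locate (z + m) ls2) D 0)) (n∸n≡0 n) ∙ +-suc (mult (locate m ls1) D 0) _) ∙
    ≡ᵇ≡⇒≡ {mult (loop (N ∷ ls1 ++ D ∷ ls2)) D 0} (proj₂ (∧-elim {mult (loop (N ∷ ls1 ++ D ∷ ls2)) N 0 ≡ᵇ 1} t))) λ ()

  prim-long : ∀ ls1 l ls2 → stay m ls1 ≡ true → valid 0 (l ∷ ls2) ≡ true → prim (N ∷ ls1 ++ E ∷ l ∷ ls2) ≡ false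
  prim-long ls1 l ls2 st ok with starts-N l ls2 ok
  ... | refl = ≢true⇒false λ t → contradiction (sym (mult-cut ls1 E (N ∷ ls2) N st ∙ cong (λ z → suc (mult (locate m ls1) N 0 + (ι (z ≡ᵇ 0) + mult (locate (z + m) ls2) N 0))) (n∸n≡0 n) ∙ cong suc (+-suc (mult (locate m ls1) N 0) _)) ∙
    ≡ᵇ≡⇒≡ {mult (loop (N ∷ ls1 ++ E ∷ N ∷ ls2)) N 0} {1} (proj₁ (∧-elim {mult (loop (N ∷ ls1 ++ E ∷ N ∷ ls2)) N 0 ≡ᵇ 1} t))) λ ()

  Σ-primitive : ∀ i (Y : List Letter → ℕ) → Σ (words3 (suc (suc i))) (λ v → ι (valid 0 v) * (ι (prim v) * Y v)) ≡ Σ (words3 i) (λ ls1 → ι (stay m ls1) * Y (N ∷ ls1 ++ E ∷ []))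
  Σ-primitive i Y = valid-0 (suc i) Θ
    ∙ cut (suc i) m (Θ ∘ (N ∷_)) m>0
    ∙ Σ-upTo-snoc i (λ j → returns (i ∸ j) (Θ ∘ (N ∷_)) m j)
    ∙ cong₂ _+_ (Σ-upTo-vanish i early) (cong (λ z → returns z (Θ ∘ (N ∷_)) m i) (n∸n≡0 i))
    ∙ Σ-cong (words3 i) final
    where
    Θ : List Letter → ℕ
    Θ v = ι (prim v) * Y v
    D-part : ∀ ls1 ls2 → stay m ls1 ≡ true → ι (valid m ls2) * Θ (N ∷ ls1 ++ D ∷ ls2) ≡ 0
    D-part ls1 ls2 st = cong (λ b → ι (valid m ls2) * (ι b * Y (N ∷ ls1 ++ D ∷ ls2))) (prim-D ls1 ls2 st) ∙ *-zeroʳ (ι (valid m ls2))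
    early : ∀ {j} → j < i → returns (i ∸ j) (Θ ∘ (N ∷_)) m j ≡ 0
    early {j} j<i = Σ-vanish (words3 j) λ {ls1} _ → pt ls1
      where
      pt : ∀ ls1 → ι (stay m ls1) * Σ (words3 (i ∸ j)) (λ ls2 → ι (valid 0 ls2) * Θ (N ∷ ls1 ++ E ∷ ls2) + ι (valid m ls2) * Θ (N ∷ ls1 ++ D ∷ ls2)) ≡ 0
      pt ls1 with stay m ls1 in st
      ... | false = refl
      ... | true = *-identityˡ _ ∙ (Σ-vanish (words3 (i ∸ j)) λ {ls2} ls2∈ → cong₂ _+_ (E-part ls2 (words3-length (i ∸ j) ls2∈)) (D-part ls1 ls2 st))
        where
        E-part : ∀ ls2 → length ls2 ≡ i ∸ j → ι (valid 0 ls2) * Θ (N ∷ ls1 ++ E ∷ ls2) ≡ 0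
        E-part [] e = contradiction (sym e) (>⇒≢ (m<n⇒0<n∸m j<i))
        E-part (l ∷ ls2) e with valid 0 (l ∷ ls2) in ok
        ... | false = refl
        ... | true = *-identityˡ _ ∙ cong (λ b → ι b * Y (N ∷ ls1 ++ E ∷ l ∷ ls2)) (prim-long ls1 l ls2 st ok)
    final : ∀ ls1 → ι (stay m ls1) * Σ (words3 0) (λ ls2 → ι (valid 0 ls2) * Θ (N ∷ ls1 ++ E ∷ ls2) + ι (valid m ls2) * Θ (N ∷ ls1 ++ D ∷ ls2)) ≡ ι (stay m ls1) * Y (N ∷ ls1 ++ E ∷ [])
    final ls1 with stay m ls1 in st
    ... | false = refl
    ... | true = cong (1 *_) (+-identityʳ _ ∙ cong₂ _+_ (*-identityˡ _ ∙ cong (λ b → ι b * Y (N ∷ ls1 ++ E ∷ [])) (prim-E ls1 st) ∙ *-identityˡ _) (D-part ls1 [] st) ∙ +-identityʳ _)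

  continuations : ℕ → (List Letter → ℕ) → List Letter → ℕ
  continuations k Θ v = Σ (words3 k) (λ w → ι (valid 0 w) * Θ (v ++ w)) + Σ (words3 (suc k)) (λ w → ι (valid 0 w) * Θ (glue v w))

  first-return : ∀ K (Θ : List Letter → ℕ) → Σ (words3 (suc (suc K))) (λ ls → ι (valid 0 ls) * Θ ls) ≡
    Σ< (suc K) (λ i → Σ (words3 (suc (suc i))) (λ v → ι (valid 0 v) * (ι (prim v) * continuations (K ∸ i) Θ v)))
  first-return K Θ = valid-0 (suc K) Θ ∙ cut (suc K) m (Θ ∘ (N ∷_)) m>0 ∙ (Σ-cong (upTo (suc K)) λ i → (Σ-cong (words3 i) λ ls1 → cong (ι (stay m ls1) *_) (split i ls1)) ∙ sym (Σ-primitive i (continuations (K ∸ i) Θ)))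
    where
    split : ∀ i ls1 → Σ (words3 (K ∸ i)) (λ ls2 → ι (valid 0 ls2) * Θ (N ∷ ls1 ++ E ∷ ls2) + ι (valid m ls2) * Θ (N ∷ ls1 ++ D ∷ ls2)) ≡ continuations (K ∸ i) Θ (N ∷ ls1 ++ E ∷ [])
    split i ls1 = Σ-+ _ _ (words3 (K ∸ i)) ∙ cong₂ _+_
      (Σ-cong (words3 (K ∸ i)) λ ls2 → cong (λ z → ι (valid 0 ls2) * Θ (N ∷ z)) (sym (List.++-assoc ls1 (E ∷ []) ls2)))
      ((Σ-cong (words3 (K ∸ i)) λ ls2 → cong (λ z → ι (valid m ls2) * Θ (z ++ D ∷ ls2)) (sym (dropLast-snoc (N ∷ ls1) E))) ∙ sym (valid-0 (K ∸ i) (λ w → Θ (glue (N ∷ ls1 ++ E ∷ []) w))))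

northBases-++ : ∀ u v → northBases (u ++ v) ≡ northBases u ++ northBases v
northBases-++ [] v = refl
northBases-++ ((N , ℓ) ∷ u) v = cong (ℓ ∷_) (northBases-++ u v)
northBases-++ ((D , ℓ) ∷ u) v = cong (ℓ ∷_) (northBases-++ u v)
northBases-++ ((E , ℓ) ∷ u) v = northBases-++ u v

bits-++ : ∀ u v → bits (u ++ v) ≡ bits u ++ bits v
bits-++ [] v = refl
bits-++ (N ∷ u) v = cong (0 ∷_) (bits-++ u v)
bits-++ (D ∷ u) v = cong (1 ∷_) (bits-++ u v)
bits-++ (E ∷ u) v = bits-++ u v

rows-merge : ∀ cur u w → rows cur (u ++ D ∷ w) ≡ rows cur (u ++ E ∷ N ∷ w)
rows-merge cur [] w = refl
rows-merge cur (N ∷ u) w = cong (cur ∷_) (rows-merge cur u w)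
rows-merge cur (D ∷ u) w = cong (suc cur ∷_) (rows-merge (suc cur) u w)
rows-merge cur (E ∷ u) w = rows-merge (suc cur) u w

at-flip : ∀ P R j → at (P ++ 1 ∷ R) j ≡ ι (length P ≡ᵇ j) + at (P ++ 0 ∷ R) j
at-flip [] R zero = refl
at-flip [] R (suc j) = refl
at-flip (x ∷ P) R zero = refl
at-flip (x ∷ P) R (suc j) = at-flip P R j

northBases>0 : ∀ w → mult w N 0 ≡ 0 → mult w D 0 ≡ 0 → ∀ {j} → j < length (northBases w) → 0 < at (northBases w) j
northBases>0 ((N , zero) ∷ w) ()
northBases>0 ((N , suc ℓ) ∷ w) zN zD {zero} _ = s≤s z≤n
northBases>0 ((N , suc ℓ) ∷ w) zN zD {suc j} (s≤s h) = northBases>0 w zN zD h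
northBases>0 ((D , zero) ∷ w) zN ()
northBases>0 ((D , suc ℓ) ∷ w) zN zD {zero} _ = s≤s z≤n
northBases>0 ((D , suc ℓ) ∷ w) zN zD {suc j} (s≤s h) = northBases>0 w zN zD h
northBases>0 ((E , ℓ) ∷ w) zN zD h = northBases>0 w zN zD h

wordWeight : ℕ → ℕ → ℤ → ℤ → List Letter → ℕ
wordWeight m n a b ls = weight m n (rows 0 ls) (pos (pdinv m n (rows 0 ls)) Int.- pos (lost m n (rows 0 ls) (bits ls))) a b

markWeight : ℕ → ℕ → ℕ → ℤ → ℤ → List Letter → ℕ
markWeight m n p a b ls = ι (markCount ls ≡ᵇ p) * wordWeight m n a b ls

difference-≡ : ∀ p l p' l' → p + l' ≡ p' + l → pos p Int.- pos l ≡ pos p' Int.- pos l'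
difference-≡ p l p' l' e = expand (pos p) (pos l) (pos l') ∙ cong (λ z → z Int.- (Int._+_ (pos l) (pos l'))) (sym (ℤₚ.pos-+ p l') ∙ cong pos e ∙ ℤₚ.pos-+ p' l) ∙ shrink (pos p') (pos l) (pos l')
  where
  expand : ∀ x y z → x Int.- y ≡ (Int._+_ x z) Int.- (Int._+_ y z)
  expand = ℤSolver.solve-∀
  shrink : ∀ x y z → (Int._+_ x y) Int.- (Int._+_ y z) ≡ x Int.- z
  shrink = ℤSolver.solve-∀

module Glue (m n : ℕ) (m>0 : 0 < m) (n>0 : 0 < n) (v w : List Letter)
  (ok-v : Walks.valid m n 0 v ≡ true) (ok-w : Walks.valid m n 0 w ≡ true) (pr : FirstReturn.prim m n m>0 n>0 v ≡ true) (w>0 : 0 < length w) where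

  open Walks m n using (valid)
  open FirstReturn m n m>0 n>0 using (prim; ends-E; starts-N)

  v-ends : ∀ v → valid 0 v ≡ true → prim v ≡ true → ∃ λ v1 → v ≡ v1 ++ E ∷ []
  v-ends (l ∷ u) ok pr = ends-E 0 l u ok

  w-starts : ∀ w → valid 0 w ≡ true → 0 < length w → ∃ λ w1 → w ≡ N ∷ w1
  w-starts (k ∷ w1) ok _ = w1 , cong (_∷ w1) (starts-N k w1 ok)

  v1 w1 : List Letter
  v1 = proj₁ (v-ends v ok-v pr)
  w1 = proj₁ (w-starts w ok-w w>0)

  v≡ : v ≡ v1 ++ E ∷ []
  v≡ = proj₂ (v-ends v ok-v pr)

  w≡ : w ≡ N ∷ w1
  w≡ = proj₂ (w-starts w ok-w w>0)

  merged : glue v w ≡ v1 ++ D ∷ w1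
  merged = cong₂ (λ a b → a ++ D ∷ b) (cong dropLast v≡ ∙ dropLast-snoc v1 E) (cong (drop 1) w≡)

  whole : v ++ w ≡ v1 ++ E ∷ N ∷ w1
  whole = cong₂ _++_ v≡ w≡ ∙ List.++-assoc v1 (E ∷ []) (N ∷ w1)

  bits-D : bits (glue v w) ≡ bits v1 ++ 1 ∷ bits w1
  bits-D = cong bits merged ∙ bits-++ v1 (D ∷ w1)

  bits-E : bits (v ++ w) ≡ bits v1 ++ 0 ∷ bits w1
  bits-E = cong bits whole ∙ bits-++ v1 (E ∷ N ∷ w1)

  markCount-glue : markCount (glue v w) ≡ suc (markCount (v ++ w))
  markCount-glue = cong (λ l → Σ l (λ b → b)) bits-D ∙ Σ-++ (λ b → b) (bits v1) (1 ∷ bits w1) ∙ +-suc (Σ (bits v1) (λ b → b)) _ ∙ cong suc (sym (cong (λ l → Σ l (λ b → b)) bits-E ∙ Σ-++ (λ b → b) (bits v1) (0 ∷ bits w1)))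

module Split (m n : ℕ) (m>0 : 0 < m) (n>0 : 0 < n) (v w : List Letter)
  (ok-v : Walks.valid m n 0 v ≡ true) (ok-w : Walks.valid m n 0 w ≡ true) (pr : FirstReturn.prim m n m>0 n>0 v ≡ true)
  (len : length (v ++ w) + markCount (v ++ w) ≡ m + n) where

  open Walks m n using (valid; locate; valid⇒walk)
  open FirstReturn m n m>0 n>0
  open Bijection m n m>0 n>0 using (marks-locate)
  open Rows m n using (walk-slope; length-bits)

  ok : valid 0 (v ++ w) ≡ true
  ok = valid-++ 0 v w ok-v ∙ ok-w

  loop≡ : loop (v ++ w) ≡ loop v ++ loop w
  loop≡ = locate-++ 0 v w ok-v

  open WalkPath m n m>0 n>0 (v ++ w) ok (cong (length (v ++ w) +_) (marks-locate 0 (v ++ w)) ∙ len) public using (x; s; counts; pdinv≡pdʷ; lost≡lostʷ; area+λ; walk; ret-first; lost-mark)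

  Y X : ℕ
  Y = norths (loop v)
  X = easts (loop v)

  norths-sum : Y + norths (loop w) ≡ n
  norths-sum = sym (Σ-++ (λ s → ι (northish s)) (loop v) (loop w)) ∙ cong norths (sym loop≡) ∙ proj₁ counts

  bases≡ = cong northBases loop≡ ∙ northBases-++ (loop v) (loop w)

  start : ∀ w → valid 0 w ≡ true → at (northBases (loop w)) 0 ≡ 0
  start [] ok = refl
  start (l ∷ w) ok with starts-N l w ok
  ... | refl = refl

  Y>0 : 0 < Y
  Y>0 = go v ok-v pr
    where
    go : ∀ v → valid 0 v ≡ true → prim v ≡ true → 0 < norths (loop v)
    go (l ∷ v) ok pr with starts-N l v ok
    ... | refl = s≤s z≤n

  above-0 : ∀ {j} → 0 < j → j < Y → 0 < at (northBases (loop (v ++ w))) j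
  above-0 {j} j>0 j<Y = subst (λ l → 0 < at l j) (sym bases≡) (subst (0 <_) (sym (at-++ˡ (northBases (loop v)) (northBases (loop w)) (subst (j <_) (sym (length-northBases (loop v))) j<Y))) (go v ok-v pr j>0 (subst (j <_) (sym (length-northBases (loop v))) j<Y)))
    where
    go : ∀ v → valid 0 v ≡ true → prim v ≡ true → ∀ {j} → 0 < j → j < length (northBases (loop v)) → 0 < at (northBases (loop v)) j
    go (l ∷ v) ok pr {suc j} _ h with starts-N l v ok
    ... | refl = northBases>0 (locate m v) (suc-injective (≡ᵇ≡⇒≡ {mult (loop (N ∷ v)) N 0} {1} (proj₁ (∧-elim {mult (loop (N ∷ v)) N 0 ≡ᵇ 1} pr)))) (≡ᵇ≡⇒≡ {mult (loop (N ∷ v)) D 0} (proj₂ (∧-elim {mult (loop (N ∷ v)) N 0 ≡ᵇ 1} pr))) (≤-pred h)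

  at-Y : at (northBases (loop (v ++ w))) Y ≡ 0
  at-Y = cong₂ at bases≡ (sym (length-northBases (loop v)) ∙ sym (+-identityʳ _)) ∙ at-++ʳ (northBases (loop v)) (northBases (loop w)) 0 ∙ start w ok-w

  ret-v : ret m n x * divℕ n (gcd m n) ≡ Y × ret m n x * divℕ m (gcd m n) ≡ X
  ret-v = ret-first Y X Y>0 (m≤m+n Y _ ≤∙ ≤-reflexive norths-sum) (walk-slope (loop v) (valid⇒walk 0 v ok-v)) above-0 (λ _ → at-Y)

  glued : 0 < length w → rows 0 (glue v w) ≡ x × lost m n x (bits (glue v w)) ≡ suc (lost m n x s)
  glued w>0 = cong (rows 0) merged ∙ rows-merge 0 v1 w1 ∙ cong (rows 0) (sym whole) ,
    lost-mark s (bits (glue v w)) Y Y>0 Y<n at-Y (start (v ++ w) ok) above-0 (λ {j} _ → cong (λ l → at l j) bits-D ∙ at-flip (bits v1) (bits w1) j ∙ cong₂ (λ k l → ι (k ≡ᵇ j) + at l j) length-v1 (sym bits-E))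
    where
    open Glue m n m>0 n>0 v w ok-v ok-w pr w>0
    length-v1 : length (bits v1) ≡ Y
    length-v1 = cong length (sym (cong bits v≡ ∙ bits-++ v1 (E ∷ []) ∙ List.++-identityʳ (bits v1))) ∙ length-bits 0 v
    Y<n : Y < n
    Y<n = <-≤-trans (m<m+n Y (subst (λ w → 0 < norths (loop w)) (sym w≡) (s≤s z≤n))) (≤-reflexive norths-sum)

module Symmetric (m n : ℕ) (m>0 : 0 < m) (n>0 : 0 < n) where

  module W = Walks m n
  module W' = Walks n m
  module S = Stats m n
  module S' = Stats n m
  module F = FirstReturn m n m>0 n>0
  module F' = FirstReturn n m n>0 m>0
  module T = Transposition m n
  module B = Bijection m n m>0 n>0
  module B' = Bijection n m n>0 m>0
  module CW = ClosedWalks m n m>0 n>0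

  Same : List Letter → List Letter → Set
  Same v v' = mult (F.loop v) ≐ transpose (mult (F'.loop v'))

  Σ-same : ∀ {v v'} → Same v v' → ∀ (f : Step → ℕ) → Σ (F.loop v) f ≡ Σ (F'.loop v') (f ∘ swapS)
  Σ-same {v} {v'} same f = (Σ-mult f (F.loop v) (map swapS (F'.loop v')) λ l ℓ → same l ℓ ∙ sym (mult-swap (F'.loop v') l ℓ)) ∙ Σ-map f swapS (F'.loop v')

  marks-same : ∀ {v v'} → Same v v' → markCount v ≡ markCount v'
  marks-same {v} {v'} same = sym (B.marks-locate 0 v) ∙ Σ-same {v} {v'} same (λ s → ι (marked s)) ∙ (Σ-cong (F'.loop v') λ s → cong ι (marked-swap s)) ∙ B'.marks-locate 0 v'

  markCount-++ : ∀ v w → markCount (v ++ w) ≡ markCount v + markCount w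
  markCount-++ v w = cong (λ l → Σ l (λ b → b)) (bits-++ v w) ∙ Σ-++ (λ b → b) (bits v) (bits w)

  prim-same : ∀ {v v'} → W.valid 0 v ≡ true → Same v v' → F.prim v ≡ F'.prim v'
  prim-same {v} {v'} ok same = cong₂ (λ a b → (a ≡ᵇ 1) ∧ (b ≡ᵇ 0)) (at-0 ∙ same E 0) (same D 0)
    where
    M = mult (F.loop v)
    at-0 : M N 0 ≡ M E 0
    at-0 = sym (cong₂ _+_ (delay-< n (M E) n>0) (cong (_+ M N 0) (delay-< n (M D) n>0))) ∙ T.walk-balanced (F.loop v) (W.valid⇒walk 0 v ok) 0 ∙ cong₂ _+_ (delay-< m (M N) m>0) (cong (_+ M E 0) (delay-< m (M D) m>0))

  module Compatible {v w v' w' : List Letter} (ok-v : W.valid 0 v ≡ true) (ok-w : W.valid 0 w ≡ true) (ok-v' : W'.valid 0 v' ≡ true) (ok-w' : W'.valid 0 w' ≡ true)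
    (same-v : Same v v') (same-w : Same w w') (inv-v : W.inv (F.loop v) ≡ W'.inv (F'.loop v')) (inv-w : W.inv (F.loop w) ≡ W'.inv (F'.loop w'))
    (pr : F.prim v ≡ true) (len-v : length v ≡ length v') (len-w : length w ≡ length w') where

    marks≡ : markCount (v ++ w) ≡ markCount (v' ++ w')
    marks≡ = markCount-++ v w ∙ cong₂ _+_ (marks-same {v} {v'} same-v) (marks-same {w} {w'} same-w) ∙ sym (markCount-++ v' w')

    pr' : F'.prim v' ≡ true
    pr' = sym (prim-same {v} {v'} ok-v same-v) ∙ pr

    module _ (len : length (v ++ w) + markCount (v ++ w) ≡ m + n) where

      len' : length (v' ++ w') + markCount (v' ++ w') ≡ n + m
      len' = cong₂ _+_ (List.length-++ v' ∙ cong₂ _+_ (sym len-v) (sym len-w) ∙ sym (List.length-++ v)) (sym marks≡) ∙ len ∙ +-comm m n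
      module P = Split m n m>0 n>0 v w ok-v ok-w pr len
      module P' = Split n m n>0 m>0 v' w' ok-v' ok-w' pr' len'

      same : mult (F.loop (v ++ w)) ≐ transpose (mult (F'.loop (v' ++ w')))
      same l ℓ = cong (λ u → mult u l ℓ) P.loop≡ ∙ mult-++ (F.loop v) (F.loop w) l ℓ ∙ cong₂ _+_ (same-v l ℓ) (same-w l ℓ) ∙ sym (cong (λ u → mult u (swapL l) ℓ) P'.loop≡ ∙ mult-++ (F'.loop v') (F'.loop w') (swapL l) ℓ)

      cross-term : Σ (F.loop v) (λ s → W.κ s (mult (F.loop w))) ≡ Σ (F'.loop v') (λ s → W'.κ s (mult (F'.loop w')))
      cross-term = T.cross m>0 n>0 (mult (F.loop w)) (T.walk-balanced (F.loop w) (W.valid⇒walk 0 w ok-w)) (F.loop v) (W.valid⇒walk 0 v ok-v) ∙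
        Σ-same {v} {v'} same-v (λ s → W'.κ (swapS s) (transpose (mult (F.loop w)))) ∙ (Σ-cong (F'.loop v') λ s →
          trans (cong (λ t → W'.κ t (transpose (mult (F.loop w)))) (swapS-involutive s)) (W'.κ-cong s λ l ℓ → same-w (swapL l) ℓ ∙ transpose-transpose (mult (F'.loop w')) l ℓ))

      inv≡ : W.inv (F.loop (v ++ w)) ≡ W'.inv (F'.loop (v' ++ w'))
      inv≡ = cong W.inv P.loop≡ ∙ W.inv-++ (F.loop v) (F.loop w) ∙ cong₂ _+_ (cong₂ _+_ inv-v inv-w) cross-term ∙ sym (cong W'.inv P'.loop≡ ∙ W'.inv-++ (F'.loop v') (F'.loop w'))

      ret≡ : ret m n P.x ≡ ret n m P'.x
      ret≡ = *-cancelʳ-≡ _ _ m0 {{>-nonZero (Diagonal.m0>0 m n m>0 n>0)}} (proj₂ P.ret-v ∙ Σ-same {v} {v'} same-v (λ s → ι (eastish s)) ∙ (Σ-cong (F'.loop v') λ s → cong ι (eastish-swap s)) ∙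
        sym (proj₁ P'.ret-v) ∙ cong (λ d → ret n m P'.x * divℕ m d) (GCD.gcd-comm n m))
        where
        m0 = divℕ m (gcd m n)

      module ST = StatTransposition m n n>0 m>0

      area≡' : area m n P.x ≡ area n m P'.x
      area≡' = +-cancelʳ-≡ (S.λʷ (F.loop (v ++ w))) _ _ (P.area+λ ∙ diagonalCells-swap m n ∙ sym P'.area+λ ∙ cong (area n m P'.x +_) (sym (ST.λ-transpose P.walk P'.walk same)))

      dinv≡ = cong₂ _+_ P.pdinv≡pdʷ P'.lost≡lostʷ ∙ ST.dinv-transpose P.walk P'.walk same inv≡ ∙ sym (cong₂ _+_ P'.pdinv≡pdʷ P.lost≡lostʷ)

      weight≡ : ∀ l l' a b → pdinv m n P.x + l' ≡ pdinv n m P'.x + l → weight m n P.x (pos (pdinv m n P.x) Int.- pos l) a b ≡ weight n m P'.x (pos (pdinv n m P'.x) Int.- pos l') a b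
      weight≡ l l' a b e = cong (λ δ → weight m n P.x δ a b) (difference-≡ (pdinv m n P.x) l (pdinv n m P'.x) l' e) ∙ weight-cong {m} {n} {n} {m} {P.x} {P'.x} (pos (pdinv n m P'.x) Int.- pos l') a b ret≡ area≡'

      lost-glue : ∀ a b → 0 < length w → wordWeight m n a b (glue v w) ≡
        wordWeight n m a b (glue v' w')
      lost-glue a b w>0 = cong (λ x → weight m n x (pos (pdinv m n x) Int.- pos (lost m n x (bits (glue v w)))) a b) (proj₁ gl)
        ∙ weight≡ (lost m n P.x (bits (glue v w))) (lost n m P'.x (bits (glue v' w'))) a b (cong (pdinv m n P.x +_) (proj₂ gl') ∙ +-suc (pdinv m n P.x) _ ∙ cong suc dinv≡ ∙ sym (+-suc (pdinv n m P'.x) _) ∙ cong (pdinv n m P'.x +_) (sym (proj₂ gl)))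
        ∙ cong (λ x → weight n m x (pos (pdinv n m x) Int.- pos (lost n m x (bits (glue v' w')))) a b) (sym (proj₁ gl'))
        where
        gl = P.glued w>0
        gl' = P'.glued (subst (0 <_) len-w w>0)

    plain : ∀ p a b → (markCount (v ++ w) ≡ p → length (v ++ w) + markCount (v ++ w) ≡ m + n) → markWeight m n p a b (v ++ w) ≡ markWeight n m p a b (v' ++ w')
    plain p a b len = case-mark (markCount (v ++ w) ≡ᵇ p) refl ∙ cong (λ k → ι (k ≡ᵇ p) * wordWeight n m a b (v' ++ w')) marks≡
      where
      case-mark : ∀ c → (markCount (v ++ w) ≡ᵇ p) ≡ c → ι c * wordWeight m n a b (v ++ w) ≡
        ι c * wordWeight n m a b (v' ++ w')
      case-mark false _ = refl
      case-mark true e = cong (1 *_) (weight≡ len0 (lost m n (rows 0 (v ++ w)) (bits (v ++ w))) (lost n m (rows 0 (v' ++ w')) (bits (v' ++ w'))) a b (dinv≡ len0))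
        where
        len0 = len (≡ᵇ≡⇒≡ {markCount (v ++ w)} e)

    glued-weights : ∀ p a b → 0 < length w → (suc (markCount (v ++ w)) ≡ p → length (v ++ w) + markCount (v ++ w) ≡ m + n) → markWeight m n p a b (glue v w) ≡ markWeight n m p a b (glue v' w')
    glued-weights p a b w>0 len = cong (λ k → ι (k ≡ᵇ p) * wordWeight m n a b (glue v w)) mk ∙
      case-mark (suc (markCount (v ++ w)) ≡ᵇ p) refl ∙ cong (λ k → ι (k ≡ᵇ p) * wordWeight n m a b (glue v' w')) (cong suc marks≡ ∙ sym mk')
      where
      mk = Glue.markCount-glue m n m>0 n>0 v w ok-v ok-w pr w>0
      mk' = Glue.markCount-glue n m n>0 m>0 v' w' ok-v' ok-w' pr' (subst (0 <_) len-w w>0)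
      case-mark : ∀ c → (suc (markCount (v ++ w)) ≡ᵇ p) ≡ c → ι c * wordWeight m n a b (glue v w) ≡
        ι c * wordWeight n m a b (glue v' w')
      case-mark false _ = refl
      case-mark true e = cong (1 *_) (lost-glue (len (≡ᵇ≡⇒≡ {suc (markCount (v ++ w))} e)) a b w>0)

  module _ (K p : ℕ) (L+p : suc (suc K) + p ≡ m + n) (a b : ℤ) where

    I = suc (suc K)

    classes : List Letter → List ℕ
    classes v = W.inv (F.loop v) ∷ CW.class I v

    classes' : List Letter → List ℕ
    classes' v = W'.inv (F'.loop v) ∷ CW.class' I v

    by-classes : ∀ j → j ≤ I → (φ φ' : List Letter → ℕ) →
      (∀ {v v'} → length v ≡ j → length v' ≡ j → W.valid 0 v ≡ true → W'.valid 0 v' ≡ true → W.inv (F.loop v) ≡ W'.inv (F'.loop v') → Same v v' → φ v ≡ φ' v') →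
      Σ (words3 j) (λ v → ι (W.valid 0 v) * φ v) ≡ Σ (words3 j) (λ v → ι (W'.valid 0 v) * φ' v)
    by-classes j j≤I φ φ' h = (Σ-cong (words3 j) λ v → *-comm (ι (W.valid 0 v)) (φ v)) ∙ trans
      (Σ-classes (words3 j) (words3 j) (λ v → ι (W.valid 0 v)) (λ v → ι (W'.valid 0 v)) classes classes' φ φ' (CW.walk-classes I j j≤I)
        λ {v} {v'} v∈ v'∈ ne ne' e → h {v} {v'} (words3-length j v∈) (words3-length j v'∈) (ι≢0 ne) (ι≢0 ne') (∷-head-injective e)
          (CW.class≡⇒≐ I {v} {v'} (≤-reflexive (words3-length j v∈) ≤∙ j≤I) (≤-reflexive (words3-length j v'∈) ≤∙ j≤I) (∷-tail-injective e)))
      (Σ-cong (words3 j) λ v → *-comm (φ' v) (ι (W'.valid 0 v)))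

    markWeight-symmetric : Σ (words3 I) (λ ls → ι (W.valid 0 ls) * markWeight m n p a b ls) ≡ Σ (words3 I) (λ ls → ι (W'.valid 0 ls) * markWeight n m p a b ls)
    markWeight-symmetric = F.first-return K (markWeight m n p a b) ∙ Σ-upTo-cong (suc K) (λ {i} i≤K → per-length i (≤-pred i≤K)) ∙ sym (F'.first-return K (markWeight n m p a b))
      where
      per-length : ∀ i → i ≤ K → Σ (words3 (suc (suc i))) (λ v → ι (W.valid 0 v) * (ι (F.prim v) * F.continuations (K ∸ i) (markWeight m n p a b) v)) ≡
        Σ (words3 (suc (suc i))) (λ v → ι (W'.valid 0 v) * (ι (F'.prim v) * F'.continuations (K ∸ i) (markWeight n m p a b) v))
      per-length i i≤K = by-classes (suc (suc i)) (s≤s (s≤s i≤K)) _ _ λ {v} {v'} lv lv' ok-v ok-v' iv sv →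
        trans (with-prim {v} {v'} lv lv' ok-v ok-v' iv sv (F.prim v) refl) (cong (λ c → ι c * F'.continuations (K ∸ i) (markWeight n m p a b) v') (prim-same {v} {v'} ok-v sv))
        where
        with-prim : ∀ {v v'} → length v ≡ suc (suc i) → length v' ≡ suc (suc i) → W.valid 0 v ≡ true → W'.valid 0 v' ≡ true → W.inv (F.loop v) ≡ W'.inv (F'.loop v') → Same v v' →
          ∀ c → F.prim v ≡ c → ι c * F.continuations (K ∸ i) (markWeight m n p a b) v ≡ ι c * F'.continuations (K ∸ i) (markWeight n m p a b) v'
        with-prim lv lv' ok-v ok-v' iv sv false _ = refl
        with-prim {v} {v'} lv lv' ok-v ok-v' iv sv true pr = cong (1 *_) (cong₂ _+_
          (by-classes (K ∸ i) (m∸n≤m K i ≤∙ n≤1+n K ≤∙ n≤1+n (suc K)) (λ w → markWeight m n p a b (v ++ w)) (λ w → markWeight n m p a b (v' ++ w)) λ {w} {w'} lw lw' ok-w ok-w' iw sw →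
            Compatible.plain {v} {w} {v'} {w'} ok-v ok-w ok-v' ok-w' sv sw iv iw pr (lv ∙ sym lv') (lw ∙ sym lw') p a b
              λ e → cong₂ _+_ (List.length-++ v ∙ cong₂ _+_ lv lw ∙ cong (suc ∘ suc) (m+[n∸m]≡n i≤K)) e ∙ L+p)
          (by-classes (suc (K ∸ i)) (s≤s (m∸n≤m K i ≤∙ n≤1+n K)) (λ w → markWeight m n p a b (glue v w)) (λ w → markWeight n m p a b (glue v' w)) λ {w} {w'} lw lw' ok-w ok-w' iw sw →
            Compatible.glued-weights {v} {w} {v'} {w'} ok-v ok-w ok-v' ok-w' sv sw iv iw pr (lv ∙ sym lv') (lw ∙ sym lw') p a b (subst (0 <_) (sym lw) (s≤s z≤n))
              λ e → cong (_+ markCount (v ++ w)) (List.length-++ v ∙ cong₂ _+_ lv lw ∙ +-suc (suc (suc i)) (K ∸ i) ∙ cong (suc ∘ suc ∘ suc) (m+[n∸m]≡n i≤K)) ∙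
                sym (+-suc (suc (suc K)) (markCount (v ++ w))) ∙ cong (suc (suc K) +_) e ∙ L+p))

hikita-transpose : ∀ p r r' a b → hikitaCoeff (suc (p + r')) (suc (p + r)) (suc p ∷ replicate r 1) a b ≡ hikitaCoeff (suc (p + r)) (suc (p + r')) (suc p ∷ replicate r' 1) a b
hikita-transpose p r r' a b = hikita-hook m n p r a b m>0 refl ∙ Bijection.words-paths m n m>0 n>0 p (suc (suc K)) L+p (λ x s → weight m n x (pos (pdinv m n x) Int.- pos (lost m n x s)) a b) ∙
  Symmetric.markWeight-symmetric m n m>0 n>0 K p L+p a b ∙
    sym (hikita-hook n m p r' a b n>0 refl ∙ Bijection.words-paths n m n>0 m>0 p (suc (suc K)) (L+p ∙ +-comm m n) (λ x s → weight n m x (pos (pdinv n m x) Int.- pos (lost n m x s)) a b))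
  where
  m = suc (p + r')
  n = suc (p + r)
  m>0 : 0 < m
  m>0 = s≤s z≤n
  n>0 : 0 < n
  n>0 = s≤s z≤n
  K = p + r + r'
  L+p : suc (suc K) + p ≡ m + n
  L+p = arith p r r'
    where
    arith : ∀ p r s → 2 + (p + r + s) + p ≡ (1 + (p + s)) + (1 + (p + r))
    arith = solve-∀

partC : ∀ m n k → 1 ≤ k → k ≤ m → k ≤ n → ∀ (d d' : List ℕ → ℤ → ℤ → ℤ) → IsSchurExpansion m n d → IsSchurExpansion n m d' →
  ∀ a b → d (k ∷ replicate (n ∸ k) 1) a b ≡ d' (k ∷ replicate (m ∸ k) 1) a b
partC m n (suc p) _ k≤m k≤n d d' e e' a b with m≤n⇒∃[o]m+o≡n k≤m | m≤n⇒∃[o]m+o≡n k≤n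
... | r' , refl | r , refl rewrite m+n∸m≡n p r | m+n∸m≡n p r' = sym (expansion-hook p r (λ lam → d lam a b))
  ∙ sym (e (suc p ∷ replicate r 1) a b)
  ∙ cong pos (hikita-transpose p r r' a b)
  ∙ e' (suc p ∷ replicate r' 1) a b
  ∙ expansion-hook p r' (λ lam → d' lam a b)

-- The coefficient of s_{1^n} is transposed to that of s_{1^m}, grows by a part n, and is transposed back.
hikita-column-row : ∀ r r' a b → hikitaCoeff (suc r') (suc r) (replicate (suc r) 1) a b ≡ hikitaCoeff (suc r' + suc r) (suc r) (suc r ∷ []) a b
hikita-column-row r r' a b = hikita-transpose 0 r r' a b
  ∙ sym (HikitaPeel.hikita-peel r r' (1 ∷ replicate r' 1) (λ ()) a b)
  ∙ cong (λ k → hikitaCoeff (suc k) (n + m) (suc r ∷ replicate m 1) a b) (sym (+-identityʳ r))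
  ∙ sym (hikita-transpose r 0 m a b)
  ∙ cong₂ (λ k l → hikitaCoeff k (suc l) (n ∷ []) a b) (+-comm n m) (+-identityʳ r)
  where
  m = suc r'
  n = suc r

partA : ∀ m n → 1 ≤ m → 1 ≤ n → ∀ (d d' : List ℕ → ℤ → ℤ → ℤ) → IsSchurExpansion m n d → IsSchurExpansion (m + n) n d' →
  ∀ a b → d (replicate n 1) a b ≡ d' (n ∷ []) a b
partA (suc r') (suc r) _ _ d d' e e' a b = sym (expansion-hook 0 r (λ lam → d lam a b))
  ∙ sym (e (replicate (suc r) 1) a b)
  ∙ cong pos (hikita-column-row r r' a b)
  ∙ e' (suc r ∷ []) a b
  ∙ expansion-row r (λ lam → d' lam a b)

theorem3 : ∀ (m n : ℕ) → 1 ≤ m → 1 ≤ n →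
  -- (a)
  (∀ (d d' : List ℕ → ℤ → ℤ → ℤ) → IsSchurExpansion m n d → IsSchurExpansion (m + n) n d' →
    ∀ (a b : ℤ) → d (replicate n 1) a b ≡ d' (n ∷ []) a b)
  -- (b)
  × (∀ (A : ℕ) → A * m < n → ∀ (lam' : List ℕ) → IsPartition lam' → sum lam' ≡ n ∸ A * m → All (_≤ m) lam' →
    ∀ (d d' : List ℕ → ℤ → ℤ → ℤ) → IsSchurExpansion m n d → IsSchurExpansion m (n ∸ A * m) d' →
    ∀ (a b : ℤ) → d (replicate A m ++ lam') a b ≡ d' lam' a b)
  -- (c)
  × (∀ (k : ℕ) → 1 ≤ k → k ≤ m → k ≤ n →
    ∀ (d d' : List ℕ → ℤ → ℤ → ℤ) → IsSchurExpansion m n d → IsSchurExpansion n m d' →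
    ∀ (a b : ℤ) → d (k ∷ replicate (n ∸ k) 1) a b ≡ d' (k ∷ replicate (m ∸ k) 1) a b)
theorem3 m n m>0 n>0 = partA m n m>0 n>0 , partB m n m>0 , partC m n
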